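{- Let $G$ be a cubic brick which is not isomorphic to $K_4$, to $\overline{C_6}$, or to $R_8$. Then $G$ has a matching $M$ with $|M|\geq |V(G)|/7$ such that every edge of $M$ is removable in $G$.
   Context: All graphs are finite, simple and undirected. A connected graph is matching covered if every edge lies in some perfect matching. An edge $e$ of a matching covered graph $G$ is removable if $G-e$ is matching covered. For $X\subseteq V(G)$, $\partial(X)$ is the set of edges with exactly one end in $X$; it is tight if every perfect matching of $G$ contains exactly one edge of $\partial(X)$, and trivial if $|X|=1$ or $|V(G)\setminus X|=1$. A brick is a non-bipartite matching covered graph with no non-trivial tight cut (equivalently, a 3-connected graph $G$ such that $G-\{x,y\}$ has a perfect matching for all distinct $x,y$). $\overline{C_6}$ is the complement of the 6-cycle (the triangular prism). $R_8$ is the cubic brick on 8 vertices $u,v,w,x,y,z,u_1,v_1$ with edge set $\{uv,uw,vw,xy,xz,yz,wz,uu_1,u_1x,vv_1,v_1y,u_1v_1\}$ (two triangles $uvw$ and $xyz$ joined by the edge $wz$ and by the paths $uu_1x$, $vv_1y$, together with the edge $u_1v_1$); it has exactly one removable edge. -}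

module Defs where

open import Data.Nat using (ℕ; zero; suc; _+_; _*_; _≤_)
open import Data.Bool using (Bool; true; false; not; _∧_; _∨_; if_then_else_)
open import Data.Fin using (Fin; _≟_; #_)
open import Data.List using (List; []; _∷_; allFin; map; concatMap; length)
open import Data.Nat.ListAction using (sum)
open import Data.Bool.ListAction using (any)
open import Data.List.Relation.Unary.All using (All)
open import Data.List.Relation.Unary.Unique.Propositional using (Unique)
open import Data.Product using (Σ; _×_; _,_; proj₁; proj₂; ∃)
open import Data.Sum using (_⊎_)
open import Relation.Nullary using (¬_)
open import Relation.Nullary.Decidable using (⌊_⌋)
open import Relation.Binary.PropositionalEquality using (_≡_; _≢_)
open import Function.Bundles using (_↔_; Inverse)

Graph : ℕ → Set
Graph n = Fin n → Fin n → Bool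

IsSimple : ∀ {n} → Graph n → Set
IsSimple {n} G = (∀ u v → G u v ≡ G v u) × (∀ u → G u u ≡ false)

_==_ : ∀ {n} → Fin n → Fin n → Bool
u == v = ⌊ u ≟ v ⌋

count : ∀ {n} → (Fin n → Bool) → ℕ
count {n} P = sum (map (λ v → if P v then 1 else 0) (allFin n))

Cubic : ∀ {n} → Graph n → Set
Cubic G = ∀ u → count (G u) ≡ 3

data Reach {n} (G : Graph n) : Fin n → Fin n → Set where
  here : ∀ {u} → Reach G u u
  step : ∀ {u v w} → G u v ≡ true → Reach G v w → Reach G u w

Connected : ∀ {n} → Graph n → Set
Connected G = ∀ u v → Reach G u v

record PerfectMatching {n} (G : Graph n) : Set where
  field
    mate   : Fin n → Fin n
    invol  : ∀ v → mate (mate v) ≡ v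
    nofix  : ∀ v → mate v ≢ v
    onEdge : ∀ v → G v (mate v) ≡ true
open PerfectMatching public

MatchingCovered : ∀ {n} → Graph n → Set
MatchingCovered G =
  Connected G × (∀ a b → G a b ≡ true → Σ (PerfectMatching G) λ M → mate M a ≡ b)

Bipartite : ∀ {n} → Graph n → Set
Bipartite {n} G = Σ (Fin n → Bool) λ c → ∀ u v → G u v ≡ true → c u ≢ c v

-- ∂(X) is tight: every perfect matching has exactly one edge in ∂(X)
Tight : ∀ {n} → Graph n → (Fin n → Bool) → Set
Tight G X = ∀ (M : PerfectMatching G) → count (λ v → X v ∧ not (X (mate M v))) ≡ 1

NonTrivial : ∀ {n} → (Fin n → Bool) → Set
NonTrivial X = 2 ≤ count X × 2 ≤ count (λ v → not (X v))

Brick : ∀ {n} → Graph n → Set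
Brick G = MatchingCovered G × ¬ Bipartite G × (∀ X → Tight G X → ¬ NonTrivial X)

deleteEdge : ∀ {n} → Graph n → Fin n → Fin n → Graph n
deleteEdge G a b u v = G u v ∧ not ((u == a ∧ v == b) ∨ (u == b ∧ v == a))

Removable : ∀ {n} → Graph n → Fin n → Fin n → Set
Removable G a b = G a b ≡ true × MatchingCovered (deleteEdge G a b)

endpoints : ∀ {n} → List (Fin n × Fin n) → List (Fin n)
endpoints = concatMap (λ e → proj₁ e ∷ proj₂ e ∷ [])

IsMatching : ∀ {n} → Graph n → List (Fin n × Fin n) → Set
IsMatching G M = All (λ e → G (proj₁ e) (proj₂ e) ≡ true) M × Unique (endpoints M)

_≅_ : ∀ {n m} → Graph n → Graph m → Set
_≅_ {n} {m} G H = Σ (Fin n ↔ Fin m) λ f →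
  ∀ u v → G u v ≡ H (Inverse.to f u) (Inverse.to f v)

fromEdges : ∀ {n} → List (Fin n × Fin n) → Graph n
fromEdges es u v = any (λ e → (proj₁ e == u ∧ proj₂ e == v) ∨ (proj₁ e == v ∧ proj₂ e == u)) es

K4 : Graph 4
K4 u v = not (u == v)

C6 : Graph 6
C6 = fromEdges ((# 0 , # 1) ∷ (# 1 , # 2) ∷ (# 2 , # 3) ∷ (# 3 , # 4) ∷ (# 4 , # 5) ∷ (# 5 , # 0) ∷ [])

C6bar : Graph 6
C6bar u v = not (u == v) ∧ not (C6 u v)

-- R8 with u=0, v=1, w=2, x=3, y=4, z=5, u1=6, v1=7
R8 : Graph 8
R8 = fromEdges ((# 0 , # 1) ∷ (# 0 , # 2) ∷ (# 1 , # 2) ∷ (# 3 , # 4) ∷ (# 3 , # 5) ∷ (# 4 , # 5) ∷ (# 2 , # 5)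
              ∷ (# 0 , # 6) ∷ (# 6 , # 3) ∷ (# 1 , # 7) ∷ (# 7 , # 4) ∷ (# 6 , # 7) ∷ [])

{-# OPTIONS --safe #-}

-- In a cubic brick every cut has at least three edges, and 3-cuts ("shores") do not cross.  By Tutte's theorem an
-- edge e = ab can fail to be removable only if, for some edge f = xy, there are S ∋ x , y and a partition of the
-- other vertices into |S| parts, each with three cut edges, such that f is the only edge inside S and e the only one
-- between two parts.  Split G along its 3-cuts into pieces, whose only 3-cuts are trivial.  Modulo 3-cuts, S and the
-- parts become a 2-colouring of a piece with exactly two monochromatic edges (a "doubleton"), and at most one
-- contracted shore gets the colour of S.  Comparing two such colourings cuts the piece along four edges; hence two
-- doubleton edges at a vertex force a third edge joining it to a vertex of the same kind, and three meet only in K₄.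
-- A discharging over the other edges then bounds the vertices missed by a maximal matching of removable edges in each
-- piece.  Pieces equal to K₄ and shores spanning a triangle are treated separately, and an induction on shores Y gives
-- 7|M| ≥ |Y| + 2 unless Y is a triangle.
module Submission where

open import Defs
open import Data.Nat.Properties hiding (_≟_)
open import Data.Maybe as Maybe using (Maybe; just; nothing)
open import Relation.Binary.PropositionalEquality
open import Data.Nat using (ℕ; zero; suc; _+_; _*_; _≤_; _<_; z≤n; s≤s; s≤s⁻¹; _≤ᵇ_; _<ᵇ_; _≤?_)
open import Data.Bool using (Bool; true; false; not; _∧_; _∨_; if_then_else_; T)
open import Data.Fin using (Fin; zero; suc; _≟_; toℕ) renaming (#_ to ♯_)
open import Data.Fin.Permutation using (permutation)
open import Data.List using (List; []; _∷_; map; allFin; tabulate; cartesianProduct; length; lookup; filter)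
open import Data.List.Properties using (map-tabulate; length-map)
open import Data.Vec as Vec using (Vec; []; _∷_)
open import Data.Product using (Σ; ∃; _×_; _,_; proj₁; proj₂)
open import Data.Sum using (_⊎_; inj₁; inj₂)
open import Data.Empty using (⊥; ⊥-elim)
open import Data.Unit using (⊤; tt)
open import Function using (_∘_; id; case_of_)
open import Relation.Nullary using (¬_; Dec; yes; no)
open import Relation.Nullary.Decidable using (map′; _×-dec_; toWitness)
open import Data.List.Membership.Propositional using (_∈_)
open import Data.List.Membership.Propositional.Properties using (∈-allFin; ∈-cartesianProduct⁺)
open import Data.List.Relation.Unary.Any using (here; there)
open import Axiom.UniquenessOfIdentityProofs.WithK using (uip)
open import Data.List.Relation.Unary.All using (All; []; _∷_)
open import Data.List.Relation.Unary.AllPairs using ([]; _∷_)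
open import Data.List.Relation.Unary.Unique.Propositional using (Unique)
open import Data.List.Relation.Unary.Unique.Propositional.Properties using (filter⁺; allFin⁺)
open import Data.List.Relation.Unary.All.Properties using (all-filter)
open import Function.Bundles using (mk↔ₛ′)
import Data.Bool.Properties as Bool
import Data.Fin.Properties as Fin
import Data.Nat.ListAction as List
import Algebra.Properties.CommutativeMonoid.Sum +-0-commutativeMonoid as Sum
import Data.Nat.Properties as Nat
import Data.List.Relation.Unary.All as All
import Data.List.Relation.Unary.All.Properties as AllP

-- Linear arithmetic over ℕ by Farkas certificates

-- The quotient of a piece is never built as a graph. A piece is a class map on the vertices of `G`
-- and every count is made in `G`, so cut bounds and uncrossing are proved once, and no contraction
-- has to be shown to be a brick. Non-removability is rigid because the degree count around a Tutte
-- barrier has no slack: the two ends of f inside S and the two crossings of e balance exactly. This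
-- is why all parts have three cut edges. The constants come from a small configuration: a triangle
-- and two further vertices joined by a removable edge form a shore with |Y| = 5 and |M| = 1. The
-- summand 2 is the surplus that a shore hands to the piece above it. A triangle has no surplus and
-- perhaps no removable edge, which is the obstacle. Outside pieces with four classes a triangle
-- class does contain a removable edge; the four-class pieces that remain lead to the other two
-- excluded graphs.

infixl 6 _⊕_
infixr 7 _⊗_

data Lin (k : ℕ) : Set where
  var : Fin k → Lin k
  con : ℕ → Lin k
  _⊕_ : Lin k → Lin k → Lin k
  _⊗_ : ℕ → Lin k → Lin k

⟦_⟧ : ∀ {k} → Lin k → Vec ℕ k → ℕ
⟦ var i ⟧ ρ = Vec.lookup ρ i
⟦ con c ⟧ ρ = c
⟦ a ⊕ b ⟧ ρ = ⟦ a ⟧ ρ + ⟦ b ⟧ ρ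
⟦ c ⊗ a ⟧ ρ = c * ⟦ a ⟧ ρ

coef : ∀ {k} → Lin k → Fin k → ℕ
coef (var i) j = if i == j then 1 else 0
coef (con c) j = 0
coef (a ⊕ b) j = coef a j + coef b j
coef (c ⊗ a) j = c * coef a j

const : ∀ {k} → Lin k → ℕ
const (var i) = 0
const (con c) = c
const (a ⊕ b) = const a + const b
const (c ⊗ a) = c * const a

==-refl : ∀ {n} (i : Fin n) → (i == i) ≡ true
==-refl i with i ≟ i
... | yes _ = refl
... | no ¬p = ⊥-elim (¬p refl)

==-≡ : ∀ {n} {i j : Fin n} → (i == j) ≡ true → i ≡ j
==-≡ {i = i} {j} h with i ≟ j
... | yes p = p

==-≢ : ∀ {n} {i j : Fin n} → i ≢ j → (i == j) ≡ false
==-≢ {i = i} {j} h with i ≟ j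
... | yes p = ⊥-elim (h p)
... | no _ = refl

==-≡f : ∀ {n} {i j : Fin n} → (i == j) ≡ false → i ≢ j
==-≡f {i = i} h refl with trans (sym h) (==-refl i)
... | ()

same? : ∀ {n} (i j : Fin n) → i ≡ j ⊎ i ≢ j
same? i j with i ≟ j
... | yes p = inj₁ p
... | no p = inj₂ p

==-sym : ∀ {n} (i j : Fin n) → (i == j) ≡ (j == i)
==-sym i j with i ≟ j
... | yes refl = sym (==-refl i)
... | no ¬p = sym (==-≢ (¬p ∘ sym))

-- Finite sums over the vertices.

opaque
  -- Opaque, so that sums stay folded and enter the linear arithmetic as entries of `ρ`.
  sum : ∀ {n} → (Fin n → ℕ) → ℕ
  sum = Sum.sum

  sum-mono : ∀ {n} {f g : Fin n → ℕ} → (∀ i → f i ≤ g i) → sum f ≤ sum g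
  sum-mono {zero} h = z≤n
  sum-mono {suc n} h = +-mono-≤ (h zero) (sum-mono (h ∘ suc))

  *-distrib-sum : ∀ {n} c (f : Fin n → ℕ) → c * sum f ≡ sum (λ i → c * f i)
  *-distrib-sum {zero} c f = *-zeroʳ c
  *-distrib-sum {suc n} c f =
    trans (*-distribˡ-+ c (f zero) _) (cong (c * f zero +_) (*-distrib-sum c (f ∘ suc)))

  sum-cong : ∀ {n} {f g : Fin n → ℕ} → (∀ i → f i ≡ g i) → sum f ≡ sum g
  sum-cong = Sum.sum-cong-≗

  sum-+ : ∀ {n} (f g : Fin n → ℕ) → sum (λ i → f i + g i) ≡ sum f + sum g
  sum-+ = Sum.∑-distrib-+

  sum-comm : ∀ {m n} (f : Fin m → Fin n → ℕ) → sum (λ i → sum (f i)) ≡ sum (λ j → sum (λ i → f i j))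
  sum-comm = Sum.∑-comm

  sum-involution : ∀ {n} (f : Fin n → ℕ) (μ : Fin n → Fin n) → (∀ v → μ (μ v) ≡ v) → sum f ≡ sum (f ∘ μ)
  sum-involution f μ inv = Sum.sum-permute f (permutation μ μ inv inv)

  sum-0 : ∀ n → sum {n} (λ _ → 0) ≡ 0
  sum-0 n = Sum.sum-replicate-zero n

  sum-1 : ∀ n → sum {n} (λ _ → 1) ≡ n
  sum-1 zero = refl
  sum-1 (suc n) = cong suc (sum-1 n)

  sum-delta : ∀ {n} (i : Fin n) (f : Fin n → ℕ) → sum (λ j → (if i == j then 1 else 0) * f j) ≡ f i
  sum-delta {suc n} zero f = trans (cong₂ _+_ (+-identityʳ (f zero)) (sum-0 n)) (+-identityʳ _)
  sum-delta {suc n} (suc i) f =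
    trans (Sum.sum-cong-≗ (λ j → cong (λ b → (if b then 1 else 0) * f (suc j)) (eqs j))) (sum-delta i (f ∘ suc))
    where
    eqs : ∀ j → (suc i == suc j) ≡ (i == j)
    eqs j with i ≟ j
    ... | yes p = refl
    ... | no p = refl

  term≤sum : ∀ {n} (f : Fin n → ℕ) i → f i ≤ sum f
  term≤sum f zero = m≤m+n _ _
  term≤sum f (suc i) = ≤-trans (term≤sum (f ∘ suc) i) (m≤n+m _ _)

  -- The totals leave no slack for any single term. This is how a chain of inequalities that closes
  -- up yields structure: odd parts crossed once by each matching, parts with exactly three cut
  -- edges, embeddings of cubic graphs that are isomorphisms.
  squeeze : ∀ {n} (f g : Fin n → ℕ) → (∀ i → g i ≤ f i) → sum f ≤ sum g → ∀ i → f i ≡ g i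
  squeeze {suc n} f g h le zero = ≤-antisym
    (+-cancelʳ-≤ (sum (g ∘ suc)) _ _ (≤-trans (+-monoʳ-≤ (f zero) (sum-mono (h ∘ suc))) le)) (h zero)
  squeeze {suc n} f g h le (suc i) = squeeze (f ∘ suc) (g ∘ suc) (h ∘ suc)
    (+-cancelˡ-≤ (g zero) _ _ (≤-trans (+-monoˡ-≤ _ (h zero)) le)) i

  list-sum : ∀ {n} (f : Fin n → ℕ) → List.sum (map f (allFin n)) ≡ sum f
  list-sum {n} f = trans (cong List.sum (map-tabulate id f)) (go f)
    where
    go : ∀ {m} (f : Fin m → ℕ) → List.sum (tabulate f) ≡ sum f
    go {zero} f = refl
    go {suc m} f = cong (f zero +_) (go (f ∘ suc))

-- Soundness of the certificates.

lin-eval : ∀ {k} (e : Lin k) ρ → ⟦ e ⟧ ρ ≡ const e + sum (λ i → coef e i * Vec.lookup ρ i)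
lin-eval (var i) ρ = sym (sum-delta i (Vec.lookup ρ))
lin-eval {k} (con c) ρ = sym (trans (cong (c +_) (sum-0 k)) (+-identityʳ c))
lin-eval (a ⊕ b) ρ rewrite lin-eval a ρ | lin-eval b ρ =
  trans (inter (const a) _ (const b) _)
    (cong (const a + const b +_)
      (trans (sym (sum-+ _ _)) (sum-cong (λ i → sym (*-distribʳ-+ (Vec.lookup ρ i) (coef a i) (coef b i))))))
  where
  inter : ∀ x y z w → x + y + (z + w) ≡ x + z + (y + w)
  inter x y z w = trans (+-assoc x y _) (trans (cong (x +_) (trans (sym (+-assoc y z w))
    (trans (cong (_+ w) (+-comm y z)) (+-assoc z y w)))) (sym (+-assoc x z _)))
lin-eval (c ⊗ a) ρ rewrite lin-eval a ρ =
  trans (*-distribˡ-+ c (const a) _)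
    (cong (c * const a +_) (trans (*-distrib-sum c _) (sum-cong (λ i → sym (*-assoc c (coef a i) (Vec.lookup ρ i))))))

allB : ∀ {k} → (Fin k → Bool) → Bool
allB {zero} f = true
allB {suc k} f = f zero ∧ allB (f ∘ suc)

∧-splitT : ∀ a {b} → T (a ∧ b) → T a × T b
∧-splitT true h = tt , h

allB-sound : ∀ {k} (f : Fin k → Bool) → T (allB f) → ∀ i → T (f i)
allB-sound f h zero = proj₁ (∧-splitT (f zero) h)
allB-sound f h (suc i) = allB-sound (f ∘ suc) (proj₂ (∧-splitT (f zero) h)) i

Hyps : ℕ → Set
Hyps k = List (ℕ × Lin k × Lin k)

Holds : ∀ {k} → Vec ℕ k → Hyps k → Set
Holds ρ [] = ⊤
Holds ρ ((c , l , r) ∷ hs) = ⟦ l ⟧ ρ ≤ ⟦ r ⟧ ρ × Holds ρ hs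

lhs rhs : ∀ {k} → Hyps k → Lin k
lhs [] = con 0
lhs ((c , l , r) ∷ hs) = c ⊗ l ⊕ lhs hs
rhs [] = con 0
rhs ((c , l , r) ∷ hs) = c ⊗ r ⊕ rhs hs

combine : ∀ {k} ρ (hs : Hyps k) → Holds ρ hs → ⟦ lhs hs ⟧ ρ ≤ ⟦ rhs hs ⟧ ρ
combine ρ [] h = z≤n
combine ρ ((c , l , r) ∷ hs) (h , h') = +-mono-≤ (*-monoʳ-≤ c h) (combine ρ hs h')

-- The scaled hypotheses add up to an inequality whose left side has the larger constant and nowhere
-- a smaller coefficient. Variables range over ℕ, so it is false.
farkas : ∀ {k} → Hyps k → Bool
farkas hs = (const (rhs hs) <ᵇ const (lhs hs)) ∧ allB (λ i → coef (rhs hs) i ≤ᵇ coef (lhs hs) i)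

refute : ∀ {k} (ρ : Vec ℕ k) (hs : Hyps k) {_ : T (farkas hs)} → Holds ρ hs → ⊥
refute ρ hs {t} h with ∧-splitT (const (rhs hs) <ᵇ const (lhs hs)) t
... | t₁ , t₂ = <-irrefl refl (<-≤-trans
  (subst₂ _<_ (sym (lin-eval (rhs hs) ρ)) (sym (lin-eval (lhs hs) ρ))
    (+-mono-<-≤ (<ᵇ⇒< (const (rhs hs)) (const (lhs hs)) t₁)
      (sum-mono {f = λ i → coef (rhs hs) i * Vec.lookup ρ i} {λ i → coef (lhs hs) i * Vec.lookup ρ i} (λ i → *-monoˡ-≤ (Vec.lookup ρ i) (≤ᵇ⇒≤ (coef (rhs hs) i) (coef (lhs hs) i) (allB-sound (λ i → coef (rhs hs) i ≤ᵇ coef (lhs hs) i) t₂ i))))))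
  (combine ρ hs h))

-- The negated goal joins the hypotheses with multiplier `c`. As it reads `1 + r ≤ l`, the method
-- can round: a multiplier above 1 exploits integrality.
prove : ∀ {k} (ρ : Vec ℕ k) (l r : Lin k) c (hs : Hyps k) {_ : T (farkas ((c , con 1 ⊕ r , l) ∷ hs))} →
  Holds ρ hs → ⟦ l ⟧ ρ ≤ ⟦ r ⟧ ρ
prove ρ l r c hs {t} h = ≮⇒≥ (λ lt → refute ρ ((c , con 1 ⊕ r , l) ∷ hs) {t} (lt , h))

linear : ∀ {k} (ρ : Vec ℕ k) (l r : Lin k) {_ : T (farkas ((1 , con 1 ⊕ r , l) ∷ []))}
  {_ : T (farkas ((1 , con 1 ⊕ l , r) ∷ []))} → ⟦ l ⟧ ρ ≡ ⟦ r ⟧ ρ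
linear ρ l r {t} {t'} = ≤-antisym (prove ρ l r 1 [] {t} tt) (prove ρ r l 1 [] {t'} tt)

pattern x0 = var zero
pattern x1 = var (suc zero)
pattern x2 = var (suc (suc zero))
pattern x3 = var (suc (suc (suc zero)))
pattern x4 = var (suc (suc (suc (suc zero))))
pattern x5 = var (suc (suc (suc (suc (suc zero)))))
pattern x6 = var (suc (suc (suc (suc (suc (suc zero))))))
pattern x7 = var (suc (suc (suc (suc (suc (suc (suc zero)))))))

≤r : ∀ {a b : ℕ} → a ≡ b → a ≤ b
≤r = ≤-reflexive

≥r : ∀ {a b : ℕ} → a ≡ b → b ≤ a
≥r e = ≤-reflexive (sym e)

-- Indicators and truth tables.

ι : Bool → ℕ
ι b = if b then 1 else 0

everyB : ∀ k → (Vec Bool k → Bool) → Bool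
everyB zero f = f []
everyB (suc k) f = everyB k (f ∘ (true ∷_)) ∧ everyB k (f ∘ (false ∷_))

everyB-sound : ∀ k f → T (everyB k f) → ∀ v → T (f v)
everyB-sound zero f t [] = t
everyB-sound (suc k) f t (true ∷ v) = everyB-sound k _ (proj₁ (∧-splitT (everyB k (f ∘ (true ∷_))) t)) v
everyB-sound (suc k) f t (false ∷ v) = everyB-sound k _ (proj₂ (∧-splitT (everyB k (f ∘ (true ∷_))) t)) v

-- The implicit argument evaluates the whole truth table, so inequalities between indicator
-- expressions are settled by computation.
bool≤ : ∀ {k} (v : Vec Bool k) (f g : Vec Bool k → ℕ) {_ : T (everyB k (λ w → f w ≤ᵇ g w))} → f v ≤ g v
bool≤ {k} v f g {t} = ≤ᵇ⇒≤ _ _ (everyB-sound k _ t v)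

bool≡ : ∀ {k} (v : Vec Bool k) (f g : Vec Bool k → ℕ)
  {_ : T (everyB k (λ w → (f w ≤ᵇ g w) ∧ (g w ≤ᵇ f w)))} → f v ≡ g v
bool≡ {k} v f g {t} with ∧-splitT (f v ≤ᵇ g v) (everyB-sound k (λ w → (f w ≤ᵇ g w) ∧ (g w ≤ᵇ f w)) t v)
... | t₁ , t₂ = ≤-antisym (≤ᵇ⇒≤ _ _ t₁) (≤ᵇ⇒≤ _ _ t₂)

true≢false : ∀ {b} → b ≡ true → b ≡ false → ⊥
true≢false refl ()

¬true : ∀ {b} → ¬ (b ≡ true) → b ≡ false
¬true {true} h = ⊥-elim (h refl)
¬true {false} h = refl

¬false : ∀ {b} → ¬ (b ≡ false) → b ≡ true
¬false {true} h = refl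
¬false {false} h = ⊥-elim (h refl)

∧-l : ∀ {a b} → a ∧ b ≡ true → a ≡ true
∧-l {true} h = refl

∧-r : ∀ {a b} → a ∧ b ≡ true → b ≡ true
∧-r {true} h = h

∧-i : ∀ {a b} → a ≡ true → b ≡ true → a ∧ b ≡ true
∧-i refl refl = refl

∨-e : ∀ {a b} → a ∨ b ≡ true → a ≡ true ⊎ b ≡ true
∨-e {true} h = inj₁ refl
∨-e {false} h = inj₂ h

∨-l : ∀ {a b} → a ≡ true → a ∨ b ≡ true
∨-l refl = refl

∨-r : ∀ {a b} → b ≡ true → a ∨ b ≡ true
∨-r {true} h = refl
∨-r {false} h = h

not-t : ∀ {a} → not a ≡ true → a ≡ false
not-t {false} h = refl

not-f : ∀ {a} → a ≡ false → not a ≡ true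
not-f refl = refl

bool? : ∀ b → b ≡ true ⊎ b ≡ false
bool? true = inj₁ refl
bool? false = inj₂ refl

ι-true : ∀ {b} → b ≡ true → ι b ≡ 1
ι-true refl = refl

ι-false : ∀ {b} → b ≡ false → ι b ≡ 0
ι-false refl = refl

ι≤1 : ∀ b → ι b ≤ 1
ι≤1 true = ≤-refl
ι≤1 false = z≤n

ι-mono : ∀ {a b} → (a ≡ true → b ≡ true) → ι a ≤ ι b
ι-mono {false} h = z≤n
ι-mono {true} h rewrite h refl = ≤-refl

ι-cong : ∀ {a b} → (a ≡ true → b ≡ true) → (b ≡ true → a ≡ true) → ι a ≡ ι b
ι-cong h k = ≤-antisym (ι-mono h) (ι-mono k)

ι-≤ : ∀ {a m} → (a ≡ true → 1 ≤ m) → ι a ≤ m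
ι-≤ {true} h = h refl
ι-≤ {false} h = z≤n

-- Vertex sets and their sizes.

VSet : ℕ → Set
VSet n = Fin n → Bool

# : ∀ {n} → VSet n → ℕ
# P = sum (λ v → ι (P v))

count≡# : ∀ {n} (P : VSet n) → count P ≡ # P
count≡# P = list-sum (λ v → if P v then 1 else 0)

infixl 6 _─_

_─_ : ∀ {n} → VSet n → Fin n → VSet n
(P ─ v) w = P w ∧ not (w == v)

∁ : ∀ {n} → VSet n → VSet n
∁ P v = not (P v)

⁅_⁆ : ∀ {n} → Fin n → VSet n
⁅ v ⁆ w = v == w

#-mono : ∀ {n} {P Q : VSet n} → (∀ v → P v ≡ true → Q v ≡ true) → # P ≤ # Q
#-mono h = sum-mono (λ v → ι-mono (h v))

#-cong : ∀ {n} {P Q : VSet n} → (∀ v → P v ≡ Q v) → # P ≡ # Q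
#-cong h = sum-cong (λ v → cong ι (h v))

#-single : ∀ {n} (v : Fin n) → # ⁅ v ⁆ ≡ 1
#-single v = trans (sum-cong (λ w → sym (*-identityʳ _))) (sum-delta v (λ _ → 1))

#-─ : ∀ {n} (P : VSet n) v → P v ≡ true → # P ≡ suc (# (P ─ v))
#-─ P v pv = trans (sum-cong pt) (trans (sum-+ (λ w → ι (v == w)) _) (cong (_+ # (P ─ v)) (#-single v)))
  where
  pt : ∀ w → ι (P w) ≡ ι (v == w) + ι (P w ∧ not (w == v))
  pt w with v ≟ w
  ... | yes refl rewrite pv | ==-refl v = refl
  ... | no v≢w rewrite ==-≢ (v≢w ∘ sym) = cong ι (sym (Bool.∧-identityʳ (P w)))

#≥1 : ∀ {n} (P : VSet n) v → P v ≡ true → 1 ≤ # P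
#≥1 P v pv = subst (1 ≤_) (sym (#-─ P v pv)) (s≤s z≤n)

#-∃ : ∀ {n} (P : VSet n) → 1 ≤ # P → ∃ λ v → P v ≡ true
#-∃ {n} P h with Fin.any? (λ v → P v Bool.≟ true)
... | yes p = p
... | no ¬p = ⊥-elim (refute (# P ∷ []) ((1 , con 1 , x0) ∷ (1 , x0 , con 0) ∷ [])
  (h , ≤-trans (sum-mono {g = λ _ → 0} (λ v → ≤-reflexive (ι-false (¬true (λ q → ¬p (v , q)))))) (≤-reflexive (sum-0 n)) , tt))

#≥2 : ∀ {n} (P : VSet n) {v w} → P v ≡ true → P w ≡ true → v ≢ w → 2 ≤ # P
#≥2 P {v} {w} pv pw v≢w = subst (2 ≤_) (sym (#-─ P v pv))
  (s≤s (#≥1 (P ─ v) w (∧-i pw (not-f (==-≢ (v≢w ∘ sym))))))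

─-∈ : ∀ {n} {P : VSet n} {v w} → (P ─ v) w ≡ true → P w ≡ true × v ≢ w
─-∈ {P = P} {v} {w} h = ∧-l h , λ e → true≢false (==-refl w) (trans (cong (w ==_) (sym e)) (not-t (∧-r {P w} h)))

#-∃₂ : ∀ {n} (P : VSet n) → 2 ≤ # P → ∃ λ v → ∃ λ w → P v ≡ true × P w ≡ true × v ≢ w
#-∃₂ P h with #-∃ P (≤-trans (s≤s z≤n) h)
... | v , pv with #-∃ (P ─ v) (s≤s⁻¹ (subst (2 ≤_) (#-─ P v pv) h))
... | w , pw = let (a , b) = ─-∈ {P = P} pw in v , w , pv , a , b

#-∃₃ : ∀ {n} (P : VSet n) → 3 ≤ # P → ∃ λ v → ∃ λ w → ∃ λ u →
  P v ≡ true × P w ≡ true × P u ≡ true × v ≢ w × v ≢ u × w ≢ u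
#-∃₃ P h with #-∃ P (≤-trans (s≤s z≤n) h)
... | v , pv with #-∃₂ (P ─ v) (s≤s⁻¹ (subst (3 ≤_) (#-─ P v pv) h))
... | w , u , pw , pu , w≢u = let (a , b) = ─-∈ {P = P} pw ; (c , d) = ─-∈ {P = P} pu in v , w , u , pv , a , c , b , d , w≢u

#≤1-unique : ∀ {n} (P : VSet n) → # P ≤ 1 → ∀ {v w} → P v ≡ true → P w ≡ true → v ≡ w
#≤1-unique P h {v} {w} pv pw with v ≟ w
... | yes p = p
... | no ¬p = ⊥-elim (<-irrefl refl (≤-trans (#≥2 P pv pw ¬p) h))

#-0 : ∀ {n} (P : VSet n) → # P ≡ 0 → ∀ v → P v ≡ false
#-0 P h v = ¬true (λ p → case subst (1 ≤_) h (#≥1 P v p) of λ ())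

#-∁ : ∀ {n} (P : VSet n) → # P + # (∁ P) ≡ # {n} (λ _ → true)
#-∁ P = trans (sym (sum-+ (λ v → ι (P v)) _)) (sum-cong (λ v → bool≡ (P v ∷ []) (λ { (a ∷ []) → ι a + ι (not a) }) (λ _ → 1)))

#-all : ∀ n → # {n} (λ _ → true) ≡ n
#-all n = sum-1 n

-- Double sums and counting of pairs.

∑₂ : ∀ {n m} → (Fin n → Fin m → ℕ) → ℕ
∑₂ f = sum (λ u → sum (f u))

∑₂-mono : ∀ {n m} {f g : Fin n → Fin m → ℕ} → (∀ u v → f u v ≤ g u v) → ∑₂ f ≤ ∑₂ g
∑₂-mono h = sum-mono (λ u → sum-mono (h u))

∑₂-cong : ∀ {n m} {f g : Fin n → Fin m → ℕ} → (∀ u v → f u v ≡ g u v) → ∑₂ f ≡ ∑₂ g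
∑₂-cong h = sum-cong (λ u → sum-cong (h u))

∑₂-+ : ∀ {n m} (f g : Fin n → Fin m → ℕ) → ∑₂ (λ u v → f u v + g u v) ≡ ∑₂ f + ∑₂ g
∑₂-+ f g = trans (sum-cong (λ u → sum-+ (f u) (g u))) (sum-+ _ _)

∑₂-swap : ∀ {n m} (f : Fin n → Fin m → ℕ) → ∑₂ f ≡ ∑₂ (λ v u → f u v)
∑₂-swap f = sum-comm f

∑₂-* : ∀ {n m} c (f : Fin n → Fin m → ℕ) → c * ∑₂ f ≡ ∑₂ (λ u v → c * f u v)
∑₂-* c f = trans (*-distrib-sum c _) (sum-cong (λ u → *-distrib-sum c (f u)))

term≤∑₂ : ∀ {n m} (f : Fin n → Fin m → ℕ) u v → f u v ≤ ∑₂ f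
term≤∑₂ f u v = ≤-trans (term≤sum (f u) v) (term≤sum (λ u → sum (f u)) u)

∑₂-∃ : ∀ {n m} (R : Fin n → Fin m → Bool) → 1 ≤ ∑₂ (λ u v → ι (R u v)) → ∃ λ u → ∃ λ v → R u v ≡ true
∑₂-∃ R h with Fin.any? (λ u → Fin.any? (λ v → R u v Bool.≟ true))
... | yes p = p
... | no ¬p = ⊥-elim (<-irrefl refl (≤-trans h (≤-trans
  (∑₂-mono {g = λ _ _ → 0} (λ u v → ≤-reflexive (ι-false (¬true (λ q → ¬p (u , v , q))))))
  (≤-reflexive (trans (sum-cong (λ _ → sum-0 _)) (sum-0 _))))))

δ : ∀ {n m} → Fin n → Fin m → Fin n → Fin m → ℕ
δ a b u v = ι ((a == u) ∧ (b == v))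

∑₂-δ : ∀ {n m} (a : Fin n) (b : Fin m) → ∑₂ (δ a b) ≡ 1
∑₂-δ {n} {m} a b = trans (sum-cong row) (#-single a)
  where
  row : ∀ u → sum (λ v → ι ((a == u) ∧ (b == v))) ≡ ι (a == u)
  row u with a == u
  ... | true = #-single b
  ... | false = sum-0 m

δ-refl : ∀ {n m} (a : Fin n) (b : Fin m) → δ a b a b ≡ 1
δ-refl a b rewrite ==-refl a | ==-refl b = refl

-- After exchanging the summations each inner row is a delta. It regroups counts by the parts of a
-- barrier or by the classes of a piece.
fibre : ∀ {n m} (c : Fin n → Fin m) (f : Fin n → ℕ) →
  sum f ≡ sum (λ q → sum (λ v → ι (c v == q) * f v))
fibre {n} {m} c f = trans (sum-cong (λ v → sym (row v))) (sum-comm (λ v q → ι (c v == q) * f v))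
  where
  row : ∀ v → sum (λ q → ι (c v == q) * f v) ≡ f v
  row v = sum-delta (c v) (λ _ → f v)

-- Parity.

data Even : ℕ → Set where
  even : ∀ k → Even (k + k)

Odd : ℕ → Set
Odd k = Even (suc k)

parity : ∀ k → Even k ⊎ Odd k
parity zero = inj₁ (even 0)
parity (suc k) with parity k
... | inj₁ (even j) = inj₂ (subst Even (cong suc (+-suc j j)) (even (suc j)))
... | inj₂ o = inj₁ o

half : ∀ {k} → Even k → ∃ λ j → k ≡ j + j
half (even j) = j , refl

dbl≢ : ∀ i j → i + i ≢ suc (j + j)
dbl≢ (suc i) zero e = case trans (sym (+-suc i i)) (suc-injective e) of λ ()
dbl≢ (suc i) (suc j) e = dbl≢ i j (suc-injective (trans (sym (+-suc i i)) (trans (suc-injective e) (cong suc (+-suc j j)))))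

¬even-odd : ∀ {k} → Even k → Odd k → ⊥
¬even-odd e o with half e | half o
... | i , refl | j , q = dbl≢ j i (sym q)

even-+ : ∀ {a b} → Even a → Even b → Even (a + b)
even-+ (even i) (even j) = subst Even (sym (trans (cong (i + i +_) refl) (eq i j))) (even (i + j))
  where
  eq : ∀ i j → i + i + (j + j) ≡ i + j + (i + j)
  eq i j = trans (+-assoc i i _) (trans (cong (i +_) (trans (sym (+-assoc i j j)) (trans (cong (_+ j) (+-comm i j)) (+-assoc j i j)))) (sym (+-assoc i j _)))

even-cancel : ∀ {a b} → Even (a + b) → Even b → Even a
even-cancel {a} {b} e eb with parity a
... | inj₁ p = p
... | inj₂ o = ⊥-elim (¬even-odd e (even-+ o eb))

parity-pos : ∀ {k} → Even k → 1 ≤ k → 2 ≤ k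
parity-pos (even (suc j)) h = s≤s (≤-trans (s≤s z≤n) (≤-reflexive (sym (+-suc j j))))

-- A Boolean parity, because the odd parts of a barrier have to be counted by `#`.
oddᵇ : ℕ → Bool
oddᵇ zero = false
oddᵇ (suc k) = not (oddᵇ k)

oddᵇ-+ : ∀ k → oddᵇ (k + k) ≡ false
oddᵇ-+ zero = refl
oddᵇ-+ (suc k) rewrite +-suc k k | oddᵇ-+ k = refl

oddᵇ-even : ∀ {k} → Even k → oddᵇ k ≡ false
oddᵇ-even (even k) = oddᵇ-+ k

oddᵇ-odd : ∀ {k} → Odd k → oddᵇ k ≡ true
oddᵇ-odd {k} o = ¬false (λ h → true≢false (cong not h) (oddᵇ-even o))

odd-from : ∀ {k} → oddᵇ k ≡ true → Odd k
odd-from {k} h with parity k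
... | inj₁ e = ⊥-elim (true≢false h (oddᵇ-even e))
... | inj₂ o = o

even-from : ∀ {k} → oddᵇ k ≡ false → Even k
even-from {k} h with parity k
... | inj₁ e = e
... | inj₂ o = ⊥-elim (true≢false (oddᵇ-odd o) h)

-- Finite search

Searchable : Set → Set₁
Searchable A = (P : A → Set) → (∀ a → Dec (P a)) → Dec (∃ P)

-- Function extensionality is not assumed, so the predicate has to respect pointwise equality: the
-- search meets a function only as rebuilt from its head and tail.
SearchFun : ∀ m {A : Set} → Searchable A → (P : (Fin m → A) → Set) → (∀ f → Dec (P f)) →
  (∀ {f g} → (∀ i → f i ≡ g i) → P f → P g) → Dec (∃ P)
SearchFun zero {A} s P d ext = map′ (λ p → none , p) (λ (f , p) → ext {f} {none} (λ ()) p) (d none)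
  where
  none : Fin 0 → A
  none ()
SearchFun (suc m) {A} s P d ext = map′ to from
  (s (λ a → ∃ λ f → P (cons a f)) (λ a → SearchFun m s (P ∘ cons a) (d ∘ cons a) (λ h → ext (cons-cong h))))
  where
  cons : A → (Fin m → A) → Fin (suc m) → A
  cons a f zero = a
  cons a f (suc i) = f i
  cons-cong : ∀ {a f g} → (∀ i → f i ≡ g i) → ∀ i → cons a f i ≡ cons a g i
  cons-cong h zero = refl
  cons-cong h (suc i) = h i
  to : (∃ λ a → ∃ λ f → P (cons a f)) → ∃ P
  to (a , f , p) = cons a f , p
  from : ∃ P → ∃ λ a → ∃ λ f → P (cons a f)
  from (f , p) = f zero , f ∘ suc , ext (λ { zero → refl ; (suc i) → refl }) p

search-Fin : ∀ {k} → Searchable (Fin k)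
search-Fin P d = Fin.any? d

search-Bool : Searchable Bool
search-Bool P d with d true | d false
... | yes p | _ = yes (true , p)
... | no _ | yes q = yes (false , q)
... | no p | no q = no λ { (true , r) → p r ; (false , r) → q r }

-- Each improvement raises the size, which never exceeds `n`, so fuel `n` suffices.
argmax : ∀ {n} (P : VSet n → Set) → (∀ X → Dec (P X)) → (∀ {X Y} → (∀ v → X v ≡ Y v) → P X → P Y) →
  ∃ P → ∃ λ X → P X × (∀ Y → P Y → # Y ≤ # X)
argmax {n} P d ext (X₀ , p₀) = go n X₀ p₀ (m≤n+m n (# X₀))
  where
  bound : ∀ (X : VSet n) → # X ≤ n
  bound X = ≤-trans (#-mono (λ _ _ → refl)) (≤-reflexive (#-all n))
  go : ∀ fuel X → P X → n ≤ # X + fuel → ∃ λ X → P X × (∀ Y → P Y → # Y ≤ # X)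
  go zero X p h = X , p , λ Y _ → ≤-trans (bound Y) (≤-trans h (≤-reflexive (+-identityʳ _)))
  go (suc k) X p h with SearchFun n search-Bool (λ Y → P Y × # X < # Y) (λ Y → d Y ×-dec (suc (# X) ≤? # Y))
                        (λ e (p , l) → ext e p , ≤-trans l (≤-reflexive (#-cong e)))
  ... | yes (Y , q , l) = go k Y q (≤-trans h (≤-trans (≤-reflexive (+-suc (# X) k)) (+-monoˡ-≤ k l)))
  ... | no ¬q = X , p , λ Y q → ≮⇒≥ (λ l → ¬q (Y , q , l))

-- Canonical representatives, and sets closed under an involution.

first : ∀ {n} → VSet n → Maybe (Fin n)
first {zero} P = nothing
first {suc n} P = if P zero then just zero else Maybe.map suc (first (P ∘ suc))

first-cong : ∀ {n} {P Q : VSet n} → (∀ v → P v ≡ Q v) → first P ≡ first Q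
first-cong {zero} h = refl
first-cong {suc n} {P} {Q} h rewrite h zero | first-cong (h ∘ suc) = refl

first-∈ : ∀ {n} (P : VSet n) v → P v ≡ true → ∃ λ w → first P ≡ just w × P w ≡ true
first-∈ {suc n} P v pv with P zero in eq
... | true = zero , refl , eq
first-∈ {suc n} P zero pv | false = ⊥-elim (true≢false pv eq)
first-∈ {suc n} P (suc v) pv | false with first-∈ (P ∘ suc) v pv
... | w , e , q rewrite e = suc w , refl , q

-- On a nonempty set the value depends on the set alone, so all members of a class receive the same
-- label. The default `d` only makes the function total.
least : ∀ {n} → VSet n → Fin n → Fin n
least P d = Maybe.fromMaybe d (first P)

least-∈ : ∀ {n} (P : VSet n) d v → P v ≡ true → P (least P d) ≡ true
least-∈ P d v pv with first-∈ P v pv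
... | w , e , q rewrite e = q

least-cong : ∀ {n} {P Q : VSet n} d d' v → P v ≡ true → (∀ v → P v ≡ Q v) → least P d ≡ least Q d'
least-cong {P = P} d d' v pv h with first-∈ P v pv
... | w , e , q rewrite sym (first-cong h) | e = refl

lt : ∀ {n} → Fin n → Fin n → Bool
lt v w = toℕ v <ᵇ toℕ w

lt-≢ : ∀ {n} {v w : Fin n} → v ≢ w → ι (lt v w) + ι (lt w v) ≡ 1
lt-≢ {v = v} {w} v≢w = go (toℕ v) (toℕ w) (v≢w ∘ Fin.toℕ-injective)
  where
  go : ∀ a b → a ≢ b → ι (a <ᵇ b) + ι (b <ᵇ a) ≡ 1
  go zero zero h = ⊥-elim (h refl)
  go zero (suc b) h = refl
  go (suc a) zero h = refl
  go (suc a) (suc b) h = go a b (h ∘ cong suc)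

-- In each pair `v`, `μ v` exactly one vertex lies below its partner.
closed-count : ∀ {n} (P : VSet n) (μ : Fin n → Fin n) → (∀ v → μ (μ v) ≡ v) →
  (∀ v → P v ≡ true → P (μ v) ≡ true) → (∀ v → P v ≡ true → μ v ≢ v) →
  # P ≡ # (λ v → P v ∧ lt v (μ v)) + # (λ v → P v ∧ lt v (μ v))
closed-count P μ inv cl nf = trans (sum-cong pt) (trans (sum-+ (λ v → ι (P v ∧ lt v (μ v))) _)
  (cong (# (λ v → P v ∧ lt v (μ v)) +_) (sym (trans (sum-involution _ μ inv) (sum-cong pt₂)))))
  where
  pt : ∀ v → ι (P v) ≡ ι (P v ∧ lt v (μ v)) + ι (P v ∧ lt (μ v) v)
  pt v with P v in e
  ... | true = sym (lt-≢ (nf v e ∘ sym))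
  ... | false = refl
  pt₂ : ∀ v → ι (P (μ v) ∧ lt (μ v) (μ (μ v))) ≡ ι (P v ∧ lt (μ v) v)
  pt₂ v rewrite inv v with P v in e | P (μ v) in e'
  ... | true | true = refl
  ... | false | false = refl
  ... | true | false = ⊥-elim (true≢false (cl v e) e')
  ... | false | true = ⊥-elim (true≢false (subst (λ w → P w ≡ true) (inv v) (cl (μ v) e')) e)

closed-even : ∀ {n} (P : VSet n) (μ : Fin n → Fin n) → (∀ v → μ (μ v) ≡ v) →
  (∀ v → P v ≡ true → P (μ v) ≡ true) → (∀ v → P v ≡ true → μ v ≢ v) → Even (# P)
closed-even P μ inv cl nf = subst Even (sym (closed-count P μ inv cl nf)) (even (# (λ v → P v ∧ lt v (μ v))))

-- Matchings are involutions whose fixed points are the unmatched vertices.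

unlink : ∀ {n} → (Fin n → Fin n) → Fin n → Fin n → Fin n
unlink μ u v with v ≟ u | v ≟ μ u
... | yes _ | _ = v
... | no _ | yes _ = v
... | no _ | no _ = μ v

unlink-u : ∀ {n} (μ : Fin n → Fin n) u → unlink μ u u ≡ u
unlink-u μ u with u ≟ u | u ≟ μ u
... | yes _ | _ = refl
... | no ¬p | _ = ⊥-elim (¬p refl)

unlink-μ : ∀ {n} (μ : Fin n → Fin n) u → unlink μ u (μ u) ≡ μ u
unlink-μ μ u with μ u ≟ u | μ u ≟ μ u
... | yes _ | _ = refl
... | no _ | yes _ = refl
... | no _ | no ¬p = ⊥-elim (¬p refl)

unlink-o : ∀ {n} (μ : Fin n → Fin n) u v → v ≢ u → v ≢ μ u → unlink μ u v ≡ μ v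
unlink-o μ u v p q with v ≟ u | v ≟ μ u
... | yes r | _ = ⊥-elim (p r)
... | no _ | yes r = ⊥-elim (q r)
... | no _ | no _ = refl

link : ∀ {n} → (Fin n → Fin n) → Fin n → Fin n → Fin n → Fin n
link μ u w v with v ≟ u | v ≟ w
... | yes _ | _ = w
... | no _ | yes _ = u
... | no _ | no _ = μ v

link-u : ∀ {n} (μ : Fin n → Fin n) u w → link μ u w u ≡ w
link-u μ u w with u ≟ u | u ≟ w
... | yes _ | _ = refl
... | no ¬p | _ = ⊥-elim (¬p refl)

link-w : ∀ {n} (μ : Fin n → Fin n) u w → link μ u w w ≡ u
link-w μ u w with w ≟ u | w ≟ w
... | yes e | _ = e
... | no _ | yes _ = refl
... | no _ | no ¬p = ⊥-elim (¬p refl)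

link-o : ∀ {n} (μ : Fin n → Fin n) u w v → v ≢ u → v ≢ w → link μ u w v ≡ μ v
link-o μ u w v p q with v ≟ u | v ≟ w
... | yes r | _ = ⊥-elim (p r)
... | no _ | yes r = ⊥-elim (q r)
... | no _ | no _ = refl

Involution : ∀ {n} → (Fin n → Fin n) → Set
Involution μ = ∀ v → μ (μ v) ≡ v

unlink-inv : ∀ {n} {μ : Fin n → Fin n} u → Involution μ → Involution (unlink μ u)
unlink-inv {μ = μ} u inv v with same? v u | same? v (μ u)
... | inj₁ refl | _ = trans (cong (unlink μ u) (unlink-u μ u)) (unlink-u μ u)
... | inj₂ _ | inj₁ refl = trans (cong (unlink μ u) (unlink-μ μ u)) (unlink-μ μ u)
... | inj₂ v≢u | inj₂ v≢μ = trans (cong (unlink μ u) (unlink-o μ u v v≢u v≢μ))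
  (trans (unlink-o μ u (μ v) (λ e → v≢μ (trans (sym (inv v)) (cong μ e)))
    (λ e → v≢u (trans (sym (inv v)) (trans (cong μ e) (inv u))))) (inv v))

link-inv : ∀ {n} {μ : Fin n → Fin n} u w → μ u ≡ u → μ w ≡ w → Involution μ → Involution (link μ u w)
link-inv {μ = μ} u w fu fw inv v with same? v u | same? v w
... | inj₁ refl | _ = trans (cong (link μ u w) (link-u μ u w)) (link-w μ u w)
... | inj₂ _ | inj₁ refl = trans (cong (link μ u w) (link-w μ u w)) (link-u μ u w)
... | inj₂ v≢u | inj₂ v≢w = trans (cong (link μ u w) (link-o μ u w v v≢u v≢w))
  (trans (link-o μ u w (μ v) (λ e → v≢u (trans (sym (inv v)) (trans (cong μ e) fu)))
    (λ e → v≢w (trans (sym (inv v)) (trans (cong μ e) fw)))) (inv v))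

-- Switching along an alternating path: on a set closed under both matchings one may be exchanged
-- for the other.
flip : ∀ {n} → VSet n → (Fin n → Fin n) → (Fin n → Fin n) → Fin n → Fin n
flip X μ' μ v = if X v then μ' v else μ v

flip-inv : ∀ {n} (X : VSet n) {μ' μ : Fin n → Fin n} → Involution μ' → Involution μ →
  (∀ v → X v ≡ true → X (μ' v) ≡ true) → (∀ v → X v ≡ true → X (μ v) ≡ true) → Involution (flip X μ' μ)
flip-inv X {μ'} {μ} i' i c' c v with X v in e
... | true rewrite c' v e = i' v
... | false with X (μ v) in e'
...   | true = ⊥-elim (true≢false (subst (λ w → X w ≡ true) (i v) (c (μ v) e')) e)
...   | false = i v

-- The component of q in the union of two matchings, when q is unmatched by the second one

module Walk {n} (μ₁ μ₂ : Fin n → Fin n) (inv₁ : Involution μ₁) (inv₂ : Involution μ₂)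
  (q : Fin n) (q-fix : μ₂ q ≡ q) where

  par : ℕ → Bool
  par zero = true
  par (suc i) = not (par i)

  stepB : Bool → Fin n → Fin n
  stepB b = if b then μ₁ else μ₂

  p : ℕ → Fin n
  p zero = q
  p (suc i) = stepB (par i) (p i)

  back : ∀ i → stepB (par i) (p (suc i)) ≡ p i
  back i with par i
  ... | true = inv₁ (p i)
  ... | false = inv₂ (p i)

  Stop : ℕ → Set
  Stop k = p (suc k) ≡ p k

  par-≢ : ∀ i → par i ≢ not (par i)
  par-≢ i e with par i
  par-≢ i () | true
  par-≢ i () | false

  -- By parity, two equal positions either move one step towards each other or both move one step
  -- back. They end as consecutive equal positions, or at `q`, which `μ₂` fixes; both are stops.
  repeat : ∀ d i → p i ≡ p (i + suc d) → ∃ λ k → k < i + suc d × Stop k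
  repeat d i e with par i Bool.≟ par (i + d)
  repeat zero i e | yes _ = i , ≤-reflexive (sym (trans (+-suc i 0) (cong suc (+-identityʳ i)))) ,
    trans (cong p (trans (cong suc (sym (+-identityʳ i))) (sym (+-suc i 0)))) (sym e)
  repeat (suc zero) i e | yes r = ⊥-elim (par-≢ i (trans r (trans (cong par (+-suc i 0)) (cong (not ∘ par) (+-identityʳ i)))))
  repeat (suc (suc d)) i e | yes r with repeat d (suc i)
      (trans (cong₂ stepB r e) (trans (cong (stepB (par (i + suc (suc d)))) (cong p (+-suc i (suc (suc d)))))
        (trans (back (i + suc (suc d))) (cong p (+-suc i (suc d))))))
  ... | k , lt' , s = k , ≤-trans lt' (≤-trans (≤-reflexive (sym (+-suc i (suc d)))) (+-monoʳ-≤ i (n≤1+n _))) , s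
  repeat d zero e | no r = d , ≤-refl , trans (sym e) (sym (trans (sym (back d))
    (trans (cong (λ b → stepB b (p (suc d))) (¬true (λ t → r (sym t)))) (trans (cong μ₂ (sym e)) q-fix))))
  repeat d (suc i) e | no r with repeat d i
      (trans (sym (back i)) (trans (cong₂ stepB par-eq e) (trans (cong (stepB (par (suc i + d))) (cong p (cong suc (+-suc i d))))
        (trans (back (suc i + d)) (cong p (sym (+-suc i d)))))))
    where
    flipB : ∀ {a b} → not a ≢ b → a ≡ b
    flipB {true} {true} h = refl
    flipB {true} {false} h = ⊥-elim (h refl)
    flipB {false} {true} h = ⊥-elim (h refl)
    flipB {false} {false} h = refl
    par-eq : par i ≡ par (suc i + d)
    par-eq = flipB r
  ... | k , lt' , s = k , m≤n⇒m≤1+n lt' , s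

  least-ℕ : ∀ k → Stop k → ∃ λ k → Stop k × (∀ j → j < k → ¬ Stop j)
  least-ℕ k s = go k 0 (≤-reflexive (sym (+-identityʳ k))) λ _ ()
    where
    go : ∀ fuel j → k ≤ fuel + j → (∀ i → i < j → ¬ Stop i) → ∃ λ k → Stop k × (∀ j → j < k → ¬ Stop j)
    go fuel j h no' with p (suc j) ≟ p j
    ... | yes t = j , t , no'
    go zero j h no' | no t with ≤⇒≤′ h
    ... | _ = k , s , λ i i<k → no' i (≤-trans i<k h)
    go (suc f) j h no' | no t = go f (suc j) (≤-trans h (≤-reflexive (sym (+-suc f j))))
      λ i i< → case m≤n⇒m<n∨m≡n (s≤s⁻¹ i<) of λ { (inj₁ l) → no' i l ; (inj₂ refl) → t }

  opaque
    stop : ∃ λ k → Stop k × (∀ j → j < k → ¬ Stop j)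
    stop with Fin.pigeonhole (n<1+n n) (λ i → p (toℕ i))
    ... | i , j , i<j , e with m≤n⇒∃[o]m+o≡n i<j
    ... | d , r with repeat d (toℕ i) (trans e (cong p (sym (trans (+-suc (toℕ i) d) r))))
    ... | k , _ , s = least-ℕ k s

  k : ℕ
  k = proj₁ stop

  k-stop : Stop k
  k-stop = proj₁ (proj₂ stop)

  k-min : ∀ j → j < k → ¬ Stop j
  k-min = proj₂ (proj₂ stop)

  On : Fin n → Set
  On v = ∃ λ i → i < suc k × p i ≡ v

  opaque
    on? : ∀ v → Dec (On v)
    on? v = anyUpTo? (λ i → p i ≟ v) (suc k)

  X : VSet n
  X v with on? v
  ... | yes _ = true
  ... | no _ = false

  X-on : ∀ {v} → X v ≡ true → On v
  X-on {v} h with on? v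
  ... | yes o = o

  on-X : ∀ {v} → On v → X v ≡ true
  on-X {v} o with on? v
  ... | yes _ = refl
  ... | no ¬o = ⊥-elim (¬o o)

  X-q : X q ≡ true
  X-q = on-X (0 , s≤s z≤n , refl)

  next-on : ∀ i → i < suc k → On (p (suc i))
  next-on i h with m≤n⇒m<n∨m≡n (s≤s⁻¹ h)
  ... | inj₁ l = suc i , s≤s l , refl
  ... | inj₂ refl = k , ≤-refl , sym k-stop

  back-b : ∀ i b → par i ≡ b → stepB b (p (suc i)) ≡ p i
  back-b i b refl = back i

  closed₁ : ∀ v → X v ≡ true → X (μ₁ v) ≡ true
  closed₁ v h with X-on h
  ... | i , l , refl with bool? (par i)
  ... | inj₁ t = on-X (subst (λ b → On (stepB b (p i))) t (next-on i l))
  closed₁ v h | zero , l , refl | inj₂ ()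
  closed₁ v h | suc i , l , refl | inj₂ f = on-X (i , <⇒≤ l , sym (back-b i true (¬false (λ e → true≢false (cong not e) f))))

  closed₂ : ∀ v → X v ≡ true → X (μ₂ v) ≡ true
  closed₂ v h with X-on h
  ... | i , l , refl with bool? (par i)
  ... | inj₂ t = on-X (subst (λ b → On (stepB b (p i))) t (next-on i l))
  closed₂ v h | zero , l , refl | inj₁ _ = subst (λ w → X w ≡ true) (sym q-fix) X-q
  closed₂ v h | suc i , l , refl | inj₁ f = on-X (i , <⇒≤ l , sym (back-b i false (not-t f)))

  end : Fin n
  end = p k

  next-b : ∀ i b → par i ≡ b → p (suc i) ≡ stepB b (p i)
  next-b i b refl = refl

  -- A fixed vertex before the end would have stopped the walk there or one step earlier, against
  -- the minimality of `k`. So only the end can be fixed, and only if `μ₁` is the matching due next.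
  fixed₁ : ∀ v → X v ≡ true → μ₁ v ≡ v → v ≡ end × par k ≡ true
  fixed₁ v h f with X-on h
  ... | i , l , refl with bool? (par i)
  fixed₁ v h f | i , l , refl | inj₁ t with m≤n⇒m<n∨m≡n (s≤s⁻¹ l)
  ... | inj₁ l' = ⊥-elim (k-min i l' (trans (next-b i true t) f))
  ... | inj₂ refl = refl , t
  fixed₁ v h f | zero , l , refl | inj₂ ()
  fixed₁ v h f | suc i , l , refl | inj₂ t = ⊥-elim (k-min i (s≤s⁻¹ l)
    (trans (sym f) (back-b i true (¬false (λ e → true≢false (cong not e) t)))))

  fixed₂ : ∀ v → X v ≡ true → μ₂ v ≡ v → v ≡ q ⊎ (v ≡ end × par k ≡ false)
  fixed₂ v h f with X-on h
  ... | i , l , refl with bool? (par i)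
  fixed₂ v h f | i , l , refl | inj₂ t with m≤n⇒m<n∨m≡n (s≤s⁻¹ l)
  ... | inj₁ l' = ⊥-elim (k-min i l' (trans (next-b i false t) f))
  ... | inj₂ refl = inj₂ (refl , t)
  fixed₂ v h f | zero , l , refl | inj₁ _ = inj₁ refl
  fixed₂ v h f | suc i , l , refl | inj₁ t = ⊥-elim (k-min i (s≤s⁻¹ l) (trans (sym f) (back-b i false (not-t t))))

  X-end : X end ≡ true
  X-end = on-X (k , ≤-refl , refl)

  end₁ : par k ≡ true → μ₁ end ≡ end
  end₁ t = trans (sym (next-b k true t)) k-stop

  end₂ : par k ≡ false → μ₂ end ≡ end
  end₂ t = trans (sym (next-b k false t)) k-stop

  -- A return to `q` repeats position 0 and so forces a stop before `k`.
  end≢q : par k ≡ false → end ≢ q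
  end≢q = go k k-min
    where
    go : ∀ k → (∀ j → j < k → ¬ Stop j) → par k ≡ false → p k ≢ q
    go (suc k) min f e with repeat k 0 (sym e)
    ... | j , l , s = min j l s

-- Tutte's theorem for perfect matchings containing a prescribed edge x y

Symmetric Irreflexive : ∀ {n} → Graph n → Set
Symmetric H = ∀ u v → H u v ≡ H v u
Irreflexive H = ∀ u → H u u ≡ false

_⊆ᴳ_ : ∀ {n} → Graph n → Graph n → Set
H ⊆ᴳ K = ∀ u v → H u v ≡ true → K u v ≡ true

isE : ∀ {n} → Fin n → Fin n → Fin n → Fin n → Bool
isE u v s t = (u == s ∧ v == t) ∨ (u == t ∧ v == s)

isE-e : ∀ {n} {u v s t : Fin n} → isE u v s t ≡ true → (u ≡ s × v ≡ t) ⊎ (u ≡ t × v ≡ s)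
isE-e {u = u} {v} {s} {t} h with ∨-e {u == s ∧ v == t} h
... | inj₁ p = inj₁ (==-≡ (∧-l p) , ==-≡ (∧-r {u == s} p))
... | inj₂ p = inj₂ (==-≡ (∧-l p) , ==-≡ (∧-r {u == t} p))

isE-1 : ∀ {n} (u v : Fin n) → isE u v u v ≡ true
isE-1 u v rewrite ==-refl u | ==-refl v = refl

isE-2 : ∀ {n} (u v : Fin n) → isE u v v u ≡ true
isE-2 u v = ∨-r {u == v ∧ v == u} (∧-i (==-refl u) (==-refl v))

isE-sym : ∀ {n} (u v s t : Fin n) → isE u v s t ≡ isE u v t s
isE-sym u v s t = Bool.∨-comm (u == s ∧ v == t) (u == t ∧ v == s)

addEdge : ∀ {n} → Graph n → Fin n → Fin n → Graph n
addEdge H u v s t = H s t ∨ isE u v s t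

record Perf {n} (x y : Fin n) (H : Graph n) (μ : Fin n → Fin n) : Set where
  constructor perf
  field
    inv : Involution μ
    edge : ∀ v → H v (μ v) ≡ true
    pin : μ x ≡ y

Perf-mono : ∀ {n x y} {H K : Graph n} {μ} → H ⊆ᴳ K → Perf x y H μ → Perf x y K μ
Perf-mono h (perf i e p) = perf i (λ v → h v _ (e v)) p

perf? : ∀ {n} x y (H : Graph n) → Dec (∃ (Perf x y H))
perf? {n} x y H = SearchFun n search-Fin (Perf x y H) dec ext
  where
  dec : ∀ μ → Dec (Perf x y H μ)
  dec μ with Fin.all? (λ v → μ (μ v) ≟ v) | Fin.all? (λ v → H v (μ v) Bool.≟ true) | μ x ≟ y
  ... | yes a | yes b | yes c = yes (perf a b c)
  ... | no ¬a | _ | _ = no (¬a ∘ Perf.inv)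
  ... | yes _ | no ¬b | _ = no (¬b ∘ Perf.edge)
  ... | yes _ | yes _ | no ¬c = no (¬c ∘ Perf.pin)
  ext : ∀ {f g} → (∀ i → f i ≡ g i) → Perf x y H f → Perf x y H g
  ext {f} {g} h (perf a b c) = perf
    (λ v → trans (sym (h (g v))) (trans (cong f (sym (h v))) (a v)))
    (λ v → trans (cong (H v) (sym (h v))) (b v)) (trans (sym (h x)) c)

-- Edge-maximality is what turns the components outside the universal vertices into cliques.
record Saturated {n} (x y : Fin n) (H K : Graph n) : Set where
  field
    extends : H ⊆ᴳ K
    symK : Symmetric K
    irrK : Irreflexive K
    noPM : ¬ ∃ (Perf x y K)
    maximal : ∀ u v → u ≢ v → K u v ≡ false → ∃ (Perf x y (addEdge K u v))

-- One pass over all pairs is enough: a pair that was refused stays refused, because the perfect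
-- matching it would create survives in every larger graph.
saturate : ∀ {n} x y (H : Graph n) → Symmetric H → Irreflexive H → ¬ ∃ (Perf x y H) → ∃ (Saturated x y H)
saturate {n} x y H sH iH nH with go (cartesianProduct (allFin n) (allFin n)) H sH iH nH
  where
  Done : Graph n → Fin n × Fin n → Set
  Done K (u , v) = u ≢ v → K u v ≡ false → ∃ (Perf x y (addEdge K u v))
  addEdge-mono : ∀ {H K : Graph n} u v → H ⊆ᴳ K → addEdge H u v ⊆ᴳ addEdge K u v
  addEdge-mono {H} {K} u v h s t e with ∨-e {H s t} e
  ... | inj₁ p = ∨-l (h s t p)
  ... | inj₂ p = ∨-r {K s t} p
  go : (es : List (Fin n × Fin n)) (H : Graph n) → Symmetric H → Irreflexive H → ¬ ∃ (Perf x y H) →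
    ∃ λ K → H ⊆ᴳ K × Symmetric K × Irreflexive K × (¬ ∃ (Perf x y K)) × (∀ e → e ∈ es → Done K e)
  go [] H s i nP = H , (λ _ _ h → h) , s , i , nP , λ _ ()
  go ((u , v) ∷ es) H s i nP with same? u v
  ... | inj₁ refl with go es H s i nP
  ... | K , h , sK , iK , nK , d = K , h , sK , iK , nK ,
        λ { e (here refl) ne _ → ⊥-elim (ne refl) ; e (there m) → d e m }
  go ((u , v) ∷ es) H s i nP | inj₂ u≢v with perf? x y (addEdge H u v)
  ... | yes (μ , P) with go es H s i nP
  ... | K , h , sK , iK , nK , d = K , h , sK , iK , nK ,
        λ { e (here refl) _ _ → μ , Perf-mono (addEdge-mono u v h) P ; e (there m) → d e m }
  go ((u , v) ∷ es) H s i nP | inj₂ u≢v | no nP' with go es (addEdge H u v)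
      (λ a b → cong₂ _∨_ (s a b) (isE-sym u v a b))
      (λ a → cong₂ _∨_ (i a) (¬true (λ e → case isE-e {u = u} {v} {a} {a} e of λ { (inj₁ (refl , q)) → u≢v (sym q) ; (inj₂ (refl , q)) → u≢v (sym q) }))) nP'
  ... | K , h , sK , iK , nK , d = K , (λ a b e → h a b (∨-l e)) , sK , iK , nK ,
        λ { e (here refl) _ f → ⊥-elim (true≢false (h u v (∨-r {H u v} (isE-1 u v))) f) ; e (there m) → d e m }
... | K , h , sK , iK , nK , d = K , record { extends = h ; symK = sK ; irrK = iK ; noPM = nK
      ; maximal = λ u v → d (u , v) (∈-cartesianProduct⁺ (∈-allFin u) (∈-allFin v)) }

-- Tutte's condition for the graph without `x` and `y`, with both vertices put back into the
-- violating set: by parity there are then still at least `# S` odd parts. `L` sends a vertex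
-- outside `S` to the representative of its part; a part may be a union of components.
record Barrier {n} (H : Graph n) (x y : Fin n) : Set where
  field
    S : VSet n
    L : Fin n → Fin n
    x∈S : S x ≡ true
    y∈S : S y ≡ true
    respects : ∀ u v → S u ≡ false → S v ≡ false → H u v ≡ true → L u ≡ L v
    L-idem : ∀ v → S v ≡ false → L (L v) ≡ L v
    L-out : ∀ v → S v ≡ false → S (L v) ≡ false
    large : # S ≤ # (λ ℓ → oddᵇ (# (λ v → not (S v) ∧ (L v == ℓ))))

record Near {n} (x y : Fin n) (K : Graph n) (a b : Fin n) (μ : Fin n → Fin n) : Set where
  field
    inv : Involution μ
    edge : ∀ v → μ v ≢ v → K v (μ v) ≡ true
    pin : μ x ≡ y
    a≢b : a ≢ b
    fixA : μ a ≡ a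
    fixB : μ b ≡ b
    only : ∀ v → μ v ≡ v → v ≡ a ⊎ v ≡ b

Near-sym : ∀ {n} {x y : Fin n} {K a b μ} → Near x y K a b μ → Near x y K b a μ
Near-sym N = record { inv = inv ; edge = edge ; pin = pin ; a≢b = a≢b ∘ sym ; fixA = fixB ; fixB = fixA
  ; only = λ v e → case only v e of λ { (inj₁ p) → inj₂ p ; (inj₂ p) → inj₁ p } }
  where open Near N

module _ {n} (x y : Fin n) (x≢y : x ≢ y) (K : Graph n) (symK : Symmetric K) where

  join : ∀ {a b μ} → Near x y K a b μ → K a b ≡ true → ∃ (Perf x y K)
  join {a} {b} {μ} N h = link μ a b , perf (link-inv a b fixA fixB inv) e
      (trans (link-o μ a b x (λ { refl → x≢y (trans (sym fixA) pin) }) (λ { refl → x≢y (trans (sym fixB) pin) })) pin)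
    where
    open Near N
    e : ∀ v → K v (link μ a b v) ≡ true
    e v with same? v a | same? v b
    ... | inj₁ refl | _ = trans (cong (K v) (link-u μ v b)) h
    ... | inj₂ _ | inj₁ refl = trans (cong (K v) (link-w μ a v)) (trans (symK v a) h)
    ... | inj₂ p | inj₂ q = trans (cong (K v) (link-o μ a b v p q))
      (edge v (λ f → case only v f of λ { (inj₁ r) → p r ; (inj₂ r) → q r }))

  -- The partner of `z` is rematched to `b`, so the missed vertex `b` is traded for `z`. The pinned
  -- pair must stay untouched, hence the conditions on `x` and `y`.
  exchange : ∀ {a b μ} → Near x y K a b μ → ∀ z → μ z ≢ z → K (μ z) b ≡ true → z ≢ x → z ≢ y →
    ∃ λ μ' → Near x y K a z μ' × (∀ v → v ≢ z → v ≢ μ z → v ≢ b → μ' v ≡ μ v)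
  exchange {a} {b} {μ} N z nz h z≢x z≢y = μ' , record
      { inv = link-inv (μ z) b (unlink-μ μ z) b-fix (unlink-inv z inv)
      ; edge = e
      ; pin = trans (unch x (z≢x ∘ sym) (λ r → z≢y (trans (sym (inv z)) (trans (cong μ (sym r)) pin))) (λ { refl → x≢y (trans (sym fixB) pin) })) pin
      ; a≢b = a≢z
      ; fixA = trans (unch a a≢z a≢μz a≢b) fixA
      ; fixB = trans (link-o _ (μ z) b z (nz ∘ sym) (b≢z ∘ sym)) (unlink-u μ z)
      ; only = onl } , unch
    where
    open Near N
    μ' = link (unlink μ z) (μ z) b
    b≢z : b ≢ z
    b≢z refl = nz fixB
    b≢μz : b ≢ μ z
    b≢μz r = b≢z (trans (trans (sym fixB) (cong μ r)) (inv z))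
    a≢z : a ≢ z
    a≢z refl = nz fixA
    a≢μz : a ≢ μ z
    a≢μz r = a≢z (trans (trans (sym fixA) (cong μ r)) (inv z))
    b-fix : unlink μ z b ≡ b
    b-fix = trans (unlink-o μ z b b≢z b≢μz) fixB
    unch : ∀ v → v ≢ z → v ≢ μ z → v ≢ b → μ' v ≡ μ v
    unch v p q r = trans (link-o _ (μ z) b v q r) (unlink-o μ z v p q)
    cases : ∀ v → v ≡ μ z ⊎ v ≡ b ⊎ v ≡ z ⊎ (v ≢ z × v ≢ μ z × v ≢ b)
    cases v with same? v (μ z) | same? v b | same? v z
    ... | inj₁ p | _ | _ = inj₁ p
    ... | inj₂ _ | inj₁ p | _ = inj₂ (inj₁ p)
    ... | inj₂ _ | inj₂ _ | inj₁ p = inj₂ (inj₂ (inj₁ p))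
    ... | inj₂ p | inj₂ q | inj₂ r = inj₂ (inj₂ (inj₂ (r , p , q)))
    z-fix : μ' z ≡ z
    z-fix = trans (link-o _ (μ z) b z (nz ∘ sym) (b≢z ∘ sym)) (unlink-u μ z)
    e : ∀ v → μ' v ≢ v → K v (μ' v) ≡ true
    e v f with cases v
    ... | inj₁ refl = trans (cong (K (μ z)) (link-u _ (μ z) b)) h
    ... | inj₂ (inj₁ refl) = trans (cong (K v) (link-w _ (μ z) v)) (trans (symK v (μ z)) h)
    ... | inj₂ (inj₂ (inj₁ refl)) = ⊥-elim (f z-fix)
    ... | inj₂ (inj₂ (inj₂ (p , q , r))) = trans (cong (K v) (unch v p q r)) (edge v (f ∘ trans (unch v p q r)))
    onl : ∀ v → μ' v ≡ v → v ≡ a ⊎ v ≡ z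
    onl v f with cases v
    ... | inj₁ refl = ⊥-elim (b≢μz (trans (sym (link-u _ (μ z) b)) f))
    ... | inj₂ (inj₁ refl) = ⊥-elim (b≢μz (sym (trans (sym (link-w _ (μ z) v)) f)))
    ... | inj₂ (inj₂ (inj₁ r)) = inj₂ r
    ... | inj₂ (inj₂ (inj₂ (p , q , r))) with only v (trans (sym (unch v p q r)) f)
    ...   | inj₁ s = inj₁ s
    ...   | inj₂ s = ⊥-elim (r s)

-- The structure of a saturated graph.

module Gallai {n} (x y : Fin n) (x≢y : x ≢ y) (H K : Graph n) (Hxy : H x y ≡ true)
  (sat : Saturated x y H K) where
  open Saturated sat

  Kxy : K x y ≡ true
  Kxy = extends x y Hxy

  ¬join : ∀ {a b μ} → Near x y K a b μ → K a b ≡ true → ⊥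
  ¬join N h = noPM (join x y x≢y K symK N h)

  -- By maximality the extra edge `u v` completes a perfect matching, which has to use it; dropping
  -- that edge leaves `u` and `v` unmatched.
  nonadjacent : ∀ u v → u ≢ v → K u v ≡ false → ∃ (Near x y K u v)
  nonadjacent u v u≢v f with maximal u v u≢v f
  ... | μ , perf inv edge pin with same? (μ u) v
  ... | inj₂ ne = ⊥-elim (noPM (μ , perf inv (λ w → old w (edge w)) pin))
    where
    old : ∀ w → addEdge K u v w (μ w) ≡ true → K w (μ w) ≡ true
    old w h with ∨-e {K w (μ w)} h
    ... | inj₁ k = k
    ... | inj₂ k with isE-e {u = u} {v} {w} {μ w} k
    ...   | inj₁ (refl , q) = ⊥-elim (ne (sym q))
    ...   | inj₂ (q , refl) = ⊥-elim (ne (trans (cong μ q) (inv v)))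
  ... | inj₁ refl = unlink μ u , record
    { inv = unlink-inv u inv
    ; edge = λ w ne → let p = λ { refl → ne (unlink-u μ u) } ; q = λ { refl → ne (unlink-μ μ u) } in
        trans (cong (K w) (unlink-o μ u w p q)) (old w p q (edge w))
    ; pin = trans (unlink-o μ u x (λ { refl → true≢false (subst (λ w → K x w ≡ true) (sym pin) Kxy) f })
              (λ { refl → true≢false (trans (symK (u) (μ u)) (subst (λ w → K (μ u) w ≡ true) (trans (sym pin) (inv u)) Kxy)) f })) pin
    ; a≢b = u≢v
    ; fixA = unlink-u μ u
    ; fixB = unlink-μ μ u
    ; only = onl }
    where
    old : ∀ w → w ≢ u → w ≢ μ u → addEdge K u (μ u) w (μ w) ≡ true → K w (μ w) ≡ true
    old w p q h with ∨-e {K w (μ w)} h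
    ... | inj₁ k = k
    ... | inj₂ k with isE-e {u = u} {μ u} {w} {μ w} k
    ...   | inj₁ (r , _) = ⊥-elim (p (sym r))
    ...   | inj₂ (_ , r) = ⊥-elim (q (sym r))
    onl : ∀ w → unlink μ u w ≡ w → w ≡ u ⊎ w ≡ μ u
    onl w e with same? w u | same? w (μ u)
    ... | inj₁ r | _ = inj₁ r
    ... | inj₂ _ | inj₁ r = inj₂ r
    ... | inj₂ p | inj₂ q = ⊥-elim (true≢false (old w p q (edge w))
            (trans (cong (K w) (trans (sym (unlink-o μ u w p q)) e)) (irrK w)))

  universal? : ∀ v → (∀ w → w ≢ v → K v w ≡ true) ⊎ (∃ λ w → w ≢ v × K v w ≡ false)
  universal? v with Fin.any? (λ w → ((w == v) ∨ K v w) Bool.≟ false)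
  ... | yes (w , e) = inj₂ (w , (λ { refl → true≢false (∨-l (==-refl w)) e }) , ¬true (λ k → true≢false (∨-r {w == v} k) e))
  ... | no ¬e = inj₁ λ w ne → case ∨-e {w == v} (¬false (λ e → ¬e (w , e))) of λ
          { (inj₁ p) → ⊥-elim (ne (==-≡ p)) ; (inj₂ p) → p }

  opaque
    U : VSet n
    U v with universal? v
    ... | inj₁ _ = true
    ... | inj₂ _ = false

    U-t : ∀ {v} → U v ≡ true → ∀ w → w ≢ v → K v w ≡ true
    U-t {v} h with universal? v
    ... | inj₁ u = u

    U-f : ∀ {v} → U v ≡ false → ∃ λ w → w ≢ v × K v w ≡ false
    U-f {v} h with universal? v
    ... | inj₂ u = u

  K≢ : ∀ {u v} → K u v ≡ true → u ≢ v
  K≢ h refl = true≢false h (irrK _)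

  -- A non-neighbour of `x` would give a near-perfect matching missing `x`, yet `x` is pinned to
  -- `y`.
  Ux : U x ≡ true
  Ux = ¬false λ f → case U-f f of λ { (w , ne , k) → case nonadjacent x w (ne ∘ sym) k of λ
         { (μ , N) → x≢y (trans (sym (Near.fixA N)) (Near.pin N)) } }

  Uy : U y ≡ true
  Uy = ¬false λ f → case U-f f of λ { (w , ne , k) → case nonadjacent y w (ne ∘ sym) k of λ
         { (μ , N) → x≢y (trans (trans (sym (Near.inv N x)) (cong μ (Near.pin N))) (Near.fixA N)) } }

  -- Otherwise ps and qt are non-edges; following the union of the two near-perfect matchings from q
  -- yields a perfect matching or a near-perfect one missing the ends of the edge pq or qs.
  K-trans : ∀ p q s → U q ≡ false → K p q ≡ true → K q s ≡ true → p ≢ s → K p s ≡ true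
  K-trans p q s Uq pq qs p≢s = ¬false contra
    where
    contra : K p s ≡ false → ⊥
    contra ps with U-f Uq
    ... | t , t≢q , qt with nonadjacent p s p≢s ps | nonadjacent q t (t≢q ∘ sym) qt
    ... | μ₁ , N₁ | μ₂ , N₂ = caseWalk (bool? (par k))
      where
      module N₁ = Near N₁
      module N₂ = Near N₂
      open Walk μ₁ μ₂ N₁.inv N₂.inv q N₂.fixA hiding (p)
      μ' = flip X μ₂ μ₁
      flip-t : ∀ (ν ν' : Fin n → Fin n) v → X v ≡ true → flip X ν ν' v ≡ ν v
      flip-t ν ν' v h rewrite h = refl
      flip-f : ∀ (ν ν' : Fin n → Fin n) v → X v ≡ false → flip X ν ν' v ≡ ν' v
      flip-f ν ν' v h rewrite h = refl
      flipE : ∀ {ν ν' : Fin n → Fin n} → (∀ v → ν v ≢ v → K v (ν v) ≡ true) → (∀ v → ν' v ≢ v → K v (ν' v) ≡ true) →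
        ∀ v → flip X ν ν' v ≢ v → K v (flip X ν ν' v) ≡ true
      flipE e e' v with X v
      ... | true = e v
      ... | false = e' v
      flipPin : ∀ {ν ν' : Fin n → Fin n} → ν x ≡ y → ν' x ≡ y → flip X ν ν' x ≡ y
      flipPin e e' with X x
      ... | true = e
      ... | false = e'
      K≢ps : p ≢ q × s ≢ q
      K≢ps = K≢ pq , λ e → K≢ qs (sym e)
      caseA : par k ≡ true → ∀ a b → (∀ v → μ₁ v ≡ v → v ≡ a ⊎ v ≡ b) → a ≢ b → b ≢ q → μ₁ b ≡ b → end ≡ a → K q b ≡ true → ⊥
      caseA t' a b only a≢b b≢q fb refl qb = ¬join {q} {b} {μ'} (record
        { inv = flip-inv X N₂.inv N₁.inv closed₂ closed₁ ; edge = flipE {μ₂} {μ₁} N₂.edge N₁.edge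
        ; pin = flipPin {μ₂} {μ₁} N₂.pin N₁.pin ; a≢b = b≢q ∘ sym
        ; fixA = trans (flip-t μ₂ μ₁ q X-q) N₂.fixA
        ; fixB = trans (flip-f μ₂ μ₁ b b∉) fb ; only = onl }) qb
        where
        b∉ : X b ≡ false
        b∉ = ¬true λ h → a≢b (sym (proj₁ (fixed₁ b h fb)))
        onl : ∀ v → μ' v ≡ v → v ≡ q ⊎ v ≡ b
        onl v e with bool? (X v)
        ... | inj₁ h with fixed₂ v h (trans (sym (flip-t μ₂ μ₁ v h)) e)
        ...   | inj₁ r = inj₁ r
        ...   | inj₂ (r , f) = ⊥-elim (true≢false t' f)
        onl v e | inj₂ h with only v (trans (sym (flip-f μ₂ μ₁ v h)) e)
        ...   | inj₂ r = inj₂ r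
        ...   | inj₁ refl = ⊥-elim (true≢false X-end h)
      caseB : par k ≡ false → ⊥
      caseB f = noPM (flip X μ₁ μ₂ , perf (flip-inv X N₁.inv N₂.inv closed₁ closed₂) e (flipPin {μ₁} {μ₂} N₁.pin N₂.pin))
        where
        end≡t : end ≡ t
        end≡t with N₂.only end (end₂ f)
        ... | inj₁ r = ⊥-elim (end≢q f r)
        ... | inj₂ r = r
        unfixed : ∀ v → flip X μ₁ μ₂ v ≢ v
        unfixed v e with bool? (X v)
        ... | inj₁ h = true≢false (proj₂ (fixed₁ v h (trans (sym (flip-t μ₁ μ₂ v h)) e))) f
        ... | inj₂ h with N₂.only v (trans (sym (flip-f μ₁ μ₂ v h)) e)
        ...   | inj₁ refl = true≢false X-q h
        ...   | inj₂ refl = true≢false (subst (λ w → X w ≡ true) end≡t X-end) h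
        e : ∀ v → K v (flip X μ₁ μ₂ v) ≡ true
        e v = flipE {μ₁} {μ₂} N₁.edge N₂.edge v (unfixed v)
      caseWalk : par k ≡ true ⊎ par k ≡ false → ⊥
      caseWalk (inj₂ f) = caseB f
      caseWalk (inj₁ t') with N₁.only end (end₁ t')
      ... | inj₁ r = caseA t' p s N₁.only p≢s (proj₂ K≢ps) N₁.fixB r qs
      ... | inj₂ r = caseA t' s p (λ v e → case N₁.only v e of λ { (inj₁ z) → inj₂ z ; (inj₂ z) → inj₁ z })
                       (p≢s ∘ sym) (proj₁ K≢ps) N₁.fixA r (trans (symK q p) pq)

  -- The reflexive closure of adjacency. By `K-trans` it is an equivalence on the non-universal
  -- vertices; its classes are the cliques left when `U` is removed.
  ~ : Fin n → Fin n → Bool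
  ~ v w = (v == w) ∨ K v w

  ~-refl : ∀ v → ~ v v ≡ true
  ~-refl v = ∨-l (==-refl v)

  ~-sym : ∀ v w → ~ v w ≡ ~ w v
  ~-sym v w = cong₂ _∨_ (==-sym v w) (symK v w)

  ~-K : ∀ {v w} → ~ v w ≡ true → v ≢ w → K v w ≡ true
  ~-K {v} {w} h ne with ∨-e {v == w} h
  ... | inj₁ p = ⊥-elim (ne (==-≡ p))
  ... | inj₂ p = p

  ~-trans : ∀ u v w → U v ≡ false → ~ u v ≡ true → ~ v w ≡ true → ~ u w ≡ true
  ~-trans u v w Uv p q with same? u v | same? v w | same? u w
  ... | inj₁ refl | _ | _ = q
  ... | inj₂ _ | inj₁ refl | _ = p
  ... | _ | _ | inj₁ refl = ~-refl u
  ... | inj₂ a | inj₂ b | inj₂ c = ∨-r {u == w} (K-trans u v w Uv (~-K p a) (~-K q b) c)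

  clique : Fin n → VSet n
  clique v w = not (U w) ∧ ~ v w

  L : Fin n → Fin n
  L v = least (clique v) v

  clique-self : ∀ {v} → U v ≡ false → clique v v ≡ true
  clique-self {v} Uv = ∧-i (not-f Uv) (~-refl v)

  clique-cong : ∀ {v w} → U v ≡ false → U w ≡ false → ~ v w ≡ true → ∀ z → clique v z ≡ clique w z
  clique-cong {v} {w} Uv Uw h z with U z in Uz
  ... | true = refl
  ... | false with ~ v z in a | ~ w z in b
  ...   | true | true = refl
  ...   | false | false = refl
  ...   | true | false = ⊥-elim (true≢false (~-trans w v z Uv (trans (~-sym w v) h) a) b)
  ...   | false | true = ⊥-elim (true≢false (~-trans v w z Uw h b) a)

  L-cong : ∀ {v w} → U v ≡ false → U w ≡ false → ~ v w ≡ true → L v ≡ L w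
  L-cong {v} {w} Uv Uw h = least-cong v w v (clique-self Uv) (clique-cong Uv Uw h)

  L-∈ : ∀ {v} → U v ≡ false → clique v (L v) ≡ true
  L-∈ {v} Uv = least-∈ (clique v) v v (clique-self Uv)

  L-U : ∀ {v} → U v ≡ false → U (L v) ≡ false
  L-U Uv = not-t (∧-l (L-∈ Uv))

  L-~ : ∀ {v} → U v ≡ false → ~ v (L v) ≡ true
  L-~ {v} Uv = ∧-r {not (U (L v))} (L-∈ Uv)

  L-~₂ : ∀ {v w} → U v ≡ false → U w ≡ false → L v ≡ L w → ~ v w ≡ true
  L-~₂ {v} {w} Uv Uw e = ~-trans v (L v) w (L-U Uv) (L-~ Uv)
    (trans (~-sym (L v) w) (subst (λ z → ~ w z ≡ true) (sym e) (L-~ Uw)))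

  module _ {a b : Fin n} {μ : Fin n → Fin n} (N : Near x y K a b μ) where
    open Near N

    Ua : U a ≡ false
    Ua = ¬true λ u → ¬join N (U-t u b (a≢b ∘ sym))

    Ub : U b ≡ false
    Ub = ¬true λ u → ¬join N (trans (symK a b) (U-t u a a≢b))

    x≢D : ∀ {v} → U v ≡ false → v ≢ x × v ≢ y
    x≢D f = (λ { refl → true≢false Ux f }) , (λ { refl → true≢false Uy f })

    -- The non-universal vertices that have no partner once the universal vertices are deleted.
    special : VSet n
    special v = not (U v) ∧ (((v == a) ∨ (v == b)) ∨ U (μ v))

    data Kind (v : Fin n) : Set where
      is-a : v ≡ a → Kind v
      is-b : v ≡ b → Kind v
      to-U : U (μ v) ≡ true → μ v ≢ v → Kind v

    kind : ∀ {v} → special v ≡ true → Kind v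
    kind {v} h with ∨-e {(v == a) ∨ (v == b)} (∧-r {not (U v)} h)
    ... | inj₂ u = to-U u λ e → true≢false (subst (λ w → U w ≡ true) e u) (not-t (∧-l h))
    ... | inj₁ p with ∨-e {v == a} p
    ...   | inj₁ q = is-a (==-≡ q)
    ...   | inj₂ q = is-b (==-≡ q)

    moveB : ∀ {a b μ} (N : Near x y K a b μ) z → U z ≡ false → U (μ z) ≡ true → μ z ≢ z →
      ∃ λ μ' → Near x y K a z μ' × (∀ v → v ≢ z → v ≢ μ z → v ≢ b → μ' v ≡ μ v)
    moveB {b = b} {μ} N z Uz Uμ ne = exchange x y x≢y K symK N z ne
      (U-t Uμ b (λ e → ne (trans (sym e) (trans (trans (sym (Near.fixB N)) (cong μ e)) (Near.inv N z)))))
      (proj₁ (x≢D Uz)) (proj₂ (x≢D Uz))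

    -- A universal partner can be rematched to `a` or to `b`. So any two special vertices can take
    -- the role of the missed pair.
    special-near : ∀ {v w} → special v ≡ true → special w ≡ true → v ≢ w → ∃ (Near x y K v w)
    special-near {v} {w} sv sw v≢w with kind sv | kind sw | not-t (∧-l sv) | not-t (∧-l sw)
    ... | is-a refl | is-a refl | _ | _ = ⊥-elim (v≢w refl)
    ... | is-a refl | is-b refl | _ | _ = μ , N
    ... | is-b refl | is-a refl | _ | _ = μ , Near-sym N
    ... | is-b refl | is-b refl | _ | _ = ⊥-elim (v≢w refl)
    ... | is-a refl | to-U u ne | _ | f = let (μ' , N' , _) = moveB N w f u ne in μ' , N'
    ... | is-b refl | to-U u ne | _ | f = let (μ' , N' , _) = moveB (Near-sym N) w f u ne in μ' , N'
    ... | to-U u ne | is-a refl | f | _ = let (μ' , N' , _) = moveB N v f u ne in μ' , Near-sym N'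
    ... | to-U u ne | is-b refl | f | _ = let (μ' , N' , _) = moveB (Near-sym N) v f u ne in μ' , Near-sym N'
    ... | to-U u ne | to-U u' ne' | f | f' with moveB N v f u ne
    ... | μ' , N' , same with same w (v≢w ∘ sym) (λ { refl → true≢false u f' })
                          (λ { refl → ne' fixB })
    ... | e = let (μ'' , N'' , _) = moveB (Near-sym N') w f' (subst (λ z → U z ≡ true) (sym e) u') (λ r → ne' (trans (sym e) r)) in μ'' , N''

    class : Fin n → VSet n
    class ℓ v = not (U v) ∧ (L v == ℓ)

    odd-class : VSet n
    odd-class ℓ = oddᵇ (# (class ℓ))

    -- Two special vertices of one clique are adjacent, and joining them would complete a perfect
    -- matching.
    at-most : ∀ ℓ → ¬ (1 < # (λ v → special v ∧ (L v == ℓ)))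
    at-most ℓ l with #-∃₂ (λ v → special v ∧ (L v == ℓ)) l
    ... | v , w , pv , pw , v≢w with special-near (∧-l pv) (∧-l pw) v≢w
    ... | _ , N' = ¬join N' (~-K (L-~₂ (not-t (∧-l (∧-l pv))) (not-t (∧-l (∧-l pw)))
            (trans (==-≡ (∧-r {special v} pv)) (sym (==-≡ (∧-r {special w} pw))))) v≢w)

    -- The ordinary vertices of a clique are matched among themselves, so the clique has the parity
    -- of its number of special vertices, which is 0 or 1.
    class-special : ∀ ℓ → # (λ v → special v ∧ (L v == ℓ)) ≤ ι (odd-class ℓ)
    class-special ℓ with odd-class ℓ in odd
    ... | true = ≮⇒≥ (at-most ℓ)
    ... | false = ≮⇒≥ λ l → one-or-more (even-cancel (subst Even split (even-from odd)) rest-even) l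
      where
      rest : VSet n
      rest v = class ℓ v ∧ not (special v)
      split : # (class ℓ) ≡ # (λ v → special v ∧ (L v == ℓ)) + # rest
      split = trans (sum-cong (λ v → bool≡ (U v ∷ (L v == ℓ) ∷ (((v == a) ∨ (v == b)) ∨ U (μ v)) ∷ [])
        (λ { (u ∷ l ∷ s ∷ []) → ι (not u ∧ l) })
        (λ { (u ∷ l ∷ s ∷ []) → ι ((not u ∧ s) ∧ l) + ι ((not u ∧ l) ∧ not (not u ∧ s)) }))) (sum-+ _ _)
      ordinary : ∀ v → rest v ≡ true → U v ≡ false × U (μ v) ≡ false × v ≢ a × v ≢ b × L v ≡ ℓ
      ordinary v h = Uv , ¬true (λ u → ¬sp (∨-r {(v == a) ∨ (v == b)} u)) ,
          (λ e → ¬sp (∨-l (∨-l {v == a} (trans (cong (v ==_) (sym e)) (==-refl v))))) ,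
          (λ e → ¬sp (∨-l (∨-r {v == a} (trans (cong (v ==_) (sym e)) (==-refl v))))) , ==-≡ (∧-r {not (U v)} (∧-l h))
        where
        Uv : U v ≡ false
        Uv = not-t (∧-l (∧-l {class ℓ v} h))
        ¬sp : ((v == a) ∨ (v == b)) ∨ U (μ v) ≡ true → ⊥
        ¬sp q = true≢false (∧-i (not-f Uv) q) (not-t (∧-r {class ℓ v} h))
      moved : ∀ v → rest v ≡ true → μ v ≢ v
      moved v h e with ordinary v h | only v e
      ... | _ , _ , na , _ , _ | inj₁ r = na r
      ... | _ , _ , _ , nb , _ | inj₂ r = nb r
      stays : ∀ v → rest v ≡ true → rest (μ v) ≡ true
      stays v h with ordinary v h
      ... | Uv , Uμ , na , nb , l = ∧-i (∧-i (not-f Uμ) (trans (cong (_== ℓ) (trans (sym (L-cong Uv Uμ (∨-r {v == μ v} (edge v (moved v h))))) l)) (==-refl ℓ)))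
          (not-f (¬true λ s → case kind s of λ
            { (is-a e) → na (trans (sym (inv v)) (trans (cong μ e) (trans fixA refl)))
            ; (is-b e) → nb (trans (sym (inv v)) (trans (cong μ e) fixB))
            ; (to-U u _) → true≢false (subst (λ w → U w ≡ true) (inv v) u) Uv }))
      rest-even : Even (# rest)
      rest-even = closed-even rest μ inv stays moved
      one-or-more : Even (# (λ v → special v ∧ (L v == ℓ))) → ¬ (0 < # (λ v → special v ∧ (L v == ℓ)))
      one-or-more e l with parity-pos e l
      ... | l₂ = at-most ℓ l₂

    -- Count the partners of universal vertices. A partner is special unless it is universal too,
    -- and a matched universal pair other than `x`, `y` could be broken up to match `a` and `b`. The
    -- twos added below stand for `a`, `b` on the left and `x`, `y` on the right.
    U≤special : # U ≤ # special
    U≤special = prove (# U ∷ # special ∷ []) x0 x1 1 ((1 , x0 ⊕ con 2 , x1 ⊕ con 2) ∷ []) (bound , tt)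
      where
      f g : Fin n → ℕ
      f v = ι (U (μ v)) + (ι (a == v) + ι (b == v))
      g v = ι (special v) + (ι (x == v) + ι (y == v))
      total : ∀ (P : VSet n) c d → sum (λ v → ι (P v) + (ι (c == v) + ι (d == v))) ≡ # P + 2
      total P c d = trans (sum-+ (λ v → ι (P v)) _) (cong (# P +_) (trans (sum-+ (λ v → ι (c == v)) _) (cong₂ _+_ (#-single c) (#-single d))))
      pt : ∀ v → f v ≤ g v
      pt v with same? v a | same? v b
      ... | inj₁ refl | _ rewrite fixA | Ua | ==-refl v | ==-≢ (a≢b ∘ sym) = m≤m+n 1 _
      ... | inj₂ _ | inj₁ refl rewrite fixB | Ub | ==-refl v | ==-≢ a≢b | Bool.∨-zeroʳ (v == a) = m≤m+n 1 _
      ... | inj₂ p | inj₂ q rewrite ==-≢ (p ∘ sym) | ==-≢ (q ∘ sym) | ==-≢ p | ==-≢ q with U (μ v) in Uμ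
      ...   | false = z≤n
      ...   | true with U v in Uv
      ...     | false = m≤m+n 1 _
      ...     | true with same? v x | same? v y
      ...       | inj₁ refl | _ rewrite ==-refl v = m≤m+n 1 _
      ...       | inj₂ _ | inj₁ refl rewrite ==-refl v = m≤n+m 1 (ι (x == v))
      ...       | inj₂ r | inj₂ s = ⊥-elim (bad (exchange x y x≢y K symK N v vne (U-t Uμ b (λ e → q (trans (sym (inv v)) (trans (cong μ (sym e)) fixB)))) r s))
        where
        vne : μ v ≢ v
        vne e = case only v e of λ { (inj₁ z) → p z ; (inj₂ z) → q z }
        bad : _ → ⊥
        bad (_ , N' , _) = ¬join N' (trans (symK a v) (U-t Uv a (p ∘ sym)))
      bound : # U + 2 ≤ # special + 2
      bound = subst₂ _≤_ (trans (total (U ∘ μ) a b) (cong (_+ 2) (sym (sum-involution (λ v → ι (U v)) μ inv)))) (total special x y) (sum-mono pt)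

    special≤odd : # special ≤ # odd-class
    special≤odd = ≤-trans (≤-reflexive (trans (fibre L (λ v → ι (special v)))
      (sum-cong (λ ℓ → sum-cong (λ v → bool≡ ((L v == ℓ) ∷ special v ∷ []) (λ { (l ∷ s ∷ []) → ι l * ι s }) (λ { (l ∷ s ∷ []) → ι (s ∧ l) }))))))
      (sum-mono class-special)

    barrier : Barrier H x y
    barrier = record { S = U ; L = L ; x∈S = Ux ; y∈S = Uy
      ; respects = λ u v Uu Uv h → L-cong Uu Uv (∨-r {u == v} (extends u v h))
      ; L-idem = λ v Uv → sym (L-cong Uv (L-U Uv) (L-~ Uv))
      ; L-out = λ v Uv → L-U Uv
      ; large = ≤-trans U≤special special≤odd }

opaque
  -- The given near-perfect matching survives in the saturated graph; its special vertices are the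
  -- ones that count the odd cliques.
  tutte : ∀ {n} {x y : Fin n} {H : Graph n} {a b} → Symmetric H → Irreflexive H → H x y ≡ true →
    ¬ ∃ (Perf x y H) → ∃ (Near x y H a b) → Barrier H x y
  tutte {x = x} {y} {H} {a} {b} sH iH Hxy nP (μ , N) with saturate x y H sH iH nP
  ... | K , sat = Gallai.barrier x y (λ { refl → true≢false Hxy (iH x) }) H K Hxy sat N'
    where
    N' : Near x y K a b μ
    N' = record { inv = Near.inv N ; edge = λ v ne → Saturated.extends sat v _ (Near.edge N v ne) ; pin = Near.pin N
      ; a≢b = Near.a≢b N ; fixA = Near.fixA N ; fixB = Near.fixB N ; only = Near.only N }

_∩_ _∪_ _∖_ : ∀ {n} → VSet n → VSet n → VSet n
(A ∩ B) v = A v ∧ B v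
(A ∪ B) v = A v ∨ B v
(A ∖ B) v = A v ∧ not (B v)

two-pairs : ∀ {n} (R : Fin n → Fin n → Bool) {a b c d} → R a b ≡ true → R c d ≡ true → (a ≡ c → b ≡ d → ⊥) →
  2 ≤ ∑₂ (λ u v → ι (R u v))
two-pairs R {a} {b} {c} {d} h h' ne = ≤-trans
  (≤r (sym (trans (∑₂-+ (δ a b) (δ c d)) (cong₂ _+_ (∑₂-δ a b) (∑₂-δ c d))))) (∑₂-mono pt)
  where
  pt : ∀ u v → δ a b u v + δ c d u v ≤ ι (R u v)
  pt u v with a ≟ u | b ≟ v | c ≟ u | d ≟ v
  ... | yes refl | yes refl | yes refl | yes refl = ⊥-elim (ne refl refl)
  ... | yes refl | yes refl | yes refl | no _ rewrite h = ≤-refl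
  ... | yes refl | yes refl | no _ | _ rewrite h = ≤-refl
  ... | yes refl | no _ | yes refl | yes refl rewrite h' = ≤-refl
  ... | yes refl | no _ | yes refl | no _ = z≤n
  ... | yes refl | no _ | no _ | _ = z≤n
  ... | no _ | _ | yes refl | yes refl rewrite h' = ≤-refl
  ... | no _ | _ | yes refl | no _ = z≤n
  ... | no _ | _ | no _ | _ = z≤n

-- The entries above and below the diagonal have the same total.
even-sym : ∀ {n} (f : Fin n → Fin n → ℕ) → (∀ u v → f u v ≡ f v u) → (∀ u → f u u ≡ 0) → Even (∑₂ f)
even-sym f s d = subst Even (sym eq) (even (∑₂ (λ u v → ι (lt u v) * f u v)))
  where
  pt : ∀ u v → f u v ≡ ι (lt u v) * f u v + ι (lt v u) * f v u
  pt u v with same? u v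
  ... | inj₁ refl rewrite d u | *-zeroʳ (ι (lt u u)) = refl
  ... | inj₂ ne rewrite sym (s u v) = trans (sym (+-identityʳ (f u v))) (trans (cong (_* f u v) (sym (lt-≢ ne))) (*-distribʳ-+ (f u v) (ι (lt u v)) _))
  eq : ∑₂ f ≡ ∑₂ (λ u v → ι (lt u v) * f u v) + ∑₂ (λ u v → ι (lt u v) * f u v)
  eq = trans (∑₂-cong pt) (trans (∑₂-+ (λ u v → ι (lt u v) * f u v) (λ u v → ι (lt v u) * f v u))
    (cong (∑₂ (λ u v → ι (lt u v) * f u v) +_) (∑₂-swap (λ u v → ι (lt v u) * f v u))))

-- Edge counts and cuts in cubic graphs

module Cuts {n} (G : Graph n) (simple : IsSimple G) (cubic : Cubic G) where

  symG : Symmetric G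
  symG = proj₁ simple

  irrG : Irreflexive G
  irrG = proj₂ simple

  G≢ : ∀ {u v} → G u v ≡ true → u ≢ v
  G≢ h refl = true≢false h (irrG _)

  flipG : ∀ {u v} → G u v ≡ true → G v u ≡ true
  flipG {u} {v} h = trans (symG v u) h

  -- Ordered pairs are counted, so an edge inside `A` contributes 2 to `E A A`. A single edge inside
  -- a barrier therefore reads `E S S ≡ 2`.
  E : VSet n → VSet n → ℕ
  E A B = ∑₂ (λ u v → ι (A u ∧ (B v ∧ G u v)))

  ∂ : VSet n → ℕ
  ∂ X = E X (∁ X)

  all : VSet n
  all _ = true

  E-sym : ∀ A B → E A B ≡ E B A
  E-sym A B = trans (∑₂-swap _) (∑₂-cong (λ v u → trans (cong (λ g → ι (A u ∧ (B v ∧ g))) (symG u v))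
    (bool≡ (A u ∷ B v ∷ G v u ∷ []) (λ { (a ∷ b ∷ g ∷ []) → ι (a ∧ (b ∧ g)) }) (λ { (a ∷ b ∷ g ∷ []) → ι (b ∧ (a ∧ g)) }))))

  E-mono : ∀ {A B C D : VSet n} → (∀ v → A v ≡ true → C v ≡ true) → (∀ v → B v ≡ true → D v ≡ true) → E A B ≤ E C D
  E-mono {A} {B} h k = ∑₂-mono (λ u v → ι-mono (λ e → ∧-i (h u (∧-l e)) (∧-i (k v (∧-l (∧-r {A u} e))) (∧-r {B v} (∧-r {A u} e)))))

  E-cong : ∀ {A B C D : VSet n} → (∀ v → A v ≡ C v) → (∀ v → B v ≡ D v) → E A B ≡ E C D
  E-cong h k = ∑₂-cong (λ u v → cong ι (cong₂ _∧_ (h u) (cong (_∧ G u v) (k v))))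

  E-split : ∀ A B C D → (∀ v → ι (B v) ≡ ι (C v) + ι (D v)) → E A B ≡ E A C + E A D
  E-split A B C D h = trans (∑₂-cong pt) (∑₂-+ _ _)
    where
    pt : ∀ u v → ι (A u ∧ (B v ∧ G u v)) ≡ ι (A u ∧ (C v ∧ G u v)) + ι (A u ∧ (D v ∧ G u v))
    pt u v with A u | G u v
    ... | false | _ = refl
    ... | true | true rewrite Bool.∧-identityʳ (B v) | Bool.∧-identityʳ (C v) | Bool.∧-identityʳ (D v) = h v
    ... | true | false rewrite Bool.∧-zeroʳ (B v) | Bool.∧-zeroʳ (C v) | Bool.∧-zeroʳ (D v) = refl

  E-∁ : ∀ A B → E A all ≡ E A B + E A (∁ B)
  E-∁ A B = E-split A all B (∁ B) (λ v → bool≡ (B v ∷ []) (λ _ → 1) (λ { (b ∷ []) → ι b + ι (not b) }))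

  deg : ∀ u → # (G u) ≡ 3
  deg u = trans (sym (count≡# (G u))) (cubic u)

  E-all : ∀ A → E A all ≡ 3 * # A
  E-all A = trans (sum-cong row) (sym (*-distrib-sum 3 _))
    where
    row : ∀ u → sum (λ v → ι (A u ∧ (true ∧ G u v))) ≡ 3 * ι (A u)
    row u with A u
    ... | true = deg u
    ... | false = sum-0 n

  E-edge : ∀ (A B : VSet n) {u v} → A u ≡ true → B v ≡ true → G u v ≡ true → 1 ≤ E A B
  E-edge A B {u} {v} a b g = ≤-trans (≤r (sym (ι-true (∧-i a (∧-i b g))))) (term≤∑₂ (λ u v → ι (A u ∧ (B v ∧ G u v))) u v)

  E-none : ∀ (A B : VSet n) → E A B ≡ 0 → ∀ {u v} → A u ≡ true → B v ≡ true → G u v ≡ true → ⊥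
  E-none A B e a b g = case subst (1 ≤_) e (E-edge A B a b g) of λ ()

  E-∃ : ∀ A B → 1 ≤ E A B → ∃ λ u → ∃ λ v → A u ≡ true × B v ≡ true × G u v ≡ true
  E-∃ A B h with ∑₂-∃ (λ u v → A u ∧ (B v ∧ G u v)) h
  ... | u , v , e = u , v , ∧-l e , ∧-l (∧-r {A u} e) , ∧-r {B v} (∧-r {A u} e)

  E-0 : ∀ A B → (∀ u v → A u ≡ true → B v ≡ true → G u v ≡ true → ⊥) → E A B ≡ 0
  E-0 A B h with E A B in e
  ... | zero = refl
  ... | suc _ with E-∃ A B (subst (1 ≤_) (sym e) (s≤s z≤n))
  ... | u , v , a , b , g = ⊥-elim (h u v a b g)

  E-self-even : ∀ A → Even (E A A)
  E-self-even A = even-sym _ (λ u v → trans (cong (λ g → ι (A u ∧ (A v ∧ g))) (symG u v))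
      (bool≡ (A u ∷ A v ∷ G v u ∷ []) (λ { (a ∷ b ∷ g ∷ []) → ι (a ∧ (b ∧ g)) }) (λ { (a ∷ b ∷ g ∷ []) → ι (b ∧ (a ∧ g)) })))
    (λ u → ι-false (¬true (λ e → true≢false (∧-r {A u} (∧-r {A u} e)) (irrG u))))

  handshake : ∀ A → 3 * # A ≡ E A A + ∂ A
  handshake A = trans (sym (E-all A)) (E-∁ A A)

  ∂-∁ : ∀ A → ∂ (∁ A) ≡ ∂ A
  ∂-∁ A = trans (E-cong {A = ∁ A} (λ _ → refl) (λ v → Bool.not-involutive (A v))) (E-sym (∁ A) A)

  even-3 : ∀ {k} → Even (3 * k) → Even k
  even-3 {k} e = even-cancel {k} {k + k} (subst Even (cong (λ z → k + (k + z)) (+-identityʳ k)) e) (even k)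

  3-even : ∀ {k} → Even k → Even (3 * k)
  3-even {k} e = subst Even (sym (cong (λ z → k + (k + z)) (+-identityʳ k))) (even-+ e (even k))

  #-even : ∀ {A} → Even (∂ A) → Even (# A)
  #-even {A} e = even-3 (subst Even (sym (handshake A)) (even-+ (E-self-even A) e))

  ∂-even : ∀ {A} → Even (# A) → Even (∂ A)
  ∂-even {A} e = even-cancel (subst Even (trans (handshake A) (+-comm (E A A) _)) (3-even e)) (E-self-even A)

  #-odd : ∀ {A} → Odd (∂ A) → Odd (# A)
  #-odd {A} o with parity (# A)
  ... | inj₂ p = p
  ... | inj₁ e = ⊥-elim (¬even-odd (∂-even {A} e) o)

  odd-3 : Odd 3
  odd-3 = even 2

  shore-odd : ∀ {A} → ∂ A ≡ 3 → Odd (# A)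
  shore-odd {A} e = #-odd {A} (subst Odd (sym e) odd-3)

  -- Holds for each ordered pair separately, by the membership of its two ends.
  submodular : ∀ A B → ∂ (A ∩ B) + ∂ (A ∪ B) ≤ ∂ A + ∂ B
  submodular A B = subst₂ _≤_ (∑₂-+ _ _) (∑₂-+ _ _) (∑₂-mono (λ u v →
    bool≤ (A u ∷ B u ∷ A v ∷ B v ∷ G u v ∷ [])
      (λ { (a ∷ b ∷ c ∷ d ∷ g ∷ []) → ι ((a ∧ b) ∧ (not (c ∧ d) ∧ g)) + ι ((a ∨ b) ∧ (not (c ∨ d) ∧ g)) })
      (λ { (a ∷ b ∷ c ∷ d ∷ g ∷ []) → ι (a ∧ (not c ∧ g)) + ι (b ∧ (not d ∧ g)) })))

  submodular-∖ : ∀ A B → ∂ (A ∖ B) + ∂ (B ∖ A) ≤ ∂ A + ∂ B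
  submodular-∖ A B = subst₂ _≤_
    (cong (∂ (A ∖ B) +_) (trans (sym (∂-∁ (A ∪ ∁ B))) (E-cong
      (λ v → demorgan (A v) (B v)) (λ v → cong not (demorgan (A v) (B v))))))
    (cong (∂ A +_) (∂-∁ B)) (submodular A (∁ B))
    where
    demorgan : ∀ a b → not (a ∨ not b) ≡ b ∧ not a
    demorgan true true = refl
    demorgan true false = refl
    demorgan false true = refl
    demorgan false false = refl

  ∂-single : ∀ v → ∂ ⁅ v ⁆ ≡ 3
  ∂-single v = begin
    ∂ ⁅ v ⁆                     ≡⟨ cong (_+ ∂ ⁅ v ⁆) (E-0 ⁅ v ⁆ ⁅ v ⁆ (λ u w a b g → G≢ g (trans (sym (==-≡ a)) (==-≡ b)))) ⟨
    E ⁅ v ⁆ ⁅ v ⁆ + ∂ ⁅ v ⁆     ≡⟨ handshake ⁅ v ⁆ ⟨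
    3 * # ⁅ v ⁆                 ≡⟨ cong (3 *_) (#-single v) ⟩
    3                           ∎
    where open ≡-Reasoning

  third-neighbour : ∀ a b → ∃ λ c → G a c ≡ true × c ≢ b
  third-neighbour a b with #-∃₂ (G a) (≤-trans (s≤s (s≤s z≤n)) (≤r (sym (deg a))))
  ... | v , w , gv , gw , v≢w with same? v b
  ...   | inj₁ refl = w , gw , v≢w ∘ sym
  ...   | inj₂ ne = v , gv , ne

-- Small cuts of a cubic brick and the uncrossing of 3-cuts.

module CubicBrick {n} (G : Graph n) (simple : IsSimple G) (cubic : Cubic G) (brick : Brick G) where
  open Cuts G simple cubic public

  connected : Connected G
  connected = proj₁ (proj₁ brick)

  covered : ∀ a b → G a b ≡ true → Σ (PerfectMatching G) λ M → mate M a ≡ b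
  covered = proj₂ (proj₁ brick)

  nonbipartite : ¬ Bipartite G
  nonbipartite = proj₁ (proj₂ brick)

  no-tight : ∀ X → Tight G X → ¬ NonTrivial X
  no-tight = proj₂ (proj₂ brick)

  closed-all : ∀ X → ∂ X ≡ 0 → ∀ {u} → X u ≡ true → ∀ w → X w ≡ true
  closed-all X e {u} xu w = go xu (connected u w)
    where
    go : ∀ {u w} → X u ≡ true → Reach G u w → X w ≡ true
    go xu here = xu
    go xu (step g r) = go (¬false (λ f → E-none X (∁ X) e xu (not-f f) g)) r

  cut≥1 : ∀ X {u w} → X u ≡ true → X w ≡ false → 1 ≤ ∂ X
  cut≥1 X xu xw with ∂ X in e
  ... | zero = ⊥-elim (true≢false (closed-all X e xu _) xw)
  ... | suc _ = s≤s z≤n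

  cr : PerfectMatching G → VSet n → ℕ
  cr M X = # (λ v → X v ∧ not (X (mate M v)))

  -- The vertices of `X` matched within `X` come in pairs, so the number of crossings has the parity
  -- of `X`.
  cr-split : ∀ M X → ∃ λ k → # X ≡ k + cr M X × Even k
  cr-split M X = # inner , trans (sum-cong (λ v → bool≡ (X v ∷ X (mate M v) ∷ []) (λ { (a ∷ b ∷ []) → ι a })
      (λ { (a ∷ b ∷ []) → ι (a ∧ b) + ι (a ∧ not b) }))) (sum-+ _ _) ,
    closed-even inner (mate M) (invol M) (λ v h → ∧-i (∧-r {X v} h) (trans (cong X (invol M v)) (∧-l h))) (λ v _ → nofix M v)
    where
    inner : VSet n
    inner v = X v ∧ X (mate M v)

  cr-odd : ∀ M X → Odd (# X) → Odd (cr M X)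
  cr-odd M X o with cr-split M X | parity (cr M X)
  ... | _ | inj₂ p = p
  ... | k , e , ev | inj₁ p = ⊥-elim (¬even-odd (subst Even (sym e) (even-+ ev p)) o)

  odd≥1 : ∀ {k} → Odd k → 1 ≤ k
  odd≥1 {zero} o = ⊥-elim (¬even-odd (even 0) o)
  odd≥1 {suc k} o = s≤s z≤n

  odd<3 : ∀ {k} → Odd k → k ≤ 2 → k ≡ 1
  odd<3 {zero} o h = ⊥-elim (¬even-odd (even 0) o)
  odd<3 {suc zero} o h = refl
  odd<3 {suc (suc zero)} o h = ⊥-elim (¬even-odd (even 1) o)
  odd<3 {suc (suc (suc k))} o (s≤s (s≤s ()))

  tight-if : ∀ X → (∀ M → cr M X ≡ 1) → Tight G X
  tight-if X h M = trans (count≡# (λ v → X v ∧ not (X (mate M v)))) (h M)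

  -- A bridge lies in every perfect matching, so the other edges at its ends would lie in none.
  cut≢1 : ∀ X → ∂ X ≢ 1
  cut≢1 X e with E-∃ X (∁ X) (≤r (sym e))
  ... | a , b , xa , xb , gab with third-neighbour a b
  ... | c , gac , c≢b with covered a c gac
  ... | M , refl with #-∃ (λ v → X v ∧ not (X (mate M v))) (odd≥1 (cr-odd M X (#-odd {X} (subst Odd (sym e) (even 1)))))
  ... | v , h = <-irrefl refl (≤-trans (two-pairs (λ u v → X u ∧ (∁ X v ∧ G u v)) (∧-i xa (∧-i xb gab))
        (∧-i {X v} {∁ X (mate M v) ∧ G v (mate M v)} (∧-l h) (∧-i (∧-r {X v} h) (onEdge M v)))
        λ { refl q → c≢b (sym q) }) (≤r e))

  -- X has size ≥ 4; removing an end of one of the two cut edges leaves a tight cut.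
  cut≢2 : ∀ X → ∂ X ≢ 2
  cut≢2 X e with E-∃ X (∁ X) (≤-trans (s≤s z≤n) (≤r (sym e)))
  ... | a , b , xa , xb , gab = no-tight X' (tight-if X' tight) (subst (2 ≤_) (sym (count≡# X')) X'≥2 ,
        subst (2 ≤_) (sym (count≡# (∁ X'))) (#≥2 (∁ X') {a} {b} (not-f a∉) (not-f b∉) (λ { refl → true≢false xa (not-t xb) })))
    where
    X' : VSet n
    X' = X ─ a
    a∉ : X' a ≡ false
    a∉ = ¬true (λ h → true≢false (==-refl a) (not-t (∧-r {X a} h)))
    b∉ : X' b ≡ false
    b∉ = ¬true (λ h → true≢false (∧-l h) (not-t xb))
    A = ⁅ a ⁆
    split-X : ∀ v → ι (X v) ≡ ι (X' v) + ι (A v)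
    split-X v with same? a v
    ... | inj₁ refl rewrite xa | ==-refl v = refl
    ... | inj₂ ne rewrite ==-≢ ne | ==-≢ (ne ∘ sym) | Bool.∧-identityʳ (X v) = sym (+-identityʳ _)
    split-∁X' : ∀ v → ι (∁ X' v) ≡ ι (∁ X v) + ι (A v)
    split-∁X' v with same? a v
    ... | inj₁ refl rewrite xa | ==-refl v = refl
    ... | inj₂ ne rewrite ==-≢ ne | ==-≢ (ne ∘ sym) | Bool.∧-identityʳ (X v) = sym (+-identityʳ _)
    AX' = E A X'
    t = E A (∁ X)
    r = E X' (∁ X)
    e₁ : r + t ≡ 2
    e₁ = trans (cong₂ _+_ (E-sym X' (∁ X)) (E-sym A (∁ X))) (trans (sym (E-split (∁ X) X X' A split-X)) (trans (E-sym (∁ X) X) e))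
    e₂ : AX' + t ≡ 3
    e₂ = trans (sym (trans (E-split A (∁ A) X' (∁ X) pt) refl)) (∂-single a)
      where
      pt : ∀ v → ι (∁ A v) ≡ ι (X' v) + ι (∁ X v)
      pt v with same? a v
      ... | inj₁ refl rewrite xa | ==-refl v = refl
      ... | inj₂ ne rewrite ==-≢ ne | ==-≢ (ne ∘ sym) with X v
      ...   | true = refl
      ...   | false = refl
    e₃ : ∂ X' ≡ r + AX'
    e₃ = trans (E-split X' (∁ X') (∁ X) A split-∁X') (cong (r +_) (E-sym X' A))
    t≥1 : 1 ≤ t
    t≥1 = E-edge A (∁ X) (==-refl a) xb gab
    -- If both cut edges met at `a`, the set `X'` would have a single cut edge.
    t≤1 : t ≤ 1
    t≤1 = ≮⇒≥ λ l → cut≢1 X' (≤-antisym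
      (prove (r ∷ t ∷ AX' ∷ ∂ X' ∷ []) x3 (con 1) 1 ((1 , x3 , x0 ⊕ x2) ∷ (1 , x0 ⊕ x1 , con 2) ∷ (1 , x2 ⊕ x1 , con 3) ∷ (2 , con 2 , x1) ∷ [])
        (≤r e₃ , ≤r e₁ , ≤r e₂ , l , tt))
      (cut≥1 X' {proj₁ X'-elt} (proj₂ X'-elt) a∉))
      where
      X'-elt : ∃ λ v → X' v ≡ true
      X'-elt with E-∃ A X' (prove (r ∷ t ∷ AX' ∷ []) (con 1) x2 1 ((1 , x0 ⊕ x1 , con 2) ∷ (1 , con 3 , x2 ⊕ x1) ∷ []) (≤r e₁ , ≥r e₂ , tt))
      ... | _ , v , _ , xv , _ = v , xv
    odd-X' : Odd (# X')
    odd-X' = subst Even (#-─ X a xa) (#-even {X} (subst Even (sym e) (even 1)))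
    X'≥2 : 2 ≤ # X'
    X'≥2 = ≮⇒≥ λ l → <-irrefl refl (≤-trans (prove (r ∷ t ∷ AX' ∷ []) (con 2) x2 1 ((1 , con 3 , x2 ⊕ x1) ∷ (1 , x1 , con 1) ∷ []) (≥r e₂ , t≤1 , tt))
      (≤-trans (∑₂-mono (λ u v → ι-mono (λ h → uniq l u v h))) (≤r (∑₂-δ a (proj₁ (X'-one l))))))
      where
      X'-one : # X' < 2 → ∃ λ v → X' v ≡ true
      X'-one l = #-∃ X' (odd≥1 odd-X')
      uniq : ∀ (l : # X' < 2) u v → A u ∧ (X' v ∧ G u v) ≡ true → (a == u) ∧ (proj₁ (X'-one l) == v) ≡ true
      uniq l u v h = ∧-i (∧-l h) (trans (cong (_== v) (#≤1-unique X' (s≤s⁻¹ l) (proj₂ (X'-one l)) (∧-l (∧-r {A u} h)))) (==-refl v))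
    -- Only the partner of `a` and the end of the other cut edge can be matched out of `X'`. That is
    -- at most two crossings, and their number is odd.
    tight : ∀ M → cr M X' ≡ 1
    tight M = odd<3 (cr-odd M X' odd-X') (≤-trans (sum-mono pt) (≤-trans (≤r (sum-+ (λ v → ι (mate M a == v)) (λ v → sum (λ w → ι (X' v ∧ (∁ X w ∧ G v w))))))
        (≤-trans (+-monoʳ-≤ _ r≤1) (≤r (cong (_+ 1) (#-single (mate M a)))))))
      where
      r≤1 : r ≤ 1
      r≤1 = prove (r ∷ t ∷ []) x0 (con 1) 1 ((1 , x0 ⊕ x1 , con 2) ∷ (1 , con 1 , x1) ∷ []) (≤r e₁ , t≥1 , tt)
      pt : ∀ v → ι (X' v ∧ not (X' (mate M v))) ≤ ι (mate M a == v) + sum (λ w → ι (X' v ∧ (∁ X w ∧ G v w)))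
      pt v = ι-≤ λ h → go h (same? (mate M v) a)
        where
        go : X' v ∧ not (X' (mate M v)) ≡ true → mate M v ≡ a ⊎ mate M v ≢ a → 1 ≤ ι (mate M a == v) + sum (λ w → ι (X' v ∧ (∁ X w ∧ G v w)))
        go h (inj₁ q) = ≤-trans (≤r (sym (ι-true (trans (cong (λ z → mate M z == v) (sym q)) (trans (cong (_== v) (invol M v)) (==-refl v)))))) (m≤m+n _ _)
        go h (inj₂ q) = ≤-trans (≤-trans (≤r (sym (ι-true (∧-i {X' v} (∧-l h) (∧-i out (onEdge M v))))))
            (term≤sum (λ w → ι (X' v ∧ (∁ X w ∧ G v w))) (mate M v))) (m≤n+m _ (ι (mate M a == v)))
          where
          out : ∁ X (mate M v) ≡ true
          out = not-f (¬true λ x → true≢false (∧-i x (not-f (==-≢ q))) (not-t (∧-r {X' v} h)))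

  cut≥3 : ∀ X {u w} → X u ≡ true → X w ≡ false → 3 ≤ ∂ X
  cut≥3 X xu xw with ∂ X in e | cut≥1 X xu xw
  ... | suc zero | _ = ⊥-elim (cut≢1 X e)
  ... | suc (suc zero) | _ = ⊥-elim (cut≢2 X e)
  ... | suc (suc (suc k)) | _ = s≤s (s≤s (s≤s z≤n))

  -- In a cubic graph a cut has the parity of its sides, so an even set cannot have three cut edges.
  cut≥4 : ∀ X {u w} → X u ≡ true → X w ≡ false → Even (# X) → 4 ≤ ∂ X
  cut≥4 X xu xw ev with m≤n⇒m<n∨m≡n (cut≥3 X xu xw)
  ... | inj₁ l = l
  ... | inj₂ e = ⊥-elim (¬even-odd (∂-even {X} ev) (subst Odd e odd-3))

  Shore : VSet n → Set
  Shore X = ∂ X ≡ 3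

  shore-∃ : ∀ {X} → Shore X → ∃ λ v → X v ≡ true
  shore-∃ {X} s with E-∃ X (∁ X) (≤-trans (s≤s z≤n) (≤r (sym s)))
  ... | u , _ , xu , _ = u , xu

  shore-co : ∀ {X} → Shore X → ∃ λ v → X v ≡ false
  shore-co {X} s with E-∃ X (∁ X) (≤-trans (s≤s z≤n) (≤r (sym s)))
  ... | _ , v , _ , xv , _ = v , not-t xv

  _⊆_ : VSet n → VSet n → Set
  A ⊆ B = ∀ v → A v ≡ true → B v ≡ true

  ⊆? : ∀ A B → A ⊆ B ⊎ ∃ λ v → A v ≡ true × B v ≡ false
  ⊆? A B with Fin.any? (λ v → (A v ∧ not (B v)) Bool.≟ true)
  ... | yes (v , e) = inj₂ (v , ∧-l e , not-t (∧-r {A v} e))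
  ... | no ¬e = inj₁ λ v av → ¬false (λ f → ¬e (v , ∧-i av (not-f f)))

  data Nested (A B : VSet n) : Set where
    sub : A ⊆ B → Nested A B
    sup : B ⊆ A → Nested A B
    disjoint : A ⊆ ∁ B → Nested A B
    cover : ∁ A ⊆ B → Nested A B

  -- If all four corners are nonempty, parity makes either the intersection and the union even or
  -- both differences even. Two even corners need four cut edges each, while submodularity allows
  -- six in total.
  nested : ∀ A B → Shore A → Shore B → Nested A B
  nested A B sA sB with ⊆? A B | ⊆? B A | ⊆? A (∁ B) | ⊆? (∁ A) B
  ... | inj₁ h | _ | _ | _ = sub h
  ... | inj₂ _ | inj₁ h | _ | _ = sup h
  ... | inj₂ _ | inj₂ _ | inj₁ h | _ = disjoint h
  ... | inj₂ _ | inj₂ _ | inj₂ _ | inj₁ h = cover h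
  ... | inj₂ (p , ap , bp) | inj₂ (q , bq , aq) | inj₂ (r , ar , br) | inj₂ (s , as , bs) = ⊥-elim (absurd (parity (# (A ∩ B))))
    where
    br' : B r ≡ true
    br' = ¬false (λ f → true≢false (not-f f) br)
    sum∩∪ : # (A ∩ B) + # (A ∪ B) ≡ # A + # B
    sum∩∪ = trans (sym (sum-+ _ _)) (trans (sum-cong (λ v → bool≡ (A v ∷ B v ∷ []) (λ { (a ∷ b ∷ []) → ι (a ∧ b) + ι (a ∨ b) }) (λ { (a ∷ b ∷ []) → ι a + ι b }))) (sum-+ _ _))
    split-A : # A ≡ # (A ∖ B) + # (A ∩ B)
    split-A = trans (sum-cong (λ v → bool≡ (A v ∷ B v ∷ []) (λ { (a ∷ b ∷ []) → ι a }) (λ { (a ∷ b ∷ []) → ι (a ∧ not b) + ι (a ∧ b) }))) (sum-+ _ _)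
    split-B : # B ≡ # (B ∖ A) + # (A ∩ B)
    split-B = trans (sum-cong (λ v → bool≡ (A v ∷ B v ∷ []) (λ { (a ∷ b ∷ []) → ι b }) (λ { (a ∷ b ∷ []) → ι (b ∧ not a) + ι (a ∧ b) }))) (sum-+ _ _)
    oddA = shore-odd {A} sA
    oddB = shore-odd {B} sB
    odd-minus : ∀ {a b c} → a ≡ b + c → Odd a → Odd c → Even b
    odd-minus {b = b} {c} refl oa oc = even-cancel {b} {suc c} (subst Even (sym (+-suc b c)) oa) oc
    odd-plus : ∀ {a b c d} → a + b ≡ c + d → Odd c → Odd d → Even a → Even b
    odd-plus {a} {b} {c} {d} e oc od ea = even-cancel {b} {a} (subst Even (trans (sym e) (+-comm a b))
      (even-cancel {c + d} {2} (subst Even (trans (cong suc (+-suc c d)) (trans (sym (+-comm (c + d) 2)) refl)) (even-+ oc od)) (even 1))) ea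
    at-most-6 : ∀ X Y → ∂ X + ∂ Y ≤ ∂ A + ∂ B → 4 ≤ ∂ X → 4 ≤ ∂ Y → ⊥
    at-most-6 X Y h a b = refute (∂ X ∷ ∂ Y ∷ []) ((1 , x0 ⊕ x1 , con 6) ∷ (1 , con 4 , x0) ∷ (1 , con 4 , x1) ∷ [])
      (≤-trans h (≤r (cong₂ _+_ sA sB)) , a , b , tt)
    absurd : Even (# (A ∩ B)) ⊎ Odd (# (A ∩ B)) → ⊥
    absurd (inj₁ ev) = at-most-6 (A ∩ B) (A ∪ B) (submodular A B)
      (cut≥4 (A ∩ B) {r} {s} (∧-i ar br') (trans (cong (_∧ B s) (not-t as)) refl) ev)
      (cut≥4 (A ∪ B) {r} {s} (∨-l ar) (trans (cong (_∨ B s) (not-t as)) bs) (odd-plus sum∩∪ oddA oddB ev))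
    absurd (inj₂ od) = at-most-6 (A ∖ B) (B ∖ A) (submodular-∖ A B)
      (cut≥4 (A ∖ B) {p} {q} (∧-i ap (not-f bp)) (trans (cong (_∧ not (B q)) aq) refl) (odd-minus split-A oddA od))
      (cut≥4 (B ∖ A) {q} {p} (∧-i bq (not-f aq)) (trans (cong (_∧ not (A p)) bp) refl) (odd-minus split-B oddB od))

-- Barriers, and certificates of non-removability.

module Barriers {n} (G : Graph n) (simple : IsSimple G) (cubic : Cubic G) (brick : Brick G) where
  open CubicBrick G simple cubic brick public

  part : VSet n → (Fin n → Fin n) → Fin n → VSet n
  part S L ℓ v = not (S v) ∧ (L v == ℓ)

  Respects : VSet n → (Fin n → Fin n) → Set
  Respects S L = ∀ u v → S u ≡ false → S v ≡ false → G u v ≡ true → L u ≡ L v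

  -- The odd parts of a barrier are tight, hence singletons, and then G is bipartite.
  no-barrier : ∀ S L → Respects S L → 2 ≤ # S → # S ≤ # (λ ℓ → oddᵇ (# (part S L ℓ))) → ⊥
  no-barrier S L label S≥2 large = nonbipartite (S , colour)
    where
    K = part S L
    odd : VSet n
    odd ℓ = oddᵇ (# (K ℓ))
    crossings : ∀ M → sum (λ ℓ → cr M (K ℓ)) ≤ # S
    crossings M = begin
      sum (λ ℓ → cr M (K ℓ))                                   ≡⟨ sum-cong (λ ℓ → sum-cong (λ v → pt ℓ v)) ⟩
      sum (λ ℓ → sum (λ v → ι (L v == ℓ) * f v))              ≡⟨ fibre L f ⟨
      sum f                                                    ≤⟨ sum-mono (λ v → ι-mono (out v)) ⟩
      # (λ v → S (mate M v))                                   ≡⟨ sum-involution (λ v → ι (S v)) (mate M) (invol M) ⟨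
      # S                                                      ∎
      where
      open ≤-Reasoning
      f : Fin n → ℕ
      f v = ι (not (S v) ∧ not (K (L v) (mate M v)))
      pt : ∀ ℓ v → ι (K ℓ v ∧ not (K ℓ (mate M v))) ≡ ι (L v == ℓ) * f v
      pt ℓ v with same? (L v) ℓ
      ... | inj₁ refl rewrite ==-refl (L v) with S v
      ...   | true = refl
      ...   | false = sym (+-identityʳ _)
      pt ℓ v | inj₂ ne rewrite ==-≢ ne with S v
      ...   | true = refl
      ...   | false = refl
      out : ∀ v → not (S v) ∧ not (K (L v) (mate M v)) ≡ true → S (mate M v) ≡ true
      out v h = ¬false λ f → true≢false (∧-i (not-f f) (trans (cong (_== L v) (sym (label v (mate M v) (not-t (∧-l h)) f (onEdge M v)))) (==-refl (L v))))
                   (not-t (∧-r {not (S v)} h))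
    cr≡ : ∀ M ℓ → cr M (K ℓ) ≡ ι (odd ℓ)
    cr≡ M = squeeze (λ ℓ → cr M (K ℓ)) (λ ℓ → ι (odd ℓ))
      (λ ℓ → ι-≤ (λ o → odd≥1 (cr-odd M (K ℓ) (odd-from o)))) (≤-trans (crossings M) large)
    singleton : ∀ ℓ → odd ℓ ≡ true → ∀ {v w} → K ℓ v ≡ true → K ℓ w ≡ true → v ≡ w
    singleton ℓ o = #≤1-unique (K ℓ) (≮⇒≥ λ l → no-tight (K ℓ) (tight-if (K ℓ) (λ M → trans (cr≡ M ℓ) (ι-true o)))
      (subst (2 ≤_) (sym (count≡# (K ℓ))) l ,
       subst (2 ≤_) (sym (count≡# (∁ (K ℓ)))) (≤-trans S≥2 (#-mono λ v s → not-f (cong (λ b → not b ∧ (L v == ℓ)) s)))))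
    O : VSet n
    O v = not (S v) ∧ odd (L v)
    O-K : ∀ {v} → O v ≡ true → K (L v) v ≡ true
    O-K {v} o = ∧-i (∧-l o) (==-refl (L v))
    O-nbr : ∀ {u v} → O u ≡ true → G u v ≡ true → S v ≡ true
    O-nbr {u} {v} o g = ¬false λ f → G≢ g (singleton (L u) (∧-r {not (S u)} o) (O-K o)
      (∧-i (not-f f) (trans (cong (_== L u) (sym (label u v (not-t (∧-l o)) f g))) (==-refl (L u)))))
    S≤O : # S ≤ # O
    S≤O = ≤-trans large (≤-trans (sum-mono per) (≤r (sym (fibre L (λ v → ι (O v))))))
      where
      per : ∀ ℓ → ι (odd ℓ) ≤ sum (λ v → ι (L v == ℓ) * ι (O v))
      per ℓ = ι-≤ λ o → let (v , k) = #-∃ (K ℓ) (odd≥1 (odd-from o)) ; e = ==-≡ (∧-r {not (S v)} k) in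
        ≤-trans (≤r (sym (cong₂ _*_ (ι-true (∧-r {not (S v)} k)) (ι-true (∧-i (∧-l k) (trans (cong odd e) o))))))
          (term≤sum (λ v → ι (L v == ℓ) * ι (O v)) v)
    EOS : E O S ≡ 3 * # O
    EOS = trans (sym (trans (cong (E O S +_) (E-0 O (∁ S) λ u v o s g → true≢false (O-nbr o g) (not-t s))) (+-identityʳ _)))
            (trans (sym (E-∁ O S)) (E-all O))
    -- All edges at `O` go to `S`, and `S` is no larger than `O`. By 3-regularity `S` has no edge
    -- left for anything else.
    ES∁O : E S (∁ O) ≡ 0
    ES∁O = n≤0⇒n≡0 (prove (# S ∷ # O ∷ E O S ∷ E S (∁ O) ∷ []) x3 (con 0) 1
      ((1 , x2 ⊕ x3 , 3 ⊗ x0) ∷ (1 , 3 ⊗ x1 , x2) ∷ (3 , x0 , x1) ∷ [])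
      (≤r (trans (cong (_+ E S (∁ O)) (E-sym O S)) (trans (sym (E-∁ S O)) (E-all S))) , ≥r EOS , S≤O , tt))
    T' : VSet n
    T' v = S v ∨ O v
    T'-closed : ∂ T' ≡ 0
    T'-closed = E-0 T' (∁ T') λ u v t t' g → case ∨-e {S u} t of λ
      { (inj₁ s) → E-none S (∁ O) ES∁O s (not-f (¬true λ o → true≢false (∨-r {S v} o) (not-t t'))) g
      ; (inj₂ o) → true≢false (∨-l (O-nbr o g)) (not-t t') }
    T'-all : ∀ v → T' v ≡ true
    T'-all = let (s , e) = #-∃ S (≤-trans (s≤s z≤n) S≥2) in closed-all T' T'-closed {s} (∨-l e)
    colour : ∀ u v → G u v ≡ true → S u ≢ S v
    colour u v g e with S u in su | S v in sv
    ... | true | true = E-none S (∁ O) ES∁O su (not-f (cong (λ b → not b ∧ odd (L v)) sv)) g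
    ... | false | false = true≢false (O-nbr (case ∨-e {S u} (T'-all u) of λ { (inj₁ s) → ⊥-elim (true≢false s su) ; (inj₂ o) → o }) g) sv

  -- The certificate that every perfect matching through x y contains a b
  record Cert (a b : Fin n) : Set where
    field
      S : VSet n
      L : Fin n → Fin n
      x y : Fin n
      x∈S : S x ≡ true
      y∈S : S y ≡ true
      Gxy : G x y ≡ true
      ESS : E S S ≡ 2
      a∉S : S a ≡ false
      b∉S : S b ≡ false
      La≢Lb : L a ≢ L b
      respects : ∀ u v → S u ≡ false → S v ≡ false → G u v ≡ true → L u ≡ L v ⊎ isE a b u v ≡ true
      L-idem : ∀ v → S v ≡ false → L (L v) ≡ L v
      L-out : ∀ v → S v ≡ false → S (L v) ≡ false
      part-shore : ∀ v → S v ≡ false → Shore (part S L (L v))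

  Cert-sym : ∀ {a b} → Cert a b → Cert b a
  Cert-sym {a} {b} C = record { S = S ; L = L ; x = x ; y = y ; x∈S = x∈S ; y∈S = y∈S ; Gxy = Gxy ; ESS = ESS
    ; a∉S = b∉S ; b∉S = a∉S ; La≢Lb = La≢Lb ∘ sym
    ; respects = λ u v p q g → case respects u v p q g of λ { (inj₁ e) → inj₁ e ; (inj₂ e) → inj₂ (trans (swapE b a u v) e) }
    ; L-idem = L-idem ; L-out = L-out ; part-shore = part-shore }
    where
    open Cert C
    swapE : ∀ (b a u v : Fin n) → isE b a u v ≡ isE a b u v
    swapE b a u v with b == u | a == v | b == v | a == u
    ... | true | true | true | true = refl
    ... | true | true | true | false = refl
    ... | true | true | false | true = refl
    ... | true | true | false | false = refl
    ... | true | false | true | true = refl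
    ... | true | false | true | false = refl
    ... | true | false | false | true = refl
    ... | true | false | false | false = refl
    ... | false | true | true | true = refl
    ... | false | true | true | false = refl
    ... | false | true | false | true = refl
    ... | false | true | false | false = refl
    ... | false | false | true | true = refl
    ... | false | false | true | false = refl
    ... | false | false | false | true = refl
    ... | false | false | false | false = refl

  module Delete (a b : Fin n) (gab : G a b ≡ true) where

    H : Graph n
    H = deleteEdge G a b

    isE' : Fin n → Fin n → Bool
    isE' u v = (u == a ∧ v == b) ∨ (u == b ∧ v == a)

    isE'-e : ∀ u v → isE' u v ≡ true → (u ≡ a × v ≡ b) ⊎ (u ≡ b × v ≡ a)
    isE'-e u v h with ∨-e {u == a ∧ v == b} h
    ... | inj₁ p = inj₁ (==-≡ (∧-l p) , ==-≡ (∧-r {u == a} p))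
    ... | inj₂ p = inj₂ (==-≡ (∧-l p) , ==-≡ (∧-r {u == b} p))

    isE'-1 : isE' a b ≡ true
    isE'-1 = ∨-l (∧-i (==-refl a) (==-refl b))

    isE'-2 : isE' b a ≡ true
    isE'-2 = ∨-r {b == a ∧ a == b} (∧-i (==-refl b) (==-refl a))

    H-G : ∀ {u v} → H u v ≡ true → G u v ≡ true
    H-G h = ∧-l h

    H-i : ∀ {u v} → G u v ≡ true → isE' u v ≡ false → H u v ≡ true
    H-i g f = ∧-i g (not-f f)

    symH : Symmetric H
    symH u v = cong₂ (λ g e → g ∧ not e) (symG u v) (sw (u == a) (v == b) (u == b) (v == a))
      where
      sw : ∀ p q r s → (p ∧ q) ∨ (r ∧ s) ≡ (s ∧ r) ∨ (q ∧ p)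
      sw p q r s rewrite Bool.∧-comm s r | Bool.∧-comm q p = Bool.∨-comm (p ∧ q) (r ∧ s)

    irrH : Irreflexive H
    irrH u = cong (λ g → g ∧ not (isE' u u)) (irrG u)

    -- A cut has at least three edges, so it keeps one after deleting ab.
    H-connected : Connected H
    H-connected u w = reach n ⁅ u ⁆ (λ v h → subst (Reach H u) (==-≡ h) here) (==-refl u) (m≤n+m n _)
      where
      snoc : ∀ {p q r} → Reach H p q → H q r ≡ true → Reach H p r
      snoc here h = step h here
      snoc (step g p) h = step g (snoc p h)
      crossing : ∀ X {p q} → X p ≡ true → X q ≡ false → ∃ λ s → ∃ λ t → X s ≡ true × X t ≡ false × H s t ≡ true
      crossing X {p} {q} xp xq with Fin.any? (λ s → Fin.any? (λ t → (X s ∧ (not (X t) ∧ H s t)) Bool.≟ true))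
      ... | yes (s , t , e) = s , t , ∧-l e , not-t (∧-l (∧-r {X s} e)) , ∧-r {not (X t)} (∧-r {X s} e)
      ... | no ¬e = ⊥-elim (<-irrefl refl (≤-trans (cut≥3 X xp xq) (≤-trans (∑₂-mono pt)
          (≤r (trans (∑₂-+ (δ a b) (δ b a)) (cong₂ _+_ (∑₂-δ a b) (∑₂-δ b a)))))))
        where
        pt : ∀ s t → ι (X s ∧ (∁ X t ∧ G s t)) ≤ δ a b s t + δ b a s t
        pt s t = ι-≤ λ h → go h (bool? (isE' s t))
          where
          go : X s ∧ (∁ X t ∧ G s t) ≡ true → isE' s t ≡ true ⊎ isE' s t ≡ false → 1 ≤ δ a b s t + δ b a s t
          go h (inj₂ f) = ⊥-elim (¬e (s , t , ∧-i {X s} (∧-l h) (∧-i {∁ X t} (∧-l (∧-r {X s} h)) (H-i (∧-r {∁ X t} (∧-r {X s} h)) f))))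
          go h (inj₁ e) with isE'-e s t e
          ... | inj₁ (refl , refl) = ≤-trans (≤r (sym (δ-refl s t))) (m≤m+n _ _)
          ... | inj₂ (refl , refl) = ≤-trans (≤r (sym (δ-refl s t))) (m≤n+m _ (δ t s s t))
      reach : ∀ fuel (X : VSet n) → (∀ v → X v ≡ true → Reach H u v) → X u ≡ true → n ≤ # X + fuel → Reach H u w
      reach fuel X r xu h with X w in xw
      ... | true = r w xw
      reach zero X r xu h | false = ⊥-elim (<-irrefl refl (≤-trans (≤-trans (#-∁-pos) (≤r (trans (#-∁ X) (#-all n)))) (≤-trans h (≤r (+-identityʳ _)))))
        where
        #-∁-pos : suc (# X) ≤ # X + # (∁ X)
        #-∁-pos = ≤-trans (≤r (sym (+-comm (# X) 1))) (+-monoʳ-≤ (# X) (#≥1 (∁ X) w (not-f xw)))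
      reach (suc k) X r xu h | false with crossing X xu xw
      ... | s , t , xs , xt , g = reach k (X ∪ ⁅ t ⁆)
        (λ v e → case ∨-e {X v} e of λ { (inj₁ p) → r v p ; (inj₂ p) → subst (Reach H u) (==-≡ p) (snoc (r s xs) g) })
        (∨-l xu) (≤-trans h (≤-trans (≤r (+-suc (# X) k)) (+-monoˡ-≤ k bigger)))
        where
        bigger : suc (# X) ≤ # (X ∪ ⁅ t ⁆)
        bigger = ≤-trans (≤r (+-comm 1 (# X))) (≤-trans (≤r (sym (trans (sum-+ (λ v → ι (X v)) (λ v → ι (t == v))) (cong (# X +_) (#-single t)))))
          (sum-mono pt))
          where
          pt : ∀ v → ι (X v) + ι (t == v) ≤ ι (X v ∨ (t == v))
          pt v with same? t v
          ... | inj₁ refl rewrite xt | ==-refl v = ≤-refl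
          ... | inj₂ ne rewrite ==-≢ ne | Bool.∨-identityʳ (X v) = ≤r (+-identityʳ _)

    perfect : ∀ {x y μ} → Perf x y H μ → Σ (PerfectMatching H) λ M → mate M x ≡ y
    perfect {x} {y} {μ} (perf i e p) = record { mate = μ ; invol = i
      ; nofix = λ v q → true≢false (subst (λ w → H v w ≡ true) q (e v)) (irrH v) ; onEdge = e } , p

    -- Of the `3 * # S` edge ends at `S` at least two are spent on `x y`. At least `# S` odd parts
    -- need three cut edges each, and besides edges to `S` only `a b` can supply them, once in each
    -- direction. So nothing is left over: `x y` is the only edge inside `S`, `a b` joins two parts,
    -- and every part has exactly three cut edges.
    cert : ∀ {x y} → H x y ≡ true → ¬ ∃ (Perf x y H) → Cert a b
    cert {x} {y} hxy nP with covered x y (H-G hxy)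
    ... | M , Mxy with same? (mate M a) b
    ... | inj₂ ne = ⊥-elim (nP (mate M , perf (invol M) (λ v → H-i (onEdge M v) (¬true λ e → case isE'-e v (mate M v) e of λ
            { (inj₁ (refl , q)) → ne q ; (inj₂ (refl , q)) → ne (trans (cong (mate M) (sym q)) (invol M v)) })) Mxy))
    ... | inj₁ refl = record { S = S ; L = L ; x = x ; y = y ; x∈S = x∈S ; y∈S = y∈S ; Gxy = H-G hxy
        ; ESS = ≤-antisym (prove (# S ∷ E S S ∷ E (∁ S) S ∷ ε ∷ sum (λ ℓ → ∂ (K ℓ)) ∷ # odd ∷ []) x1 (con 2) 1
                   ((1 , x1 ⊕ x2 , 3 ⊗ x0) ∷ (3 , x0 , x5) ∷ (1 , 3 ⊗ x5 , x4) ∷ (1 , x4 , x2 ⊕ x3) ∷ (1 , x3 , con 2) ∷ [])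
                   (≤r ES , large , odd≤cuts , cuts≤ , ε≤2 , tt)) ESS≥2
        ; a∉S = proj₁ ends ; b∉S = proj₁ (proj₂ ends) ; La≢Lb = proj₂ (proj₂ ends)
        ; respects = label ; L-idem = L-idem ; L-out = L-out ; part-shore = shore }
      where
      b' = mate M a
      a≢b : a ≢ b'
      a≢b e = nofix M a (sym e)
      x≢a : x ≢ a
      x≢a refl = true≢false hxy (trans (cong (H x) (sym Mxy)) (trans (cong (G x b' ∧_) (cong not isE'-1)) (Bool.∧-zeroʳ _)))
      x≢b : x ≢ b'
      x≢b refl = true≢false hxy (trans (cong (H x) (trans (sym Mxy) (invol M a))) (trans (cong (G b' a ∧_) (cong not isE'-2)) (Bool.∧-zeroʳ _)))
      -- A perfect matching of `G` through `x y` must use `a b`, as it would otherwise survive in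
      -- `H`. Without that edge it is the near-perfect matching that `tutte` asks for.
      near : Near x y H a b' (unlink (mate M) a)
      near = record { inv = unlink-inv a (invol M)
        ; edge = λ v ne → let p = λ { refl → ne (unlink-u (mate M) a) } ; q = λ { refl → ne (unlink-μ (mate M) a) } in
            trans (cong (H v) (unlink-o (mate M) a v p q)) (H-i (onEdge M v) (¬true λ e → case isE'-e v (mate M v) e of λ
              { (inj₁ (r , _)) → p r ; (inj₂ (r , _)) → q r }))
        ; pin = trans (unlink-o (mate M) a x x≢a x≢b) Mxy
        ; a≢b = a≢b ; fixA = unlink-u (mate M) a ; fixB = unlink-μ (mate M) a
        ; only = λ v e → case same? v a of λ { (inj₁ p) → inj₁ p ; (inj₂ p) → case same? v b' of λ
            { (inj₁ q) → inj₂ q ; (inj₂ q) → ⊥-elim (nofix M v (trans (sym (unlink-o (mate M) a v p q)) e)) } } }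
      open Barrier (tutte symH irrH hxy nP (_ , near)) hiding (respects)
      K = part S L
      odd : VSet n
      odd ℓ = oddᵇ (# (K ℓ))
      label : ∀ u v → S u ≡ false → S v ≡ false → G u v ≡ true → L u ≡ L v ⊎ isE a b' u v ≡ true
      label u v su sv g with bool? (isE' u v)
      ... | inj₂ f = inj₁ (Barrier.respects (tutte symH irrH hxy nP (_ , near)) u v su sv (H-i g f))
      ... | inj₁ e with isE'-e u v e
      ...   | inj₁ (refl , refl) = inj₂ (isE-1 u v)
      ...   | inj₂ (refl , refl) = inj₂ (isE-2 v u)
      εR : Fin n → Fin n → Bool
      εR u v = not (S u) ∧ (not (S v) ∧ (not (L u == L v) ∧ isE a b' u v))
      ε = ∑₂ (λ u v → ι (εR u v))
      ES : E S S + E (∁ S) S ≡ 3 * # S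
      ES = trans (cong (E S S +_) (E-sym (∁ S) S)) (trans (sym (E-∁ S S)) (E-all S))
      ESS≥2 : 2 ≤ E S S
      ESS≥2 = two-pairs (λ u v → S u ∧ (S v ∧ G u v)) (∧-i x∈S (∧-i y∈S (H-G hxy))) (∧-i y∈S (∧-i x∈S (flipG (H-G hxy))))
        λ p _ → G≢ (H-G hxy) p
      odd-cut : ∀ ℓ → 3 * ι (odd ℓ) ≤ ∂ (K ℓ)
      odd-cut ℓ with odd ℓ in o
      ... | false = z≤n
      ... | true = let (v , k) = #-∃ (K ℓ) (odd≥1 (odd-from o)) in cut≥3 (K ℓ) {v} {x} k (cong (λ s → not s ∧ (L x == ℓ)) x∈S)
      odd≤cuts : 3 * # odd ≤ sum (λ ℓ → ∂ (K ℓ))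
      odd≤cuts = ≤-trans (≤r (*-distrib-sum 3 (λ ℓ → ι (odd ℓ)))) (sum-mono odd-cut)
      cuts≤ : sum (λ ℓ → ∂ (K ℓ)) ≤ E (∁ S) S + ε
      cuts≤ = ≤-trans (≤r (sym (trans (fibre L f) (sum-cong λ ℓ → sum-cong λ u → fib ℓ u))))
          (≤-trans (∑₂-mono pt) (≤r (∑₂-+ (λ u v → ι (∁ S u ∧ (S v ∧ G u v))) _)))
        where
        f : Fin n → ℕ
        f u = sum (λ v → ι (∁ S u ∧ (not (K (L u) v) ∧ G u v)))
        fib : ∀ ℓ u → ι (L u == ℓ) * f u ≡ sum (λ v → ι (K ℓ u ∧ (not (K ℓ v) ∧ G u v)))
        fib ℓ u with same? (L u) ℓ
        ... | inj₁ refl = trans (cong (λ b → ι b * f u) (==-refl (L u))) (trans (+-identityʳ _)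
                (sum-cong (λ v → cong (λ b → ι (b ∧ (not (K (L u) v) ∧ G u v))) (sym (trans (cong (∁ S u ∧_) (==-refl (L u))) (Bool.∧-identityʳ _))))))
        ... | inj₂ ne = trans (cong (λ b → ι b * f u) (==-≢ ne)) (sym (trans (sum-cong (λ v → cong (λ b → ι (b ∧ (not (K ℓ v) ∧ G u v)))
                (trans (cong (∁ S u ∧_) (==-≢ ne)) (Bool.∧-zeroʳ _)))) (sum-0 n)))
        pt : ∀ u v → ι (∁ S u ∧ (not (K (L u) v) ∧ G u v)) ≤ ι (∁ S u ∧ (S v ∧ G u v)) + ι (εR u v)
        pt u v = ι-≤ λ h → go h (bool? (S v))
          where
          go : ∁ S u ∧ (not (K (L u) v) ∧ G u v) ≡ true → S v ≡ true ⊎ S v ≡ false → 1 ≤ ι (∁ S u ∧ (S v ∧ G u v)) + ι (εR u v)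
          go h (inj₁ s) = ≤-trans (≤r (sym (ι-true (∧-i {∁ S u} (∧-l h) (∧-i s (∧-r {not (K (L u) v)} (∧-r {∁ S u} h))))))) (m≤m+n _ _)
          go h (inj₂ s) with label u v (not-t (∧-l h)) s (∧-r {not (K (L u) v)} (∧-r {∁ S u} h))
          ... | inj₁ e = ⊥-elim (true≢false (∧-i (not-f s) (trans (cong (_== L u) (sym e)) (==-refl (L u)))) (not-t (∧-l (∧-r {∁ S u} h))))
          ... | inj₂ e = ≤-trans (≤r (sym (ι-true (∧-i {∁ S u} (∧-l h) (∧-i (not-f s) (∧-i (not-f (==-≢ λ q →
                  true≢false (∧-i (not-f s) (trans (cong (_== L u) (sym q)) (==-refl (L u)))) (not-t (∧-l (∧-r {∁ S u} h))))) e)))))) (m≤n+m _ (ι (∁ S u ∧ (S v ∧ G u v))))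
      ε≤2 : ε ≤ 2
      ε≤2 = ≤-trans (∑₂-mono {g = λ u v → δ a b' u v + δ b' a u v} pt) (≤r (trans (∑₂-+ (δ a b') (δ b' a)) (cong₂ _+_ (∑₂-δ a b') (∑₂-δ b' a))))
        where
        pt : ∀ u v → ι (εR u v) ≤ δ a b' u v + δ b' a u v
        pt u v = ι-≤ λ h → case isE-e {u = a} {b'} {u} {v} (∧-r {not (L u == L v)} (∧-r {not (S v)} (∧-r {not (S u)} h))) of λ
          { (inj₁ (refl , refl)) → ≤-trans (≤r (sym (δ-refl u v))) (m≤m+n _ _)
          ; (inj₂ (refl , refl)) → ≤-trans (≤r (sym (δ-refl u v))) (m≤n+m _ (δ v u u v)) }
      ε≥1 : 1 ≤ ε
      ε≥1 = prove (# S ∷ E S S ∷ E (∁ S) S ∷ ε ∷ sum (λ ℓ → ∂ (K ℓ)) ∷ # odd ∷ []) (con 1) x3 1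
        ((1 , x1 ⊕ x2 , 3 ⊗ x0) ∷ (3 , x0 , x5) ∷ (1 , 3 ⊗ x5 , x4) ∷ (1 , x4 , x2 ⊕ x3) ∷ (1 , con 2 , x1) ∷ [])
        (≤r ES , large , odd≤cuts , cuts≤ , ESS≥2 , tt)
      ends : S a ≡ false × S b' ≡ false × L a ≢ L b'
      ends with ∑₂-∃ εR ε≥1
      ... | u , v , h with isE-e {u = a} {b'} {u} {v} (∧-r {not (L u == L v)} (∧-r {not (S v)} (∧-r {not (S u)} h)))
      ...   | inj₁ (refl , refl) = not-t (∧-l h) , not-t (∧-l (∧-r {not (S u)} h)) , ==-≡f (not-t (∧-l (∧-r {not (S v)} (∧-r {not (S u)} h))))
      ...   | inj₂ (refl , refl) = not-t (∧-l (∧-r {not (S u)} h)) , not-t (∧-l h) , ==-≡f (not-t (∧-l (∧-r {not (S v)} (∧-r {not (S u)} h)))) ∘ sym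
      cut≡ : ∀ ℓ → ∂ (K ℓ) ≡ 3 * ι (odd ℓ)
      cut≡ = squeeze (λ ℓ → ∂ (K ℓ)) (λ ℓ → 3 * ι (odd ℓ)) odd-cut (≤-trans
        (prove (# S ∷ E S S ∷ E (∁ S) S ∷ ε ∷ sum (λ ℓ → ∂ (K ℓ)) ∷ # odd ∷ []) x4 (3 ⊗ x5) 1
          ((1 , x1 ⊕ x2 , 3 ⊗ x0) ∷ (3 , x0 , x5) ∷ (1 , x4 , x2 ⊕ x3) ∷ (1 , x3 , con 2) ∷ (1 , con 2 , x1) ∷ [])
          (≤r ES , large , cuts≤ , ε≤2 , ESS≥2 , tt)) (≤r (*-distrib-sum 3 (λ ℓ → ι (odd ℓ)))))
      -- An even part would have no cut edge at all, which connectivity forbids as `x` lies outside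
      -- it.
      shore : ∀ v → S v ≡ false → Shore (K (L v))
      shore v sv with odd (L v) in o | cut≡ (L v)
      ... | true | e = e
      ... | false | e = ⊥-elim (true≢false (closed-all (K (L v)) e {v} (∧-i (not-f sv) (==-refl (L v))) x) (cong (λ s → not s ∧ (L x == L v)) x∈S))

    removable⊎cert : Removable G a b ⊎ Cert a b
    removable⊎cert with Fin.any? (λ x → Fin.any? (λ y → bad? x y))
      where
      bad? : ∀ x y → Dec (H x y ≡ true × ¬ ∃ (Perf x y H))
      bad? x y with H x y Bool.≟ true | perf? x y H
      ... | no p | _ = no (p ∘ proj₁)
      ... | yes p | yes q = no λ (_ , r) → r q
      ... | yes p | no q = yes (p , q)
    ... | yes (x , y , h , nP) = inj₂ (cert h nP)
    ... | no ¬p = inj₁ (gab , H-connected , λ c d h → case perf? c d H of λ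
            { (yes (μ , P)) → perfect P ; (no q) → ⊥-elim (¬p (c , d , h , q)) })

  removable? : ∀ a b → G a b ≡ true → Removable G a b ⊎ Cert a b
  removable? a b g = Delete.removable⊎cert a b g

bool-iff : ∀ {a b} → (a ≡ true → b ≡ true) → (b ≡ true → a ≡ true) → a ≡ b
bool-iff {true} {b} h k = sym (h refl)
bool-iff {false} {false} h k = refl
bool-iff {false} {true} h k = k refl

∑₂-─ : ∀ {n m} (R : Fin n → Fin m → Bool) {a b} → R a b ≡ true →
  ∑₂ (λ u v → ι (R u v)) ≡ suc (∑₂ (λ u v → ι (R u v ∧ not ((a == u) ∧ (b == v)))))
∑₂-─ R {a} {b} h = trans (∑₂-cong pt) (trans (∑₂-+ (δ a b) _) (cong (_+ ∑₂ (λ u v → ι (R u v ∧ not ((a == u) ∧ (b == v))))) (∑₂-δ a b)))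
  where
  pt : ∀ u v → ι (R u v) ≡ δ a b u v + ι (R u v ∧ not ((a == u) ∧ (b == v)))
  pt u v with a ≟ u | b ≟ v
  ... | yes refl | yes refl rewrite h = refl
  ... | yes refl | no _ = cong ι (sym (Bool.∧-identityʳ _))
  ... | no _ | _ = cong ι (sym (Bool.∧-identityʳ _))

three-pairs : ∀ {n} (R : Fin n → Fin n → Bool) {a b c d e f} → R a b ≡ true → R c d ≡ true → R e f ≡ true →
  (a ≡ c → b ≡ d → ⊥) → (a ≡ e → b ≡ f → ⊥) → (c ≡ e → d ≡ f → ⊥) → 3 ≤ ∑₂ (λ u v → ι (R u v))
three-pairs R {a} {b} h₁ h₂ h₃ p q r = subst (3 ≤_) (sym (∑₂-─ R h₁)) (s≤s (two-pairs _ (∧-i h₂ (differ p)) (∧-i h₃ (differ q)) r))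
  where
  differ : ∀ {c d} → (a ≡ c → b ≡ d → ⊥) → not ((a == c) ∧ (b == d)) ≡ true
  differ {c} {d} k = not-f (¬true λ e → k (==-≡ (∧-l e)) (==-≡ (∧-r {a == c} e)))

unique-pair : ∀ {n} (R : Fin n → Fin n → Bool) → ∑₂ (λ u v → ι (R u v)) ≤ 1 → ∀ {a b c d} → R a b ≡ true → R c d ≡ true → a ≡ c × b ≡ d
unique-pair R h {a} {b} {c} {d} p q with same? a c | same? b d
... | inj₁ e | inj₁ f = e , f
... | inj₂ ne | _ = ⊥-elim (<-irrefl refl (≤-trans (two-pairs R p q (λ e _ → ne e)) h))
... | _ | inj₂ ne = ⊥-elim (<-irrefl refl (≤-trans (two-pairs R p q (λ _ e → ne e)) h))

mod3-1 : ∀ a b → 3 * a ≢ suc (3 * b)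
mod3-1 zero b ()
mod3-1 (suc a) zero e = refute (a ∷ []) ((1 , 3 ⊗ (con 1 ⊕ x0) , con 1) ∷ []) (≤r e , tt)
mod3-1 (suc a) (suc b) e = mod3-1 a b (+-cancelˡ-≡ 3 _ _ (trans (sym (*-suc 3 a)) (trans e (cong suc (*-suc 3 b)))))

mod3-2 : ∀ a b → 3 * a ≢ suc (suc (3 * b))
mod3-2 zero b ()
mod3-2 (suc a) zero e = refute (a ∷ []) ((1 , 3 ⊗ (con 1 ⊕ x0) , con 2) ∷ []) (≤r e , tt)
mod3-2 (suc a) (suc b) e = mod3-2 a b (+-cancelˡ-≡ 3 _ _ (trans (sym (*-suc 3 a)) (trans e (cong (λ z → suc (suc z)) (*-suc 3 b)))))

-- Pieces, and the colourings that certificates induce on them.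

module Pieces {n} (G : Graph n) (simple : IsSimple G) (cubic : Cubic G) (brick : Brick G) where
  open Barriers G simple cubic brick public

  -- A partition of V(G) into shores whose quotient has only trivial 3-cuts
  record Piece : Set where
    field
      cls : Fin n → Fin n
      cls-idem : ∀ v → cls (cls v) ≡ cls v
    Cl : Fin n → VSet n
    Cl q v = cls v == q
    field
      shore : ∀ v → Shore (Cl (cls v))
      pieces : ∀ X → Shore X → ∃ λ q → X ⊆ Cl q ⊎ ∁ X ⊆ Cl q
    Single : Fin n → Set
    Single v = ∀ w → cls w ≡ cls v → w ≡ v
    -- Edges inside a class are excluded, since they vanish in the quotient.
    mono : VSet n → Fin n → Fin n → Bool
    mono κ s t = G s t ∧ (not (cls s == cls t) ∧ ((κ s ∧ κ t) ∨ (not (κ s) ∧ not (κ t))))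
    -- κ shows that deleting the edges uv and cd makes the quotient bipartite
    Dbl : VSet n → (u v c d : Fin n) → Set
    Dbl κ u v c d = (∀ s t → mono κ s t ≡ isE u v s t ∨ isE c d s t) × (∀ v → κ v ≡ κ (cls v)) × κ u ≢ κ c
    Bip : VSet n → Set
    Bip κ = (∀ s t → mono κ s t ≡ false) × (∀ v → κ v ≡ κ (cls v))

  -- A certificate read modulo the classes. That `S` meets the classes of `a` and `b` at most once
  -- ensures that no part has its complement inside a single class.
  module Kill (P : Piece) {a b : Fin n} (C : Cert a b)
    (fewA : ∀ s t → Cert.S C s ≡ true → Cert.S C t ≡ true → Piece.cls P s ≡ Piece.cls P a → Piece.cls P t ≡ Piece.cls P a → s ≡ t)
    (fewB : ∀ s t → Cert.S C s ≡ true → Cert.S C t ≡ true → Piece.cls P s ≡ Piece.cls P b → Piece.cls P t ≡ Piece.cls P b → s ≡ t)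
    where
    open Piece P
    open Cert C

    x≢y : x ≢ y
    x≢y = G≢ Gxy

    SS-edge : ∀ {u v} → S u ≡ true → S v ≡ true → G u v ≡ true → isE x y u v ≡ true
    SS-edge {u} {v} su sv g with bool? (isE x y u v)
    ... | inj₁ t = t
    ... | inj₂ f = ⊥-elim (<-irrefl refl (≤-trans (three-pairs (λ u v → S u ∧ (S v ∧ G u v))
        (∧-i x∈S (∧-i y∈S Gxy)) (∧-i y∈S (∧-i x∈S (flipG Gxy))) (∧-i su (∧-i sv g))
        (λ e _ → x≢y e) (λ { refl refl → true≢false (isE-1 u v) f }) (λ { refl refl → true≢false (isE-2 v u) f })) (≤r ESS)))

    opaque
      -- A part is a shore, so it or its complement lies in one class. In the second case `x` and
      -- `y` would share a class with whichever of `a`, `b` is outside the part.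
      unite : ∀ {u v} → S u ≡ false → S v ≡ false → L u ≡ L v → cls u ≡ cls v
      unite {u} {v} su sv e with pieces (part S L (L u)) (part-shore u su)
      ... | q , inj₁ h = trans (==-≡ (h u (∧-i (not-f su) (==-refl (L u))))) (sym (==-≡ (h v (∧-i (not-f sv) (trans (cong (_== L u) (sym e)) (==-refl (L u)))))))
      ... | q , inj₂ h = ⊥-elim (absurd (same? (L a) (L u)))
        where
        out : ∀ s → S s ≡ true → cls s ≡ q
        out s ss = ==-≡ (h s (not-f (cong (λ b → not b ∧ (L s == L u)) ss)))
        out' : ∀ w → L w ≢ L u → cls w ≡ q
        out' w ne = ==-≡ (h w (not-f (trans (cong (not (S w) ∧_) (==-≢ ne)) (Bool.∧-zeroʳ _))))
        absurd : L a ≡ L u ⊎ L a ≢ L u → ⊥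
        absurd (inj₂ ne) = x≢y (fewA x y x∈S y∈S (trans (out x x∈S) (sym (out' a ne))) (trans (out y y∈S) (sym (out' a ne))))
        absurd (inj₁ r) = let ne = λ r' → La≢Lb (trans r (sym r')) in
          x≢y (fewB x y x∈S y∈S (trans (out x x∈S) (sym (out' b ne))) (trans (out y y∈S) (sym (out' b ne))))

    Closed : VSet n → Set
    Closed Q = ∀ {u v} → cls u ≡ cls v → Q u ≡ Q v

    bd : VSet n → ℕ
    bd Q = E (S ∩ Q) (∁ Q)

    -- Bookkeeping in a union `Q` of classes with three cut edges. It has `s` barrier vertices and
    -- `c` parts; `φ` and `m` count edges within `S ∩ Q` and from there to parts in `Q`, `x'` and
    -- `y'` the cut edges starting in `S` and outside `S`, and `ε` the edges between two parts.
    -- Inner edges are counted in both directions in `φ` and `ε`.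
    module Count (Q : VSet n) (cl : Closed Q) (sQ : Shore Q) where
      rep : VSet n
      rep ℓ = not (S ℓ) ∧ (Q ℓ ∧ (L ℓ == ℓ))
      s c φ x' y' ε m : ℕ
      s = # (S ∩ Q)
      c = # rep
      φ = E (S ∩ Q) (S ∩ Q)
      x' = bd Q
      y' = E (Q ∖ S) (∁ Q)
      m = E (S ∩ Q) (Q ∖ S)
      εR : Fin n → Fin n → Bool
      εR u v = (Q u ∧ not (S u)) ∧ ((Q v ∧ not (S v)) ∧ (not (L u == L v) ∧ G u v))
      ε = ∑₂ (λ u v → ι (εR u v))

      Q-L : ∀ {v} → S v ≡ false → Q (L v) ≡ Q v
      Q-L {v} sv = cl (unite (L-out v sv) sv (L-idem v sv))

      xy : x' + y' ≡ 3
      xy = trans (cong₂ _+_ (E-sym (S ∩ Q) (∁ Q)) (E-sym (Q ∖ S) (∁ Q))) (trans (sym (E-split (∁ Q) Q (S ∩ Q) (Q ∖ S)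
          (λ v → bool≡ (Q v ∷ S v ∷ []) (λ { (q ∷ s ∷ []) → ι q }) (λ { (q ∷ s ∷ []) → ι (s ∧ q) + ι (q ∧ not s) })))) (trans (E-sym (∁ Q) Q) sQ))

      count-s : 3 * s ≡ φ + m + x'
      count-s = trans (sym (E-all (S ∩ Q))) (trans (E-∁ (S ∩ Q) Q) (cong (_+ x')
        (E-split (S ∩ Q) Q (S ∩ Q) (Q ∖ S) (λ v → bool≡ (Q v ∷ S v ∷ []) (λ { (q ∷ s ∷ []) → ι q }) (λ { (q ∷ s ∷ []) → ι (s ∧ q) + ι (q ∧ not s) })))))

      -- Each part in `Q` has three cut edges, which lead to `S ∩ Q`, out of `Q`, or to another part
      -- in `Q`.
      count-c : 3 * c ≡ m + y' + ε
      count-c = trans (*-distrib-sum 3 (λ ℓ → ι (rep ℓ))) (trans (sym (trans (fibre L g) (sum-cong per)))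
          (trans (∑₂-cong pt) (trans (∑₂-+ (λ u v → ι ((Q ∖ S) u ∧ ((S ∩ Q) v ∧ G u v)) + ι ((Q ∖ S) u ∧ (∁ Q v ∧ G u v))) (λ u v → ι (εR u v)))
            (cong (_+ ε) (trans (∑₂-+ (λ u v → ι ((Q ∖ S) u ∧ ((S ∩ Q) v ∧ G u v))) _) (cong (_+ y') (E-sym (Q ∖ S) (S ∩ Q))))))))
        where
        K = part S L
        h : Fin n → Fin n → ℕ
        h u v = ι ((Q ∖ S) u ∧ (not (K (L u) v) ∧ G u v))
        g : Fin n → ℕ
        g u = sum (h u)
        pt : ∀ u v → h u v ≡ ι ((Q ∖ S) u ∧ ((S ∩ Q) v ∧ G u v)) + ι ((Q ∖ S) u ∧ (∁ Q v ∧ G u v)) + ι (εR u v)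
        pt u v with S u in su | Q u in qu | G u v
        ... | true | true | _ = refl
        ... | true | false | _ = refl
        ... | false | false | _ = refl
        ... | false | true | false = bool≡ (S v ∷ Q v ∷ (L u == L v) ∷ (L v == L u) ∷ [])
                (λ { (s ∷ q ∷ l ∷ l' ∷ []) → ι (not (not s ∧ l') ∧ false) }) (λ { (s ∷ q ∷ l ∷ l' ∷ []) → ι ((s ∧ q) ∧ false) + ι (not q ∧ false) + ι ((q ∧ not s) ∧ (not l ∧ false)) })
        ... | false | true | true with S v in sv | Q v in qv | L v ≟ L u
        ...   | true | true | _ = refl
        ...   | true | false | _ = refl
        ...   | false | true | yes e rewrite e | ==-refl (L u) = refl
        ...   | false | true | no ne rewrite ==-≢ (ne ∘ sym) = refl
        ...   | false | false | yes e = ⊥-elim (true≢false (trans (cl (sym (unite su sv (sym e)))) qu) qv)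
        ...   | false | false | no ne = refl
        per : ∀ ℓ → sum (λ u → ι (L u == ℓ) * g u) ≡ 3 * ι (rep ℓ)
        per ℓ with rep ℓ in r
        ... | true = trans (sum-cong λ u → trans (*-distrib-sum (ι (L u == ℓ)) (h u)) (sum-cong (λ v → same u v))) (subst (λ w → ∂ (K w) ≡ 3) Lℓ (part-shore ℓ Sℓ))
          where
          Lℓ : L ℓ ≡ ℓ
          Lℓ = ==-≡ (∧-r {Q ℓ} (∧-r {not (S ℓ)} r))
          Sℓ : S ℓ ≡ false
          Sℓ = not-t (∧-l r)
          same : ∀ u v → ι (L u == ℓ) * h u v ≡ ι (K ℓ u ∧ (not (K ℓ v) ∧ G u v))
          same u v with same? (L u) ℓ
          ... | inj₂ ne rewrite ==-≢ ne | Bool.∧-zeroʳ (not (S u)) = refl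
          ... | inj₁ e rewrite e | ==-refl ℓ with S u in su
          ...   | true rewrite Bool.∧-zeroʳ (Q u) = refl
          ...   | false rewrite trans (cl {u} {ℓ} (unite su Sℓ (trans e (sym Lℓ)))) (∧-l (∧-r {not (S ℓ)} r)) = +-identityʳ _
        ... | false = trans (sum-cong λ u → zero' u) (sum-0 n)
          where
          zero' : ∀ u → ι (L u == ℓ) * g u ≡ 0
          zero' u with same? (L u) ℓ
          ... | inj₂ ne rewrite ==-≢ ne = refl
          ... | inj₁ refl = trans (cong (ι (L u == L u) *_) (trans (sum-cong (λ v → none v)) (sum-0 n))) (*-zeroʳ (ι (L u == L u)))
            where
            none : ∀ v → h u v ≡ 0
            none v = ι-false (¬true λ t → let qs = ∧-l t ; su = not-t (∧-r {Q u} qs) in true≢false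
              (∧-i (not-f (L-out u su)) (∧-i (trans (Q-L su) (∧-l qs)) (trans (cong (_== L u) (L-idem u su)) (==-refl (L u))))) r)

      ε-0 : (Q a ≡ true → Q b ≡ true → ⊥) → ε ≡ 0
      ε-0 h = trans (∑₂-cong (λ u v → ι-false (¬true (bad u v)))) (trans (sum-cong (λ _ → sum-0 n)) (sum-0 n))
        where
        bad : ∀ u v → εR u v ≡ true → ⊥
        bad u v t with respects u v (not-t (∧-r {Q u} (∧-l t))) (not-t (∧-r {Q v} (∧-l (∧-r {Q u ∧ not (S u)} t)))) (∧-r {not (L u == L v)} (∧-r {Q v ∧ not (S v)} (∧-r {Q u ∧ not (S u)} t)))
        ... | inj₁ e = ==-≡f (not-t (∧-l (∧-r {Q v ∧ not (S v)} (∧-r {Q u ∧ not (S u)} t)))) e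
        ... | inj₂ e with isE-e {u = a} {b} {u} {v} e
        ...   | inj₁ (refl , refl) = h (∧-l (∧-l t)) (∧-l (∧-l (∧-r {Q u ∧ not (S u)} t)))
        ...   | inj₂ (refl , refl) = h (∧-l (∧-l (∧-r {Q u ∧ not (S u)} t))) (∧-l (∧-l t))

      ε-2 : G a b ≡ true → Q a ≡ true → Q b ≡ true → ε ≡ 2
      ε-2 gab qa qb = ≤-antisym (≤-trans (∑₂-mono {g = λ u v → δ a b u v + δ b a u v} pt) (≤r (trans (∑₂-+ (δ a b) (δ b a)) (cong₂ _+_ (∑₂-δ a b) (∑₂-δ b a)))))
        (two-pairs εR (∧-i (∧-i qa (not-f a∉S)) (∧-i (∧-i qb (not-f b∉S)) (∧-i (not-f (==-≢ La≢Lb)) gab)))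
          (∧-i (∧-i qb (not-f b∉S)) (∧-i (∧-i qa (not-f a∉S)) (∧-i (not-f (==-≢ (La≢Lb ∘ sym))) (flipG gab)))) (λ e _ → G≢ gab e))
        where
        pt : ∀ u v → ι (εR u v) ≤ δ a b u v + δ b a u v
        pt u v = ι-≤ λ t → case respects u v (not-t (∧-r {Q u} (∧-l t))) (not-t (∧-r {Q v} (∧-l (∧-r {Q u ∧ not (S u)} t)))) (∧-r {not (L u == L v)} (∧-r {Q v ∧ not (S v)} (∧-r {Q u ∧ not (S u)} t))) of λ
          { (inj₁ e) → ⊥-elim (==-≡f (not-t (∧-l (∧-r {Q v ∧ not (S v)} (∧-r {Q u ∧ not (S u)} t)))) e)
          ; (inj₂ e) → case isE-e {u = a} {b} {u} {v} e of λ
            { (inj₁ (refl , refl)) → ≤-trans (≤r (sym (δ-refl u v))) (m≤m+n _ _)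
            ; (inj₂ (refl , refl)) → ≤-trans (≤r (sym (δ-refl u v))) (m≤n+m _ (δ v u u v)) } }

      φ≤2 : φ ≤ 2
      φ≤2 = ≤-trans (E-mono {S ∩ Q} {S ∩ Q} {S} {S} (λ v h → ∧-l h) (λ v h → ∧-l h)) (≤r ESS)

      -- A shore with all its cut edges at S is a trivial one: S ∩ Q would be a barrier otherwise.
      full : (Q a ≡ true → Q b ≡ true → ⊥) → y' ≡ 0 → s ≡ suc c → s ≤ 1
      full nab y0 sc = ≮⇒≥ λ two → no-barrier S' L' resp' two (≤-trans (≤r sc) enough)
        where
        S' = S ∩ Q
        -- The label of everything outside `Q`: it makes `∁ Q` one more odd part, which raises their
        -- number from `c` to `s`.
        ℓ₀ = proj₁ (shore-co {Q} sQ)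
        Qℓ₀ = proj₂ (shore-co {Q} sQ)
        L' : Fin n → Fin n
        L' v = if Q v then L v else ℓ₀
        resp' : Respects S' L'
        resp' u v su sv g with Q u in qu | Q v in qv
        ... | false | false = refl
        ... | true | false = ⊥-elim (E-none (Q ∖ S) (∁ Q) y0 (∧-i qu (not-f (trans (sym (Bool.∧-identityʳ _)) su))) (not-f qv) g)
        ... | false | true = ⊥-elim (E-none (Q ∖ S) (∁ Q) y0 (∧-i qv (not-f (trans (sym (Bool.∧-identityʳ _)) sv))) (not-f qu) (flipG g))
        ... | true | true with respects u v (trans (sym (Bool.∧-identityʳ _)) su) (trans (sym (Bool.∧-identityʳ _)) sv) g
        ...   | inj₁ e = e
        ...   | inj₂ e with isE-e {u = a} {b} {u} {v} e
        ...     | inj₁ (refl , refl) = ⊥-elim (nab qu qv)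
        ...     | inj₂ (refl , refl) = ⊥-elim (nab qv qu)
        odd' : VSet n
        odd' ℓ = oddᵇ (# (part S' L' ℓ))
        rep-odd : ∀ ℓ → rep ℓ ≡ true → odd' ℓ ≡ true
        rep-odd ℓ r = oddᵇ-odd (subst Odd (#-cong eq) (shore-odd {part S L ℓ} (subst (λ w → Shore (part S L w)) Lℓ (part-shore ℓ Sℓ))))
          where
          Lℓ : L ℓ ≡ ℓ
          Lℓ = ==-≡ (∧-r {Q ℓ} (∧-r {not (S ℓ)} r))
          Sℓ : S ℓ ≡ false
          Sℓ = not-t (∧-l r)
          Qℓ : Q ℓ ≡ true
          Qℓ = ∧-l (∧-r {not (S ℓ)} r)
          eq : ∀ v → part S L ℓ v ≡ part S' L' ℓ v
          eq v with Q v in qv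
          ... | true rewrite Bool.∧-identityʳ (S v) = refl
          ... | false rewrite Bool.∧-zeroʳ (S v) | ==-≢ {i = ℓ₀} {ℓ} (λ { refl → true≢false Qℓ Qℓ₀ }) = ¬true λ t →
                true≢false (trans (cl (unite {v} {ℓ} (not-t (∧-l t)) Sℓ (trans (==-≡ (∧-r {not (S v)} t)) (sym Lℓ)))) Qℓ) qv
        co-odd : odd' ℓ₀ ≡ true
        co-odd = oddᵇ-odd (subst Odd (#-cong eq) (shore-odd {∁ Q} (trans (∂-∁ Q) sQ)))
          where
          eq : ∀ v → ∁ Q v ≡ part S' L' ℓ₀ v
          eq v with Q v in qv
          ... | false rewrite Bool.∧-zeroʳ (S v) = sym (==-refl ℓ₀)
          ... | true rewrite Bool.∧-identityʳ (S v) with S v in sv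
          ...   | true = refl
          ...   | false = sym (==-≢ λ e → true≢false (trans (cong Q (sym e)) (trans (Q-L sv) qv)) Qℓ₀)
        enough : suc c ≤ # odd'
        enough = ≤-trans (s≤s (#-mono {P = rep} {odd' ─ ℓ₀} λ ℓ r → ∧-i (rep-odd ℓ r)
            (not-f (==-≢ λ { refl → true≢false (∧-l (∧-r {not (S ℓ)} r)) Qℓ₀ })))) (≤r (sym (#-─ odd' ℓ₀ co-odd)))

      -- Named after the number of cut edges of `Q` that start in `S`: with 0 it behaves like a
      -- part, with 2 it contains `x y`, with 3 it is a single barrier vertex.
      data Type : Set where
        type0 : bd Q ≡ 0 → φ ≡ 0 → Type
        type2 : bd Q ≡ 2 → y' ≡ 1 → Q x ≡ true → Q y ≡ true → Type
        type3 : bd Q ≡ 3 → (∀ v w → Q v ≡ true → Q w ≡ true → v ≡ w) → (∀ v → Q v ≡ true → S v ≡ true) → Type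

      -- Counting the edges at S ∩ Q and at the parts inside Q; taken modulo 3 this determines x'.
      balance : φ + x' + 3 * c ≡ 3 * s + y' + ε
      balance = trans (cong (φ + x' +_) count-c) (trans (lemma φ x' m y' ε) (sym (cong (λ z → z + y' + ε) count-s)))
        where
        lemma : ∀ f x m y e → f + x + (m + y + e) ≡ f + m + x + y + e
        lemma f x m y e = linear (f ∷ x ∷ m ∷ y ∷ e ∷ []) (x0 ⊕ x1 ⊕ (x2 ⊕ x3 ⊕ x4)) (x0 ⊕ x2 ⊕ x1 ⊕ x3 ⊕ x4)

      φ-cases : φ ≡ 0 ⊎ φ ≡ 2
      φ-cases = go φ φ≤2 (E-self-even (S ∩ Q))
        where
        go : ∀ k → k ≤ 2 → Even k → k ≡ 0 ⊎ k ≡ 2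
        go 0 _ _ = inj₁ refl
        go 1 _ ev = ⊥-elim (¬even-odd ev (even 1))
        go 2 _ _ = inj₂ refl
        go (suc (suc (suc _))) (s≤s (s≤s ())) _

      solve : ∀ f x y c s → f ≡ 0 ⊎ f ≡ 2 → x + y ≡ 3 → f + x + 3 * c ≡ 3 * s + y →
        (f ≡ 0 × x ≡ 0) ⊎ (f ≡ 2 × x ≡ 2 × y ≡ 1) ⊎ (x ≡ 3 × y ≡ 0 × s ≡ suc c)
      solve f 0 y c s (inj₁ refl) refl e = inj₁ (refl , refl)
      solve f 1 y c s (inj₁ refl) refl e = ⊥-elim (mod3-1 c s (suc-injective (trans e (+-comm (3 * s) 2))))
      solve f 2 y c s (inj₁ refl) refl e = ⊥-elim (mod3-1 s c (sym (suc-injective (trans e (+-comm (3 * s) 1)))))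
      solve f 3 y c s (inj₁ refl) refl e = inj₂ (inj₂ (refl , refl , *-cancelˡ-≡ s (suc c) 3 (trans (sym (trans e (+-identityʳ _))) (sym (*-suc 3 c)))))
      solve f 0 y c s (inj₂ refl) refl e = ⊥-elim (mod3-1 c s (suc-injective (suc-injective (trans e (+-comm (3 * s) 3)))))
      solve f 1 y c s (inj₂ refl) refl e = ⊥-elim (mod3-1 s c (sym (suc-injective (suc-injective (trans e (+-comm (3 * s) 2))))))
      solve f 2 y c s (inj₂ refl) refl e = inj₂ (inj₁ (refl , refl , refl))
      solve f 3 y c s (inj₂ refl) refl e = ⊥-elim (mod3-2 s (suc c) (trans (sym (trans e (+-identityʳ _))) (cong (λ z → suc (suc z)) (sym (*-suc 3 c)))))
      solve f (suc (suc (suc (suc _)))) y c s h () e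

      opaque
        type : (Q a ≡ true → Q b ≡ true → ⊥) → Type
        type nab with solve φ x' y' c s φ-cases xy (trans balance (trans (cong (3 * s + y' +_) (ε-0 nab)) (+-identityʳ _)))
        ... | inj₁ (f , e) = type0 e f
        ... | inj₂ (inj₁ (f , e , e')) with E-∃ (S ∩ Q) (S ∩ Q) (≤-trans (s≤s z≤n) (≤r (sym f)))
        ...   | u , v , su , sv , g with isE-e {u = x} {y} {u} {v} (SS-edge (∧-l su) (∧-l sv) g)
        ...     | inj₁ (refl , refl) = type2 e e' (∧-r {S u} su) (∧-r {S v} sv)
        ...     | inj₂ (refl , refl) = type2 e e' (∧-r {S v} sv) (∧-r {S u} su)
        type nab | inj₂ (inj₂ (e , e' , sc)) = type3 e
            (λ v w qv qw → #≤1-unique (S ∩ Q) s≤1 (∧-i (inS v qv) qv) (∧-i (inS w qw) qw)) inS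
          where
          s≤1 : s ≤ 1
          s≤1 = full nab e' sc
          inS : ∀ v → Q v ≡ true → S v ≡ true
          inS v qv = ¬false λ sv → refute (s ∷ c ∷ []) ((1 , x0 , con 1) ∷ (1 , con 1 ⊕ x1 , x0) ∷ (1 , con 1 , x1) ∷ [])
            (s≤1 , ≥r sc , #≥1 rep (L v) (∧-i (not-f (L-out v sv)) (∧-i (trans (Q-L sv) qv) (trans (cong (_== L v) (L-idem v sv)) (==-refl (L v))))) , tt)

      -- With `a b` inside `Q` the term `ε` is 2, which moves `x'` from residue 0 to residue 1
      -- modulo three.
      type-T : G a b ≡ true → Q a ≡ true → Q b ≡ true → φ ≡ 0 → x' ≡ 1
      type-T gab qa qb f = go x' y' c s xy (trans (cong (λ z → z + x' + 3 * c) (sym f)) (trans balance (cong (3 * s + y' +_) (ε-2 gab qa qb))))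
        where
        go : ∀ x y c s → x + y ≡ 3 → x + 3 * c ≡ 3 * s + y + 2 → x ≡ 1
        go 0 y c s refl e = ⊥-elim (mod3-2 c (suc s) (trans e (linear (s ∷ []) (3 ⊗ x0 ⊕ con 3 ⊕ con 2) (con 2 ⊕ 3 ⊗ (con 1 ⊕ x0)))))
        go 1 y c s refl e = refl
        go 2 y c s refl e = ⊥-elim (mod3-2 (suc s) c (sym (trans e (linear (s ∷ []) (3 ⊗ x0 ⊕ con 1 ⊕ con 2) (3 ⊗ (con 1 ⊕ x0))))))
        go 3 y c s refl e = ⊥-elim (mod3-1 s c (sym (suc-injective (suc-injective (trans e (linear (s ∷ []) (3 ⊗ x0 ⊕ con 0 ⊕ con 2) (con 2 ⊕ 3 ⊗ x0)))))))
        go (suc (suc (suc (suc _)))) y c s () e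

    Cl-closed : ∀ q → Closed (Cl q)
    Cl-closed q e = cong (_== q) e

    Cl-self : ∀ v → Cl (cls v) v ≡ true
    Cl-self v = ==-refl (cls v)

    Cl-in : ∀ {q v} → cls v ≡ q → Cl q v ≡ true
    Cl-in {v = v} refl = Cl-self v

    module At (v : Fin n) = Count (Cl (cls v)) (Cl-closed (cls v)) (shore v)

    opaque
      -- A class is coloured by the side of the barrier that holds most ends of its three cut edges.
      κ : VSet n
      κ v = bd (Cl (cls v)) ≤ᵇ 1

      κ-≡ : ∀ {v w} → cls v ≡ cls w → κ v ≡ κ w
      κ-≡ e = cong (λ q → bd (Cl q) ≤ᵇ 1) e

      κ-cls : ∀ v → κ v ≡ κ (cls v)
      κ-cls v = κ-≡ (sym (cls-idem v))

      κ-bd : ∀ {v k} → bd (Cl (cls v)) ≡ k → κ v ≡ (k ≤ᵇ 1)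
      κ-bd e = cong (_≤ᵇ 1) e

    Other : Fin n → Set
    Other v = cls a ≡ cls v → cls b ≡ cls v → ⊥

    typ : ∀ v → Other v → At.Type v
    typ v o = At.type v (λ p q → o (==-≡ p) (==-≡ q))

    bd-S : ∀ {v w} → S v ≡ true → G v w ≡ true → cls v ≢ cls w → 1 ≤ bd (Cl (cls v))
    bd-S {v} {w} sv g ne = E-edge (S ∩ Cl (cls v)) (∁ (Cl (cls v))) (∧-i sv (Cl-self v)) (not-f (==-≢ (ne ∘ sym))) g

    κ-S : ∀ {v w} → Other v → S v ≡ true → G v w ≡ true → cls v ≢ cls w → κ v ≡ false
    κ-S {v} o sv g ne with typ v o
    ... | Count.type0 e _ = ⊥-elim (<-irrefl refl (≤-trans (bd-S sv g ne) (≤r e)))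
    ... | Count.type2 e _ _ _ = κ-bd {v} e
    ... | Count.type3 e _ _ = κ-bd {v} e

    κ-out : ∀ {v w} → Other v → κ v ≡ true → G v w ≡ true → cls v ≢ cls w → S v ≡ false
    κ-out o k g ne = ¬true λ sv → true≢false k (κ-S o sv g ne)

    CC-edge : ∀ {s t} → S s ≡ false → S t ≡ false → G s t ≡ true → cls s ≢ cls t → isE a b s t ≡ true
    CC-edge {s} {t} ss st g ne with respects s t ss st g
    ... | inj₁ e = ⊥-elim (ne (unite ss st e))
    ... | inj₂ e = e

    false-class : ∀ v → Other v → κ v ≡ false → (At.y' v ≡ 1 × cls x ≡ cls v × cls y ≡ cls v) ⊎ (Single v × S v ≡ true)
    false-class v o k with typ v o
    ... | Count.type0 e _ = ⊥-elim (true≢false (κ-bd {v} e) k)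
    ... | Count.type2 _ e qx qy = inj₁ (e , ==-≡ qx , ==-≡ qy)
    ... | Count.type3 e u inS = inj₂ ((λ w e → u w v (Cl-in e) (Cl-self v)) , inS v (Cl-self v))

    cut-pair : ∀ {v} → At.y' v ≡ 1 → ∀ {s t s' t'} → cls s ≡ cls v → cls s' ≡ cls v → S s ≡ false → S s' ≡ false →
      G s t ≡ true → G s' t' ≡ true → cls t ≢ cls v → cls t' ≢ cls v → s ≡ s' × t ≡ t'
    cut-pair {v} e p p' ss ss' g g' q q' = unique-pair (λ s t → (Cl (cls v) ∖ S) s ∧ (∁ (Cl (cls v)) t ∧ G s t)) (≤r e)
      (∧-i (∧-i (Cl-in p) (not-f ss)) (∧-i (not-f (==-≢ q)) g)) (∧-i (∧-i (Cl-in p') (not-f ss')) (∧-i (not-f (==-≢ q')) g'))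

    mono-e : ∀ {s t} → mono κ s t ≡ true → G s t ≡ true × cls s ≢ cls t × ((κ s ≡ true × κ t ≡ true) ⊎ (κ s ≡ false × κ t ≡ false))
    mono-e {s} {t} h = ∧-l h , ==-≡f (not-t (∧-l (∧-r {G s t} h))) , (case ∨-e {κ s ∧ κ t} (∧-r {not (cls s == cls t)} (∧-r {G s t} h)) of λ
      { (inj₁ p) → inj₁ (∧-l p , ∧-r {κ s} p) ; (inj₂ p) → inj₂ (not-t (∧-l p) , not-t (∧-r {not (κ s)} p)) })

    mono-i : ∀ {s t β} → G s t ≡ true → cls s ≢ cls t → κ s ≡ β → κ t ≡ β → mono κ s t ≡ true
    mono-i {s} {t} {true} g ne p q = ∧-i g (∧-i (not-f (==-≢ ne)) (∨-l (∧-i p q)))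
    mono-i {s} {t} {false} g ne p q = ∧-i g (∧-i (not-f (==-≢ ne)) (∨-r {κ s ∧ κ t} (∧-i (not-f p) (not-f q))))

    -- The second edge of the doubleton. It is `x y` itself if this joins two classes; otherwise it
    -- is the one cut edge that leaves the class of `x` and `y` from a vertex outside `S`.
    record FalseEdge : Set where
      field
        c d : Fin n
        Gcd : G c d ≡ true
        cross : cls c ≢ cls d
        κc : κ c ≡ false
        d∈S : S d ≡ true
        unique : ∀ s t → G s t ≡ true → cls s ≢ cls t → κ s ≡ false → κ t ≡ false → isE c d s t ≡ true

    opaque
      false-edge : (∀ v → κ v ≡ false → Other v) → Other x → FalseEdge
      false-edge other ox with same? (cls x) (cls y)
      ... | inj₂ ne = record { c = x ; d = y ; Gcd = Gxy ; cross = ne ; κc = κ-S ox x∈S Gxy ne ; d∈S = y∈S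
          ; unique = λ s t g cr ks kt → SS-edge (inS s ks) (inS t kt) g }
        where
        inS : ∀ s → κ s ≡ false → S s ≡ true
        inS s ks with false-class s (other s ks) ks
        ... | inj₁ (_ , p , q) = ⊥-elim (ne (trans p (sym q)))
        ... | inj₂ (_ , h) = h
      ... | inj₁ xy = go (typ x ox)
        where
        go : At.Type x → FalseEdge
        go (Count.type0 _ f) = ⊥-elim (E-none (S ∩ Cl (cls x)) (S ∩ Cl (cls x)) f (∧-i x∈S (Cl-self x)) (∧-i y∈S (Cl-in (sym xy))) Gxy)
        go (Count.type3 _ u _) = ⊥-elim (x≢y (u x y (Cl-self x) (Cl-in (sym xy))))
        go (Count.type2 e e' _ _) with E-∃ (Cl (cls x) ∖ S) (∁ (Cl (cls x))) (≤r (sym e'))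
        ... | u₀ , v₀ , hu , hv , g = record { c = u₀ ; d = v₀ ; Gcd = g ; cross = λ r → v₀∉ (trans (sym r) u₀∈)
              ; κc = trans (κ-≡ u₀∈) (κ-bd {x} e) ; d∈S = ¬false v₀∈S ; unique = uniq }
          where
          u₀∈ : cls u₀ ≡ cls x
          u₀∈ = ==-≡ (∧-l hu)
          u₀∉S : S u₀ ≡ false
          u₀∉S = not-t (∧-r {Cl (cls x) u₀} hu)
          v₀∉ : cls v₀ ≢ cls x
          v₀∉ = ==-≡f (not-t hv)
          v₀∈S : S v₀ ≢ false
          v₀∈S f with isE-e {u = a} {b} {u₀} {v₀} (CC-edge u₀∉S f g (λ r → v₀∉ (trans (sym r) u₀∈)))
          ... | inj₁ (refl , _) = x≢y (fewA x y x∈S y∈S (sym u₀∈) (trans (sym xy) (sym u₀∈)))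
          ... | inj₂ (_ , refl) = x≢y (fewB x y x∈S y∈S (sym u₀∈) (trans (sym xy) (sym u₀∈)))
          at : ∀ s t → G s t ≡ true → cls s ≢ cls t → κ s ≡ false → S s ≡ false → s ≡ u₀ × t ≡ v₀
          at s t g' ne ks ss with false-class s (other s ks) ks
          ... | inj₂ (_ , h) = ⊥-elim (true≢false h ss)
          ... | inj₁ (_ , p , _) = cut-pair {x} e' (sym p) u₀∈ ss u₀∉S g' g (λ r → ne (trans (sym p) (sym r))) v₀∉
          uniq : ∀ s t → G s t ≡ true → cls s ≢ cls t → κ s ≡ false → κ t ≡ false → isE u₀ v₀ s t ≡ true
          uniq s t g' ne ks kt with bool? (S s) | bool? (S t)
          ... | inj₂ ss | _ = let (p , q) = at s t g' ne ks ss in subst₂ (λ u v → isE u₀ v₀ u v ≡ true) (sym p) (sym q) (isE-1 u₀ v₀)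
          ... | inj₁ _ | inj₂ st = let (p , q) = at t s (flipG g') (ne ∘ sym) kt st in subst₂ (λ u v → isE u₀ v₀ u v ≡ true) (sym q) (sym p) (isE-2 u₀ v₀)
          ... | inj₁ ss | inj₁ st with isE-e {u = x} {y} {s} {t} (SS-edge ss st g')
          ...   | inj₁ (refl , refl) = ⊥-elim (ne xy)
          ...   | inj₂ (refl , refl) = ⊥-elim (ne (sym xy))

    -- A nontrivial class with the colour of `S` has type 2 and hence contains the edge `x y`.
    at-most-one : (∀ v → κ v ≡ false → Other v) → ∀ v w → κ v ≡ false → κ w ≡ false → ¬ Single v → ¬ Single w → cls v ≡ cls w
    at-most-one other v w kv kw nv nw with false-class v (other v kv) kv | false-class w (other w kw) kw
    ... | inj₁ (_ , p , _) | inj₁ (_ , q , _) = trans (sym p) q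
    ... | inj₂ (s , _) | _ = ⊥-elim (nv s)
    ... | inj₁ _ | inj₂ (s , _) = ⊥-elim (nw s)

  module _ (P : Piece) where
    open Piece P

    AtMostOne : VSet n → Set
    AtMostOne κ = ∀ v w → κ v ≡ false → κ w ≡ false → ¬ Single v → ¬ Single w → cls v ≡ cls w

    record KillR (a b : Fin n) : Set where
      field
        κ : VSet n
        c d : Fin n
        dbl : Dbl κ a b c d
        κa : κ a ≡ true
        κc : κ c ≡ false
        unique : AtMostOne κ

    opaque
      -- Two classes coloured as parts can only be joined by an edge between distinct parts, that
      -- is, by `a b`. The edge with both ends coloured like `S` comes from `false-edge`.
      killR : ∀ {a b} → G a b ≡ true → Cert a b → Single a → Single b → KillR a b
      killR {a} {b} gab C singleA singleB = build (false-edge (λ v _ → other v) (other x))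
        where
        open Cert C
        open Kill P C (λ s t ss _ e _ → ⊥-elim (true≢false (subst (λ w → S w ≡ true) (singleA s e) ss) a∉S))
                      (λ s t ss _ e _ → ⊥-elim (true≢false (subst (λ w → S w ≡ true) (singleB s e) ss) b∉S))
        ab-cross : cls a ≢ cls b
        ab-cross e = G≢ gab (singleB a e)
        other : ∀ v → Other v
        other v p q = ab-cross (trans p (sym q))
        κ-end : ∀ v → S v ≡ false → (∀ w → cls w ≡ cls v → w ≡ v) → κ v ≡ true
        κ-end v sv single = ¬false λ k → case false-class v (other v) k of λ
          { (inj₁ (_ , p , _)) → true≢false (subst (λ w → S w ≡ true) (single x p) x∈S) sv
          ; (inj₂ (_ , h)) → true≢false h sv }
        κa : κ a ≡ true
        κa = κ-end a a∉S singleA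
        build : FalseEdge → KillR a b
        build F = record { κ = κ ; c = c ; d = d ; dbl = (λ s t → bool-iff (fwd s t) (bwd s t)) , κ-cls , (λ e → true≢false κa (trans e κc))
            ; κa = κa ; κc = κc ; unique = at-most-one (λ v _ → other v) }
          where
          open FalseEdge F
          κd : κ d ≡ false
          κd = κ-S (other d) d∈S (flipG Gcd) (cross ∘ sym)
          fwd : ∀ s t → mono κ s t ≡ true → isE a b s t ∨ isE c d s t ≡ true
          fwd s t h with mono-e {s} {t} h
          ... | g , ne , inj₁ (ks , kt) = ∨-l (CC-edge (κ-out (other s) ks g ne) (κ-out (other t) kt (flipG g) (ne ∘ sym)) g ne)
          ... | g , ne , inj₂ (ks , kt) = ∨-r {isE a b s t} (unique s t g ne ks kt)
          bwd : ∀ s t → isE a b s t ∨ isE c d s t ≡ true → mono κ s t ≡ true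
          bwd s t h with ∨-e {isE a b s t} h
          ... | inj₁ e with isE-e {u = a} {b} {s} {t} e
          ...   | inj₁ (refl , refl) = mono-i gab ab-cross κa (κ-end b b∉S singleB)
          ...   | inj₂ (refl , refl) = mono-i (flipG gab) (ab-cross ∘ sym) (κ-end b b∉S singleB) κa
          bwd s t h | inj₂ e with isE-e {u = c} {d} {s} {t} e
          ...   | inj₁ (refl , refl) = mono-i Gcd cross κc κd
          ...   | inj₂ (refl , refl) = mono-i (flipG Gcd) (cross ∘ sym) κd κc

    -- The class of `a` is a triangle with outer neighbours `ta`, `tb`, `t₃`. The vertices `p` and
    -- `q` witness that its complement is not a single vertex, which excludes type 3 there.
    record Tri (a b w₃ ta tb t₃ : Fin n) : Set where
      field
        gab : G a b ≡ true
        ab : cls b ≡ cls a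
        aw : cls w₃ ≡ cls a
        only : ∀ v → cls v ≡ cls a → v ≡ a ⊎ v ≡ b ⊎ v ≡ w₃
        gta : G a ta ≡ true
        gtb : G b tb ≡ true
        gt₃ : G w₃ t₃ ≡ true
        ta∉ : cls ta ≢ cls a
        tb∉ : cls tb ≢ cls a
        t₃∉ : cls t₃ ≢ cls a
        only₃ : ∀ t → G w₃ t ≡ true → cls t ≢ cls a → t ≡ t₃
        p q : Fin n
        p≢q : p ≢ q
        p∉ : cls p ≢ cls a
        q∉ : cls q ≢ cls a

    record KillT (w₃ ta tb t₃ : Fin n) : Set where
      field
        κ : VSet n
        unique : AtMostOne κ
        κta : κ ta ≡ false
        κtb : κ tb ≡ false
        outcome : (∃ λ c → ∃ λ d → Dbl κ w₃ t₃ c d) ⊎ (Bip κ × κ t₃ ≡ false × ¬ Single t₃)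

    opaque
      -- Inside the triangle `a` and `b` belong to different parts, and `w₃`, `ta`, `tb` to `S`,
      -- while `t₃` does not. The colour of `t₃` decides: either `w₃ t₃` takes the place of `a b` in
      -- a doubleton, or it is the exceptional cut edge of a class of type 2, and no monochromatic
      -- edge remains.
      killT : ∀ {a b w₃ ta tb t₃} → Tri a b w₃ ta tb t₃ → Cert a b → KillT w₃ ta tb t₃
      killT {a} {b} {w₃} {ta} {tb} {t₃} T C = record { κ = κ ; unique = at-most-one falseOther
          ; κta = κ-S ta-other ta∈S (flipG gta) ta∉ ; κtb = κ-S tb-other tb∈S (flipG gtb) (λ e → tb∉ (trans e ab)) ; outcome = result (false-edge falseOther (other (proj₂ W-type))) }
        where
        open Cert C
        open Tri T
        inZ-S : ∀ s → S s ≡ true → cls s ≡ cls a → s ≡ w₃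
        inZ-S s ss e with only s e
        ... | inj₁ refl = ⊥-elim (true≢false ss a∉S)
        ... | inj₂ (inj₁ refl) = ⊥-elim (true≢false ss b∉S)
        ... | inj₂ (inj₂ r) = r
        open Kill P C (λ s t ss st e e' → trans (inZ-S s ss e) (sym (inZ-S t st e')))
                      (λ s t ss st e e' → trans (inZ-S s ss (trans e ab)) (sym (inZ-S t st (trans e' ab))))
        Z W : VSet n
        Z = Cl (cls a)
        W = ∁ Z
        W-closed : Closed W
        W-closed e = cong (λ q → not (q == cls a)) e
        W-shore : Shore W
        W-shore = trans (∂-∁ Z) (shore a)
        bdZ : bd Z ≡ 1
        bdZ = At.type-T a gab (Cl-self a) (Cl-in ab) (E-0 (S ∩ Z) (S ∩ Z) λ u v hu hv g →
          G≢ g (trans (inZ-S u (∧-l hu) (==-≡ (∧-r {S u} hu))) (sym (inZ-S v (∧-l hv) (==-≡ (∧-r {S v} hv))))))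
        w₃∈S : S w₃ ≡ true
        w₃∈S with E-∃ (S ∩ Z) (∁ Z) (≤r (sym bdZ))
        ... | u , _ , hu , _ = subst (λ w → S w ≡ true) (inZ-S u (∧-l hu) (==-≡ (∧-r {S u} hu))) (∧-l hu)
        a≢w₃ : a ≢ w₃
        a≢w₃ e = true≢false w₃∈S (trans (cong S (sym e)) a∉S)
        b≢w₃ : b ≢ w₃
        b≢w₃ e = true≢false w₃∈S (trans (cong S (sym e)) b∉S)
        out-S : ∀ {z t} → S z ≡ false → cls z ≡ cls a → G z t ≡ true → cls t ≢ cls a → S t ≡ true
        out-S {z} {t} sz e g ne = ¬false λ st → case isE-e {u = a} {b} {z} {t} (CC-edge sz st g (λ r → ne (trans (sym r) e))) of λ
          { (inj₁ (_ , r)) → ne (trans (cong cls (sym r)) ab) ; (inj₂ (r , _)) → ne (cong cls (sym r)) }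
        ta∈S : S ta ≡ true
        ta∈S = out-S a∉S refl gta ta∉
        tb∈S : S tb ≡ true
        tb∈S = out-S b∉S ab gtb tb∉
        other : ∀ {v} → cls v ≢ cls a → Other v
        other ne p _ = ne (sym p)
        ta-other : Other ta
        ta-other = other ta∉
        tb-other : Other tb
        tb-other = other tb∉
        κZ : ∀ {v} → cls v ≡ cls a → κ v ≡ true
        κZ {v} e = trans (κ-≡ e) (κ-bd {a} bdZ)
        falseOther : ∀ v → κ v ≡ false → Other v
        falseOther v k p _ = true≢false (κZ (sym p)) k
        module OnW = Count W W-closed W-shore
        inW : ∀ {v} → cls v ≢ cls a → W v ≡ true
        inW ne = not-f (==-≢ ne)
        inZ : ∀ {v} → cls v ≡ cls a → ∁ W v ≡ true
        inZ e = trans (Bool.not-involutive _) (Cl-in e)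
        -- Type 0 fails because `ta` sends an edge from `S` into the triangle, type 3 because `W`
        -- has two vertices.
        W-type : bd W ≡ 2 × cls x ≢ cls a
        W-type with OnW.type (λ wa _ → true≢false (Cl-self a) (not-t wa))
        ... | Count.type0 e _ = ⊥-elim (E-none (S ∩ W) (∁ W) e (∧-i ta∈S (inW ta∉)) (inZ refl) (flipG gta))
        ... | Count.type2 e _ wx _ = e , ==-≡f (not-t wx)
        ... | Count.type3 _ u _ = ⊥-elim (p≢q (u p q (inW p∉) (inW q∉)))
        -- The edges from `ta` and `tb` already account for `bd W`.
        t₃∉S : S t₃ ≡ false
        t₃∉S = ¬true λ s → <-irrefl refl (≤-trans (three-pairs (λ u v → (S ∩ W) u ∧ (∁ W v ∧ G u v))
          (∧-i (∧-i ta∈S (inW ta∉)) (∧-i (inZ refl) (flipG gta))) (∧-i (∧-i tb∈S (inW tb∉)) (∧-i (inZ ab) (flipG gtb)))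
          (∧-i (∧-i s (inW t₃∉)) (∧-i (inZ aw) (flipG gt₃))) (λ _ → G≢ gab) (λ _ → a≢w₃) (λ _ → b≢w₃)) (≤r (proj₁ W-type)))
        true-edge : ∀ s t → G s t ≡ true → cls s ≢ cls t → κ s ≡ true → κ t ≡ true → isE w₃ t₃ s t ≡ true
        true-edge s t g ne ks kt with same? (cls s) (cls a) | same? (cls t) (cls a)
        ... | inj₁ p | inj₁ q = ⊥-elim (ne (trans p (sym q)))
        ... | inj₁ p | inj₂ q with bool? (S s)
        ...   | inj₂ ss = ⊥-elim (true≢false (out-S ss p g q) (κ-out (other q) kt (flipG g) (ne ∘ sym)))
        ...   | inj₁ ss with inZ-S s ss p
        ...     | refl = subst (λ z → isE s t₃ s z ≡ true) (sym (only₃ t g q)) (isE-1 s t₃)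
        true-edge s t g ne ks kt | inj₂ p | inj₁ q with bool? (S t)
        ...   | inj₂ st = ⊥-elim (true≢false (out-S st q (flipG g) p) (κ-out (other p) ks g ne))
        ...   | inj₁ st with inZ-S t st q
        ...     | refl = subst (λ z → isE t t₃ z t ≡ true) (sym (only₃ s (flipG g) p)) (isE-2 t t₃)
        true-edge s t g ne ks kt | inj₂ p | inj₂ q with isE-e {u = a} {b} {s} {t} (CC-edge (κ-out (other p) ks g ne) (κ-out (other q) kt (flipG g) (ne ∘ sym)) g ne)
        ... | inj₁ (r , _) = ⊥-elim (p (cong cls (sym r)))
        ... | inj₂ (r , _) = ⊥-elim (q (cong cls (sym r)))
        κw₃ : κ w₃ ≡ true
        κw₃ = κZ aw
        wt-cross : cls w₃ ≢ cls t₃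
        wt-cross e = t₃∉ (trans (sym e) aw)
        result : FalseEdge → (∃ λ c → ∃ λ d → Dbl κ w₃ t₃ c d) ⊎ (Bip κ × κ t₃ ≡ false × ¬ Single t₃)
        result F with bool? (κ t₃)
        ... | inj₁ kt₃ = inj₁ (FalseEdge.c F , FalseEdge.d F , (λ s t → bool-iff (fwd s t) (bwd s t)) , κ-cls , λ e → true≢false κw₃ (trans e (FalseEdge.κc F)))
          where
          open FalseEdge F
          κd : κ d ≡ false
          κd with same? (cls d) (cls a)
          ... | inj₂ ne = κ-S (other ne) d∈S (flipG Gcd) (cross ∘ sym)
          ... | inj₁ e with inZ-S d d∈S e
          ...   | r = ⊥-elim (true≢false (subst (λ z → κ z ≡ true) (sym (only₃ c (subst (λ z → G z c ≡ true) r (flipG Gcd)) (λ q → cross (trans q (sym e))))) kt₃) κc)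
          fwd : ∀ s t → mono κ s t ≡ true → isE w₃ t₃ s t ∨ isE c d s t ≡ true
          fwd s t h with mono-e {s} {t} h
          ... | g , ne , inj₁ (ks , kt) = ∨-l (true-edge s t g ne ks kt)
          ... | g , ne , inj₂ (ks , kt) = ∨-r {isE w₃ t₃ s t} (unique s t g ne ks kt)
          bwd : ∀ s t → isE w₃ t₃ s t ∨ isE c d s t ≡ true → mono κ s t ≡ true
          bwd s t h with ∨-e {isE w₃ t₃ s t} h
          ... | inj₁ e with isE-e {u = w₃} {t₃} {s} {t} e
          ...   | inj₁ (refl , refl) = mono-i gt₃ wt-cross κw₃ kt₃
          ...   | inj₂ (refl , refl) = mono-i (flipG gt₃) (wt-cross ∘ sym) kt₃ κw₃
          bwd s t h | inj₂ e with isE-e {u = c} {d} {s} {t} e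
          ...   | inj₁ (refl , refl) = mono-i Gcd cross κc κd
          ...   | inj₂ (refl , refl) = mono-i (flipG Gcd) (cross ∘ sym) κd κc
        ... | inj₂ kt₃ with false-class t₃ (other t₃∉) kt₃
        ...   | inj₂ (_ , h) = ⊥-elim (true≢false h t₃∉S)
        ...   | inj₁ (e , px , py) = inj₂ (((λ s t → ¬true λ h → bip s t h) , κ-cls) , kt₃ ,
                  λ single → x≢y (trans (single x px) (sym (single y py))))
          where
          at : ∀ s t → G s t ≡ true → cls s ≢ cls t → κ s ≡ false → κ t ≡ false → S s ≡ false → ⊥
          at s t g ne ks kt ss with false-class s (falseOther s ks) ks
          ... | inj₂ (_ , h) = true≢false h ss
          ... | inj₁ (_ , p , _) = let (_ , r) = cut-pair {t₃} e (trans (sym p) px) refl ss t₃∉S g (flipG gt₃) (λ r → ne (trans (trans (sym p) px) (sym r))) wt-cross in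
                  true≢false κw₃ (subst (λ z → κ z ≡ false) r kt)
          bip : ∀ s t → mono κ s t ≡ true → ⊥
          bip s t h with mono-e {s} {t} h
          ... | g , ne , inj₁ (ks , kt) with isE-e {u = w₃} {t₃} {s} {t} (true-edge s t g ne ks kt)
          ...   | inj₁ (_ , r) = true≢false (subst (λ z → κ z ≡ true) (sym r) kt) kt₃
          ...   | inj₂ (_ , r) = true≢false (subst (λ z → κ z ≡ true) (sym r) ks) kt₃
          bip s t h | g , ne , inj₂ (ks , kt) with bool? (S s) | bool? (S t)
          ... | inj₂ ss | _ = at s t g ne ks kt ss
          ... | inj₁ _ | inj₂ st = at t s (flipG g) (ne ∘ sym) kt ks st
          ... | inj₁ ss | inj₁ st with isE-e {u = x} {y} {s} {t} (SS-edge ss st g)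
          ...   | inj₁ (refl , refl) = ne (trans px (sym py))
          ...   | inj₂ (refl , refl) = ne (trans py (sym px))

-- Comparing the colourings of two doubletons.

module Doubletons {n} (G : Graph n) (simple : IsSimple G) (cubic : Cubic G) (brick : Brick G) where
  open Pieces G simple cubic brick public

  drop2 : ∀ A B C → B ⊆ C → ∀ {a b c d} → A a ≡ true → A c ≡ true → C b ≡ true → C d ≡ true → B b ≡ false → B d ≡ false →
    G a b ≡ true → G c d ≡ true → (a ≡ c → b ≡ d → ⊥) → E A B + 2 ≤ E A C
  drop2 A B C h {a} {b} {c} {d} Aa Ac Cb Cd Bb Bd gab gcd ne = ≤-trans
    (+-monoʳ-≤ (E A B) (two-pairs (λ u v → A u ∧ ((C ∖ B) v ∧ G u v)) (∧-i Aa (∧-i (∧-i Cb (not-f Bb)) gab)) (∧-i Ac (∧-i (∧-i Cd (not-f Bd)) gcd)) ne))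
    (≤r (sym (E-split A C B (C ∖ B) pt)))
    where
    pt : ∀ v → ι (C v) ≡ ι (B v) + ι (C v ∧ not (B v))
    pt v with B v in bv
    ... | true rewrite h v bv = refl
    ... | false rewrite Bool.∧-identityʳ (C v) = refl

  -- Across a cut each of the two named edges occurs in only one direction, the one starting in `X`;
  -- `o` and `o'` select it.
  cut-by-two : ∀ Y X → Y ⊆ X → ∀ {c d c' d'} →
    (∀ s t → Y s ≡ true → X t ≡ false → G s t ≡ true → isE c d s t ≡ true ⊎ isE c' d' s t ≡ true) → E Y (∁ X) ≤ 2
  cut-by-two Y X YX {c} {d} {c'} {d'} h = ≤-trans (∑₂-mono {g = λ s t → δ (o c d) (o' c d) s t + δ (o c' d') (o' c' d') s t} pt)
      (≤r (trans (∑₂-+ (δ (o c d) (o' c d)) (δ (o c' d') (o' c' d'))) (cong₂ _+_ (∑₂-δ (o c d) (o' c d)) (∑₂-δ (o c' d') (o' c' d')))))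
    where
    o o' : Fin n → Fin n → Fin n
    o c d = if X c then c else d
    o' c d = if X c then d else c
    orient : ∀ c d s t → X s ≡ true → X t ≡ false → isE c d s t ≡ true → 1 ≤ δ (o c d) (o' c d) s t
    orient c d s t xs xt e with isE-e {u = c} {d} {s} {t} e
    ... | inj₁ (refl , refl) rewrite xs = ≤r (sym (δ-refl s t))
    ... | inj₂ (refl , refl) rewrite xt = ≤r (sym (δ-refl s t))
    pt : ∀ s t → ι (Y s ∧ (∁ X t ∧ G s t)) ≤ δ (o c d) (o' c d) s t + δ (o c' d') (o' c' d') s t
    pt s t = ι-≤ λ e → let xt = not-t (∧-l (∧-r {Y s} e)) ; xs = YX s (∧-l e) in
      case h s t (∧-l e) xt (∧-r {∁ X t} (∧-r {Y s} e)) of λ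
        { (inj₁ q) → ≤-trans (orient c d s t xs xt q) (m≤m+n _ _)
        ; (inj₂ q) → ≤-trans (orient c' d' s t xs xt q) (m≤n+m _ (δ (o c d) (o' c d) s t)) }

  eqB : Bool → Bool → Bool
  eqB true b = b
  eqB false b = not b

  eqB-t : ∀ {a b} → eqB a b ≡ true → a ≡ b
  eqB-t {true} {true} h = refl
  eqB-t {false} {false} h = refl

  eqB-i : ∀ {a b} → a ≡ b → eqB a b ≡ true
  eqB-i {true} refl = refl
  eqB-i {false} refl = refl

  eqB-f : ∀ {a b} → a ≢ b → eqB a b ≡ false
  eqB-f {a} {b} h = ¬true λ e → h (eqB-t e)

  bool-≢≢ : ∀ {a b c : Bool} → a ≢ b → c ≢ b → a ≡ c
  bool-≢≢ {true} {b} {true} h k = refl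
  bool-≢≢ {false} {b} {false} h k = refl
  bool-≢≢ {true} {true} {false} h k = ⊥-elim (h refl)
  bool-≢≢ {true} {false} {false} h k = ⊥-elim (k refl)
  bool-≢≢ {false} {true} {true} h k = ⊥-elim (k refl)
  bool-≢≢ {false} {false} {true} h k = ⊥-elim (h refl)

  module OnPiece (P : Piece) where
    open Piece P public

    -- The quotient has at most four vertices (repetitions are allowed); this is the K₄ case, which
    -- the discharging excludes.
    Cover4 : Set
    Cover4 = ∃ λ q₁ → ∃ λ q₂ → ∃ λ q₃ → ∃ λ q₄ → ∀ v → cls v ≡ q₁ ⊎ cls v ≡ q₂ ⊎ cls v ≡ q₃ ⊎ cls v ≡ q₄

    DE : Fin n → Fin n → Set
    DE u v = ∃ λ κ → ∃ λ c → ∃ λ d → Dbl κ u v c d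

    isE-flip : ∀ (u v s t : Fin n) → isE u v s t ≡ isE v u s t
    isE-flip u v s t = trans (Bool.∨-comm (u == s ∧ v == t) (u == t ∧ v == s)) (cong₂ _∨_ (Bool.∧-comm (u == t) (v == s)) (Bool.∧-comm (u == s) (v == t)))

    mono-parts : ∀ {κ s t} → mono κ s t ≡ true → G s t ≡ true × cls s ≢ cls t × κ s ≡ κ t
    mono-parts {κ} {s} {t} h = ∧-l h , ==-≡f (not-t (∧-l (∧-r {G s t} h))) , same' (∧-r {not (cls s == cls t)} (∧-r {G s t} h))
      where
      same' : ∀ {a b} → (a ∧ b) ∨ (not a ∧ not b) ≡ true → a ≡ b
      same' {true} {true} _ = refl
      same' {false} {false} _ = refl

    mono-make : ∀ {κ s t} → G s t ≡ true → cls s ≢ cls t → κ s ≡ κ t → mono κ s t ≡ true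
    mono-make {κ} {s} {t} g ne e = ∧-i g (∧-i (not-f (==-≢ ne)) (same' e))
      where
      same' : ∀ {a b} → a ≡ b → (a ∧ b) ∨ (not a ∧ not b) ≡ true
      same' {true} refl = refl
      same' {false} refl = refl

    dbl-edge : ∀ {κ u v c d} → Dbl κ u v c d → mono κ u v ≡ true
    dbl-edge {κ} {u} {v} {c} {d} (m , _) = trans (m u v) (∨-l (isE-1 u v))

    dbl-edge₂ : ∀ {κ u v c d} → Dbl κ u v c d → mono κ c d ≡ true
    dbl-edge₂ {κ} {u} {v} {c} {d} (m , _) = trans (m c d) (∨-r {isE u v c d} (isE-1 c d))

    κ-const : ∀ {κ : VSet n} → (∀ v → κ v ≡ κ (cls v)) → ∀ {v w} → cls v ≡ cls w → κ v ≡ κ w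
    κ-const {κ} h {v} {w} e = trans (h v) (trans (cong κ e) (sym (h w)))

    dbl-flip : ∀ {κ u v c d} → Dbl κ u v c d → Dbl κ v u c d
    dbl-flip {κ} {u} {v} {c} {d} D@(m , k , ne) = (λ s t → trans (m s t) (cong (_∨ isE c d s t) (isE-flip u v s t))) , k ,
      λ e → ne (trans (proj₂ (proj₂ (mono-parts {κ} (dbl-edge D)))) e)

    dbl-swap : ∀ {κ u v c d} → Dbl κ u v c d → Dbl κ c d u v
    dbl-swap {κ} {u} {v} {c} {d} (m , k , ne) = (λ s t → trans (m s t) (Bool.∨-comm (isE u v s t) (isE c d s t))) , k , ne ∘ sym

    dbl-not : ∀ {κ u v c d} → Dbl κ u v c d → Dbl (not ∘ κ) u v c d
    dbl-not {κ} (m , k , ne) = (λ s t → trans (cong (λ b → G s t ∧ (not (cls s == cls t) ∧ b)) (flipm (κ s) (κ t))) (m s t)) ,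
      (λ v → cong not (k v)) , λ e → ne (Bool.not-injective e)
      where
      flipm : ∀ a b → (not a ∧ not b) ∨ (not (not a) ∧ not (not b)) ≡ (a ∧ b) ∨ (not a ∧ not b)
      flipm true true = refl
      flipm true false = refl
      flipm false true = refl
      flipm false false = refl

    DE-flip : ∀ {u v} → DE u v → DE v u
    DE-flip (κ , c , d , D) = κ , c , d , dbl-flip D

    -- The two colours may be exchanged, so several colourings can be made to agree at a common
    -- class.
    normalise : ∀ {u v} → DE u v → ∃ λ κ → ∃ λ c → ∃ λ d → Dbl κ u v c d × κ u ≡ true
    normalise {u} (κ , c , d , D) with bool? (κ u)
    ... | inj₁ t = κ , c , d , D , t
    ... | inj₂ f = not ∘ κ , c , d , dbl-not D , not-f f

    dbl-isE : ∀ {κ u v c d s t} → Dbl κ u v c d → isE u v s t ∨ isE c d s t ≡ true → DE s t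
    dbl-isE {κ} {u} {v} {c} {d} {s} {t} D h with ∨-e {isE u v s t} h
    ... | inj₁ e with isE-e {u = u} {v} {s} {t} e
    ...   | inj₁ (refl , refl) = κ , c , d , D
    ...   | inj₂ (refl , refl) = κ , c , d , dbl-flip D
    dbl-isE {κ} {u} {v} {c} {d} {s} {t} D h | inj₂ e with isE-e {u = c} {d} {s} {t} e
    ...   | inj₁ (refl , refl) = κ , u , v , dbl-swap D
    ...   | inj₂ (refl , refl) = κ , u , v , dbl-flip (dbl-swap D)

    dec-DE : ∀ u v → Dec (DE u v)
    dec-DE u v = SearchFun n search-Bool (λ κ → ∃ λ c → ∃ λ d → Dbl κ u v c d)
      (λ κ → Fin.any? (λ c → Fin.any? (λ d → dec κ c d))) (λ e (c , d , D) → c , d , ext e D)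
      where
      dec : ∀ κ c d → Dec (Dbl κ u v c d)
      dec κ c d with Fin.all? (λ s → Fin.all? (λ t → mono κ s t Bool.≟ (isE u v s t ∨ isE c d s t))) | Fin.all? (λ v → κ v Bool.≟ κ (cls v)) | κ u Bool.≟ κ c
      ... | yes p | yes q | no r = yes (p , q , r)
      ... | no p | _ | _ = no (p ∘ proj₁)
      ... | yes _ | no q | _ = no (q ∘ proj₁ ∘ proj₂)
      ... | yes _ | yes _ | yes r = no (λ D → proj₂ (proj₂ D) r)
      ext : ∀ {f g c d} → (∀ i → f i ≡ g i) → Dbl f u v c d → Dbl g u v c d
      ext {f} {g} {c} {d} h (m , k , ne) = (λ s t → trans (cong₂ (λ a b → G s t ∧ (not (cls s == cls t) ∧ ((a ∧ b) ∨ (not a ∧ not b)))) (sym (h s)) (sym (h t))) (m s t)) ,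
        (λ w → trans (sym (h w)) (trans (k w) (h (cls w)))) , λ e → ne (trans (h u) (trans e (sym (h c))))

    -- An edge leaving the set where the colourings agree is bichromatic for `κ₀` and therefore
    -- monochromatic for `κ`, so it is `a b` or `c d`. As `a b` does leave it, this would be a cut
    -- with one or two edges.
    bip-dbl : ∀ {κ κ₀ a b c d} → Dbl κ a b c d → Bip κ₀ → ⊥
    bip-dbl {κ} {κ₀} {a} {b} {c} {d} D@(m , k , _) (m₀ , k₀) = go (bool? (X a))
      where
      X : VSet n
      X v = eqB (κ v) (κ₀ v)
      cross : ∀ s t → X s ≡ true → X t ≡ false → G s t ≡ true → isE a b s t ≡ true ⊎ isE c d s t ≡ true
      cross s t xs xt g = ∨-e {isE a b s t} (trans (sym (m s t)) (mono-make {κ} g ne (bool-≢≢ {κ s} {κ₀ t} {κ t}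
          (λ e → true≢false (mono-make {κ₀} g ne (trans (sym (eqB-t xs)) e)) (m₀ s t)) (λ e → true≢false (eqB-i e) xt))))
        where
        ne : cls s ≢ cls t
        ne e = true≢false (eqB-i {κ t} {κ₀ t} (trans (κ-const {κ} k (sym e)) (trans (eqB-t xs) (κ-const {κ₀} k₀ e)))) xt
      ab = mono-parts {κ} {a} {b} (dbl-edge {κ} {a} {b} {c} {d} D)
      κ₀ab : κ₀ a ≢ κ₀ b
      κ₀ab e = true≢false (mono-make {κ₀} (proj₁ ab) (proj₁ (proj₂ ab)) e) (m₀ a b)
      small : ∂ X ≤ 2
      small = cut-by-two X X (λ _ h → h) {a} {b} {c} {d} cross
      go : X a ≡ true ⊎ X a ≡ false → ⊥
      go (inj₁ t) = <-irrefl refl (≤-trans (cut≥3 X {a} {b} t (eqB-f (λ e → κ₀ab (trans (sym (eqB-t t)) (trans (proj₂ (proj₂ ab)) e))))) small)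
      go (inj₂ f) = <-irrefl refl (≤-trans (cut≥3 X {b} {a} (eqB-i (trans (sym (proj₂ (proj₂ ab))) (bool-≢≢ {κ a} {κ₀ a} {κ₀ b} (λ e → true≢false (eqB-i e) f) (κ₀ab ∘ sym)))) f) small)

    -- `κ` and `κ'` agree on just two classes. At least two of the three cut edges at the second one
    -- lie in doubletons, which is what the discharging uses.
    record Rung (κ κ' : VSet n) (a : Fin n) : Set where
      field
        w : Fin n
        w∉ : cls w ≢ cls a
        agree : ∀ v → κ v ≡ κ' v → cls v ≡ cls a ⊎ cls v ≡ cls w
        once : E (Cl (cls a)) (Cl (cls w)) ≤ 1
        out : ∀ s t → cls s ≡ cls w → G s t ≡ true → cls t ≢ cls w → cls t ≢ cls a → DE s t

    opaque
      -- The cut around the vertices where κ and κ' agree consists of the four edges of the two doubletons.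
      rung : ∀ {κ κ' a b c d a' b' c' d'} → Dbl κ a b c d → κ a ≡ true → Dbl κ' a' b' c' d' → κ' a' ≡ true →
        cls a' ≡ cls a → (a ≡ a' → b ≡ b' → ⊥) → Rung κ κ' a
      rung {κ} {κ'} {a} {b} {c} {d} {a'} {b'} {c'} {d'} D@(m , k , ne) κa D'@(m' , k' , ne') κ'a' aa' diff = build w (proj₁ (proj₂ nonempty))
        where
        X u Y : VSet n
        X v = eqB (κ v) (κ' v)
        u = Cl (cls a)
        Y = X ∖ u
        X-closed : ∀ {v w} → cls v ≡ cls w → X v ≡ X w
        X-closed e = cong₂ eqB (κ-const {κ} k e) (κ-const {κ'} k' e)
        κ'a : κ' a ≡ true
        κ'a = trans (κ-const {κ'} k' (sym aa')) κ'a'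
        u⊆X : u ⊆ X
        u⊆X v h = trans (X-closed (==-≡ h)) (eqB-i (trans κa (sym κ'a)))
        in-u : ∀ {v} → cls v ≡ cls a → u v ≡ true
        in-u {v} e = trans (cong (_== cls a) e) (==-refl (cls a))
        ab : G a b ≡ true × cls a ≢ cls b × κ a ≡ κ b
        ab = mono-parts {κ} {a} {b} (dbl-edge {κ} {a} {b} {c} {d} D)
        ab' : G a' b' ≡ true × cls a' ≢ cls b' × κ' a' ≡ κ' b'
        ab' = mono-parts {κ'} {a'} {b'} (dbl-edge {κ'} {a'} {b'} {c'} {d'} D')
        cd : G c d ≡ true × cls c ≢ cls d × κ c ≡ κ d
        cd = mono-parts {κ} {c} {d} (dbl-edge₂ {κ} {a} {b} {c} {d} D)
        cd' : G c' d' ≡ true × cls c' ≢ cls d' × κ' c' ≡ κ' d'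
        cd' = mono-parts {κ'} {c'} {d'} (dbl-edge₂ {κ'} {a'} {b'} {c'} {d'} D')
        far : ∀ {s} → κ s ≡ κ c → cls s ≢ cls a
        far e q = ne (trans (κ-const {κ} k (sym q)) e)
        far' : ∀ {s} → κ' s ≡ κ' c' → cls s ≢ cls a
        far' e q = ne' (trans (κ-const {κ'} k' (trans aa' (sym q))) e)
        b∉u : cls b ≢ cls a
        b∉u e = proj₁ (proj₂ ab) (sym e)
        b'∉u : cls b' ≢ cls a
        b'∉u e = proj₁ (proj₂ ab') (trans aa' (sym e))
        b∉X : X b ≡ false
        b∉X = eqB-f λ e → case ∨-e {isE a' b' a b} (trans (sym (m' a b)) (mono-make {κ'} (proj₁ ab) (proj₁ (proj₂ ab)) (trans κ'a (trans (sym κa) (trans (proj₂ (proj₂ ab)) e))))) of λ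
          { (inj₁ h) → case isE-e {u = a'} {b'} {a} {b} h of λ
             { (inj₁ (p , q)) → diff (sym p) (sym q) ; (inj₂ (p , q)) → b∉u (trans (cong cls (sym p)) aa') }
          ; (inj₂ h) → case isE-e {u = c'} {d'} {a} {b} h of λ
             { (inj₁ (p , q)) → far' {c'} refl (cong cls p) ; (inj₂ (p , q)) → far' {d'} (sym (proj₂ (proj₂ cd'))) (cong cls q) } }
        b'∉X : X b' ≡ false
        b'∉X = eqB-f λ e → case ∨-e {isE a b a' b'} (trans (sym (m a' b')) (mono-make {κ} (proj₁ ab') (proj₁ (proj₂ ab')) (trans (κ-const {κ} k aa') (trans κa (trans (sym κ'a') (trans (proj₂ (proj₂ ab')) (sym e))))))) of λ
          { (inj₁ h) → case isE-e {u = a} {b} {a'} {b'} h of λ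
             { (inj₁ (p , q)) → diff p q ; (inj₂ (p , q)) → b'∉u (cong cls (sym p)) }
          ; (inj₂ h) → case isE-e {u = c} {d} {a'} {b'} h of λ
             { (inj₁ (p , q)) → far {c} refl (trans (cong cls p) aa') ; (inj₂ (p , q)) → far {d} (sym (proj₂ (proj₂ cd))) (trans (cong cls q) aa') } }
        cross : ∀ s t → X s ≡ true → X t ≡ false → G s t ≡ true →
          (isE a b s t ∨ isE c d s t ≡ true) ⊎ (isE a' b' s t ∨ isE c' d' s t ≡ true)
        cross s t xs xt g with κ s Bool.≟ κ t
        ... | yes e = inj₁ (trans (sym (m s t)) (mono-make {κ} g (λ q → true≢false (trans (X-closed (sym q)) xs) xt) e))
        ... | no ne₁ = inj₂ (trans (sym (m' s t)) (mono-make {κ'} g (λ q → true≢false (trans (X-closed (sym q)) xs) xt)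
                (trans (sym (eqB-t xs)) (bool-≢≢ {κ s} {κ t} {κ' t} ne₁ (λ e → true≢false (eqB-i (sym e)) xt)))))
        cross-Y : ∀ s t → Y s ≡ true → X t ≡ false → G s t ≡ true → isE c d s t ≡ true ⊎ isE c' d' s t ≡ true
        cross-Y s t ys xt g with cross s t (∧-l ys) xt g
        ... | inj₁ h with ∨-e {isE a b s t} h
        ...   | inj₂ e = inj₁ e
        ...   | inj₁ e with isE-e {u = a} {b} {s} {t} e
        ...     | inj₁ (refl , _) = ⊥-elim (true≢false (in-u refl) (not-t (∧-r {X s} ys)))
        ...     | inj₂ (refl , refl) = ⊥-elim (true≢false (u⊆X t (in-u refl)) xt)
        cross-Y s t ys xt g | inj₂ h with ∨-e {isE a' b' s t} h
        ...   | inj₂ e = inj₂ e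
        ...   | inj₁ e with isE-e {u = a'} {b'} {s} {t} e
        ...     | inj₁ (refl , _) = ⊥-elim (true≢false (in-u aa') (not-t (∧-r {X s} ys)))
        ...     | inj₂ (refl , refl) = ⊥-elim (true≢false (u⊆X t (in-u aa')) xt)
        Y⊆∁u : Y ⊆ ∁ u
        Y⊆∁u v h = ∧-r {X v} h
        -- Of the three cut edges at `u`, the edges `a b` and `a' b'` leave `X`.
        uY≤1 : E u Y ≤ 1
        uY≤1 = prove (E u Y ∷ []) x0 (con 1) 1 ((1 , x0 ⊕ con 2 , con 3) ∷ [])
          (≤-trans (drop2 u Y (∁ u) Y⊆∁u (in-u refl) (in-u aa') (not-f (==-≢ b∉u)) (not-f (==-≢ b'∉u))
            (cong (_∧ not (u b)) b∉X) (cong (_∧ not (u b')) b'∉X) (proj₁ ab) (proj₁ ab') diff) (≤r (shore a)) , tt)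
        -- At most one edge goes to `u`, and out of `X` at most the partner edges `c d` and `c' d'`.
        Y≤3 : ∂ Y ≤ 3
        Y≤3 = ≤-trans (≤r (trans (E-split Y (∁ Y) u (∁ X) pt) (cong (_+ E Y (∁ X)) (E-sym Y u)))) (+-mono-≤ uY≤1 (cut-by-two Y X (λ v h → ∧-l h) {c} {d} {c'} {d'} cross-Y))
          where
          pt : ∀ v → ι (∁ Y v) ≡ ι (u v) + ι (∁ X v)
          pt v with u v in uv
          ... | true rewrite u⊆X v uv = refl
          ... | false rewrite Bool.∧-identityʳ (X v) = refl
        u-edge : ∀ s t → u s ≡ true → u t ≡ false → G s t ≡ true → X t ≡ false → 1 ≤ δ a b s t + δ a' b' s t
        u-edge s t us ut g xt = go (cross s t (u⊆X s us) xt g)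
          where
          cs : cls s ≡ cls a
          cs = ==-≡ us
          go : (isE a b s t ∨ isE c d s t ≡ true) ⊎ (isE a' b' s t ∨ isE c' d' s t ≡ true) → 1 ≤ δ a b s t + δ a' b' s t
          go (inj₁ h) with ∨-e {isE a b s t} h
          ... | inj₁ e with isE-e {u = a} {b} {s} {t} e
          ...   | inj₁ (refl , refl) = ≤-trans (≤r (sym (δ-refl s t))) (m≤m+n _ _)
          ...   | inj₂ (refl , refl) = ⊥-elim (b∉u cs)
          go (inj₁ h) | inj₂ e with isE-e {u = c} {d} {s} {t} e
          ...   | inj₁ (refl , refl) = ⊥-elim (far {c} refl cs)
          ...   | inj₂ (refl , refl) = ⊥-elim (far {d} (sym (proj₂ (proj₂ cd))) cs)
          go (inj₂ h) with ∨-e {isE a' b' s t} h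
          ... | inj₁ e with isE-e {u = a'} {b'} {s} {t} e
          ...   | inj₁ (refl , refl) = ≤-trans (≤r (sym (δ-refl s t))) (m≤n+m _ (δ a b s t))
          ...   | inj₂ (refl , refl) = ⊥-elim (b'∉u cs)
          go (inj₂ h) | inj₂ e with isE-e {u = c'} {d'} {s} {t} e
          ...   | inj₁ (refl , refl) = ⊥-elim (far' {c'} refl cs)
          ...   | inj₂ (refl , refl) = ⊥-elim (far' {d'} (sym (proj₂ (proj₂ cd'))) cs)
        -- If `X` were just `u`, the three cut edges at `u` would all be among `a b` and `a' b'`.
        nonempty : ∃ λ v → Y v ≡ true × ⊤
        nonempty with ⊆? Y (λ _ → false)
        ... | inj₂ (v , h , _) = v , h , tt
        ... | inj₁ none = ⊥-elim (<-irrefl refl (≤-trans (≤r (sym (shore a))) (≤-trans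
            (∑₂-mono {g = λ s t → δ a b s t + δ a' b' s t} λ s t → ι-≤ λ h → let ut = not-t (∧-l (∧-r {u s} h)) in
               u-edge s t (∧-l h) ut (∧-r {∁ u t} (∧-r {u s} h)) (¬true λ xt → true≢false (none t (∧-i xt (not-f ut))) refl))
            (≤r (trans (∑₂-+ (δ a b) (δ a' b')) (cong₂ _+_ (∑₂-δ a b) (∑₂-δ a' b')))))))
        w : Fin n
        w = proj₁ nonempty
        build : ∀ w → Y w ≡ true → Rung κ κ' a
        build w yw with pieces Y (≤-antisym Y≤3 (cut≥3 Y {w} {a} yw (trans (cong (X a ∧_) (cong not (in-u refl))) (Bool.∧-zeroʳ _))))
        ... | q , inj₂ h = ⊥-elim (b∉u (trans (==-≡ (h b (not-f (cong (_∧ not (u b)) b∉X)))) (sym (==-≡ (h a (not-f (trans (cong (X a ∧_) (cong not (in-u refl))) (Bool.∧-zeroʳ _))))))))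
        ... | q , inj₁ h = record { w = w ; w∉ = w∉ ; agree = agr ; once = ≤-trans (E-mono {u} {Cl (cls w)} {u} {Y} (λ _ e → e) Qw⊆Y) uY≤1 ; out = out }
          where
          w∉ : cls w ≢ cls a
          w∉ e = true≢false (in-u e) (not-t (∧-r {X w} yw))
          Qw⊆Y : Cl (cls w) ⊆ Y
          Qw⊆Y v e = ∧-i (trans (X-closed (==-≡ e)) (∧-l yw)) (not-f (==-≢ (λ r → w∉ (trans (sym (==-≡ e)) r))))
          agr : ∀ v → κ v ≡ κ' v → cls v ≡ cls a ⊎ cls v ≡ cls w
          agr v e with same? (cls v) (cls a)
          ... | inj₁ r = inj₁ r
          ... | inj₂ r = inj₂ (trans (==-≡ (h v (∧-i (eqB-i e) (not-f (==-≢ r))))) (sym (==-≡ (h w yw))))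
          out : ∀ s t → cls s ≡ cls w → G s t ≡ true → cls t ≢ cls w → cls t ≢ cls a → DE s t
          out s t e g nw na with cross s t (∧-l (Qw⊆Y s (trans (cong (_== cls w) e) (==-refl (cls w))))) xt g
            where
            xt : X t ≡ false
            xt = ¬true λ x → case agr t (eqB-t x) of λ { (inj₁ r) → na r ; (inj₂ r) → nw r }
          ... | inj₁ h' = dbl-isE {κ} {a} {b} {c} {d} D h'
          ... | inj₂ h' = dbl-isE {κ'} {a'} {b'} {c'} {d'} D' h'

    -- Of three colourings with two colours some two agree at each vertex. So the agreement sets
    -- cover everything: the common class and one more class for each pair.
    three-DE : ∀ {a₁ b₁ a₂ b₂ a₃ b₃} → DE a₁ b₁ → DE a₂ b₂ → DE a₃ b₃ → cls a₂ ≡ cls a₁ → cls a₃ ≡ cls a₁ →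
      (a₁ ≡ a₂ → b₁ ≡ b₂ → ⊥) → (a₁ ≡ a₃ → b₁ ≡ b₃ → ⊥) → (a₂ ≡ a₃ → b₂ ≡ b₃ → ⊥) → Cover4
    three-DE {a₁} {_} {a₂} e₁ e₂ e₃ p q n₁₂ n₁₃ n₂₃ with normalise e₁ | normalise e₂ | normalise e₃
    ... | κ₁ , _ , _ , D₁ , t₁ | κ₂ , _ , _ , D₂ , t₂ | κ₃ , _ , _ , D₃ , t₃ = cls a₁ , cls R₁₂.w , cls R₁₃.w , cls R₂₃.w , covers
      where
      module R₁₂ = Rung (rung D₁ t₁ D₂ t₂ p n₁₂)
      module R₁₃ = Rung (rung D₁ t₁ D₃ t₃ q n₁₃)
      module R₂₃ = Rung (rung D₂ t₂ D₃ t₃ (trans q (sym p)) n₂₃)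
      covers : ∀ v → cls v ≡ cls a₁ ⊎ cls v ≡ cls R₁₂.w ⊎ cls v ≡ cls R₁₃.w ⊎ cls v ≡ cls R₂₃.w
      covers v with κ₁ v Bool.≟ κ₂ v
      ... | yes e with R₁₂.agree v e
      ...   | inj₁ r = inj₁ r
      ...   | inj₂ r = inj₂ (inj₁ r)
      covers v | no ne with κ₁ v Bool.≟ κ₃ v
      ... | yes e with R₁₃.agree v e
      ...   | inj₁ r = inj₁ r
      ...   | inj₂ r = inj₂ (inj₂ (inj₁ r))
      covers v | no ne | no ne' with R₂₃.agree v (bool-≢≢ (ne ∘ sym) (ne' ∘ sym))
      ...   | inj₁ r = inj₁ (trans r p)
      ...   | inj₂ r = inj₂ (inj₂ (inj₂ r))

take : ∀ {n} (P : VSet n) k → Fin n → # P ≤ suc k → ∃ λ v → # (P ─ v) ≤ k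
take P k v₀ h with Fin.any? (λ v → P v Bool.≟ true)
... | yes (v , p) = v , s≤s⁻¹ (≤-trans (≤r (sym (#-─ P v p))) h)
... | no ¬p = v₀ , ≤-trans (≤-trans (sum-mono {g = λ _ → 0} (λ w → ≤r (ι-false (¬true (λ q → ¬p (w , ∧-l q)))))) (≤r (sum-0 _))) z≤n

four : ∀ {n} (P : VSet n) → Fin n → # P ≤ 4 → ∃ λ a → ∃ λ b → ∃ λ c → ∃ λ d → ∀ v → P v ≡ true → v ≡ a ⊎ v ≡ b ⊎ v ≡ c ⊎ v ≡ d
four P v₀ h with take P 3 v₀ h
... | a , h₁ with take (P ─ a) 2 v₀ h₁
... | b , h₂ with take (P ─ a ─ b) 1 v₀ h₂
... | c , h₃ with take (P ─ a ─ b ─ c) 0 v₀ h₃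
... | d , h₄ = a , b , c , d , covers
  where
  covers : ∀ v → P v ≡ true → v ≡ a ⊎ v ≡ b ⊎ v ≡ c ⊎ v ≡ d
  covers v p with same? v a | same? v b | same? v c | same? v d
  ... | inj₁ e | _ | _ | _ = inj₁ e
  ... | inj₂ _ | inj₁ e | _ | _ = inj₂ (inj₁ e)
  ... | inj₂ _ | inj₂ _ | inj₁ e | _ = inj₂ (inj₂ (inj₁ e))
  ... | inj₂ _ | inj₂ _ | inj₂ _ | inj₁ e = inj₂ (inj₂ (inj₂ e))
  ... | inj₂ na | inj₂ nb | inj₂ nc | inj₂ nd = ⊥-elim (true≢false
        (∧-i (∧-i (∧-i (∧-i p (not-f (==-≢ na))) (not-f (==-≢ nb))) (not-f (==-≢ nc))) (not-f (==-≢ nd)))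
        (#-0 (P ─ a ─ b ─ c ─ d) (n≤0⇒n≡0 h₄) v))

-- Matchings of removable edges within a piece.

module Discharging {n} (G : Graph n) (simple : IsSimple G) (cubic : Cubic G) (brick : Brick G) where
  open Doubletons G simple cubic brick public

  opaque
    rem? : Fin n → Fin n → Bool
    rem? u v with G u v Bool.≟ true
    ... | no _ = false
    ... | yes g with removable? u v g
    ...   | inj₁ _ = true
    ...   | inj₂ _ = false

    rem-t : ∀ {u v} → rem? u v ≡ true → Removable G u v
    rem-t {u} {v} h with G u v Bool.≟ true
    ... | yes g with removable? u v g
    ...   | inj₁ r = r

    rem-f : ∀ {u v} → G u v ≡ true → rem? u v ≡ false → Cert u v
    rem-f {u} {v} g h with G u v Bool.≟ true
    ... | no ¬g = ⊥-elim (¬g g)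
    ... | yes g' with removable? u v g'
    ...   | inj₂ c = c

  -- `rem?` records a choice made separately for the two orders of the ends; requiring both makes
  -- the relation symmetric.
  good : Fin n → Fin n → Bool
  good u v = rem? u v ∧ rem? v u

  good-sym : ∀ u v → good u v ≡ good v u
  good-sym u v = Bool.∧-comm (rem? u v) (rem? v u)

  good-removable : ∀ {u v} → good u v ≡ true → Removable G u v
  good-removable h = rem-t (∧-l h)

  good-G : ∀ {u v} → good u v ≡ true → G u v ≡ true
  good-G h = proj₁ (good-removable h)

  bad-cert : ∀ {u v} → G u v ≡ true → good u v ≡ false → Cert u v
  bad-cert {u} {v} g h with bool? (rem? u v)
  ... | inj₂ f = rem-f g f
  ... | inj₁ t = Cert-sym (rem-f (flipG g) (¬true λ t' → true≢false (∧-i t t') h))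

  record RM (X : VSet n) (μ : Fin n → Fin n) : Set where
    field
      inv : Involution μ
      edge : ∀ v → μ v ≢ v → good v (μ v) ≡ true
      inside : ∀ v → μ v ≢ v → X v ≡ true

  moved : (Fin n → Fin n) → ℕ
  moved μ = # (λ v → not (μ v == v))

  Maximal : VSet n → (Fin n → Fin n) → Set
  Maximal X μ = ∀ u v → X u ≡ true → X v ≡ true → μ u ≡ u → μ v ≡ v → good u v ≡ false

  link-RM : ∀ {X μ u v} → RM X μ → X u ≡ true → X v ≡ true → μ u ≡ u → μ v ≡ v → good u v ≡ true → RM X (link μ u v)
  link-RM {X} {μ} {u} {v} R xu xv fu fv g = record { inv = link-inv u v fu fv inv
      ; edge = λ w ne → case cases w of λ
          { (inj₁ refl) → trans (cong (good w) (link-u μ w v)) g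
          ; (inj₂ (inj₁ refl)) → trans (cong (good w) (link-w μ u w)) (trans (good-sym w u) g)
          ; (inj₂ (inj₂ (p , q))) → trans (cong (good w) (link-o μ u v w p q)) (edge w (λ e → ne (trans (link-o μ u v w p q) e))) }
      ; inside = λ w ne → case cases w of λ
          { (inj₁ refl) → xu ; (inj₂ (inj₁ refl)) → xv
          ; (inj₂ (inj₂ (p , q))) → inside w (λ e → ne (trans (link-o μ u v w p q) e)) } }
    where
    open RM R
    cases : ∀ w → w ≡ u ⊎ w ≡ v ⊎ (w ≢ u × w ≢ v)
    cases w with same? w u | same? w v
    ... | inj₁ e | _ = inj₁ e
    ... | inj₂ _ | inj₁ e = inj₂ (inj₁ e)
    ... | inj₂ p | inj₂ q = inj₂ (inj₂ (p , q))

  link-moved : ∀ {μ u v} → μ u ≡ u → u ≢ v → moved μ < moved (link μ u v)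
  link-moved {μ} {u} {v} fu u≢v = ≤-trans (s≤s (#-mono {P = λ w → not (μ w == w)} {(λ w → not (link μ u v w == w)) ─ u} λ w h →
      let w≢u = λ { refl → ==-≡f (not-t h) fu } in
      ∧-i (case same? w v of λ
        { (inj₁ refl) → not-f (==-≢ (λ e → u≢v (trans (sym (link-w μ u w)) e)))
        ; (inj₂ w≢v) → not-f (==-≢ (λ e → ==-≡f (not-t h) (trans (sym (link-o μ u v w w≢u w≢v)) e))) })
      (not-f (==-≢ w≢u)))) (≤r (sym (#-─ (λ w → not (link μ u v w == w)) u (not-f (==-≢ λ e → u≢v (sym (trans (sym (link-u μ u v)) e)))))))

  opaque
    maximal-matching : ∀ X → ∃ λ μ → RM X μ × Maximal X μ
    maximal-matching X = go n id (record { inv = λ _ → refl ; edge = λ v ne → ⊥-elim (ne refl) ; inside = λ v ne → ⊥-elim (ne refl) }) (m≤n+m n _)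
      where
      go : ∀ fuel μ → RM X μ → n ≤ moved μ + fuel → ∃ λ μ → RM X μ × Maximal X μ
      go fuel μ R h with Fin.any? (λ u → Fin.any? (λ v → (X u ∧ (X v ∧ ((μ u == u) ∧ ((μ v == v) ∧ good u v)))) Bool.≟ true))
      ... | no none = μ , R , λ u v xu xv fu fv → ¬true λ g → none (u , v ,
              ∧-i xu (∧-i xv (∧-i (trans (cong (_== u) fu) (==-refl u)) (∧-i (trans (cong (_== v) fv) (==-refl v)) g))))
      go zero μ R h | yes (u , v , e) = ⊥-elim (<-irrefl refl (≤-trans (link-moved {μ} {u} {v} fu u≢v)
          (≤-trans (≤-trans (#-mono {P = λ w → not (link μ u v w == w)} {λ _ → true} (λ _ _ → refl)) (≤r (#-all n))) (≤-trans h (≤r (+-identityʳ _))))))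
        where
        g : good u v ≡ true
        g = ∧-r {μ v == v} (∧-r {μ u == u} (∧-r {X v} (∧-r {X u} e)))
        fu : μ u ≡ u
        fu = ==-≡ (∧-l (∧-r {X v} (∧-r {X u} e)))
        u≢v : u ≢ v
        u≢v = G≢ (good-G g)
      go (suc k) μ R h | yes (u , v , e) = go k (link μ u v) (link-RM R (∧-l e) (∧-l (∧-r {X u} e)) fu fv g)
          (≤-trans h (≤-trans (≤r (+-suc (moved μ) k)) (+-monoˡ-≤ k (link-moved {μ} {u} {v} fu (G≢ (good-G g))))))
        where
        g : good u v ≡ true
        g = ∧-r {μ v == v} (∧-r {μ u == u} (∧-r {X v} (∧-r {X u} e)))
        fu : μ u ≡ u
        fu = ==-≡ (∧-l (∧-r {X v} (∧-r {X u} e)))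
        fv : μ v ≡ v
        fv = ==-≡ (∧-l (∧-r {μ u == u} (∧-r {X v} (∧-r {X u} e))))

  module Classes (P : Piece) where
    open OnPiece P public

    opaque
      sing : VSet n
      sing v = # (Cl (cls v)) ≤ᵇ 1

      sing-t : ∀ {v} → sing v ≡ true → Single v
      sing-t {v} h w e = #≤1-unique (Cl (cls v)) (≤ᵇ⇒≤ _ _ (subst T (sym h) tt)) (trans (cong (_== cls v) e) (==-refl (cls v))) (==-refl (cls v))

      sing-f : ∀ {v} → sing v ≡ false → 2 ≤ # (Cl (cls v))
      sing-f {v} h = ≰⇒> λ l → subst T h (≤⇒≤ᵇ l)

      sing-cong : ∀ {v w} → cls v ≡ cls w → sing v ≡ sing w
      sing-cong e = cong (λ q → # (Cl q) ≤ᵇ 1) e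

    not-single : ∀ {v} → sing v ≡ false → ¬ Single v
    not-single {v} h s with #-∃₂ (Cl (cls v)) (sing-f h)
    ... | p , q , hp , hq , p≢q = p≢q (trans (s p (==-≡ hp)) (sym (s q (==-≡ hq))))

    sing-rep : ∀ {v} → sing v ≡ true → cls v ≡ v
    sing-rep {v} h = sing-t h (cls v) (cls-idem v)

    rep : VSet n
    rep q = cls q == q

    -- Each nontrivial class is counted once, through its representative.
    big : VSet n
    big q = rep q ∧ not (sing q)

    D : ℕ
    D = # big

    Cl-rep : ∀ {q v} → Cl q v ≡ true → rep q ≡ true
    Cl-rep {q} {v} h = trans (cong (λ z → cls z == z) (sym (==-≡ h))) (trans (cong (_== cls v) (cls-idem v)) (==-refl (cls v)))

    rep-shore : ∀ {q} → rep q ≡ true → Shore (Cl q)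
    rep-shore {q} h = subst (λ z → Shore (Cl z)) (==-≡ h) (shore q)

    reps : # rep ≡ # sing + D
    reps = trans (sum-cong pt) (sum-+ (λ q → ι (sing q)) _)
      where
      pt : ∀ q → ι (rep q) ≡ ι (sing q) + ι (rep q ∧ not (sing q))
      pt q with sing q in s
      ... | true rewrite sing-rep s | ==-refl q = refl
      ... | false rewrite Bool.∧-identityʳ (rep q) = refl

    many : ¬ Cover4 → Fin n → 5 ≤ # sing + D
    many nc v₀ = ≮⇒≥ λ l → nc (covers (s≤s⁻¹ (subst (_< 5) (sym reps) l)))
      where
      covers : # rep ≤ 4 → Cover4
      covers l with four rep v₀ l
      ... | a , b , c , d , h = a , b , c , d , λ v → h (cls v) (trans (cong (_== cls v) (cls-idem v)) (==-refl (cls v)))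

    opaque
      DEb : Fin n → Fin n → Bool
      DEb u v with dec-DE u v
      ... | yes _ = true
      ... | no _ = false

      DEb-t : ∀ {u v} → DEb u v ≡ true → DE u v
      DEb-t {u} {v} h with dec-DE u v
      ... | yes d = d

      DEb-i : ∀ {u v} → DE u v → DEb u v ≡ true
      DEb-i {u} {v} d with dec-DE u v
      ... | yes _ = refl
      ... | no ¬d = ⊥-elim (¬d d)

    DEb-sym : ∀ {u v} → DEb u v ≡ true → DEb v u ≡ true
    DEb-sym h = DEb-i (DE-flip (DEb-t h))

    bad-DE : ∀ {u v} → G u v ≡ true → good u v ≡ false → sing u ≡ true → sing v ≡ true → DEb u v ≡ true
    bad-DE g b su sv = let open KillR (killR P g (bad-cert g b) (sing-t su) (sing-t sv)) in DEb-i (κ , c , d , dbl)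

    DD ND : Fin n → ℕ
    DD q = ∑₂ (λ s t → ι (Cl q s ∧ (∁ (Cl q) t ∧ (G s t ∧ DEb s t))))
    ND q = ∑₂ (λ s t → ι (Cl q s ∧ (∁ (Cl q) t ∧ (G s t ∧ not (DEb s t)))))

    DD+ND : ∀ {q} → rep q ≡ true → DD q + ND q ≡ 3
    DD+ND {q} h = trans (sym (trans (∑₂-cong (λ s t → bool≡ (Cl q s ∷ Cl q t ∷ G s t ∷ DEb s t ∷ [])
      (λ { (a ∷ b ∷ g ∷ d ∷ []) → ι (a ∧ (not b ∧ g)) }) (λ { (a ∷ b ∷ g ∷ d ∷ []) → ι (a ∧ (not b ∧ (g ∧ d))) + ι (a ∧ (not b ∧ (g ∧ not d))) })))
      (∑₂-+ (λ s t → ι (Cl q s ∧ (∁ (Cl q) t ∧ (G s t ∧ DEb s t)))) _))) (rep-shore h)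

    two : Fin n → Bool
    two q = 2 ≤ᵇ DD q

    module Charge (nc : ¬ Cover4) (μ : Fin n → Fin n) (R : RM sing μ) (mx : Maximal sing μ) where
      open RM R

      U Cvd : VSet n
      U v = sing v ∧ (μ v == v)
      Cvd v = sing v ∧ not (μ v == v)

      -- Doubleton edges carry nothing; any other edge carries 1, or 2 if it is the only one leaving the class of s.
      f : Fin n → Fin n → ℕ
      f s u = ι (U u ∧ (G s u ∧ not (DEb s u))) * (1 + ι (two (cls s)))

      UU-DE : ∀ {s u} → U s ≡ true → U u ≡ true → G s u ≡ true → DEb s u ≡ true
      UU-DE us uu g = bad-DE g (mx _ _ (∧-l us) (∧-l uu) (==-≡ (∧-r us)) (==-≡ (∧-r uu))) (∧-l us) (∧-l uu)

      sing-≢ : ∀ {u t} → sing u ≡ true → G u t ≡ true → cls t ≢ cls u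
      sing-≢ su g e = G≢ g (sym (sing-t su _ e))

      -- With at most one doubleton edge at `u`, two other edges bring 1 each. With two, the third
      -- edge comes from the class found by `rung`, which has two doubleton edges of its own and
      -- therefore sends 2. Three are impossible by `three-DE`.
      receives : ∀ u → U u ≡ true → 2 ≤ sum (λ s → f s u)
      receives u uu = go (m≤n⇒m<n∨m≡n degD≤2)
        where
        su = ∧-l uu
        degD degN : ℕ
        degD = # (λ t → G u t ∧ DEb u t)
        degN = # (λ t → G u t ∧ not (DEb u t))
        deg-split : degD + degN ≡ 3
        deg-split = trans (sym (sum-+ (λ t → ι (G u t ∧ DEb u t)) _)) (trans (sum-cong (λ t → bool≡ (G u t ∷ DEb u t ∷ [])
          (λ { (g ∷ d ∷ []) → ι (g ∧ d) + ι (g ∧ not d) }) (λ { (g ∷ d ∷ []) → ι g }))) (deg u))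
        de : ∀ {t} → G u t ∧ DEb u t ≡ true → DE u t
        de {t} h = DEb-t (∧-r {G u t} h)
        degD≤2 : degD ≤ 2
        degD≤2 = ≮⇒≥ λ l → let (v , w , x , hv , hw , hx , v≢w , v≢x , w≢x) = #-∃₃ (λ t → G u t ∧ DEb u t) l in
          nc (three-DE (de hv) (de hw) (de hx) refl refl (λ _ → v≢w) (λ _ → v≢x) (λ _ → w≢x))
        weight : ∀ s → ι (G u s ∧ not (DEb u s)) * (1 + ι (two (cls s))) ≡ f s u
        weight s = cong (λ b → ι b * (1 + ι (two (cls s)))) (sym (trans (cong (_∧ (G s u ∧ not (DEb s u))) uu)
          (cong₂ (λ g d → g ∧ not d) (symG s u) (bool-iff DEb-sym DEb-sym))))
        go : degD < 2 ⊎ degD ≡ 2 → 2 ≤ sum (λ s → f s u)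
        go (inj₁ l) = ≤-trans (prove (degD ∷ degN ∷ []) (con 2) x1 1 ((1 , con 1 ⊕ x0 , con 2) ∷ (1 , con 3 , x0 ⊕ x1) ∷ []) (l , ≥r deg-split , tt))
          (sum-mono (λ s → ≤-trans (≤r (sym (*-identityʳ _))) (≤-trans (*-monoʳ-≤ (ι (G u s ∧ not (DEb u s))) (s≤s z≤n)) (≤r (weight s)))))
        go (inj₂ e) with #-∃₂ (λ t → G u t ∧ DEb u t) (≥r e) | #-∃ (λ t → G u t ∧ not (DEb u t)) (prove (degD ∷ degN ∷ []) (con 1) x1 1 ((1 , x0 , con 2) ∷ (1 , con 3 , x0 ⊕ x1) ∷ []) (≤r e , ≥r deg-split , tt))
        ... | v , w , hv , hw , v≢w | s , hs with normalise (de hv) | normalise (de hw)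
        ... | κ , c , d , Dv , kv | κ' , c' , d' , Dw , kw = ≤-trans (≤r (sym fs)) (term≤sum (λ s → f s u) s)
          where
          open Rung (rung Dv kv Dw kw refl (λ _ → v≢w)) renaming (w to w₀)
          gs : G u s ≡ true
          gs = ∧-l hs
          ns : DE u s → ⊥
          ns h = true≢false (DEb-i h) (not-t (∧-r {G u s} hs))
          s∉ : cls u ≢ cls s
          s∉ q = sing-≢ su gs (sym q)
          -- The edge `u s` lies in no doubleton, so both colourings give `s` the colour opposite to
          -- that of `u`; hence they agree at `s`.
          s∈w : cls s ≡ cls w₀
          s∈w with agree s (bool-≢≢ {κ s} {κ u} {κ' s}
              (λ q → ns (dbl-isE {κ} {u} {v} {c} {d} Dv (trans (sym (proj₁ Dv u s)) (mono-make {κ} gs s∉ (sym q)))))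
              (λ q → ns (dbl-isE {κ'} {u} {w} {c'} {d'} Dw (trans (sym (proj₁ Dw u s)) (mono-make {κ'} gs s∉ (trans kw (trans (sym kv) (sym q))))))))
          ... | inj₁ r = ⊥-elim (s∉ (sym r))
          ... | inj₂ r = r
          ds : 2 ≤ DD (cls s)
          ds = subst (λ q → 2 ≤ DD q) (sym s∈w) (prove (∂ Q ∷ DD (cls w₀) ∷ E Q (Cl (cls u)) ∷ []) (con 2) x1 1
              ((1 , con 3 , x0) ∷ (1 , x0 , x1 ⊕ x2) ∷ (1 , x2 , con 1) ∷ []) (≥r (shore w₀) , bound , ≤-trans (≤r (E-sym Q (Cl (cls u)))) once , tt))
            where
            Q : VSet n
            Q = Cl (cls w₀)
            bound : ∂ Q ≤ DD (cls w₀) + E Q (Cl (cls u))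
            bound = ≤-trans (∑₂-mono {g = λ a b → ι (Q a ∧ (∁ Q b ∧ (G a b ∧ DEb a b))) + ι (Q a ∧ (Cl (cls u) b ∧ G a b))} pt)
                (≤r (∑₂-+ (λ a b → ι (Q a ∧ (∁ Q b ∧ (G a b ∧ DEb a b)))) _))
              where
              pt : ∀ a b → ι (Q a ∧ (∁ Q b ∧ G a b)) ≤ ι (Q a ∧ (∁ Q b ∧ (G a b ∧ DEb a b))) + ι (Q a ∧ (Cl (cls u) b ∧ G a b))
              pt a b = ι-≤ λ h → let qa = ∧-l h ; qb = ∧-l (∧-r {Q a} h) ; g = ∧-r {∁ Q b} (∧-r {Q a} h) in case same? (cls b) (cls u) of λ
                { (inj₁ r) → ≤-trans (≤r (sym (ι-true (∧-i {Q a} qa (∧-i (trans (cong (_== cls u) r) (==-refl (cls u))) g))))) (m≤n+m _ (ι (Q a ∧ (∁ Q b ∧ (G a b ∧ DEb a b)))))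
                ; (inj₂ r) → ≤-trans (≤r (sym (ι-true (∧-i {Q a} qa (∧-i qb (∧-i g (DEb-i (out a b (==-≡ qa) g (==-≡f (not-t qb)) r)))))))) (m≤m+n _ _) }
          fs : f s u ≡ 2
          fs = trans (sym (weight s)) (cong₂ (λ b c → ι b * (1 + ι c)) hs (T-true (≤⇒≤ᵇ ds)))
            where
            T-true : ∀ {b} → T b → b ≡ true
            T-true {true} _ = refl

      bound : Fin n → ℕ
      bound q = 2 * ι (Cvd q) + 3 * ι (big q)

      -- An unmatched singleton sends nothing, as its edges to unmatched ones lie in doubletons. A
      -- class with two doubleton edges has at most one other edge and sends at most 2. Otherwise a
      -- matched singleton loses one edge to its partner and sends at most 2, and a nontrivial class
      -- sends at most 3.
      pays : ∀ q → sum (λ s → ι (cls s == q) * sum (f s)) ≤ bound q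
      pays q with bool? (rep q)
      ... | inj₂ nr = ≤-trans (sum-mono {g = λ _ → 0} (λ s → ≤r (cong (λ b → ι b * sum (f s)) (¬true λ h → true≢false (Cl-rep {q} {s} h) nr)))) (≤-trans (≤r (sum-0 n)) z≤n)
      ... | inj₁ r = go (bool? (sing q)) (bool? (μ q == q)) (bool? (two q))
        where
        g : Fin n → Fin n → Bool
        g s t = Cl q s ∧ (∁ (Cl q) t ∧ (G s t ∧ not (DEb s t)))
        clq : cls q ≡ q
        clq = ==-≡ r
        F : ℕ
        F = sum (λ s → ι (cls s == q) * sum (f s))
        step' : ∀ k → (∀ s u → cls s ≡ q → f s u ≤ k * ι (g s u)) → F ≤ k * ND q
        step' k h = ≤-trans (sum-mono {g = λ s → sum (λ u → k * ι (g s u))} pt) (≤r (sym (∑₂-* k (λ s t → ι (g s t)))))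
          where
          pt : ∀ s → ι (cls s == q) * sum (f s) ≤ sum (λ u → k * ι (g s u))
          pt s with same? (cls s) q
          ... | inj₂ ne rewrite ==-≢ ne = z≤n
          ... | inj₁ e = ≤-trans (≤r (trans (cong (λ b → ι b * sum (f s)) (trans (cong (_== q) e) (==-refl q))) (+-identityʳ _))) (sum-mono (λ u → h s u e))
        inner : ∀ s u → cls s ≡ q → U u ∧ (G s u ∧ not (DEb s u)) ≡ true → g s u ≡ true
        inner s u e h = ∧-i (trans (cong (_== q) e) (==-refl q)) (∧-i (not-f (==-≢ λ e' →
          G≢ (∧-l (∧-r {U u} h)) (sing-t (∧-l (∧-l h)) s (trans e (sym e'))))) (∧-r {U u} h))
        le2 : ∀ s u → cls s ≡ q → f s u ≤ 2 * ι (g s u)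
        le2 s u e = ≤-trans (*-mono-≤ (ι-mono (inner s u e)) (s≤s (ι≤1 (two (cls s))))) (≤r (*-comm (ι (g s u)) 2))
        le1 : two q ≡ false → ∀ s u → cls s ≡ q → f s u ≤ 1 * ι (g s u)
        le1 t s u e = ≤-trans (*-mono-≤ (ι-mono (inner s u e)) (≤r (cong (λ b → 1 + ι b) (trans (cong two e) t)))) (≤r (*-comm (ι (g s u)) 1))
        F≤2 : two q ≡ true → F ≤ 2
        F≤2 t = prove (F ∷ ND q ∷ DD q ∷ []) x0 (con 2) 1 ((1 , x0 , 2 ⊗ x1) ∷ (2 , x2 ⊕ x1 , con 3) ∷ (2 , con 2 , x2) ∷ []) (step' 2 le2 , ≤r (DD+ND r) , ≤ᵇ⇒≤ 2 (DD q) (subst T (sym t) tt) , tt)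
        F≤3 : two q ≡ false → F ≤ 3
        F≤3 t = prove (F ∷ ND q ∷ DD q ∷ []) x0 (con 3) 1 ((1 , x0 , 1 ⊗ x1) ∷ (1 , x2 ⊕ x1 , con 3) ∷ []) (step' 1 (le1 t) , ≤r (DD+ND r) , tt)
        only : sing q ≡ true → ∀ {s} → cls s ≡ q → s ≡ q
        only sq {s} e = sing-t sq s (trans e (sym clq))
        go : sing q ≡ true ⊎ sing q ≡ false → (μ q == q) ≡ true ⊎ (μ q == q) ≡ false → two q ≡ true ⊎ two q ≡ false → F ≤ bound q
        go (inj₁ sq) (inj₁ m) _ = ≤-trans (step' 0 λ s u e → ≤r (cong (_* (1 + ι (two (cls s)))) (ι-false (¬true λ h →
            true≢false (UU-DE {s} {u} (subst (λ z → U z ≡ true) (sym (only sq e)) (∧-i sq m)) (∧-l h) (∧-l (∧-r {U u} h))) (not-t (∧-r {G s u} (∧-r {U u} h))))))) z≤n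
        go (inj₂ sq) _ t = ≤-trans (case t of λ { (inj₁ t) → ≤-trans (F≤2 t) (s≤s (s≤s z≤n)) ; (inj₂ t) → F≤3 t })
            (≤-trans (≤r (cong (λ b → 3 * ι b) (sym (∧-i r (not-f sq))))) (m≤n+m (3 * ι (big q)) (2 * ι (Cvd q))))
        go (inj₁ sq) (inj₂ m) (inj₁ t) = ≤-trans (F≤2 t) (≤-trans (≤r (cong (λ b → 2 * ι b) (sym (∧-i sq (not-f m))))) (m≤m+n _ _))
        go (inj₁ sq) (inj₂ m) (inj₂ t) = ≤-trans F≤ (≤-trans (≤r (cong (λ b → 2 * ι b) (sym (∧-i sq (not-f m))))) (m≤m+n _ _))
          where
          qμ : μ q ≢ q
          qμ = ==-≡f m
          nbrs : # (λ u → U u ∧ G q u) + 1 ≤ 3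
          nbrs = ≤-trans (≤r (cong (# (λ u → U u ∧ G q u) +_) (sym (#-single (μ q))))) (≤-trans (≤r (sym (sum-+ (λ u → ι (U u ∧ G q u)) (λ u → ι (μ q == u))))) (≤-trans (sum-mono pt) (≤r (deg q))))
            where
            pt : ∀ u → ι (U u ∧ G q u) + ι (μ q == u) ≤ ι (G q u)
            pt u with same? (μ q) u
            ... | inj₂ ne rewrite ==-≢ ne = ≤-trans (≤r (+-identityʳ _)) (ι-mono (λ h → ∧-r {U u} h))
            ... | inj₁ refl rewrite ==-refl (μ q) | good-G (edge q qμ) | ==-≢ {i = μ (μ q)} {μ q} (λ e → qμ (trans (sym e) (inv q))) | Bool.∧-zeroʳ (sing (μ q)) = ≤-refl
          F≤ : F ≤ 2
          F≤ = prove (F ∷ # (λ u → U u ∧ G q u) ∷ []) x0 (con 2) 1 ((1 , x0 , x1) ∷ (1 , x1 ⊕ con 1 , con 3) ∷ []) (F≤nbrs , nbrs , tt)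
            where
            row : ∀ u → f q u ≤ ι (U u ∧ G q u)
            row u = ≤-trans (*-mono-≤ (ι-mono {U u ∧ (G q u ∧ not (DEb q u))} {U u ∧ G q u} (λ h → ∧-i {U u} {G q u} (∧-l {U u} h) (∧-l {G q u} (∧-r {U u} h)))) (≤r (cong (λ b → 1 + ι b) (trans (cong two clq) t)))) (≤r (*-identityʳ _))
            F≤nbrs : F ≤ # (λ u → U u ∧ G q u)
            F≤nbrs = ≤-trans (sum-mono {g = λ s → ι (q == s) * sum (f s)} (λ s → *-monoˡ-≤ (sum (f s)) (ι-mono (λ h → trans (cong (q ==_) (only sq (==-≡ h))) (==-refl q)))))
              (≤-trans (≤r (sum-delta q (λ s → sum (f s)))) (sum-mono row))

      charge : 2 * # U ≤ 2 * # Cvd + 3 * D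
      charge = begin
        2 * # U                                              ≡⟨ *-distrib-sum 2 (λ u → ι (U u)) ⟩
        sum (λ u → 2 * ι (U u))                              ≤⟨ sum-mono rec ⟩
        sum (λ u → sum (λ s → f s u))                        ≡⟨ sum-comm (λ u s → f s u) ⟩
        sum (λ s → sum (f s))                                ≡⟨ fibre cls (λ s → sum (f s)) ⟩
        sum (λ q → sum (λ s → ι (cls s == q) * sum (f s)))   ≤⟨ sum-mono pays ⟩
        sum bound                                            ≡⟨ sum-+ (λ q → 2 * ι (Cvd q)) (λ q → 3 * ι (big q)) ⟩
        sum (λ q → 2 * ι (Cvd q)) + sum (λ q → 3 * ι (big q)) ≡⟨ cong₂ _+_ (*-distrib-sum 2 (λ q → ι (Cvd q))) (*-distrib-sum 3 (λ q → ι (big q))) ⟨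
        2 * # Cvd + 3 * D                                    ∎
        where
        open ≤-Reasoning
        rec : ∀ u → 2 * ι (U u) ≤ sum (λ s → f s u)
        rec u with U u in e
        ... | false = z≤n
        ... | true = subst (2 ≤_) (sum-cong (λ s → cong (λ b → ι (b ∧ (G s u ∧ not (DEb s u))) * (1 + ι (two (cls s)))) e)) (receives u e)

      moved-Cvd : moved μ ≡ # Cvd
      moved-Cvd = #-cong (λ v → bool-iff (λ h → ∧-i (inside v (==-≡f (not-t h))) h) (λ h → ∧-r {sing v} h))

      sing-split : # sing ≡ # U + # Cvd
      sing-split = trans (sum-cong (λ v → bool≡ (sing v ∷ (μ v == v) ∷ []) (λ { (a ∷ b ∷ []) → ι a }) (λ { (a ∷ b ∷ []) → ι (a ∧ b) + ι (a ∧ not b) }))) (sum-+ _ _)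

    -- If no removable edge joins two singletons then, as three doubleton edges cannot meet,
    -- the singletons are independent and cannot form a barrier.
    module Unmatched (nc : ¬ Cover4) (mx : ∀ u v → sing u ≡ true → sing v ≡ true → good u v ≡ false) where

      third : ∀ {a} → sing a ≡ true → ∃ λ t → G a t ≡ true × sing t ≡ false
      third {a} sa with Fin.any? (λ t → (G a t ∧ not (sing t)) Bool.≟ true)
      ... | yes (t , h) = t , ∧-l h , not-t (∧-r {G a t} h)
      ... | no none = ⊥-elim (let (u , v , w , gu , gv , gw , u≢v , u≢w , v≢w) = #-∃₃ (G a) (≥r (deg a)) in
          nc (three-DE (de gu) (de gv) (de gw) refl refl (λ _ → u≢v) (λ _ → u≢w) (λ _ → v≢w)))
        where
        de : ∀ {t} → G a t ≡ true → DE a t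
        de {t} g = DEb-t (bad-DE g (mx a t sa st) sa st)
          where
          st : sing t ≡ true
          st = ¬false λ f → none (t , ∧-i g (not-f f))

      -- Both ends have a neighbour in a nontrivial class with the colour of `S`, and there is only
      -- one such class. These three mutually adjacent classes leave at most three cut edges for
      -- their union, so the rest is a single class and there are only four.
      independent : ∀ a b → sing a ≡ true → sing b ≡ true → G a b ≡ true → ⊥
      independent a b sa sb g with third sa | third sb
      ... | t , gt , st | t' , gt' , st' = absurd (cut-case (∁ Y))
        where
        open KillR (killR P g (bad-cert g (mx a b sa sb)) (sing-t sa) (sing-t sb))
        κb : κ b ≡ true
        κb = trans (sym (proj₂ (proj₂ (mono-parts {κ} {a} {b} (dbl-edge {κ} {a} {b} {c} {d} dbl))))) κa
        κd : κ d ≡ false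
        κd = trans (sym (proj₂ (proj₂ (mono-parts {κ} {c} {d} (dbl-edge₂ {κ} {a} {b} {c} {d} dbl))))) κc
        nonsing : ∀ {u v} → sing u ≡ true → sing v ≡ false → cls u ≢ cls v
        nonsing su sv e = true≢false (trans (sym (sing-cong e)) su) sv
        low : ∀ {z s} → κ z ≡ true → sing z ≡ true → G z s ≡ true → sing s ≡ false → κ s ≡ false
        low {z} {s} kz sz gz ss = ¬true λ ks → case ∨-e {isE a b z s} (trans (sym (proj₁ dbl z s)) (mono-make {κ} gz (nonsing sz ss) (trans kz (sym ks)))) of λ
          { (inj₁ h) → case isE-e {u = a} {b} {z} {s} h of λ
              { (inj₁ (_ , refl)) → true≢false sb ss ; (inj₂ (refl , _)) → true≢false sa ss }
          ; (inj₂ h) → case isE-e {u = c} {d} {z} {s} h of λ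
              { (inj₁ (refl , _)) → true≢false kz κc ; (inj₂ (_ , refl)) → true≢false kz κd } }
        tt' : cls t ≡ cls t'
        tt' = unique t t' (low κa sa gt st) (low κb sb gt' st') (not-single st) (not-single st')
        A B Q Y : VSet n
        A = ⁅ a ⁆
        B = ⁅ b ⁆
        Q = Cl (cls t)
        Y v = (A v ∨ B v) ∨ Q v
        Qa : cls a ≢ cls t
        Qa = nonsing sa st
        Qb : cls b ≢ cls t
        Qb = nonsing sb st
        a≢b : a ≢ b
        a≢b = G≢ g
        split : ∀ v → ι (Y v) ≡ ι (A v) + (ι (B v) + ι (Q v))
        split v with same? a v | same? b v
        ... | inj₁ refl | inj₁ refl = ⊥-elim (a≢b refl)
        ... | inj₁ refl | inj₂ ne rewrite ==-refl v | ==-≢ ne | ==-≢ Qa = refl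
        ... | inj₂ ne | inj₁ refl rewrite ==-refl v | ==-≢ ne | ==-≢ Qb = refl
        ... | inj₂ ne | inj₂ ne' rewrite ==-≢ ne | ==-≢ ne' = refl
        ∂Y : ∂ Y ≡ E A (∁ Y) + (E B (∁ Y) + E Q (∁ Y))
        ∂Y = trans (E-sym Y (∁ Y)) (trans (E-split (∁ Y) Y A (λ v → B v ∨ Q v) s₁) (cong₂ _+_ (E-sym (∁ Y) A)
               (trans (E-split (∁ Y) (λ v → B v ∨ Q v) B Q s₂) (cong₂ _+_ (E-sym (∁ Y) B) (E-sym (∁ Y) Q)))))
          where
          s₂ : ∀ v → ι (B v ∨ Q v) ≡ ι (B v) + ι (Q v)
          s₂ v with same? b v
          ... | inj₁ refl rewrite ==-refl v | ==-≢ Qb = refl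
          ... | inj₂ ne rewrite ==-≢ ne = refl
          s₁ : ∀ v → ι (Y v) ≡ ι (A v) + ι (B v ∨ Q v)
          s₁ v = trans (split v) (cong (ι (A v) +_) (sym (s₂ v)))
        out : ∀ {v} → Y v ≡ true → ∁ Y v ≡ false
        out h = cong not h
        aY : Y a ≡ true
        aY = ∨-l (∨-l (==-refl a))
        bY : Y b ≡ true
        bY = ∨-l (∨-r {A b} (==-refl b))
        QY : ∀ {v} → cls v ≡ cls t → Y v ≡ true
        QY {v} e = ∨-r {A v ∨ B v} (trans (cong (_== cls t) e) (==-refl (cls t)))
        ∁Y⊆ : ∀ {Z : VSet n} → Z ⊆ Y → ∁ Y ⊆ ∁ Z
        ∁Y⊆ h v y = not-f (¬true λ z → true≢false (h v z) (not-t y))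
        eA : E A (∁ Y) + 2 ≤ 3
        eA = ≤-trans (drop2 A (∁ Y) (∁ A) (∁Y⊆ λ v z → ∨-l (∨-l z)) {a} {b} {a} {t} (==-refl a) (==-refl a) (not-f (==-≢ a≢b)) (not-f (==-≢ (G≢ gt)))
          (out bY) (out (QY refl)) g gt (λ _ → λ { refl → true≢false sb st })) (≤r (∂-single a))
        eB : E B (∁ Y) + 2 ≤ 3
        eB = ≤-trans (drop2 B (∁ Y) (∁ B) (∁Y⊆ λ v z → ∨-l (∨-r {A v} z)) {b} {a} {b} {t'} (==-refl b) (==-refl b) (not-f (==-≢ (a≢b ∘ sym))) (not-f (==-≢ (G≢ gt')))
          (out aY) (out (QY (sym tt'))) (flipG g) gt' (λ _ → λ { refl → true≢false sa st' })) (≤r (∂-single b))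
        eQ : E Q (∁ Y) + 2 ≤ 3
        eQ = ≤-trans (drop2 Q (∁ Y) (∁ Q) (∁Y⊆ λ v z → ∨-r {A v ∨ B v} z) {t} {a} {t'} {b} (==-refl (cls t)) (trans (cong (_== cls t) (sym tt')) (==-refl (cls t)))
          (not-f (==-≢ Qa)) (not-f (==-≢ Qb)) (out aY) (out bY) (flipG gt) (flipG gt') (λ _ → a≢b)) (≤r (shore t))
        Y≤3 : ∂ Y ≤ 3
        Y≤3 = prove (∂ Y ∷ E A (∁ Y) ∷ E B (∁ Y) ∷ E Q (∁ Y) ∷ []) x0 (con 3) 1
          ((1 , x0 , x1 ⊕ (x2 ⊕ x3)) ∷ (1 , x1 ⊕ con 2 , con 3) ∷ (1 , x2 ⊕ con 2 , con 3) ∷ (1 , x3 ⊕ con 2 , con 3) ∷ []) (≤r ∂Y , eA , eB , eQ , tt)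
        inY : ∀ v → Y v ≡ true → cls v ≡ cls a ⊎ cls v ≡ cls b ⊎ cls v ≡ cls t
        inY v h with ∨-e {A v ∨ B v} h
        ... | inj₂ q = inj₂ (inj₂ (==-≡ q))
        ... | inj₁ p with ∨-e {A v} p
        ...   | inj₁ q = inj₁ (cong cls (sym (==-≡ q)))
        ...   | inj₂ q = inj₂ (inj₁ (cong cls (sym (==-≡ q))))
        covered-by : Fin n → Set
        covered-by q = ∀ v → ∁ Y v ≡ true → cls v ≡ q
        cut-case : ∀ Z → (∃ λ q → covered-by q)
        cut-case _ with ⊆? (λ _ → true) Y
        ... | inj₁ h = cls a , λ v y → ⊥-elim (true≢false (h v refl) (not-t y))
        ... | inj₂ (w , _ , yw) with pieces Y (≤-antisym Y≤3 (cut≥3 Y {a} {w} aY yw))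
        ...   | q , inj₂ h = q , λ v y → ==-≡ (h v y)
        ...   | q , inj₁ h = ⊥-elim (Qa (trans (==-≡ (h a aY)) (sym (==-≡ (h t (QY refl))))))
        absurd : (∃ λ q → covered-by q) → ⊥
        absurd (q , h) = nc (cls a , cls b , cls t , q , λ v → case bool? (Y v) of λ
          { (inj₂ f) → inj₂ (inj₂ (inj₂ (h v (not-f f))))
          ; (inj₁ y) → case inY v y of λ { (inj₁ e) → inj₁ e ; (inj₂ (inj₁ e)) → inj₂ (inj₁ e) ; (inj₂ (inj₂ e)) → inj₂ (inj₂ (inj₁ e)) } })

      Rs Rn : Fin n → Fin n → Bool
      Rs s t = not (sing s) ∧ (not (cls s == cls t) ∧ (G s t ∧ sing t))
      Rn s t = not (sing s) ∧ (not (cls s == cls t) ∧ (G s t ∧ not (sing t)))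

      cuts : ∑₂ (λ s t → ι (Rs s t)) + ∑₂ (λ s t → ι (Rn s t)) ≡ 3 * D
      cuts = trans (sym (∑₂-+ (λ s t → ι (Rs s t)) (λ s t → ι (Rn s t)))) (trans (fibre cls (λ s → sum (λ t → ι (Rs s t) + ι (Rn s t)))) (trans (sum-cong per) (sym (*-distrib-sum 3 (λ q → ι (big q))))))
        where
        per : ∀ q → sum (λ s → ι (cls s == q) * sum (λ t → ι (Rs s t) + ι (Rn s t))) ≡ 3 * ι (big q)
        per q with big q in bq
        ... | true = trans (sum-cong λ s → trans (*-distrib-sum (ι (cls s == q)) (λ t → ι (Rs s t) + ι (Rn s t))) (sum-cong (λ t → pt s t))) (rep-shore (∧-l bq))
          where
          pt : ∀ s t → ι (cls s == q) * (ι (Rs s t) + ι (Rn s t)) ≡ ι (Cl q s ∧ (∁ (Cl q) t ∧ G s t))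
          pt s t with same? (cls s) q
          ... | inj₂ ne rewrite ==-≢ ne = refl
          ... | inj₁ e rewrite e | ==-refl q | trans (sing-cong {s} {q} (trans e (sym (==-≡ (∧-l bq))))) (not-t (∧-r {rep q} bq)) | ==-sym q (cls t) =
                bool≡ ((cls t == q) ∷ G s t ∷ sing t ∷ []) (λ { (c ∷ g ∷ s ∷ []) → 1 * (ι (not c ∧ (g ∧ s)) + ι (not c ∧ (g ∧ not s))) }) (λ { (c ∷ g ∷ s ∷ []) → ι (not c ∧ g) })
        ... | false = trans (sum-cong none) (sum-0 n)
          where
          none : ∀ s → ι (cls s == q) * sum (λ t → ι (Rs s t) + ι (Rn s t)) ≡ 0
          none s with bool? (sing s) | same? (cls s) q
          ... | _ | inj₂ ne rewrite ==-≢ ne = refl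
          ... | inj₁ ss | inj₁ e = trans (cong (ι (cls s == q) *_) (trans (sum-cong (λ t → cong (λ b → ι (not b ∧ (not (cls s == cls t) ∧ (G s t ∧ sing t))) + ι (not b ∧ (not (cls s == cls t) ∧ (G s t ∧ not (sing t))))) ss)) (sum-0 n))) (*-zeroʳ (ι (cls s == q)))
          ... | inj₂ ss | inj₁ refl = ⊥-elim (true≢false (∧-i (trans (cong (_== cls s) (cls-idem s)) (==-refl (cls s))) (not-f (trans (sing-cong (cls-idem s)) ss))) bq)

      sing-cut : ∑₂ (λ s t → ι (Rs s t)) ≡ 3 * # sing
      sing-cut = trans (∑₂-cong (λ s t → ι-cong (to s t) (from s t))) (trans (E-sym (∁ sing) sing)
          (trans (sym (trans (cong (_+ E sing (∁ sing)) (E-0 sing sing λ u v su sv g → independent u v su sv g)) refl)) (trans (sym (E-∁ sing sing)) (E-all sing))))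
        where
        to : ∀ s t → Rs s t ≡ true → ∁ sing s ∧ (sing t ∧ G s t) ≡ true
        to s t h = ∧-i {∁ sing s} {sing t ∧ G s t} (∧-l {not (sing s)} h) (∧-i (∧-r {G s t} (∧-r {not (cls s == cls t)} (∧-r {not (sing s)} h))) (∧-l {G s t} (∧-r {not (cls s == cls t)} (∧-r {not (sing s)} h))))
        from : ∀ s t → ∁ sing s ∧ (sing t ∧ G s t) ≡ true → Rs s t ≡ true
        from s t h = let st = ∧-l {sing t} (∧-r {∁ sing s} h) in ∧-i {∁ sing s} {not (cls s == cls t) ∧ (G s t ∧ sing t)} (∧-l h)
          (∧-i (not-f (==-≢ (λ e → true≢false (trans (sing-cong e) st) (not-t (∧-l {∁ sing s} h))))) (∧-i (∧-r {sing t} (∧-r {∁ sing s} h)) st))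

      -- All edges at singletons go to nontrivial classes, which have three cut edges each, so
      -- `# sing ≤ D`; equality would make `sing` a barrier. With s and d for the two sides,
      -- `3 * (s + 1) ≤ 3 * d` and `5 ≤ s + d` add up to twice the claim.
      few : Fin n → # sing + 4 ≤ 2 * D
      few v₀ = go (m≤n⇒m<n∨m≡n s≤D)
        where
        s≤D : # sing ≤ D
        s≤D = prove (# sing ∷ D ∷ ∑₂ (λ s t → ι (Rs s t)) ∷ ∑₂ (λ s t → ι (Rn s t)) ∷ []) x0 x1 3
          ((1 , x2 ⊕ x3 , 3 ⊗ x1) ∷ (1 , 3 ⊗ x0 , x2) ∷ []) (≤r cuts , ≥r sing-cut , tt)
        go : # sing < D ⊎ # sing ≡ D → # sing + 4 ≤ 2 * D
        go (inj₁ l) = prove (# sing ∷ D ∷ []) (x0 ⊕ con 4) (2 ⊗ x1) 2 ((3 , con 1 ⊕ x0 , x1) ∷ (1 , con 5 , x0 ⊕ x1) ∷ []) (l , many nc v₀ , tt)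
        go (inj₂ e) = ⊥-elim (no-barrier sing cls label s≥2 (≤-trans (≤r e) (#-mono odd)))
          where
          Rn-0 : ∑₂ (λ s t → ι (Rn s t)) ≡ 0
          Rn-0 = n≤0⇒n≡0 (prove (# sing ∷ D ∷ ∑₂ (λ s t → ι (Rs s t)) ∷ ∑₂ (λ s t → ι (Rn s t)) ∷ []) x3 (con 0) 1
            ((1 , x2 ⊕ x3 , 3 ⊗ x1) ∷ (1 , 3 ⊗ x0 , x2) ∷ (3 , x1 , x0) ∷ []) (≤r cuts , ≥r sing-cut , ≥r e , tt))
          label : Respects sing cls
          label u v su sv g with same? (cls u) (cls v)
          ... | inj₁ q = q
          ... | inj₂ ne = ⊥-elim (<-irrefl refl (≤-trans (≤-trans (≤r (sym (ι-true (∧-i (not-f su) (∧-i (not-f (==-≢ ne)) (∧-i g (not-f sv)))))))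
                  (term≤∑₂ (λ s t → ι (Rn s t)) u v)) (≤r Rn-0)))
          s≥2 : 2 ≤ # sing
          s≥2 = prove (# sing ∷ D ∷ []) (con 2) x0 2 ((1 , con 5 , x0 ⊕ x1) ∷ (1 , x1 , x0) ∷ []) (many nc v₀ , ≥r e , tt)
          odd : ∀ q → big q ≡ true → oddᵇ (# (part sing cls q)) ≡ true
          odd q b = oddᵇ-odd (subst Odd (#-cong {P = Cl q} {part sing cls q} (λ v → bool-iff (λ h → ∧-i (not-f (trans (sing-cong (trans (==-≡ h) (sym (==-≡ (∧-l b))))) (not-t (∧-r {rep q} b)))) h) (∧-r {not (sing v)})))
            (shore-odd {Cl q} (rep-shore (∧-l b))))

    opaque
      -- The first bound is the discharging; the second is the one that `combine-good` consumes. It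
      -- follows from the first if three vertices are matched, so only an empty matching and a
      -- single edge need care.
      piece-matching : ¬ Cover4 → Fin n → ∃ λ μ → RM sing μ × 2 * # sing ≤ 4 * moved μ + 3 * D ×
        (1 ≤ D → 2 * # sing + 8 ≤ 7 * moved μ + 4 * D)
      piece-matching nc v₀ with maximal-matching sing
      ... | μ , R , mx = μ , R , basic , λ D≥1 → go (moved μ) refl D≥1
        where
        open Charge nc μ R mx
        basic : 2 * # sing ≤ 4 * moved μ + 3 * D
        basic = prove (# sing ∷ moved μ ∷ D ∷ # U ∷ # Cvd ∷ []) (2 ⊗ x0) (4 ⊗ x1 ⊕ 3 ⊗ x2) 1
          ((1 , 2 ⊗ x3 , 2 ⊗ x4 ⊕ 3 ⊗ x2) ∷ (2 , x0 , x3 ⊕ x4) ∷ (4 , x4 , x1) ∷ []) (charge , ≤r sing-split , ≥r moved-Cvd , tt)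
        go : ∀ m → moved μ ≡ m → 1 ≤ D → 2 * # sing + 8 ≤ 7 * moved μ + 4 * D
        go 0 e _ = prove (# sing ∷ moved μ ∷ D ∷ []) (2 ⊗ x0 ⊕ con 8) (7 ⊗ x1 ⊕ 4 ⊗ x2) 1 ((2 , x0 ⊕ con 4 , 2 ⊗ x2) ∷ [])
            (Unmatched.few nc (λ u v su sv → mx u v su sv (fix u) (fix v)) v₀ , tt)
          where
          fix : ∀ v → μ v ≡ v
          fix v = ==-≡ (¬false λ f → true≢false (not-f f) (#-0 (λ v → not (μ v == v)) e v))
        go 1 e _ with #-∃ (λ v → not (μ v == v)) (≥r e)
        ... | v , h = ⊥-elim (<-irrefl refl (≤-trans (#≥2 (λ v → not (μ v == v)) h (not-f (==-≢ λ q → ==-≡f (not-t h) (trans (sym q) (RM.inv R v)))) (==-≡f (not-t h) ∘ sym)) (≤r e)))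
        go 2 e D≥1 with m≤n⇒m<n∨m≡n D≥1
        ... | inj₁ l = prove (# sing ∷ moved μ ∷ D ∷ []) (2 ⊗ x0 ⊕ con 8) (7 ⊗ x1 ⊕ 4 ⊗ x2) 1
                ((1 , 2 ⊗ x0 , 4 ⊗ x1 ⊕ 3 ⊗ x2) ∷ (3 , con 2 , x1) ∷ (1 , con 2 , x2) ∷ []) (basic , ≥r e , l , tt)
        ... | inj₂ d = prove (# sing ∷ moved μ ∷ D ∷ []) (2 ⊗ x0 ⊕ con 8) (7 ⊗ x1 ⊕ 4 ⊗ x2) 1 ((2 , x0 , con 5) ∷ (7 , con 2 , x1) ∷ (4 , con 1 , x2) ∷ [])
                (s≤5 , ≥r e , D≥1 , tt)
          where
          -- The first bound gives `2 * # sing ≤ 11`; integrality does the rest.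
          s≤5 : # sing ≤ 5
          s≤5 = prove (# sing ∷ moved μ ∷ D ∷ []) x0 (con 5) 2 ((1 , 2 ⊗ x0 , 4 ⊗ x1 ⊕ 3 ⊗ x2) ∷ (4 , x1 , con 2) ∷ (3 , x2 , con 1) ∷ []) (basic , ≤r e , ≥r d , tt)
        go (suc (suc (suc m))) e _ = prove (# sing ∷ moved μ ∷ D ∷ []) (2 ⊗ x0 ⊕ con 8) (7 ⊗ x1 ⊕ 4 ⊗ x2) 1
          ((1 , 2 ⊗ x0 , 4 ⊗ x1 ⊕ 3 ⊗ x2) ∷ (3 , con 3 , x1) ∷ []) (basic , subst (3 ≤_) (sym e) (s≤s (s≤s (s≤s z≤n))) , tt)

#≥length : ∀ {n} (P : VSet n) xs → All (λ x → P x ≡ true) xs → Unique xs → length xs ≤ # P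
#≥length P [] _ _ = z≤n
#≥length P (x ∷ xs) (p ∷ ps) (u ∷ us) = subst (suc (length xs) ≤_) (sym (#-─ P x p))
  (s≤s (#≥length (P ─ x) xs (All.zipWith (λ (q , ne) → ∧-i q (not-f (==-≢ (ne ∘ sym)))) (ps , u)) us))

even-sum : ∀ {n} (f : Fin n → ℕ) → (∀ i → Even (f i)) → Even (sum f)
even-sum f h = subst Even (sym (trans (sum-cong (λ i → proj₂ (half (h i)))) (sum-+ (λ i → proj₁ (half (h i))) _))) (even (sum (λ i → proj₁ (half (h i)))))

-- Triangular shores and pieces with four classes.

module Analysis {n} (G : Graph n) (simple : IsSimple G) (cubic : Cubic G) (brick : Brick G) where
  open Discharging G simple cubic brick public

  n-even : Fin n → Even n
  n-even v = let (w , gw) = #-∃ (G v) (≤-trans (s≤s z≤n) (≥r (deg v))) ; (M , _) = covered v w gw in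
    subst Even (#-all n) (closed-even (λ _ → true) (mate M) (invol M) (λ _ _ → refl) (λ v _ → nofix M v))

  module Triangle (Z : VSet n) (sZ : Shore Z) (Z3 : # Z ≡ 3) where

    -- A vertex of `Z` has at most two neighbours in `Z`, hence a cut edge of its own; three
    -- vertices share three cut edges.
    outdeg : ∀ p → sum (λ v → ι (Z p ∧ (∁ Z v ∧ G p v))) ≡ ι (Z p)
    outdeg = squeeze _ (λ p → ι (Z p)) at-least (≤r (trans sZ (sym Z3)))
      where
      at-least : ∀ p → ι (Z p) ≤ sum (λ v → ι (Z p ∧ (∁ Z v ∧ G p v)))
      at-least p with Z p in zp
      ... | false = z≤n
      ... | true = prove (# (λ v → Z v ∧ G p v) ∷ # (λ v → ∁ Z v ∧ G p v) ∷ []) (con 1) x1 1 ((1 , con 3 , x0 ⊕ x1) ∷ (1 , x0 , con 2) ∷ [])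
          (≤r (trans (sym (deg p)) (trans (sum-cong (λ v → bool≡ (Z v ∷ G p v ∷ []) (λ { (z ∷ g ∷ []) → ι g }) (λ { (z ∷ g ∷ []) → ι (z ∧ g) + ι (not z ∧ g) }))) (sum-+ _ _))) ,
           ≤-trans (#-mono {P = λ v → Z v ∧ G p v} {Z ─ p} (λ v h → ∧-i (∧-l h) (not-f (==-≢ (λ e → G≢ (∧-r {Z v} h) (sym e))))))
             (s≤s⁻¹ (≤-trans (≤r (sym (#-─ Z p zp))) (≤r Z3))) , tt)

    outs : ∀ {p} → Z p ≡ true → # (λ v → ∁ Z v ∧ G p v) ≡ 1
    outs {p} zp = trans (sum-cong (λ v → cong (λ b → ι (b ∧ (∁ Z v ∧ G p v))) (sym zp))) (trans (outdeg p) (ι-true zp))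

    outer : ∀ {p} → Z p ≡ true → ∃ λ t → Z t ≡ false × G p t ≡ true
    outer {p} zp = let (t , h) = #-∃ (λ v → ∁ Z v ∧ G p v) (≥r (outs zp)) in t , not-t (∧-l h) , ∧-r {∁ Z t} h

    outer-unique : ∀ {p s t} → Z p ≡ true → Z s ≡ false → G p s ≡ true → Z t ≡ false → G p t ≡ true → s ≡ t
    outer-unique {p} zp zs gs zt gt = #≤1-unique (λ v → ∁ Z v ∧ G p v) (≤r (outs zp)) (∧-i (not-f zs) gs) (∧-i (not-f zt) gt)

    adjacent : ∀ {p q} → Z p ≡ true → Z q ≡ true → p ≢ q → G p q ≡ true
    adjacent {p} {q} zp zq ne = ¬false λ f → refute (# (λ v → Z v ∧ G p v) ∷ []) ((1 , con 3 , x0 ⊕ con 1) ∷ (1 , x0 , con 1) ∷ [])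
        (≤r (trans (sym (deg p)) (trans (sum-cong (λ v → bool≡ (Z v ∷ G p v ∷ []) (λ { (z ∷ g ∷ []) → ι g }) (λ { (z ∷ g ∷ []) → ι (z ∧ g) + ι (not z ∧ g) })))
          (trans (sum-+ _ _) (cong (# (λ v → Z v ∧ G p v) +_) (outs zp))))) ,
         ≤-trans (#-mono {P = λ v → Z v ∧ G p v} {Z ─ p ─ q} (λ v h → ∧-i {Z v ∧ not (v == p)} (∧-i {Z v} (∧-l {Z v} h) (not-f (==-≢ (λ e → G≢ (∧-r {Z v} h) (sym e)))))
            (not-f (==-≢ λ { refl → true≢false (∧-r {Z v} h) f }))))
           (s≤s⁻¹ (≤-trans (≤r (sym (#-─ (Z ─ p) q (∧-i zq (not-f (==-≢ (ne ∘ sym))))))) (s≤s⁻¹ (≤-trans (≤r (sym (#-─ Z p zp))) (≤r Z3))))) , tt)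

    exhaust : ∀ {p q r} → Z p ≡ true → Z q ≡ true → Z r ≡ true → p ≢ q → p ≢ r → q ≢ r → ∀ v → Z v ≡ true → v ≡ p ⊎ v ≡ q ⊎ v ≡ r
    exhaust {p} {q} {r} zp zq zr pq pr qr v zv with same? v p | same? v q | same? v r
    ... | inj₁ e | _ | _ = inj₁ e
    ... | inj₂ _ | inj₁ e | _ = inj₂ (inj₁ e)
    ... | inj₂ _ | inj₂ _ | inj₁ e = inj₂ (inj₂ e)
    ... | inj₂ a | inj₂ b | inj₂ c = ⊥-elim (<-irrefl refl (≤-trans (#≥length Z (v ∷ p ∷ q ∷ r ∷ []) (zv ∷ zp ∷ zq ∷ zr ∷ [])
          ((a ∷ b ∷ c ∷ []) ∷ (pq ∷ pr ∷ []) ∷ (qr ∷ []) ∷ [] ∷ [])) (≤r Z3)))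

    third : ∀ {p q} → Z p ≡ true → Z q ≡ true → p ≢ q → ∃ λ r → Z r ≡ true × p ≢ r × q ≢ r
    third {p} {q} zp zq ne = let (r , h) = #-∃ (Z ─ p ─ q) (s≤s⁻¹ (≤-trans (s≤s⁻¹ (≤-trans (≥r Z3) (≤r (#-─ Z p zp)))) (≤r (#-─ (Z ─ p) q (∧-i zq (not-f (==-≢ (ne ∘ sym)))))))) in
      let (h' , qr) = ─-∈ {P = Z ─ p} h ; (zr , pr) = ─-∈ {P = Z} h' in r , zr , pr , qr

  -- moved counts matched vertices, that is, twice the number of edges.
  Good : VSet n → Set
  Good Y = ∃ λ μ → RM Y μ × 2 * (# Y + 2) ≤ 7 * moved μ

  single-edge : ∀ Y {a b} → Y a ≡ true → Y b ≡ true → good a b ≡ true → ∃ λ μ → RM Y μ × 2 ≤ moved μ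
  single-edge Y {a} {b} ya yb g = link id a b , link-RM {Y} {id} (record { inv = λ _ → refl ; edge = λ v ne → ⊥-elim (ne refl) ; inside = λ v ne → ⊥-elim (ne refl) }) ya yb refl refl g ,
    #≥2 (λ v → not (link id a b v == v)) {a} {b} (not-f (==-≢ λ e → ab (sym (trans (sym (link-u id a b)) e)))) (not-f (==-≢ λ e → ab (trans (sym (link-w id a b)) e))) ab
    where
    ab : a ≢ b
    ab = G≢ (good-G g)

  -- Five is exactly what one edge pays for: `2 * (5 + 2)` equals `7 * 2`.
  edge-good : ∀ Y {a b} → # Y ≤ 5 → Y a ≡ true → Y b ≡ true → good a b ≡ true → Good Y
  edge-good Y h ya yb g = let (μ , R , m) = single-edge Y ya yb g in
    μ , R , prove (# Y ∷ moved μ ∷ []) (2 ⊗ (x0 ⊕ con 2)) (7 ⊗ x1) 1 ((2 , x0 , con 5) ∷ (7 , con 2 , x1) ∷ []) (h , m , tt)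

  module InPiece (P : Piece) where
    open Classes P public

    -- Two edges between two classes leave at most two edges for their union.
    one-edge : ∀ {a b a' b'} → G a b ≡ true → G a' b' ≡ true → cls a ≡ cls a' → cls b ≡ cls b' → cls a ≢ cls b →
      (a ≡ a' → b ≡ b' → ⊥) → ∀ v → cls v ≡ cls a ⊎ cls v ≡ cls b
    one-edge {a} {b} {a'} {b'} g g' ea eb ne diff v with same? (cls v) (cls a) | same? (cls v) (cls b)
    ... | inj₁ e | _ = inj₁ e
    ... | inj₂ _ | inj₁ e = inj₂ e
    ... | inj₂ na | inj₂ nb = ⊥-elim (<-irrefl refl (≤-trans (cut≥3 X {a} {v} (∨-l (==-refl (cls a))) (cong₂ _∨_ (==-≢ na) (==-≢ nb)))
        (prove (∂ X ∷ E A (∁ X) ∷ E B (∁ X) ∷ []) x0 (con 2) 1 ((1 , x0 , x1 ⊕ x2) ∷ (1 , x1 ⊕ con 2 , con 3) ∷ (1 , x2 ⊕ con 2 , con 3) ∷ []) (≤r ∂X , eA , eB , tt))))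
      where
      A B X : VSet n
      A = Cl (cls a)
      B = Cl (cls b)
      X w = A w ∨ B w
      inA : ∀ {w} → cls w ≡ cls a → A w ≡ true
      inA {w} e = trans (cong (_== cls a) e) (==-refl (cls a))
      inB : ∀ {w} → cls w ≡ cls b → B w ≡ true
      inB {w} e = trans (cong (_== cls b) e) (==-refl (cls b))
      out : ∀ {w} → X w ≡ true → ∁ X w ≡ false
      out h = cong not h
      ∂X : ∂ X ≡ E A (∁ X) + E B (∁ X)
      ∂X = trans (E-sym X (∁ X)) (trans (E-split (∁ X) X A B s) (cong₂ _+_ (E-sym (∁ X) A) (E-sym (∁ X) B)))
        where
        s : ∀ w → ι (X w) ≡ ι (A w) + ι (B w)
        s w with same? (cls w) (cls a)
        ... | inj₁ e rewrite e | ==-refl (cls a) | ==-≢ ne = refl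
        ... | inj₂ na' rewrite ==-≢ na' = refl
      eA : E A (∁ X) + 2 ≤ 3
      eA = ≤-trans (drop2 A (∁ X) (∁ A) (λ w x → not-f (¬true λ z → true≢false (∨-l z) (not-t x))) {a} {b} {a'} {b'} (inA refl) (inA (sym ea))
        (not-f (==-≢ (ne ∘ sym))) (not-f (==-≢ (λ e → ne (trans (sym e) (sym eb)))))
        (out {b} (∨-r {A b} (inB refl))) (out {b'} (∨-r {A b'} (inB (sym eb)))) g g' diff) (≤r (shore a))
      eB : E B (∁ X) + 2 ≤ 3
      eB = ≤-trans (drop2 B (∁ X) (∁ B) (λ w x → not-f (¬true λ z → true≢false (∨-r {A w} z) (not-t x))) {b} {a} {b'} {a'} (inB refl) (inB (sym eb))
        (not-f (==-≢ ne)) (not-f (==-≢ (λ e → ne (trans ea e))))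
        (out {a} (∨-l (inA refl))) (out {a'} (∨-l (inA (sym ea)))) (flipG g) (flipG g') (λ p q → diff q p)) (≤r (shore b))

    -- Classes are shores and so have odd size, while `n` is even.
    reps-even : Fin n → Even (# rep)
    reps-even v₀ = even-cancel {# rep} {n} (subst Even (trans (sum-+ (λ q → ι (rep q)) _) (cong (# rep +_) sizes)) (even-sum _ per)) (n-even v₀)
      where
      sizes : sum (λ q → # (Cl q)) ≡ n
      sizes = trans (sum-cong (λ q → sum-cong (λ v → sym (*-identityʳ (ι (Cl q v)))))) (trans (sym (fibre cls (λ _ → 1))) (sum-1 n))
      per : ∀ q → Even (ι (rep q) + # (Cl q))
      per q with bool? (rep q)
      ... | inj₁ r = subst (λ z → Even (ι z + # (Cl q))) (sym r) (shore-odd {Cl q} (rep-shore r))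
      ... | inj₂ r = subst Even (sym (trans (cong (λ z → ι z + # (Cl q)) r) (trans (sum-cong (λ v → ι-false (¬true λ h → true≢false (Cl-rep {q} {v} h) r))) (sum-0 n)))) (even 0)

    module TriClass (z : Fin n) (Z3 : # (Cl (cls z)) ≡ 3) (co : 2 ≤ # (∁ (Cl (cls z)))) where
      open Triangle (Cl (cls z)) (shore z) Z3 public

      Z : VSet n
      Z = Cl (cls z)

      tri : ∀ {a b c ta tb tc} → Z a ≡ true → Z b ≡ true → Z c ≡ true → a ≢ b → a ≢ c → b ≢ c →
        Z ta ≡ false → G a ta ≡ true → Z tb ≡ false → G b tb ≡ true → Z tc ≡ false → G c tc ≡ true → Tri P a b c ta tb tc
      tri {a} {b} {c} za zb zc ab ac bc za' ga zb' gb zc' gc = let (p , q , hp , hq , p≢q) = #-∃₂ (∁ Z) co in record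
        { gab = adjacent za zb ab ; ab = trans (==-≡ zb) (sym ca) ; aw = trans (==-≡ zc) (sym ca)
        ; only = λ v e → exhaust za zb zc ab ac bc v (trans (cong (_== cls z) (trans e ca)) (==-refl (cls z)))
        ; gta = ga ; gtb = gb ; gt₃ = gc ; ta∉ = out za' ; tb∉ = out zb' ; t₃∉ = out zc'
        ; only₃ = λ t g e → outer-unique zc (==-≢ (λ r → e (trans r (sym ca)))) g zc' gc
        ; p = p ; q = q ; p≢q = p≢q ; p∉ = out (not-t hp) ; q∉ = out (not-t hq) }
        where
        ca : cls a ≡ cls z
        ca = ==-≡ za
        out : ∀ {t} → Z t ≡ false → cls t ≢ cls a
        out f e = ==-≡f f (trans e ca)

      pair : ∀ {a b c ta tb tc} → Z a ≡ true → Z b ≡ true → Z c ≡ true → a ≢ b → a ≢ c → b ≢ c →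
        Z ta ≡ false → G a ta ≡ true → Z tb ≡ false → G b tb ≡ true → Z tc ≡ false → G c tc ≡ true → good a b ≡ false → KillT P c ta tb tc
      pair {a} {b} za zb zc ab ac bc za' ga zb' gb zc' gc bad = killT P (tri za zb zc ab ac bc za' ga zb' gb zc' gc) (bad-cert (adjacent za zb ab) bad)

      good-edge : ∀ {a b} → Z a ≡ true → Z b ≡ true → good a b ≡ true → Good Z
      good-edge = edge-good Z (≤-trans (≤r Z3) (s≤s (s≤s (s≤s z≤n))))

      vertices : ∃ λ a → ∃ λ b → ∃ λ c → Z a ≡ true × Z b ≡ true × Z c ≡ true × a ≢ b × a ≢ c × b ≢ c
      vertices = #-∃₃ Z (≥r Z3)

      -- Two edges from the triangle into one class would leave no third class, by `one-edge`.
      separate : (∀ q → ¬ (∀ v → cls v ≡ cls z ⊎ cls v ≡ q)) → ∀ {a b ta tb} → Z a ≡ true → Z b ≡ true → a ≢ b →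
        Z ta ≡ false → G a ta ≡ true → Z tb ≡ false → G b tb ≡ true → cls ta ≢ cls tb
      separate nt {a} {b} {ta} {tb} za zb ab zta ga ztb gb e = nt (cls ta) (λ v → case one-edge ga gb (trans (==-≡ za) (sym (==-≡ zb))) e
          (λ r → ==-≡f zta (trans (sym r) (==-≡ za))) (λ p _ → ab p) v of λ { (inj₁ r) → inj₁ (trans r (==-≡ za)) ; (inj₂ r) → inj₂ r })

      -- If no edge of the triangle were removable, three doubleton edges would meet at its class, or the quotient would
      -- be bipartite with two contracted shores on a side that admits only one.
      non-K4 : ¬ Cover4 → Good Z
      non-K4 nc = let (a , b , c , za , zb , zc , ab , ac , bc) = vertices in pick a b c za zb zc ab ac bc (outer za) (outer zb) (outer zc)
        where
        nt : ∀ q → ¬ (∀ v → cls v ≡ cls z ⊎ cls v ≡ q)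
        nt q h = nc (cls z , q , q , q , λ v → case h v of λ { (inj₁ e) → inj₁ e ; (inj₂ e) → inj₂ (inj₁ e) })
        combine' : ∀ {a b c ta tb tc} → a ≢ b → a ≢ c → b ≢ c → cls b ≡ cls a → cls c ≡ cls a → cls ta ≢ cls tb →
          KillT P c ta tb tc → KillT P b ta tc tb → KillT P a tb tc ta → ⊥
        combine' {a} {b} {c} {ta} {tb} {tc} ab ac bc eb ec sep K₃ K₂ K₁ = go (K₁ .KillT.outcome) (K₂ .KillT.outcome) (K₃ .KillT.outcome)
          where
          clash : ∀ {κ κ₀ : VSet n} {u v s t} → Dbl κ u v s t → Bip κ₀ → ⊥
          clash {κ} {κ₀} {u} {v} {s} {t} = bip-dbl {κ} {κ₀} {u} {v} {s} {t}
          go : (∃ λ s → ∃ λ t → Dbl (K₁ .KillT.κ) a ta s t) ⊎ (Bip (K₁ .KillT.κ) × (K₁ .KillT.κ) ta ≡ false × ¬ Single ta) →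
               (∃ λ s → ∃ λ t → Dbl (K₂ .KillT.κ) b tb s t) ⊎ (Bip (K₂ .KillT.κ) × (K₂ .KillT.κ) tb ≡ false × ¬ Single tb) →
               (∃ λ s → ∃ λ t → Dbl (K₃ .KillT.κ) c tc s t) ⊎ (Bip (K₃ .KillT.κ) × (K₃ .KillT.κ) tc ≡ false × ¬ Single tc) → ⊥
          go (inj₁ (s , t , D₁)) (inj₁ (s' , t' , D₂)) (inj₁ (s'' , t'' , D₃)) =
            nc (three-DE (_ , s , t , D₁) (_ , s' , t' , D₂) (_ , s'' , t'' , D₃) eb ec (λ e _ → ab e) (λ e _ → ac e) (λ e _ → bc e))
          go (inj₁ (s , t , D)) (inj₂ (B , _)) _ = clash {u = a} {ta} {s} {t} D B
          go (inj₁ (s , t , D)) (inj₁ _) (inj₂ (B , _)) = clash {u = a} {ta} {s} {t} D B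
          go (inj₂ (B , _)) (inj₁ (s , t , D)) _ = clash {u = b} {tb} {s} {t} D B
          go (inj₂ (_ , _ , na)) (inj₂ (_ , _ , nb)) _ = sep (K₃ .KillT.unique ta tb (K₃ .KillT.κta) (K₃ .KillT.κtb) na nb)
        pick : ∀ a b c → Z a ≡ true → Z b ≡ true → Z c ≡ true → a ≢ b → a ≢ c → b ≢ c →
          (∃ λ t → Z t ≡ false × G a t ≡ true) → (∃ λ t → Z t ≡ false × G b t ≡ true) → (∃ λ t → Z t ≡ false × G c t ≡ true) → Good Z
        pick a b c za zb zc ab ac bc (ta , zta , ga) (tb , ztb , gb) (tc , ztc , gc) = decide (bool? (good a b)) (bool? (good a c)) (bool? (good b c))
          where
          decide : good a b ≡ true ⊎ good a b ≡ false → good a c ≡ true ⊎ good a c ≡ false → good b c ≡ true ⊎ good b c ≡ false → Good Z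
          decide (inj₁ g) _ _ = good-edge za zb g
          decide (inj₂ _) (inj₁ g) _ = good-edge za zc g
          decide (inj₂ _) (inj₂ _) (inj₁ g) = good-edge zb zc g
          decide (inj₂ f₁) (inj₂ f₂) (inj₂ f₃) = ⊥-elim (combine' ab ac bc (trans (==-≡ zb) (sym (==-≡ za))) (trans (==-≡ zc) (sym (==-≡ za)))
            (separate nt za zb ab zta ga ztb gb)
            (pair za zb zc ab ac bc zta ga ztb gb ztc gc f₁) (pair za zc zb ac ab (bc ∘ sym) zta ga ztc gc ztb gb f₂) (pair zb zc za bc (ab ∘ sym) (ac ∘ sym) ztb gb ztc gc zta ga f₃))

      -- With four classes, the edge whose ends are joined to two nontrivial classes is removable.
      K4-case : # rep ≤ 4 → ∀ p q → cls p ≢ cls z → cls q ≢ cls z → cls p ≢ cls q → sing p ≡ false → sing q ≡ false → Good Z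
      K4-case r≤4 p q pz qz pq sp sq = let (a , b , c , za , zb , zc , ab , ac , bc) = vertices in pick a b c za zb zc ab ac bc (outer za) (outer zb) (outer zc)
        where
        nt : ∀ q' → ¬ (∀ v → cls v ≡ cls z ⊎ cls v ≡ q')
        nt q' h with h p | h q
        ... | inj₁ e | _ = pz e
        ... | inj₂ _ | inj₁ e = qz e
        ... | inj₂ e | inj₂ e' = pq (trans e (sym e'))
        is-rep : ∀ v → rep (cls v) ≡ true
        is-rep v = trans (cong (_== cls v) (cls-idem v)) (==-refl (cls v))
        fin : ∀ {a b c ta tb tc} → Z a ≡ true → Z b ≡ true → Z c ≡ true → a ≢ b → a ≢ c → b ≢ c →
          Z ta ≡ false → G a ta ≡ true → Z tb ≡ false → G b tb ≡ true → Z tc ≡ false → G c tc ≡ true →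
          sing ta ≡ false → sing tb ≡ false → Good Z
        fin {a} {b} za zb zc ab ac bc zta ga ztb gb ztc gc na nb with bool? (good a b)
        ... | inj₁ g = good-edge za zb g
        ... | inj₂ f = ⊥-elim (separate nt za zb ab zta ga ztb gb
              (K .KillT.unique _ _ (K .KillT.κta) (K .KillT.κtb) (not-single na) (not-single nb)))
          where
          K : KillT P _ _ _ _
          K = pair za zb zc ab ac bc zta ga ztb gb ztc gc f
        pick : ∀ a b c → Z a ≡ true → Z b ≡ true → Z c ≡ true → a ≢ b → a ≢ c → b ≢ c →
          (∃ λ t → Z t ≡ false × G a t ≡ true) → (∃ λ t → Z t ≡ false × G b t ≡ true) → (∃ λ t → Z t ≡ false × G c t ≡ true) → Good Z
        pick a b c za zb zc ab ac bc (ta , zta , ga) (tb , ztb , gb) (tc , ztc , gc) = decide (meets p pz) (meets q qz)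
          where
          -- Besides the triangle there are at most three classes, and its outer neighbours already
          -- lie in three different ones.
          meets : ∀ v → cls v ≢ cls z → cls v ≡ cls ta ⊎ cls v ≡ cls tb ⊎ cls v ≡ cls tc
          meets v vz with same? (cls v) (cls ta) | same? (cls v) (cls tb) | same? (cls v) (cls tc)
          ... | inj₁ e | _ | _ = inj₁ e
          ... | inj₂ _ | inj₁ e | _ = inj₂ (inj₁ e)
          ... | inj₂ _ | inj₂ _ | inj₁ e = inj₂ (inj₂ e)
          ... | inj₂ n₁ | inj₂ n₂ | inj₂ n₃ = ⊥-elim (<-irrefl refl (≤-trans (#≥length rep (cls v ∷ cls z ∷ cls ta ∷ cls tb ∷ cls tc ∷ [])
                (is-rep v ∷ is-rep z ∷ is-rep ta ∷ is-rep tb ∷ is-rep tc ∷ [])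
                ((vz ∷ n₁ ∷ n₂ ∷ n₃ ∷ []) ∷ (==-≡f zta ∘ sym ∷ ==-≡f ztb ∘ sym ∷ ==-≡f ztc ∘ sym ∷ []) ∷
                 (separate nt za zb ab zta ga ztb gb ∷ separate nt za zc ac zta ga ztc gc ∷ []) ∷ (separate nt zb zc bc ztb gb ztc gc ∷ []) ∷ [] ∷ [])) r≤4))
          tr : ∀ {u v} → cls u ≡ cls v → sing u ≡ false → sing v ≡ false
          tr e f = trans (sing-cong (sym e)) f
          decide : cls p ≡ cls ta ⊎ cls p ≡ cls tb ⊎ cls p ≡ cls tc → cls q ≡ cls ta ⊎ cls q ≡ cls tb ⊎ cls q ≡ cls tc → Good Z
          decide (inj₁ e) (inj₁ e') = ⊥-elim (pq (trans e (sym e')))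
          decide (inj₁ e) (inj₂ (inj₁ e')) = fin za zb zc ab ac bc zta ga ztb gb ztc gc (tr e sp) (tr e' sq)
          decide (inj₁ e) (inj₂ (inj₂ e')) = fin za zc zb ac ab (bc ∘ sym) zta ga ztc gc ztb gb (tr e sp) (tr e' sq)
          decide (inj₂ (inj₁ e)) (inj₁ e') = fin zb za zc (ab ∘ sym) bc ac ztb gb zta ga ztc gc (tr e sp) (tr e' sq)
          decide (inj₂ (inj₁ e)) (inj₂ (inj₁ e')) = ⊥-elim (pq (trans e (sym e')))
          decide (inj₂ (inj₁ e)) (inj₂ (inj₂ e')) = fin zb zc za bc (ab ∘ sym) (ac ∘ sym) ztb gb ztc gc zta ga (tr e sp) (tr e' sq)
          decide (inj₂ (inj₂ e)) (inj₁ e') = fin zc za zb (ac ∘ sym) (bc ∘ sym) ab ztc gc zta ga ztb gb (tr e sp) (tr e' sq)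
          decide (inj₂ (inj₂ e)) (inj₂ (inj₁ e')) = fin zc zb za (bc ∘ sym) (ac ∘ sym) (ab ∘ sym) ztc gc ztb gb zta ga (tr e sp) (tr e' sq)
          decide (inj₂ (inj₂ e)) (inj₂ (inj₂ e')) = ⊥-elim (pq (trans e (sym e')))

    -- Apart from `a b` the only monochromatic edge is `c d`, whose ends have the other colour.
    killR-low : ∀ {a b} (K : KillR P a b) → ∀ {z s} → z ≡ a ⊎ z ≡ b → G z s ≡ true → cls z ≢ cls s → s ≢ a → s ≢ b → K .KillR.κ s ≡ false
    killR-low {a} {b} K {z} {s} end g ne sa sb = ¬true λ ks → case ∨-e {isE a b z s} (trans (sym (proj₁ dbl z s)) (mono-make {κ} g ne (trans kz (sym ks)))) of λ
        { (inj₁ h) → case isE-e {u = a} {b} {z} {s} h of λ { (inj₁ (_ , q)) → sb (sym q) ; (inj₂ (q , _)) → sa (sym q) }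
        ; (inj₂ h) → case isE-e {u = c} {d} {z} {s} h of λ
            { (inj₁ (q , _)) → true≢false kz (trans (cong κ (sym q)) κc)
            ; (inj₂ (_ , q)) → true≢false kz (trans (cong κ (sym q)) (trans (sym (proj₂ (proj₂ (mono-parts {κ} {c} {d} (dbl-edge₂ {κ} {a} {b} {c} {d} dbl))))) κc)) } }
      where
      open KillR K
      kz : κ z ≡ true
      kz = case end of λ
        { (inj₁ refl) → κa
        ; (inj₂ refl) → trans (sym (proj₂ (proj₂ (mono-parts {κ} {a} {b} (dbl-edge {κ} {a} {b} {c} {d} dbl))))) κa }

    is-rep : ∀ v → rep (cls v) ≡ true
    is-rep v = trans (cong (_== cls v) (cls-idem v)) (==-refl (cls v))

    big-cls : ∀ {v} → sing v ≡ false → big (cls v) ≡ true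
    big-cls {v} s = ∧-i (is-rep v) (not-f (trans (sing-cong (cls-idem v)) s))

    cover-reps : Cover4 → # rep ≤ 4
    cover-reps (a , b , c , d , h) = ≤-trans (sum-mono {g = λ q → ι (a == q) + (ι (b == q) + (ι (c == q) + ι (d == q)))} pt)
        (≤r (trans (sum-+ (λ q → ι (a == q)) _) (cong₂ _+_ (#-single a) (trans (sum-+ (λ q → ι (b == q)) _)
          (cong₂ _+_ (#-single b) (trans (sum-+ (λ q → ι (c == q)) _) (cong₂ _+_ (#-single c) (#-single d))))))))
      where
      pt : ∀ q → ι (rep q) ≤ ι (a == q) + (ι (b == q) + (ι (c == q) + ι (d == q)))
      pt q = ι-≤ λ r → hit (==-≡ r) (h q)
        where
        one : ∀ {x} → x ≡ q → 1 ≤ ι (x == q)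
        one refl = ≤r (sym (ι-true (==-refl q)))
        hit : cls q ≡ q → cls q ≡ a ⊎ cls q ≡ b ⊎ cls q ≡ c ⊎ cls q ≡ d → 1 ≤ ι (a == q) + (ι (b == q) + (ι (c == q) + ι (d == q)))
        hit r (inj₁ e) = ≤-trans (one (trans (sym e) r)) (m≤m+n _ _)
        hit r (inj₂ (inj₁ e)) = ≤-trans (≤-trans (one (trans (sym e) r)) (m≤m+n _ _)) (m≤n+m _ (ι (a == q)))
        hit r (inj₂ (inj₂ (inj₁ e))) = ≤-trans (≤-trans (≤-trans (one (trans (sym e) r)) (m≤m+n _ _)) (m≤n+m _ (ι (b == q)))) (m≤n+m _ (ι (a == q)))
        hit r (inj₂ (inj₂ (inj₂ e))) = ≤-trans (≤-trans (≤-trans (one (trans (sym e) r)) (m≤n+m _ (ι (c == q)))) (m≤n+m _ (ι (b == q)))) (m≤n+m _ (ι (a == q)))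

    -- Four classes, two of them nontrivial, with a removable edge between the singletons. `R8`
    -- arises when both nontrivial classes are triangles.
    record Ladder : Set where
      field
        b c : Fin n
        sb : sing b ≡ true
        sc : sing c ≡ true
        b≢c : b ≢ c
        g : good b c ≡ true
        r≡2 : # sing ≡ 2
        D≡2 : D ≡ 2

    -- In a `rich` piece every triangle among the classes contains a removable edge and the
    -- inductive bound is met. The other two shapes are the four-class pieces whose triangles may
    -- contain none.
    data Shape : Set where
      rich : (∀ z → sing z ≡ false → # (Cl (cls z)) ≡ 3 → Good (Cl (cls z))) →
        (∃ λ N → RM sing N × 2 * # sing + 8 ≤ 7 * moved N + 4 * D) → Shape
      prism : # sing ≡ 3 → D ≡ 1 → Shape
      ladder : Ladder → Shape

    module Analyse (v₀ : Fin n) (three : 3 ≤ # rep) (D≥1 : 1 ≤ D) where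

      co : ∀ z → 2 ≤ # (∁ (Cl (cls z)))
      co z = ≤-trans (s≤s⁻¹ (≤-trans three (≤r (#-─ rep (cls z) (is-rep z)))))
        (#-mono {P = rep ─ cls z} {∁ (Cl (cls z))} λ q h → let (r , ne) = ─-∈ {P = rep} h in not-f (==-≢ λ e → ne (trans (sym e) (==-≡ r))))

      -- If `b` and `c` were not adjacent, the edges at `b` would reach three different nontrivial
      -- classes. If `b c` were not removable, the other two edges at `b` would reach two nontrivial
      -- classes that both have the colour of `S`.
      make-ladder : # sing ≡ 2 → D ≡ 2 → Ladder
      make-ladder r2 d2 with #-∃₂ sing (≥r r2)
      ... | b , c , sb , sc , b≢c = record { b = b ; c = c ; sb = sb ; sc = sc ; b≢c = b≢c ; g = bc-good ; r≡2 = r2 ; D≡2 = d2 }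
        where
        cb : cls b ≢ cls c
        cb e = b≢c (sing-t sc b e)
        nonsing : ∀ {t} → t ≢ b → t ≢ c → sing t ≡ false
        nonsing {t} tb tc = ¬true λ st → <-irrefl refl (≤-trans (#≥length sing (t ∷ b ∷ c ∷ []) (st ∷ sb ∷ sc ∷ [])
          ((tb ∷ tc ∷ []) ∷ (b≢c ∷ []) ∷ [] ∷ [])) (≤r r2))
        same-class : ∀ {s t} → G b s ≡ true → G b t ≡ true → s ≢ c → t ≢ c → s ≢ t → cls s ≢ cls t
        same-class {s} {t} gs gt sc' tc' st e = case one-edge gs gt refl e bs (λ _ → st) c of λ
            { (inj₁ r) → cb (sym r) ; (inj₂ r) → sc' (sing-t sc s (sym r)) }
          where
          bs : cls b ≢ cls s
          bs r = G≢ gs (sym (sing-t sb s (sym r)))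
        gbc : G b c ≡ true
        gbc = ¬false λ f → let (s , t , u , gs , gt , gu , st , su , tu) = #-∃₃ (G b) (≥r (deg b))
                               nc : ∀ {x} → G b x ≡ true → x ≢ c
                               nc g = λ { refl → true≢false g f }
                               bc : ∀ {x} → G b x ≡ true → big (cls x) ≡ true
                               bc g = big-cls (nonsing (G≢ g ∘ sym) (nc g)) in
          <-irrefl refl (≤-trans (#≥length big (cls s ∷ cls t ∷ cls u ∷ []) (bc gs ∷ bc gt ∷ bc gu ∷ [])
            ((same-class gs gt (nc gs) (nc gt) st ∷ same-class gs gu (nc gs) (nc gu) su ∷ []) ∷ (same-class gt gu (nc gt) (nc gu) tu ∷ []) ∷ [] ∷ [])) (≤r d2))
        bc-good : good b c ≡ true
        bc-good = ¬false λ f → let (s , t , hs , ht , st) = #-∃₂ (G b ─ c) (s≤s⁻¹ (≤-trans (≥r (deg b)) (≤r (#-─ (G b) c gbc))))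
                                   (gs , cs) = ─-∈ {P = G b} hs
                                   (gt , ct) = ─-∈ {P = G b} ht
                                   K = killR P gbc (bad-cert gbc f) (sing-t sb) (sing-t sc)
                                   ns = nonsing (G≢ gs ∘ sym) (cs ∘ sym)
                                   nt = nonsing (G≢ gt ∘ sym) (ct ∘ sym)
                                   low : ∀ {x} → G b x ≡ true → x ≢ c → KillR.κ K x ≡ false
                                   low {x} gx xc = killR-low K (inj₁ refl) gx (λ r → G≢ gx (sym (sing-t sb x (sym r)))) (G≢ gx ∘ sym) xc in
          same-class gs gt (cs ∘ sym) (ct ∘ sym) st (KillR.unique K s t (low gs (cs ∘ sym)) (low gt (ct ∘ sym)) (not-single ns) (not-single nt))

      opaque
        analyse : Shape
        analyse with # rep ≤? 4
        ... | no big' = rich (λ z _ z3 → TriClass.non-K4 z z3 (co z) (big' ∘ cover-reps))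
                (let (N , R , _ , h) = piece-matching (big' ∘ cover-reps) v₀ in N , R , h D≥1)
        ... | yes r≤4 = go (# sing) D refl refl (trans (sym reps) (four-reps (# rep) three r≤4 (reps-even v₀)))
          where
          four-reps : ∀ k → 3 ≤ k → k ≤ 4 → Even k → k ≡ 4
          four-reps 3 _ _ e = ⊥-elim (¬even-odd e (even 2))
          four-reps 4 _ _ _ = refl
          four-reps (suc (suc (suc (suc (suc _))))) _ (s≤s (s≤s (s≤s (s≤s ())))) _
          four-reps 0 () _ _
          four-reps 1 (s≤s ()) _ _
          four-reps 2 (s≤s (s≤s ())) _ _
          -- With three nontrivial classes the empty matching already meets the bound.
          wide : 3 ≤ D → # sing + D ≡ 4 → Shape
          wide d3 e = rich tri (id , record { inv = λ _ → refl ; edge = λ v ne → ⊥-elim (ne refl) ; inside = λ v ne → ⊥-elim (ne refl) } ,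
              prove (# sing ∷ D ∷ moved id ∷ []) (2 ⊗ x0 ⊕ con 8) (7 ⊗ x2 ⊕ 4 ⊗ x1) 1 ((2 , x0 ⊕ x1 , con 4) ∷ (6 , con 3 , x1) ∷ []) (≤r e , d3 , tt))
            where
            tri : ∀ z → sing z ≡ false → # (Cl (cls z)) ≡ 3 → Good (Cl (cls z))
            tri z sz z3 = let (p , q , hp , hq , pq) = #-∃₂ (big ─ cls z) (s≤s⁻¹ (≤-trans d3 (≤r (#-─ big (cls z) (big-cls sz)))))
                              (bp , zp) = ─-∈ {P = big} hp
                              (bq , zq) = ─-∈ {P = big} hq
                              ep = ==-≡ (∧-l {rep p} bp)
                              eq = ==-≡ (∧-l {rep q} bq) in
              TriClass.K4-case z z3 (co z) r≤4 p q (λ e → zp (trans (sym e) ep)) (λ e → zq (trans (sym e) eq)) (λ e → pq (trans (sym ep) (trans e eq)))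
                (not-t (∧-r {rep p} bp)) (not-t (∧-r {rep q} bq))
          go : ∀ r d → # sing ≡ r → D ≡ d → # sing + D ≡ 4 → Shape
          go r 0 er ed e = ⊥-elim (<-irrefl refl (≤-trans D≥1 (≤r ed)))
          go r 1 er ed e = prism (+-cancelʳ-≡ D (# sing) 3 (trans e (sym (cong (3 +_) ed)))) ed
          go r 2 er ed e = ladder (make-ladder (+-cancelʳ-≡ D (# sing) 2 (trans e (sym (cong (2 +_) ed)))) ed)
          go r (suc (suc (suc d))) er ed e = wide (≤-trans (s≤s (s≤s (s≤s z≤n))) (≥r ed)) e

  -- The piece without nontrivial classes, and the piece just below a shore.

  trivial-piece : (∀ X → Shore X → ∃ λ q → X ⊆ ⁅ q ⁆ ⊎ ∁ X ⊆ ⁅ q ⁆) → Piece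
  trivial-piece h = record { cls = id ; cls-idem = λ _ → refl
    ; shore = λ v → trans (E-cong {A = λ w → w == v} {λ w → not (w == v)} {⁅ v ⁆} {∁ ⁅ v ⁆} (λ w → ==-sym w v) (λ w → cong not (==-sym w v))) (∂-single v)
    ; pieces = λ X s → case h X s of λ { (q , inj₁ k) → q , inj₁ (λ v x → trans (==-sym v q) (k v x)) ; (q , inj₂ k) → q , inj₂ (λ v x → trans (==-sym v q) (k v x)) } }

  -- The piece whose classes are the complement of Y and the maximal shores properly inside Y
  module Below (Y : VSet n) (sY : Shore Y) (Y≥2 : 2 ≤ # Y) where

    y₀ : Fin n
    y₀ = proj₁ (shore-co {Y} sY)

    y₀∉ : Y y₀ ≡ false
    y₀∉ = proj₂ (shore-co {Y} sY)

    -- Inclusion and properness are Boolean equations, so that `argmax` can decide the predicate.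
    Sub : VSet n → Set
    Sub X = Shore X × (∀ w → X w ∧ not (Y w) ≡ false) × (∃ λ w → Y w ∧ not (X w) ≡ true)

    Sub-⊆ : ∀ {X} → Sub X → X ⊆ Y
    Sub-⊆ {X} (_ , h , _) v xv = ¬false λ f → true≢false (∧-i xv (not-f f)) (h v)

    opaque
      max : ∀ v → Y v ≡ true → ∃ λ X → (Sub X × X v ≡ true) × (∀ Z → Sub Z × Z v ≡ true → # Z ≤ # X)
      max v yv = argmax (λ X → Sub X × X v ≡ true) dec ext (⁅ v ⁆ , (∂-single v , (λ w → ¬true λ h → true≢false (subst (λ z → Y z ≡ true) (==-≡ (∧-l h)) yv) (not-t (∧-r {v == w} h))) , another) , ==-refl v)
        where
        dec : ∀ X → Dec (Sub X × X v ≡ true)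
        dec X = ((∂ X Nat.≟ 3) ×-dec (Fin.all? (λ w → (X w ∧ not (Y w)) Bool.≟ false) ×-dec Fin.any? (λ w → (Y w ∧ not (X w)) Bool.≟ true))) ×-dec (X v Bool.≟ true)
        ext : ∀ {X Z} → (∀ v → X v ≡ Z v) → Sub X × X v ≡ true → Sub Z × Z v ≡ true
        ext e ((s , h , w , k) , xv) = (trans (sym (E-cong e (λ u → cong not (e u)))) s , (λ w → trans (cong (_∧ not (Y w)) (sym (e w))) (h w)) ,
          w , trans (cong (λ b → Y w ∧ not b) (sym (e w))) k) , trans (sym (e v)) xv
        another : ∃ λ w → Y w ∧ not (v == w) ≡ true
        another with #-∃ (Y ─ v) (s≤s⁻¹ (≤-trans Y≥2 (≤r (#-─ Y v yv))))
        ... | w , h = let (yw , ne) = ─-∈ {P = Y} h in w , ∧-i yw (not-f (==-≢ ne))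

    M : ∀ v → Y v ≡ true → VSet n
    M v yv = proj₁ (max v yv)

    M-sub : ∀ v yv → Sub (M v yv)
    M-sub v yv = proj₁ (proj₁ (proj₂ (max v yv)))

    M-self : ∀ v yv → M v yv v ≡ true
    M-self v yv = proj₂ (proj₁ (proj₂ (max v yv)))

    -- Two shores inside `Y` that share `v` are comparable, since both miss `y₀`. A set of maximum
    -- size is not properly contained in the other.
    M-max : ∀ {v yv Z} → Sub Z → Z v ≡ true → Z ⊆ M v yv
    M-max {v} {yv} {Z} sZ zv with nested Z (M v yv) (proj₁ sZ) (proj₁ (M-sub v yv))
    ... | sub h = h
    ... | disjoint h = ⊥-elim (true≢false (M-self v yv) (not-t (h v zv)))
    ... | cover h = ⊥-elim (true≢false (Sub-⊆ (M-sub v yv) y₀ (h y₀ (not-f (¬true λ z → true≢false (Sub-⊆ sZ y₀ z) y₀∉)))) y₀∉)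
    ... | sup h = λ w zw → ¬false λ f → <-irrefl refl (≤-trans (≤-trans (s≤s (#-mono {P = M v yv} {Z ─ w} λ u mu → ∧-i (h u mu) (not-f (==-≢ λ { refl → true≢false mu f }))))
        (≤r (sym (#-─ Z w zw)))) (proj₂ (proj₂ (max v yv)) Z (sZ , zv)))

    M-≗ : ∀ {v yv w yw} → M v yv w ≡ true → ∀ u → M v yv u ≡ M w yw u
    M-≗ {v} {yv} {w} {yw} mw u = bool-iff (M-max (M-sub v yv) mw u) (M-max (M-sub w yw) (M-max (M-sub v yv) mw v (M-self v yv)) u)

    -- `M` needs a membership proof, so the value of `Y v` travels with its equation; `uip` then
    -- makes the particular proof irrelevant.
    cls₀ : ∀ v b → Y v ≡ b → Fin n
    cls₀ v true yv = least (M v yv) v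
    cls₀ v false _ = y₀

    clsY : Fin n → Fin n
    clsY v = cls₀ v (Y v) refl

    cls₀-t : ∀ v b (e : Y v ≡ b) (yv : Y v ≡ true) → cls₀ v b e ≡ least (M v yv) v
    cls₀-t v true e yv = cong (λ z → least (M v z) v) (uip e yv)
    cls₀-t v false e yv = ⊥-elim (true≢false yv e)

    clsY-t : ∀ {v} (yv : Y v ≡ true) → clsY v ≡ least (M v yv) v
    clsY-t {v} yv = cls₀-t v (Y v) refl yv

    cls₀-f : ∀ v b (e : Y v ≡ b) → Y v ≡ false → cls₀ v b e ≡ y₀
    cls₀-f v true e f = ⊥-elim (true≢false e f)
    cls₀-f v false e f = refl

    clsY-f : ∀ {v} → Y v ≡ false → clsY v ≡ y₀
    clsY-f {v} f = cls₀-f v (Y v) refl f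

    clsY-∈ : ∀ {v} (yv : Y v ≡ true) → M v yv (clsY v) ≡ true
    clsY-∈ {v} yv = subst (λ z → M v yv z ≡ true) (sym (clsY-t yv)) (least-∈ (M v yv) v v (M-self v yv))

    clsY-Y : ∀ {v} → Y v ≡ true → Y (clsY v) ≡ true
    clsY-Y yv = Sub-⊆ (M-sub _ yv) _ (clsY-∈ yv)

    clsY-≡ : ∀ {v w} (yv : Y v ≡ true) → M v yv w ≡ true → clsY w ≡ clsY v
    clsY-≡ {v} {w} yv mw = trans (clsY-t yw) (trans (least-cong w v w (M-self w yw) (λ u → sym (M-≗ {v} {yv} {w} {yw} mw u))) (sym (clsY-t yv)))
      where
      yw : Y w ≡ true
      yw = Sub-⊆ (M-sub v yv) w mw

    clsY-M : ∀ {v w} (yv : Y v ≡ true) → clsY w ≡ clsY v → M v yv w ≡ true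
    clsY-M {v} {w} yv e with bool? (Y w)
    ... | inj₂ f = ⊥-elim (true≢false (clsY-Y yv) (trans (cong Y (trans (sym e) (clsY-f f))) y₀∉))
    ... | inj₁ yw = trans (M-≗ {v} {yv} {clsY v} {clsY-Y yv} (clsY-∈ yv) w) (trans (sym (M-≗ {w} {yw} {clsY v} {clsY-Y yv} (subst (λ z → M w yw z ≡ true) e (clsY-∈ yw)) w)) (M-self w yw))

    Cl-Y : ∀ {v} (yv : Y v ≡ true) → ∀ w → (clsY w == clsY v) ≡ M v yv w
    Cl-Y {v} yv w = bool-iff (λ h → clsY-M yv (==-≡ h)) (λ h → trans (cong (_== clsY v) (clsY-≡ yv h)) (==-refl (clsY v)))

    Cl-∁ : ∀ w → (clsY w == y₀) ≡ ∁ Y w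
    Cl-∁ w with bool? (Y w)
    ... | inj₁ yw = trans (==-≢ (λ e → true≢false (clsY-Y yw) (trans (cong Y e) y₀∉))) (cong not (sym yw))
    ... | inj₂ f = trans (trans (cong (_== y₀) (clsY-f f)) (==-refl y₀)) (cong not (sym f))

    inside : ∀ X → Shore X → X ⊆ Y → ∃ λ q → X ⊆ (λ w → clsY w == q) ⊎ ∁ X ⊆ (λ w → clsY w == q)
    inside X sX XY with ⊆? Y X
    ... | inj₁ h = y₀ , inj₂ λ v x → trans (Cl-∁ v) (not-f (¬true λ y → true≢false (h v y) (not-t x)))
    ... | inj₂ (w , yw , xw) = let (v , xv) = shore-∃ {X} sX in
          clsY v , inj₁ λ u xu → trans (Cl-Y (XY v xv) u) (M-max (sX , (λ w → ¬true λ h → true≢false (XY w (∧-l h)) (not-t (∧-r {X w} h))) , w , ∧-i yw (not-f xw)) xv u xu)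

    opaque
      -- By nesting, `X` or its complement lies inside `∁ Y` or inside `Y`; in the latter case it
      -- lies below a maximal proper shore or is all of `Y`.
      piecesY : ∀ X → Shore X → ∃ λ q → X ⊆ (λ w → clsY w == q) ⊎ ∁ X ⊆ (λ w → clsY w == q)
      piecesY X sX with nested X Y sX sY
      ... | sub h = inside X sX h
      ... | sup h = y₀ , inj₂ λ v x → trans (Cl-∁ v) (not-f (¬true λ y → true≢false (h v y) (not-t x)))
      ... | disjoint h = y₀ , inj₁ λ v x → trans (Cl-∁ v) (h v x)
      ... | cover h with inside (∁ X) (trans (∂-∁ X) sX) h
      ...   | q , inj₁ k = q , inj₂ k
      ...   | q , inj₂ k = q , inj₁ λ v x → k v (trans (Bool.not-involutive (X v)) x)

    idem : ∀ v → clsY (clsY v) ≡ clsY v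
    idem v with bool? (Y v)
    ... | inj₁ yv = clsY-≡ yv (clsY-∈ yv)
    ... | inj₂ f = trans (cong clsY (clsY-f f)) (trans (clsY-f y₀∉) (sym (clsY-f f)))

    shoreY : ∀ v → Shore (λ w → clsY w == clsY v)
    shoreY v with bool? (Y v)
    ... | inj₁ yv = trans (E-cong (Cl-Y yv) (λ w → cong not (Cl-Y yv w))) (proj₁ (M-sub v yv))
    ... | inj₂ f = trans (E-cong {A = λ w → clsY w == clsY v} {C = ∁ Y} (λ w → trans (cong (clsY w ==_) (clsY-f f)) (Cl-∁ w))
           (λ w → cong not (trans (cong (clsY w ==_) (clsY-f f)) (Cl-∁ w)))) (trans (∂-∁ Y) sY)

    pieceY : Piece
    pieceY = record { cls = clsY ; cls-idem = idem ; shore = shoreY ; pieces = piecesY }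

    three-reps : 3 ≤ # (λ q → clsY q == q)
    three-reps = let (v , yv) = shore-∃ {Y} sY ; (w , h) = proj₂ (proj₂ (M-sub v yv)) ; yw = ∧-l {Y w} h in
      #≥length (λ q → clsY q == q) (y₀ ∷ clsY v ∷ clsY w ∷ [])
        (is y₀ (clsY-f y₀∉) ∷ is (clsY v) (idem v) ∷ is (clsY w) (idem w) ∷ [])
        (((λ e → true≢false (clsY-Y yv) (trans (cong Y (sym e)) y₀∉)) ∷ (λ e → true≢false (clsY-Y yw) (trans (cong Y (sym e)) y₀∉)) ∷ []) ∷
         ((λ e → true≢false (clsY-M yv (sym e)) (not-t (∧-r {Y w} h))) ∷ []) ∷ [] ∷ [])
      where
      is : ∀ q → clsY q ≡ q → (clsY q == q) ≡ true
      is q e = trans (cong (_== q) e) (==-refl q)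

-- Isomorphism with a cubic graph from a full list of vertices and its edges

All-at : ∀ {A : Set} {P : A → Set} {xs : List A} → All P xs → ∀ i → P (lookup xs i)
All-at (p ∷ _) zero = p
All-at (_ ∷ ps) (suc i) = All-at ps i

All-from : ∀ {A : Set} {P : A → Set} (xs : List A) → (∀ i → P (lookup xs i)) → All P xs
All-from [] h = []
All-from (x ∷ xs) h = h zero ∷ All-from xs (h ∘ suc)

lookup-injective : ∀ {A : Set} {xs : List A} → Unique xs → ∀ i j → lookup xs i ≡ lookup xs j → i ≡ j
lookup-injective (_ ∷ _) zero zero _ = refl
lookup-injective (p ∷ _) zero (suc j) e = ⊥-elim (All-at p j e)
lookup-injective (p ∷ _) (suc i) zero e = ⊥-elim (All-at p i (sym e))
lookup-injective (_ ∷ ps) (suc i) (suc j) e = cong suc (lookup-injective ps i j e)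

ι-injective : ∀ {a b} → ι a ≡ ι b → a ≡ b
ι-injective {true} {true} _ = refl
ι-injective {false} {false} _ = refl

fromEdges-⊆ : ∀ {k n} (G : Graph n) (f : Fin k → Fin n) → Symmetric G → (es : List (Fin k × Fin k)) →
  All (λ e → G (f (proj₁ e)) (f (proj₂ e)) ≡ true) es → ∀ i j → fromEdges es i j ≡ true → G (f i) (f j) ≡ true
fromEdges-⊆ G f sG ((a , b) ∷ es) (g ∷ gs) i j h with ∨-e {(a == i ∧ b == j) ∨ (a == j ∧ b == i)} h
... | inj₂ r = fromEdges-⊆ G f sG es gs i j r
... | inj₁ e with isE-e {u = a} {b} {i} {j} e
...   | inj₁ (refl , refl) = g
...   | inj₂ (refl , refl) = trans (sG (f b) (f a)) g

-- The list exhausts the vertices, and an edge-preserving bijection between cubic graphs leaves no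
-- degree for further edges.
isomorphic : ∀ {n} (G : Graph n) → Cubic G → (xs : List (Fin n)) → Unique xs → n ≤ length xs →
  (H : Graph (length xs)) → (∀ i → count (H i) ≡ 3) →
  (∀ i j → H i j ≡ true → G (lookup xs i) (lookup xs j) ≡ true) → G ≅ H
isomorphic {n} G cubic xs U small H degH edges = mk↔ₛ′ idx f (λ i → lookup-injective U _ _ (f-idx (f i))) f-idx , λ u v →
    trans (cong₂ G (sym (f-idx u)) (sym (f-idx v))) (same (idx u) (idx v))
  where
  f : Fin (length xs) → Fin n
  f = lookup xs
  find : ∀ v → ∃ λ i → f i ≡ v
  find v with Fin.any? (λ i → f i ≟ v)
  ... | yes p = p
  ... | no ¬p = ⊥-elim (<-irrefl refl (≤-trans (#≥length (λ _ → true) (v ∷ xs) (All-from (v ∷ xs) (λ _ → refl))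
          (All-from xs (λ i e → ¬p (i , sym e)) ∷ U)) (≤-trans (≤r (#-all n)) small)))
  idx : Fin n → Fin (length xs)
  idx v = proj₁ (find v)
  f-idx : ∀ v → f (idx v) ≡ v
  f-idx v = proj₂ (find v)
  same : ∀ i j → G (f i) (f j) ≡ H i j
  same i j = ι-injective (squeeze (λ j → ι (G (f i) (f j))) (λ j → ι (H i j)) (λ j → ι-mono (edges i j)) le j)
    where
    le : sum (λ j → ι (G (f i) (f j))) ≤ sum (λ j → ι (H i j))
    le = begin
      sum (λ j → ι (G (f i) (f j)))                                   ≡⟨ fibre f (λ j → ι (G (f i) (f j))) ⟩
      sum (λ v → sum (λ j → ι (f j == v) * ι (G (f i) (f j))))        ≤⟨ sum-mono row ⟩
      sum (λ v → ι (G (f i) v))                                       ≡⟨ trans (sym (count≡# (G (f i)))) (cubic (f i)) ⟩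
      3                                                               ≡⟨ trans (sym (degH i)) (count≡# (H i)) ⟩
      sum (λ j → ι (H i j))                                           ∎
      where
      open ≤-Reasoning
      row : ∀ v → sum (λ j → ι (f j == v) * ι (G (f i) (f j))) ≤ ι (G (f i) v)
      row v = ≤-trans (sum-mono {g = λ j → ι (idx v == j) * ι (G (f i) v)} pt) (≤r (sum-delta (idx v) (λ _ → ι (G (f i) v))))
        where
        pt : ∀ j → ι (f j == v) * ι (G (f i) (f j)) ≤ ι (idx v == j) * ι (G (f i) v)
        pt j with same? (f j) v
        ... | inj₂ ne rewrite ==-≢ ne = z≤n
        ... | inj₁ e = ≤-trans (*-mono-≤ (ι≤1 (f j == v)) (≤r (cong (λ w → ι (G (f i) w)) e)))
              (≤r (cong (λ b → ι b * ι (G (f i) v)) (sym (trans (cong (_== j) (lookup-injective U (idx v) j (trans (f-idx v) (sym e)))) (==-refl j)))))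

-- Matchings as lists

module _ {n : ℕ} (μ : Fin n → Fin n) (inv : Involution μ) where

  low? : ∀ v → Dec (lt v (μ v) ≡ true)
  low? v = lt v (μ v) Bool.≟ true

  pairs : List (Fin n) → List (Fin n × Fin n)
  pairs = map (λ v → v , μ v)

  lt-asym : ∀ (v w : Fin n) → lt v w ≡ true → lt w v ≡ true → ⊥
  lt-asym v w p q = <-asym (<ᵇ⇒< (toℕ v) (toℕ w) (subst T (sym p) tt)) (<ᵇ⇒< (toℕ w) (toℕ v) (subst T (sym q) tt))

  fresh : ∀ {x xs} → All (x ≢_) xs → All (λ v → lt v (μ v) ≡ true) xs → lt x (μ x) ≡ true →
    All (x ≢_) (endpoints (pairs xs)) × All (μ x ≢_) (endpoints (pairs xs))
  fresh [] [] l = [] , []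
  fresh {x} {y ∷ _} (ne ∷ nes) (l' ∷ ls) l = let (p , q) = fresh nes ls l in
      (ne ∷ (λ { refl → lt-asym y (μ y) l' (trans (cong (lt (μ y)) (sym (inv y))) l) }) ∷ p) ,
      ((λ { refl → lt-asym x (μ x) l (trans (cong (lt (μ x)) (sym (inv x))) l') }) ∷ (λ e → ne (trans (sym (inv x)) (trans (cong μ e) (inv y)))) ∷ q)

  endpoints-unique : ∀ {xs} → Unique xs → All (λ v → lt v (μ v) ≡ true) xs → Unique (endpoints (pairs xs))
  endpoints-unique [] [] = []
  endpoints-unique {x ∷ _} (nes ∷ us) (l ∷ ls) = let (p , q) = fresh nes ls l in
    ((λ e → lt-asym x (μ x) l (subst₂ (λ a b → lt a b ≡ true) e (sym e) l)) ∷ p) ∷ q ∷ endpoints-unique us ls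

  -- Each matching edge is represented once, by its smaller end.
  lows : List (Fin n)
  lows = filter low? (allFin n)

  length-lows : length (pairs lows) ≡ # (λ v → lt v (μ v))
  length-lows = trans (length-map (λ v → v , μ v) lows) (trans (go (allFin n)) (list-sum (λ v → ι (lt v (μ v)))))
    where
    go : ∀ xs → length (filter low? xs) ≡ List.sum (map (λ v → ι (lt v (μ v))) xs)
    go [] = refl
    go (x ∷ xs) with lt x (μ x)
    ... | true = cong suc (go xs)
    ... | false = go xs

-- Induction over shores, and the exceptional graphs.

module Final {n} (G : Graph n) (simple : IsSimple G) (cubic : Cubic G) (brick : Brick G) where
  open Analysis G simple cubic brick public

  RM-id : ∀ X → RM X id
  RM-id X = record { inv = λ _ → refl ; edge = λ v ne → ⊥-elim (ne refl) ; inside = λ v ne → ⊥-elim (ne refl) }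

  RM-inside : ∀ {X μ} → RM X μ → ∀ v → μ v ≢ v → X (μ v) ≡ true
  RM-inside R v ne = RM.inside R _ (λ e → ne (trans (sym e) (RM.inv R v)))

  RM-⊆ : ∀ {X Y μ} → X ⊆ Y → RM X μ → RM Y μ
  RM-⊆ h R = record { inv = RM.inv R ; edge = RM.edge R ; inside = λ v ne → h v (RM.inside R v ne) }

  Good-≗ : ∀ {X Y} → (∀ v → X v ≡ Y v) → Good X → Good Y
  Good-≗ {X} {Y} e (μ , R , h) = μ , RM-⊆ (λ v x → trans (sym (e v)) x) R , subst (λ k → 2 * (k + 2) ≤ 7 * moved μ) (#-cong e) h

  -- The supports are disjoint and each matching preserves its own, so at every vertex the composite
  -- acts like one of the two.
  merge : ∀ {X Y μ ν} → RM X μ → RM Y ν → (∀ v → X v ≡ true → Y v ≡ true → ⊥) → ∃ λ ρ → RM (X ∪ Y) ρ × moved ρ ≡ moved μ + moved ν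
  merge {X} {Y} {μ} {ν} R S disj = μ ∘ ν , record { inv = invol' ; edge = edge' ; inside = inside' } , trans (sum-cong count') (sum-+ (λ v → ι (not (μ v == v))) _)
    where
    cases : ∀ v → (μ v ≢ v × ν v ≡ v) ⊎ (μ v ≡ v × ν v ≢ v × μ (ν v) ≡ ν v) ⊎ (μ v ≡ v × ν v ≡ v)
    cases v with same? (μ v) v | same? (ν v) v
    ... | inj₁ p | inj₁ q = inj₂ (inj₂ (p , q))
    ... | inj₂ p | inj₁ q = inj₁ (p , q)
    ... | inj₁ p | inj₂ q = inj₂ (inj₁ (p , q , (case same? (μ (ν v)) (ν v) of λ
          { (inj₁ e) → e ; (inj₂ ne) → ⊥-elim (disj (ν v) (RM.inside R (ν v) ne) (RM-inside S v q)) })))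
    ... | inj₂ p | inj₂ q = ⊥-elim (disj v (RM.inside R v p) (RM.inside S v q))
    val : ∀ {v} → ν v ≡ v → μ (ν v) ≡ μ v
    val e = cong μ e
    invol' : ∀ v → μ (ν (μ (ν v))) ≡ v
    invol' v with cases v
    ... | inj₁ (p , q) = trans (cong (λ z → μ (ν z)) (val q)) (trans (cong μ νμ) (RM.inv R v))
      where
      νμ : ν (μ v) ≡ μ v
      νμ = case same? (ν (μ v)) (μ v) of λ { (inj₁ e) → e ; (inj₂ ne) → ⊥-elim (disj (μ v) (RM-inside R v p) (RM.inside S (μ v) ne)) }
    ... | inj₂ (inj₁ (p , q , r)) = trans (cong (λ z → μ (ν z)) r) (trans (cong μ (RM.inv S v)) p)
    ... | inj₂ (inj₂ (p , q)) = trans (cong (λ z → μ (ν z)) (trans (val q) p)) (trans (val q) p)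
    edge' : ∀ v → μ (ν v) ≢ v → good v (μ (ν v)) ≡ true
    edge' v ne with cases v
    ... | inj₁ (p , q) = trans (cong (good v) (val q)) (RM.edge R v p)
    ... | inj₂ (inj₁ (p , q , r)) = trans (cong (good v) r) (RM.edge S v q)
    ... | inj₂ (inj₂ (p , q)) = ⊥-elim (ne (trans (val q) p))
    inside' : ∀ v → μ (ν v) ≢ v → X v ∨ Y v ≡ true
    inside' v ne with cases v
    ... | inj₁ (p , q) = ∨-l (RM.inside R v p)
    ... | inj₂ (inj₁ (p , q , r)) = ∨-r {X v} (RM.inside S v q)
    ... | inj₂ (inj₂ (p , q)) = ⊥-elim (ne (trans (val q) p))
    count' : ∀ v → ι (not (μ (ν v) == v)) ≡ ι (not (μ v == v)) + ι (not (ν v == v))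
    count' v with cases v
    ... | inj₁ (p , q) rewrite q | ==-≢ p | ==-refl v = refl
    ... | inj₂ (inj₁ (p , q , r)) rewrite p | r | ==-≢ q | ==-refl v = refl
    ... | inj₂ (inj₂ (p , q)) rewrite q | p | ==-refl v = refl

  module Step (Y : VSet n) (sY : Shore Y) (Y≥2 : 2 ≤ # Y) (co≥2 : 2 ≤ # (∁ Y)) where
    open Below Y sY Y≥2 public
    open InPiece pieceY public

    rep-y₀ : cls y₀ ≡ y₀
    rep-y₀ = clsY-f y₀∉

    sing-Y : ∀ {v} → sing v ≡ true → Y v ≡ true
    sing-Y {v} s = ¬false λ f → let (p , q , hp , hq , pq) = #-∃₂ (∁ Y) co≥2 in
      pq (trans (sing-t s p (trans (clsY-f (not-t hp)) (sym (clsY-f f)))) (sym (sing-t s q (trans (clsY-f (not-t hq)) (sym (clsY-f f))))))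

    big-y₀ : big y₀ ≡ true
    big-y₀ = ∧-i (trans (cong (_== y₀) rep-y₀) (==-refl y₀)) (not-f (¬true λ s → true≢false (sing-Y s) y₀∉))

    D≥1 : 1 ≤ D
    D≥1 = #≥1 big y₀ big-y₀

    D' : ℕ
    D' = # (λ q → big q ∧ Y q)

    D-split : D ≡ suc D'
    D-split = trans (#-─ big y₀ big-y₀) (cong suc (#-cong {P = big ─ y₀} {λ q → big q ∧ Y q} λ q → bool-iff
      (λ h → let (b , ne) = ─-∈ {P = big} h in ∧-i b (¬false λ f → ne (trans (sym (clsY-f f)) (==-≡ (∧-l b)))))
      (λ h → ∧-i {big q} {not (q == y₀)} (∧-l {big q} {Y q} h) (not-f (==-≢ λ { refl → true≢false (∧-r {big q} h) y₀∉ })))))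

    Y-cls : ∀ {v q} → cls v ≡ q → Y q ≡ true → Y v ≡ true
    Y-cls {v} refl yq = ¬false λ f → true≢false yq (trans (cong Y (clsY-f f)) y₀∉)

    Cl-Y⊆ : ∀ {q} → Y q ≡ true → Cl q ⊆ Y
    Cl-Y⊆ yq v h = Y-cls (==-≡ h) yq

    T' : ℕ
    T' = sum (λ q → ι (big q ∧ Y q) * # (Cl q))

    Y-size : # Y ≤ # sing + T'
    Y-size = ≤-trans (≤-trans (sum-mono pt) (≤r (sum-+ (λ v → ι (sing v)) (λ v → ι (not (sing v) ∧ Y v)))))
        (+-monoʳ-≤ (# sing) (≤-trans (≤r (fibre cls (λ v → ι (not (sing v) ∧ Y v)))) (sum-mono per)))
      where
      pt : ∀ v → ι (Y v) ≤ ι (sing v) + ι (not (sing v) ∧ Y v)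
      pt v = bool≤ (Y v ∷ sing v ∷ []) (λ { (y ∷ s ∷ []) → ι y }) (λ { (y ∷ s ∷ []) → ι s + ι (not s ∧ y) })
      per : ∀ q → sum (λ v → ι (cls v == q) * ι (not (sing v) ∧ Y v)) ≤ ι (big q ∧ Y q) * # (Cl q)
      per q = ≤-trans (sum-mono {g = λ v → ι (big q ∧ Y q) * ι (Cl q v)} row) (≤r (sym (*-distrib-sum (ι (big q ∧ Y q)) (λ v → ι (Cl q v)))))
        where
        row : ∀ v → ι (cls v == q) * ι (not (sing v) ∧ Y v) ≤ ι (big q ∧ Y q) * ι (Cl q v)
        row v = case same? (cls v) q of λ
          { (inj₂ ne) → ≤-trans (≤r (cong (λ b → ι b * ι (not (sing v) ∧ Y v)) (==-≢ ne))) z≤n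
          ; (inj₁ e) → ≤-trans (≤r (*-comm (ι (cls v == q)) _)) (*-monoˡ-≤ (ι (cls v == q)) (ι-mono (λ h →
              subst (λ z → big z ∧ Y z ≡ true) e (∧-i (big-cls (not-t (∧-l h))) (clsY-Y (∧-r {not (sing v)} h)))))) }

    module Combine (N : Fin n → Fin n) (RN : RM sing N) (good-classes : ∀ q → big q ≡ true → Y q ≡ true → Good (Cl q)) where

      opaque
        -- The identity at all other indices lets the sums below run over the whole of `Fin n`.
        family : ∀ q → ∃ λ μ → RM (Cl q) μ × ((big q ∧ Y q) ≡ false → ∀ v → μ v ≡ v) × ((big q ∧ Y q) ≡ true → 2 * (# (Cl q) + 2) ≤ 7 * moved μ)
        family q with bool? (big q ∧ Y q)
        ... | inj₁ t = let (μ , R , h) = good-classes q (∧-l t) (∧-r {big q} t) in μ , R , (λ f → ⊥-elim (true≢false t f)) , λ _ → h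
        ... | inj₂ f = id , RM-id (Cl q) , (λ _ _ → refl) , λ t → ⊥-elim (true≢false t f)

      F : Fin n → Fin n → Fin n
      F q = proj₁ (family q)

      RF : ∀ q → RM (Cl q) (F q)
      RF q = proj₁ (proj₂ (family q))

      F-id : ∀ q → (big q ∧ Y q) ≡ false → ∀ v → F q v ≡ v
      F-id q = proj₁ (proj₂ (proj₂ (family q)))

      F-big : ∀ q → (big q ∧ Y q) ≡ true → 2 * (# (Cl q) + 2) ≤ 7 * moved (F q)
      F-big q = proj₂ (proj₂ (proj₂ (family q)))

      O : Fin n → Fin n
      O v = F (cls v) v

      O-cls : ∀ v → cls (O v) ≡ cls v
      O-cls v with same? (O v) v
      ... | inj₁ e = cong cls e
      ... | inj₂ ne = ==-≡ (RM-inside (RF (cls v)) v ne)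

      O-moved : ∀ {v} → O v ≢ v → big (cls v) ∧ Y (cls v) ≡ true
      O-moved {v} ne = ¬false λ f → ne (F-id (cls v) f v)

      nonsing : VSet n
      nonsing v = not (sing v) ∧ Y v

      RO : RM nonsing O
      RO = record { inv = λ v → trans (cong (λ q → F q (O v)) (O-cls v)) (RM.inv (RF (cls v)) v)
        ; edge = λ v ne → RM.edge (RF (cls v)) v ne
        ; inside = λ v ne → let t = O-moved {v} ne in ∧-i (not-f (trans (sym (sing-cong (cls-idem v))) (not-t (∧-r {rep (cls v)} (∧-l {big (cls v)} t))))) (Y-cls refl (∧-r {big (cls v)} t)) }

      moved-O : 2 * T' + 4 * D' ≤ 7 * moved O
      moved-O = begin
        2 * T' + 4 * D'
          ≡⟨ cong₂ _+_ (*-distrib-sum 2 (λ q → ι (big q ∧ Y q) * # (Cl q))) (*-distrib-sum 4 (λ q → ι (big q ∧ Y q))) ⟩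
        sum (λ q → 2 * (ι (big q ∧ Y q) * # (Cl q))) + sum (λ q → 4 * ι (big q ∧ Y q))
          ≡⟨ sum-+ (λ q → 2 * (ι (big q ∧ Y q) * # (Cl q))) (λ q → 4 * ι (big q ∧ Y q)) ⟨
        sum (λ q → 2 * (ι (big q ∧ Y q) * # (Cl q)) + 4 * ι (big q ∧ Y q))
          ≤⟨ sum-mono per ⟩
        sum (λ q → 7 * moved (F q))
          ≡⟨ *-distrib-sum 7 (λ q → moved (F q)) ⟨
        7 * sum (λ q → moved (F q))
          ≡⟨ cong (7 *_) (sym (trans (fibre cls (λ v → ι (not (O v == v)))) (sum-cong (λ q → sum-cong (row q))))) ⟩
        7 * moved O ∎
        where
        open ≤-Reasoning
        per' : ∀ q → big q ∧ Y q ≡ true ⊎ big q ∧ Y q ≡ false → 2 * (ι (big q ∧ Y q) * # (Cl q)) + 4 * ι (big q ∧ Y q) ≤ 7 * moved (F q)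
        per' q (inj₂ f) = ≤-trans (≤r (cong (λ b → 2 * (ι b * # (Cl q)) + 4 * ι b) f)) z≤n
        per' q (inj₁ t) = ≤-trans (≤r (trans (cong (λ b → 2 * (ι b * # (Cl q)) + 4 * ι b) t) (linear (# (Cl q) ∷ []) (2 ⊗ (1 ⊗ x0) ⊕ con 4) (2 ⊗ (x0 ⊕ con 2))))) (F-big q t)
        per : ∀ q → 2 * (ι (big q ∧ Y q) * # (Cl q)) + 4 * ι (big q ∧ Y q) ≤ 7 * moved (F q)
        per q = per' q (bool? (big q ∧ Y q))
        row' : ∀ q v → cls v ≡ q ⊎ cls v ≢ q → ι (cls v == q) * ι (not (O v == v)) ≡ ι (not (F q v == v))
        row' q v (inj₁ refl) = trans (cong (λ b → ι b * ι (not (O v == v))) (==-refl (cls v))) (+-identityʳ _)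
        row' q v (inj₂ ne) = trans (cong (λ b → ι b * ι (not (O v == v))) (==-≢ ne)) (sym (ι-false (¬true λ h → ne (==-≡ (RM.inside (RF q) v (==-≡f (not-t h)))))))
        row : ∀ q v → ι (cls v == q) * ι (not (O v == v)) ≡ ι (not (F q v == v))
        row q v = row' q v (same? (cls v) q)

      -- Each nontrivial class inside `Y` hands over a surplus of 4. The 8 consists of the 4 that
      -- `Y` itself must show and the 4 credited to the class of `∁ Y`, which is counted in `D` but
      -- brings no matching.
      combine-good : 2 * # sing + 8 ≤ 7 * moved N + 4 * D → Good Y
      combine-good h = let (ρ , R , e) = merge RN RO (λ v s ns → true≢false s (not-t (∧-l ns))) in
        ρ , RM-⊆ (λ v z → case ∨-e {sing v} z of λ { (inj₁ s) → sing-Y s ; (inj₂ ns) → ∧-r {not (sing v)} ns }) R ,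
        prove (# Y ∷ moved ρ ∷ moved N ∷ moved O ∷ T' ∷ D' ∷ # sing ∷ D ∷ []) (2 ⊗ (x0 ⊕ con 2)) (7 ⊗ x1) 1
          ((7 , x2 ⊕ x3 , x1) ∷ (1 , 2 ⊗ x4 ⊕ 4 ⊗ x5 , 7 ⊗ x3) ∷ (1 , 2 ⊗ x6 ⊕ con 8 , 7 ⊗ x2 ⊕ 4 ⊗ x7) ∷ (4 , x7 , con 1 ⊕ x5) ∷ (2 , x0 , x6 ⊕ x4) ∷ [])
          (≥r e , moved-O , h , ≤r D-split , Y-size , tt)

    open Analyse y₀ three-reps D≥1 public

    -- The only nontrivial class is `∁ Y`, so `Y` consists of singletons; oddness excludes size 2.
    prism-3 : # sing ≡ 3 → D ≡ 1 → # Y ≡ 3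
    prism-3 r3 d1 = go (# Y) Y≥2 (≤-trans Y-size (≤-trans (+-monoʳ-≤ (# sing) T≤0) (≤r (trans (+-identityʳ _) r3)))) (shore-odd {Y} sY)
      where
      D'0 : D' ≡ 0
      D'0 = suc-injective (trans (sym D-split) d1)
      T≤0 : T' ≤ 0
      T≤0 = ≤-trans (sum-mono {g = λ _ → 0} (λ q → ≤r (cong (λ b → ι b * # (Cl q)) (#-0 (λ q → big q ∧ Y q) D'0 q)))) (≤r (sum-0 n))
      go : ∀ k → 2 ≤ k → k ≤ 3 → Odd k → k ≡ 3
      go 0 () _ _
      go 1 (s≤s ()) _ _
      go 2 _ _ o = ⊥-elim (¬even-odd (even 1) o)
      go 3 _ _ _ = refl
      go (suc (suc (suc (suc _)))) _ (s≤s (s≤s (s≤s ()))) _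

    class-shore : ∀ {q} → big q ≡ true → Shore (Cl q) × 2 ≤ # (Cl q) × 2 ≤ # (∁ (Cl q))
    class-shore {q} b = let e = ==-≡ (∧-l {rep q} b) in rep-shore (∧-l b) , subst (λ z → 2 ≤ # (Cl z)) e (sing-f (not-t (∧-r {rep q} b))) , subst (λ z → 2 ≤ # (∁ (Cl z))) e (co q)

    class-small : ∀ {q} → big q ≡ true → Y q ≡ true → # (Cl q) < # Y
    class-small {q} b yq = let (w , h) = proj₂ (proj₂ (M-sub q yq)) in
      ≤-trans (s≤s (#-mono {P = Cl q} {Y ─ w} λ v c → ∧-i (Cl-Y⊆ yq v c) (not-f (==-≢ λ e →
            true≢false (clsY-M yq (trans (==-≡ c) (sym (==-≡ (∧-l {rep q} b))))) (trans (cong (M q yq) e) (not-t (∧-r {Y w} h)))))))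
          (≤r (sym (#-─ Y w (∧-l h))))

    rich-good : (∀ z → sing z ≡ false → # (Cl (cls z)) ≡ 3 → Good (Cl (cls z))) → ∀ q → big q ≡ true →
      # (Cl q) ≡ 3 ⊎ Good (Cl q) → Good (Cl q)
    rich-good tri q b (inj₂ g) = g
    rich-good tri q b (inj₁ e) = subst (λ z → Good (Cl z)) cq (tri q (not-t (∧-r {rep q} b)) (trans (cong (λ z → # (Cl z)) cq) e))
      where
      cq : cls q ≡ q
      cq = ==-≡ (∧-l {rep q} b)

    module LadderCase (Ld : Ladder) where
      open Ladder Ld public

      inner : ∃ λ q → big q ∧ Y q ≡ true
      inner = #-∃ (λ q → big q ∧ Y q) (≥r (suc-injective (trans (sym D-split) D≡2)))

      z : Fin n
      z = proj₁ inner

      bz : big z ≡ true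
      bz = ∧-l {big z} (proj₂ inner)

      cz : cls z ≡ z
      cz = ==-≡ (∧-l {rep z} bz)

      Yz : Y z ≡ true
      Yz = ∧-r {big z} (proj₂ inner)

      only-z : ∀ q → big q ≡ true → Y q ≡ true → z ≡ q
      only-z q b y = #≤1-unique (λ q → big q ∧ Y q) (≤r (suc-injective (trans (sym D-split) D≡2))) (proj₂ inner) (∧-i b y)

      Y-z : ∀ v → Y v ≡ true → sing v ≡ true ⊎ Cl z v ≡ true
      Y-z v yv = case bool? (sing v) of λ
        { (inj₁ s) → inj₁ s
        ; (inj₂ s) → inj₂ (trans (cong (_== z) (sym (only-z (cls v) (big-cls s) (clsY-Y yv)))) (==-refl z)) }

      size : # Y ≤ 2 + # (Cl z)
      size = ≤-trans (≤-trans (sum-mono {g = λ v → ι (sing v) + ι (Cl z v)} pt) (≤r (sum-+ (λ v → ι (sing v)) _))) (≤r (cong (_+ # (Cl z)) r≡2))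
        where
        pt : ∀ v → ι (Y v) ≤ ι (sing v) + ι (Cl z v)
        pt v = ι-≤ λ y → case Y-z v y of λ { (inj₁ s) → ≤-trans (≥r (ι-true s)) (m≤m+n _ _) ; (inj₂ s) → ≤-trans (≥r (ι-true s)) (m≤n+m _ (ι (sing v))) }

      bc-matching : ∃ λ μ → RM sing μ × 2 ≤ moved μ
      bc-matching = single-edge sing sb sc g

      with-good : Good (Cl z) → Good Y
      with-good gz = let (N , RN , m) = bc-matching in Combine.combine-good N RN (λ q b y → subst (λ w → Good (Cl w)) (only-z q b y) gz)
        (prove (# sing ∷ moved N ∷ D ∷ []) (2 ⊗ x0 ⊕ con 8) (7 ⊗ x1 ⊕ 4 ⊗ x2) 1 ((2 , x0 , con 2) ∷ (7 , con 2 , x1) ∷ (4 , con 2 , x2) ∷ []) (≤r r≡2 , m , ≥r D≡2 , tt))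

      with-tri : # (Cl z) ≡ 3 → Good Y
      with-tri e = edge-good Y (≤-trans size (≤r (cong (2 +_) e))) (sing-Y sb) (sing-Y sc) g

      z-nonsing : ∀ {v} → Cl z v ≡ true → sing v ≡ false
      z-nonsing c = trans (sing-cong (trans (==-≡ c) (sym cz))) (not-t (∧-r {rep z} bz))

      -- Five vertices lie outside `Cl z`: two are covered by its surplus, the three of the triangle
      -- by the edge `b c`.
      surplus : Good (Cl z) → # (∁ Y) ≡ 3 → ∃ λ μ → RM all μ × 2 * n ≤ 7 * moved μ
      surplus (ν , Rν , h) e = let (N , RN , m) = bc-matching
                                   (ρ , R , r) = merge RN Rν (λ v s c → true≢false s (z-nonsing c)) in
        ρ , RM-⊆ (λ _ _ → refl) R , prove (n ∷ # Y ∷ # (∁ Y) ∷ # (Cl z) ∷ moved ρ ∷ moved N ∷ moved ν ∷ []) (2 ⊗ x0) (7 ⊗ x4) 1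
          ((2 , x0 , x1 ⊕ x2) ∷ (2 , x2 , con 3) ∷ (2 , x1 , con 2 ⊕ x3) ∷ (1 , 2 ⊗ (x3 ⊕ con 2) , 7 ⊗ x6) ∷ (7 , con 2 , x5) ∷ (7 , x5 ⊕ x6 , x4) ∷ [])
          (≥r (trans (#-∁ Y) (#-all n)) , ≤r e , size , h , m , ≥r r , tt)

      -- Each of `b`, `c` sends one edge to either triangle, as two edges into the same class would
      -- close up the piece. The remaining vertices of the two triangles must then be joined to each
      -- other.
      is-R8 : # (Cl z) ≡ 3 → # (∁ Y) ≡ 3 → G ≅ R8
      is-R8 z3 c3 = build (ends sb sc b≢c) (ends sc sb (b≢c ∘ sym))
        where
        A B : VSet n
        A = ∁ Y
        B = Cl z
        module A = Triangle A (trans (∂-∁ Y) sY) c3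
        module B = Triangle B (rep-shore (∧-l bz)) z3
        gbc : G b c ≡ true
        gbc = good-G g
        A-cls : ∀ {v} → A v ≡ true → cls v ≡ y₀
        A-cls h = clsY-f (not-t h)
        A-B : ∀ {v w} → A v ≡ true → B w ≡ true → v ≢ w
        A-B av bw refl = true≢false (Cl-Y⊆ Yz _ bw) (not-t av)
        A-s : ∀ {v w} → A v ≡ true → sing w ≡ true → v ≢ w
        A-s av sw refl = true≢false (sing-Y sw) (not-t av)
        B-s : ∀ {v w} → B v ≡ true → sing w ≡ true → v ≢ w
        B-s bv sw refl = true≢false sw (z-nonsing bv)
        once : ∀ {x x' s t} → sing x ≡ true → sing x' ≡ true → x ≢ x' → G x s ≡ true → G x t ≡ true → s ≢ x' → s ≢ t → cls s ≢ cls t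
        once {x} {x'} {s} {t} sx sx' ne gs gt sx'' st e = case one-edge gs gt refl e (λ r → G≢ gs (sym (sing-t sx s (sym r)))) (λ _ → st) x' of λ
          { (inj₁ r) → ne (sym (sing-t sx x' r)) ; (inj₂ r) → sx'' (sing-t sx' s (sym r)) }
        locate : ∀ {v x x'} → sing x ≡ true → sing x' ≡ true → x ≢ x' → v ≢ x → v ≢ x' → A v ≡ true ⊎ B v ≡ true
        locate {v} {x} {x'} sx sx' ne vx vx' = case bool? (Y v) of λ { (inj₂ f) → inj₁ (not-f f) ; (inj₁ y) → case Y-z v y of λ
          { (inj₂ c) → inj₂ c ; (inj₁ s) → ⊥-elim (<-irrefl refl (≤-trans (#≥length sing (v ∷ x ∷ x' ∷ []) (s ∷ sx ∷ sx' ∷ []) ((vx ∷ vx' ∷ []) ∷ (ne ∷ []) ∷ [] ∷ [])) (≤r r≡2))) } }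
        Ends : Fin n → Set
        Ends x = ∃ λ p → ∃ λ q → A p ≡ true × B q ≡ true × G x p ≡ true × G x q ≡ true
        ends : ∀ {x x'} → sing x ≡ true → sing x' ≡ true → x ≢ x' → Ends x
        ends {x} {x'} sx sx' ne = let (s , t , hs , ht , st) = #-∃₂ (G x ─ x') two-left
                                      (gs , xs) = ─-∈ {P = G x} hs
                                      (gt , xt) = ─-∈ {P = G x} ht in
            pick gs gt (xs ∘ sym) (xt ∘ sym) st (locate sx sx' ne (G≢ gs ∘ sym) (xs ∘ sym)) (locate sx sx' ne (G≢ gt ∘ sym) (xt ∘ sym))
          where
          two-left : 2 ≤ # (G x ─ x')
          two-left = case bool? (G x x') of λ
            { (inj₁ g) → s≤s⁻¹ (≤-trans (≥r (deg x)) (≤r (#-─ (G x) x' g)))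
            ; (inj₂ f) → ≤-trans (s≤s (s≤s z≤n)) (≤-trans (≥r (deg x)) (#-mono {P = G x} {G x ─ x'} (λ v g → ∧-i g (not-f (==-≢ λ { refl → true≢false g f }))))) }
          pick : ∀ {s t} → G x s ≡ true → G x t ≡ true → s ≢ x' → t ≢ x' → s ≢ t → A s ≡ true ⊎ B s ≡ true → A t ≡ true ⊎ B t ≡ true → Ends x
          pick gs gt xs xt st (inj₁ as) (inj₂ bt) = _ , _ , as , bt , gs , gt
          pick gs gt xs xt st (inj₂ bs) (inj₁ at) = _ , _ , at , bs , gt , gs
          pick gs gt xs xt st (inj₁ as) (inj₁ at) = ⊥-elim (once sx sx' ne gs gt xs st (trans (A-cls as) (sym (A-cls at))))
          pick gs gt xs xt st (inj₂ bs) (inj₂ bt) = ⊥-elim (once sx sx' ne gs gt xs st (trans (==-≡ bs) (sym (==-≡ bt))))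
        degree : ∀ i → count (R8 i) ≡ 3
        degree = toWitness {a? = Fin.all? (λ i → count (R8 i) Nat.≟ 3)} tt
        build : Ends b → Ends c → G ≅ R8
        build (p , q , ap , bq , gp , gq) (p' , q' , ap' , bq' , gp' , gq') = with-third (A.third ap ap' pp')
          where
          s∉A : ∀ {w} → sing w ≡ true → A w ≡ false
          s∉A sw = cong not (sing-Y sw)
          s∉B : ∀ {w} → sing w ≡ true → B w ≡ false
          s∉B sw = ¬true λ h → B-s h sw refl
          pp' : p ≢ p'
          pp' refl = b≢c (A.outer-unique ap (s∉A sb) (flipG gp) (s∉A sc) (flipG gp'))
          qq' : q ≢ q'
          qq' refl = b≢c (B.outer-unique bq (s∉B sb) (flipG gq) (s∉B sc) (flipG gq'))
          with-third : (∃ λ r → A r ≡ true × p ≢ r × p' ≢ r) → G ≅ R8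
          with-third (r , ar , pr , p'r) = with-outer (A.outer ar)
            where
            with-outer : (∃ λ t → A t ≡ false × G r t ≡ true) → G ≅ R8
            with-outer (t , at , grt) = finish (locate sb sc b≢c tb tc)
              where
              tb : t ≢ b
              tb refl = once sb sc b≢c gp (flipG grt) (A-s ap sc) pr (trans (A-cls ap) (sym (A-cls ar)))
              tc : t ≢ c
              tc refl = once sc sb (b≢c ∘ sym) gp' (flipG grt) (A-s ap' sb) p'r (trans (A-cls ap') (sym (A-cls ar)))
              finish : A t ≡ true ⊎ B t ≡ true → G ≅ R8
              finish (inj₁ h) = ⊥-elim (true≢false h at)
              finish (inj₂ bt) = isomorphic G cubic xs U small R8 degree (fromEdges-⊆ G (lookup xs) symG
                  ((♯ 0 , ♯ 1) ∷ (♯ 0 , ♯ 2) ∷ (♯ 1 , ♯ 2) ∷ (♯ 3 , ♯ 4) ∷ (♯ 3 , ♯ 5) ∷ (♯ 4 , ♯ 5) ∷ (♯ 2 , ♯ 5)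
                    ∷ (♯ 0 , ♯ 6) ∷ (♯ 6 , ♯ 3) ∷ (♯ 1 , ♯ 7) ∷ (♯ 7 , ♯ 4) ∷ (♯ 6 , ♯ 7) ∷ [])
                  (A.adjacent ap ap' pp' ∷ A.adjacent ap ar pr ∷ A.adjacent ap' ar p'r ∷ B.adjacent bq bq' qq' ∷ B.adjacent bq bt qt ∷ B.adjacent bq' bt q't ∷ grt
                    ∷ flipG gp ∷ gq ∷ flipG gp' ∷ gq' ∷ gbc ∷ []))
                where
                B-out : ∀ {w} → A w ≡ true → B w ≡ false
                B-out aw = ¬true λ h → A-B aw h refl
                qt : q ≢ t
                qt refl = A-s ar sb (sym (B.outer-unique bq (s∉B sb) (flipG gq) (B-out ar) (flipG grt)))
                q't : q' ≢ t
                q't refl = A-s ar sc (sym (B.outer-unique bq' (s∉B sc) (flipG gq') (B-out ar) (flipG grt)))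
                xs : List (Fin n)
                xs = p ∷ p' ∷ r ∷ q ∷ q' ∷ t ∷ b ∷ c ∷ []
                U : Unique xs
                U = (pp' ∷ pr ∷ A-B ap bq ∷ A-B ap bq' ∷ A-B ap bt ∷ A-s ap sb ∷ A-s ap sc ∷ []) ∷
                    (p'r ∷ A-B ap' bq ∷ A-B ap' bq' ∷ A-B ap' bt ∷ A-s ap' sb ∷ A-s ap' sc ∷ []) ∷
                    (A-B ar bq ∷ A-B ar bq' ∷ A-B ar bt ∷ A-s ar sb ∷ A-s ar sc ∷ []) ∷
                    (qq' ∷ qt ∷ B-s bq sb ∷ B-s bq sc ∷ []) ∷ (q't ∷ B-s bq' sb ∷ B-s bq' sc ∷ []) ∷
                    (tb ∷ tc ∷ []) ∷ (b≢c ∷ []) ∷ [] ∷ []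
                small : n ≤ 8
                small = prove (n ∷ # Y ∷ # (∁ Y) ∷ # (Cl z) ∷ []) x0 (con 8) 1
                  ((1 , x0 , x1 ⊕ x2) ∷ (1 , x2 , con 3) ∷ (1 , x1 , con 2 ⊕ x3) ∷ (1 , x3 , con 3) ∷ []) (≥r (trans (#-∁ Y) (#-all n)) , ≤r c3 , size , ≤r z3 , tt)

  shores : ∀ k Y → # Y ≤ k → Shore Y → 2 ≤ # Y → 2 ≤ # (∁ Y) → # Y ≡ 3 ⊎ Good Y
  shores zero Y h _ Y≥2 _ = ⊥-elim (<-irrefl refl (≤-trans (s≤s z≤n) (≤-trans Y≥2 h)))
  shores (suc k) Y h sY Y≥2 co≥2 = go analyse
    where
    open Step Y sY Y≥2 co≥2
    ih : ∀ q → big q ≡ true → Y q ≡ true → # (Cl q) ≡ 3 ⊎ Good (Cl q)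
    ih q b y = let (s , l , c) = class-shore b in shores k (Cl q) (s≤s⁻¹ (≤-trans (class-small b y) h)) s l c
    go : Shape → # Y ≡ 3 ⊎ Good Y
    go (prism r3 d1) = inj₁ (prism-3 r3 d1)
    go (rich tri (N , RN , e)) = inj₂ (Combine.combine-good N RN (λ q b y → rich-good tri q b (ih q b y)) e)
    go (ladder Ld) = inj₂ (case ih z bz Yz of λ { (inj₁ e) → with-tri e ; (inj₂ g) → with-good g })
      where open LadderCase Ld

  is-C6bar : ∀ Y → Shore Y → # Y ≡ 3 → # (∁ Y) ≡ 3 → G ≅ C6bar
  is-C6bar Y sY y3 c3 = let (a , b , c , ya , yb , yc , ab , ac , bc) = #-∃₃ Y (≥r y3) in build ya yb yc ab ac bc (A.outer ya) (A.outer yb) (A.outer yc)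
    where
    module A = Triangle Y sY y3
    module B = Triangle (∁ Y) (trans (∂-∁ Y) sY) c3
    es : List (Fin 6 × Fin 6)
    -- In the complement of the hexagon the even and the odd vertices form triangles, and opposite
    -- vertices are joined.
    es = (♯ 0 , ♯ 2) ∷ (♯ 0 , ♯ 4) ∷ (♯ 2 , ♯ 4) ∷ (♯ 1 , ♯ 3) ∷ (♯ 1 , ♯ 5) ∷ (♯ 3 , ♯ 5) ∷ (♯ 0 , ♯ 3) ∷ (♯ 2 , ♯ 5) ∷ (♯ 4 , ♯ 1) ∷ []
    listed : ∀ i j → C6bar i j ≡ fromEdges es i j
    listed = toWitness {a? = Fin.all? (λ i → Fin.all? (λ j → C6bar i j Bool.≟ fromEdges es i j))} tt
    degree : ∀ i → count (C6bar i) ≡ 3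
    degree = toWitness {a? = Fin.all? (λ i → count (C6bar i) Nat.≟ 3)} tt
    build : ∀ {a b c} → Y a ≡ true → Y b ≡ true → Y c ≡ true → a ≢ b → a ≢ c → b ≢ c →
      (∃ λ t → Y t ≡ false × G a t ≡ true) → (∃ λ t → Y t ≡ false × G b t ≡ true) → (∃ λ t → Y t ≡ false × G c t ≡ true) → G ≅ C6bar
    build {a} {b} {c} ya yb yc ab ac bc (s , ys , gs) (t , yt , gt) (u , yu , gu) = isomorphic G cubic xs U size C6bar degree
        (λ i j h → fromEdges-⊆ G (lookup xs) symG es
          (A.adjacent ya yb ab ∷ A.adjacent ya yc ac ∷ A.adjacent yb yc bc ∷ B.adjacent (not-f yu) (not-f ys) (su ∘ sym) ∷ B.adjacent (not-f yu) (not-f yt) (tu ∘ sym) ∷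
           B.adjacent (not-f ys) (not-f yt) st ∷ gs ∷ gt ∷ gu ∷ []) i j (trans (sym (listed i j)) h))
      where
      xs : List (Fin n)
      -- One triangle takes the even positions; each outer neighbour is placed opposite its partner.
      xs = a ∷ u ∷ b ∷ s ∷ c ∷ t ∷ []
      outs : ∀ {p q x} → Y p ≡ true → Y q ≡ true → Y x ≡ false → G p x ≡ true → G q x ≡ true → p ≡ q
      outs yp yq yx gp gq = B.outer-unique (not-f yx) (cong not yp) (flipG gp) (cong not yq) (flipG gq)
      st : s ≢ t
      st refl = ab (outs ya yb ys gs gt)
      su : s ≢ u
      su refl = ac (outs ya yc ys gs gu)
      tu : t ≢ u
      tu refl = bc (outs yb yc yt gt gu)
      ne : ∀ {p x} → Y p ≡ true → Y x ≡ false → p ≢ x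
      ne yp yx refl = true≢false yp yx
      U : Unique xs
      U = (ne ya yu ∷ ab ∷ ne ya ys ∷ ac ∷ ne ya yt ∷ []) ∷ (ne yb yu ∘ sym ∷ su ∘ sym ∷ ne yc yu ∘ sym ∷ tu ∘ sym ∷ []) ∷
          (ne yb ys ∷ bc ∷ ne yb yt ∷ []) ∷ (ne yc ys ∘ sym ∷ st ∷ []) ∷ (ne yc yt ∷ []) ∷ [] ∷ []
      size : n ≤ 6
      size = ≤r (trans (sym (#-all n)) (trans (sym (#-∁ Y)) (cong₂ _+_ y3 c3)))

  is-K4 : Fin n → n ≤ 4 → G ≅ K4
  is-K4 a small = let (b , c , d , gb , gc , gd , bc , bd , cd) = #-∃₃ (G a) (≥r (deg a)) in build gb gc gd bc bd cd
    where
    degree : ∀ i → count (K4 i) ≡ 3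
    degree = toWitness {a? = Fin.all? (λ i → count (K4 i) Nat.≟ 3)} tt
    complete : ∀ {u v} → u ≢ v → G u v ≡ true
    complete {u} {v} ne = ¬false λ f → let (p , q , r , gp , gq , gr , pq , pr , qr) = #-∃₃ (G u) (≥r (deg u))
                                           nv : ∀ {x} → G u x ≡ true → v ≢ x
                                           nv gx = λ { refl → true≢false gx f } in
      <-irrefl refl (≤-trans (#≥length (λ _ → true) (u ∷ v ∷ p ∷ q ∷ r ∷ []) (refl ∷ refl ∷ refl ∷ refl ∷ refl ∷ [])
        ((ne ∷ G≢ gp ∷ G≢ gq ∷ G≢ gr ∷ []) ∷ (nv gp ∷ nv gq ∷ nv gr ∷ []) ∷ (pq ∷ pr ∷ []) ∷ (qr ∷ []) ∷ [] ∷ [])) (≤-trans (≤r (#-all n)) small))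
    build : ∀ {b c d} → G a b ≡ true → G a c ≡ true → G a d ≡ true → b ≢ c → b ≢ d → c ≢ d → G ≅ K4
    build {b} {c} {d} gb gc gd bc bd cd = isomorphic G cubic xs U small K4 degree (λ i j h → complete (λ e → ==-≡f (not-t h) (lookup-injective U i j e)))
      where
      xs : List (Fin n)
      xs = a ∷ b ∷ c ∷ d ∷ []
      U : Unique xs
      U = (G≢ gb ∷ G≢ gc ∷ G≢ gd ∷ []) ∷ (bc ∷ bd ∷ []) ∷ (cd ∷ []) ∷ [] ∷ []

  Matched : Set
  Matched = ∃ λ μ → RM all μ × 2 * n ≤ 7 * moved μ

  both-good : ∀ {Y} → Good Y → Good (∁ Y) → Matched
  both-good {Y} (μ , R , h) (ν , S , k) = let (ρ , Q , e) = merge R S (λ v y c → true≢false y (not-t c)) in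
    ρ , RM-⊆ (λ _ _ → refl) Q , prove (n ∷ # Y ∷ # (∁ Y) ∷ moved μ ∷ moved ν ∷ moved ρ ∷ []) (2 ⊗ x0) (7 ⊗ x5) 1
      ((2 , x0 , x1 ⊕ x2) ∷ (1 , 2 ⊗ (x1 ⊕ con 2) , 7 ⊗ x3) ∷ (1 , 2 ⊗ (x2 ⊕ con 2) , 7 ⊗ x4) ∷ (7 , x3 ⊕ x4 , x5) ∷ [])
      (≥r (trans (#-∁ Y) (#-all n)) , h , k , ≥r e , tt)

  -- A triangle need not be `Good`, so the piece below `Y` is examined again with the triangle as
  -- the class of `y₀`. Either the triangle is `Good` after all, or `G` is an excluded graph, or a
  -- ladder leaves enough surplus for it.
  beside-triangle : ¬ (G ≅ C6bar) → ¬ (G ≅ R8) → ∀ Y → Shore Y → 2 ≤ # Y → 2 ≤ # (∁ Y) → Good Y → # (∁ Y) ≡ 3 → Matched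
  beside-triangle nC nR Y sY Y≥2 co≥2 gY c3 = go analyse
    where
    open Step Y sY Y≥2 co≥2
    go : Shape → Matched
    go (prism r3 d1) = ⊥-elim (nC (is-C6bar Y sY (prism-3 r3 d1) c3))
    go (rich tri _) = both-good gY (Good-≗ Cl-∁ (rich-good tri y₀ big-y₀ (inj₁ (trans (#-cong Cl-∁) c3))))
    go (ladder Ld) = let (s , l , c) = class-shore bz in case shores n (Cl z) (≤-trans (#-mono {Q = λ _ → true} (λ _ _ → refl)) (≤r (#-all n))) s l c of λ
        { (inj₁ z3) → ⊥-elim (nR (is-R8 z3 c3)) ; (inj₂ gz) → surplus gz c3 }
      where open LadderCase Ld

  Nontrivial : VSet n → Set
  Nontrivial Y = Shore Y × 2 ≤ # Y × 2 ≤ # (∁ Y)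

  nontrivial? : Dec (∃ Nontrivial)
  nontrivial? = SearchFun n search-Bool Nontrivial (λ Y → (∂ Y Nat.≟ 3) ×-dec ((2 ≤? # Y) ×-dec (2 ≤? # (∁ Y))))
    λ e (s , h , k) → trans (sym (E-cong e (λ u → cong not (e u)))) s , ≤-trans h (≤r (#-cong e)) , ≤-trans k (≤r (#-cong (λ u → cong not (e u))))

  split : ¬ (G ≅ C6bar) → ¬ (G ≅ R8) → ∀ Y → Nontrivial Y → Matched
  split nC nR Y (sY , h , k) = go (shores n Y (bound Y) sY h k) (shores n (∁ Y) (bound (∁ Y)) sY' k h')
    where
    bound : ∀ X → # X ≤ n
    bound X = ≤-trans (#-mono {Q = λ _ → true} (λ _ _ → refl)) (≤r (#-all n))
    sY' : Shore (∁ Y)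
    sY' = trans (∂-∁ Y) sY
    back : ∀ v → ∁ (∁ Y) v ≡ Y v
    back v = Bool.not-involutive (Y v)
    h' : 2 ≤ # (∁ (∁ Y))
    h' = ≤-trans h (≥r (#-cong back))
    go : # Y ≡ 3 ⊎ Good Y → # (∁ Y) ≡ 3 ⊎ Good (∁ Y) → Matched
    go (inj₂ g) (inj₂ g') = both-good g g'
    go (inj₁ e) (inj₁ e') = ⊥-elim (nC (is-C6bar Y sY e e'))
    go (inj₂ g) (inj₁ e') = beside-triangle nC nR Y sY h k g e'
    go (inj₁ e) (inj₂ g') = beside-triangle nC nR (∁ Y) sY' k h' g' (trans (#-cong back) e)

  -- Without nontrivial 3-cuts all classes are singletons and `D` is 0, so the discharging bound
  -- alone suffices.
  unsplit : ¬ (G ≅ K4) → Fin n → ¬ ∃ Nontrivial → Matched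
  unsplit nK v₀ none = let (μ , R , h , _) = piece-matching nc v₀ in μ , RM-⊆ (λ _ _ → refl) R ,
      prove (n ∷ # sing ∷ moved μ ∷ D ∷ []) (2 ⊗ x0) (7 ⊗ x2) 1 ((1 , 2 ⊗ x1 , 4 ⊗ x2 ⊕ 3 ⊗ x3) ∷ (2 , x0 , x1) ∷ (3 , x3 , con 0) ∷ [])
        (h , ≥r all-sing , ≤r no-big , tt)
    where
    small : ∀ {X} → ¬ (2 ≤ # X) → Shore X → ∃ λ q → X ⊆ ⁅ q ⁆
    small {X} l s = let (q , xq) = shore-∃ {X} s in q , λ v xv → trans (cong (_== v) (#≤1-unique X (s≤s⁻¹ (≰⇒> l)) xq xv)) (==-refl v)
    single-sides : ∀ X → Shore X → ∃ λ q → X ⊆ ⁅ q ⁆ ⊎ ∁ X ⊆ ⁅ q ⁆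
    single-sides X s with 2 ≤? # X | 2 ≤? # (∁ X)
    ... | yes p | yes q = ⊥-elim (none (X , s , p , q))
    ... | no p | _ = let (q , h) = small p s in q , inj₁ h
    ... | yes _ | no p = let (q , h) = small p (trans (∂-∁ X) s) in q , inj₂ h
    open InPiece (trivial-piece single-sides)
    nc : ¬ Cover4
    nc c = nK (is-K4 v₀ (≤-trans (≥r (trans (sum-cong (λ q → ι-true (==-refl q))) (sum-1 n))) (cover-reps c)))
    is-sing : ∀ v → sing v ≡ true
    is-sing v = ¬false λ f → let (p , q , hp , hq , pq) = #-∃₂ (Cl v) (sing-f f) in pq (trans (==-≡ hp) (sym (==-≡ hq)))
    all-sing : # sing ≡ n
    all-sing = trans (#-cong is-sing) (#-all n)
    no-big : D ≡ 0
    no-big = trans (sum-cong (λ q → ι-false (¬true λ h → true≢false (is-sing q) (not-t (∧-r {rep q} h))))) (sum-0 n)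

  matched : ¬ (G ≅ K4) → ¬ (G ≅ C6bar) → ¬ (G ≅ R8) → Fin n → Matched
  matched nK nC nR v₀ = case nontrivial? of λ { (yes (Y , h)) → split nC nR Y h ; (no none) → unsplit nK v₀ none }

  conclude : Matched → Σ (List (Fin n × Fin n)) λ M → IsMatching G M ×
    All (λ e → Removable G (proj₁ e) (proj₂ e)) M × n ≤ 7 * length M
  conclude (μ , R , h) = pairs μ inv ls , (AllP.map⁺ (All.map (λ l → good-G (edge-of l)) low) , endpoints-unique μ inv (filter⁺ (low? μ inv) (allFin⁺ n)) low) ,
      AllP.map⁺ (All.map (λ l → good-removable (edge-of l)) low) , bound
    where
    open RM R
    ls : List (Fin n)
    ls = lows μ inv
    low : All (λ v → lt v (μ v) ≡ true) ls
    low = all-filter (low? μ inv) (allFin n)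
    edge-of : ∀ {v} → lt v (μ v) ≡ true → good v (μ v) ≡ true
    edge-of {v} l = edge v λ e → lt-asym μ inv v v (subst (λ w → lt v w ≡ true) e l) (subst (λ w → lt v w ≡ true) e l)
    halves : moved μ ≡ # (λ v → lt v (μ v)) + # (λ v → lt v (μ v))
    halves = trans (closed-count (λ v → not (μ v == v)) μ inv (λ v m → not-f (==-≢ λ e → ==-≡f (not-t m) (trans (sym e) (inv v)))) (λ v m → ==-≡f (not-t m)))
      (cong₂ _+_ same same)
      where
      same : # (λ v → not (μ v == v) ∧ lt v (μ v)) ≡ # (λ v → lt v (μ v))
      same = #-cong (λ v → bool-iff (∧-r {not (μ v == v)}) (λ l → ∧-i (not-f (==-≢ (λ e → lt-asym μ inv v v (subst (λ w → lt v w ≡ true) e l) (subst (λ w → lt v w ≡ true) e l)))) l))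
    bound : n ≤ 7 * length (pairs μ inv ls)
    bound = prove (n ∷ moved μ ∷ # (λ v → lt v (μ v)) ∷ length (pairs μ inv ls) ∷ []) x0 (7 ⊗ x3) 2
      ((1 , 2 ⊗ x0 , 7 ⊗ x1) ∷ (7 , x1 , x2 ⊕ x2) ∷ (14 , x2 , x3) ∷ []) (h , ≤r halves , ≥r (length-lows μ inv) , tt)

theorem1p2 : ∀ {n} (G : Graph n) → IsSimple G → Cubic G → Brick G →
    ¬ (G ≅ K4) → ¬ (G ≅ C6bar) → ¬ (G ≅ R8) →
    Σ (List (Fin n × Fin n)) λ M → IsMatching G M ×
    All (λ e → Removable G (proj₁ e) (proj₂ e)) M × n ≤ 7 * length M
-- The empty graph is bipartite and hence no brick.
theorem1p2 {zero} G simple cubic brick nK nC nR = ⊥-elim (proj₁ (proj₂ brick) ((λ _ → true) , λ ()))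
theorem1p2 {suc n} G simple cubic brick nK nC nR = conclude (matched nK nC nR zero)
  where open Final G simple cubic brick
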